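{- Let $\rho,\gamma\ge1$. (i) A feasible solution $(x,z)$ to the linear program $\bigl(\mathrm{LP2}_{\mathcal T}^{(\rho,\gamma)}\bigr)$ for ML (respectively, to the corresponding LP relaxation $\bigl(\mathrm{LP'}_{\mathcal T}^{(\rho,\gamma)}\bigr)$ for MGL) can be rounded to obtain a solution to the ML (respectively, MGL) instance of expected cost at most $O(\rho\gamma)\cdot\sum_{j,t}t\,x_{j,t}$. (ii) A feasible solution $(x,z)$ to the linear program $\bigl(\mathrm{LP2}_{\mathcal P}^{(\rho,\gamma)}\bigr)$ for ML can be rounded to obtain a solution to the ML instance of cost at most $(3.59\cdot2)\,\rho\gamma\sum_{j,t}t\,x_{j,t}$.
   Context: Minimum latency problem (ML): given the complete graph on $\mathcal D\cup\{r\}$ with metric edge weights $\{d_e\}$ (integer values), find a path starting at $r$ visiting all nodes of $\mathcal D$ that minimizes the sum over $j\in\mathcal D$ of the length of the path from $r$ to $j$. Minimum group latency problem (MGL): given a metric $d$ on $\mathcal F\cup\{r\}$ and groups $G_1,\dots,G_m\subseteq\mathcal F$, find a path starting at $r$ minimizing the sum over $j$ of the length of the path from $r$ to the first visited node of $G_j$. "Rounding" means a polynomial-time (in (i), randomized) procedure. Times $t$ range over $\{1,\dots,T\}$, where $T$ is an integer upper bound on the largest latency in an optimal solution. For $s\ge0$ let $\mathcal P_s$ (resp. $\mathcal T_s$) be the collection of all simple paths starting at $r$ (resp. trees containing $r$) of total length at most $s$. $\bigl(\mathrm{LP2}_{\mathcal P}^{(a,b)}\bigr)$, for ML: variables $x_{j,t}\ge0$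 ($j\in\mathcal D$; $x_{j,t}=0$ if $d_{jr}>t$) and $z_{P,t}\ge0$ for $P\in\mathcal P_{bt}$; minimize $\sum_{j,t}t\,x_{j,t}$ subject to $\sum_tx_{j,t}\ge1$ for all $j$; $\sum_{P\in\mathcal P_{bt}}z_{P,t}\le a$ for all $t$; $\sum_{P\in\mathcal P_{bt}:\,j\in P}z_{P,t}\ge\sum_{t'\le t}x_{j,t'}$ for all $j,t$. $\bigl(\mathrm{LP2}_{\mathcal T}^{(a,b)}\bigr)$ is the same with trees $Q\in\mathcal T_{bt}$ (variables $z_{Q,t}$) replacing paths $P\in\mathcal P_{bt}$. $\bigl(\mathrm{LP'}_{\mathcal T}^{(a,b)}\bigr)$, for MGL, has one variable $x_{j,t}\ge 0$ per group $j$ and time $t$ and $z_{Q,t}\ge 0$ for $Q\in\mathcal T_{bt}$; minimize $\sum_{j,t}t\,x_{j,t}$ subject to $\sum_tx_{j,t}\ge1$ for all $j$; $\sum_{Q\in\mathcal T_{bt}}z_{Q,t}\le a$ for all $t$; $\sum_{Q\in\mathcal T_{bt}:\,G_j\cap Q\ne\emptyset}z_{Q,t}\ge\sum_{t'\le t}x_{j,t'}$ for all $j,t$.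
   Formalization: The parameters ρ and γ, the values of the feasible solution (x,z), and the distances of the MGL metric are taken to be rational numbers, encoded in binary as the input of the rounding algorithm. -}

module Defs where

open import Data.Bool.Base using (Bool; true; false; if_then_else_)
open import Data.Fin.Base as Fin using (Fin; zero; suc; toℕ)
import Data.Fin.Properties as Finₚ
open import Data.Fin.Subset as Subset using (Subset; outside)
open import Data.Fin.Subset.Properties using (_∈?_)
open import Data.Integer.Base using (ℤ; +_; -[1+_])
open import Data.List.Base as List using (List; []; _∷_; map; filter)
open import Data.List.Relation.Unary.All using (All)
open import Data.List.Relation.Unary.Any using (Any; any?)
open import Data.List.Relation.Unary.Unique.Propositional using (Unique)
open import Data.Nat.Base as ℕ using (ℕ; zero; suc)
open import Data.Nat.Binary.Base as Binary using (ℕᵇ; 2[1+_]; 1+[2_])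
open import Data.Product.Base using (Σ; Σ-syntax; ∃-syntax; _×_; _,_; proj₁; proj₂)
open import Data.Rational.Base using (ℚ; 0ℚ; 1ℚ; ½; _+_; _*_; _≤_; _>_; _/_; ↥_; ↧_)
open import Data.Rational.Properties using (+-0-commutativeMonoid)
open import Data.Vec.Base as Vec using (Vec; []; _∷_)
open import Function.Base using (_∘_)
open import Function.Metric.Rational using (IsMetric)
open import Relation.Binary.PropositionalEquality.Core using (_≡_)
open import Relation.Nullary.Decidable.Core using (does)
open import Relation.Unary using (Pred; Decidable)
import Level

open import Algebra.Properties.CommutativeMonoid.Sum +-0-commutativeMonoid public
  using (sum; sum-syntax)

-- The machine model is Jones's WHILE language (binary trees as the only
-- data, a while loop as the only form of recursion) in point-free form:
-- the single tree acted upon holds all the program variables.  Each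
-- primitive step has unit cost, since trees are handled by reference and
-- never copied; the functions computable in time polynomial in the size
-- of the input tree are those computable in polynomial time on Turing
-- machines.

infixr 5 _·_

data 𝔻 : Set where
  nil : 𝔻
  _·_ : 𝔻 → 𝔻 → 𝔻

size : 𝔻 → ℕ
size nil     = 1
size (a · b) = suc (size a ℕ.+ size b)

data Prog : Set where
  nil id hd tl : Prog
  _⨾_          : Prog → Prog → Prog
  ⟨_,_⟩        : Prog → Prog → Prog
  cond         : Prog → Prog → Prog
  while        : Prog → Prog

head tail : 𝔻 → 𝔻
head nil     = nil
head (a · _) = a
tail nil     = nil
tail (_ · b) = b

data IsCons : 𝔻 → Set where
  cons : ∀ {a b} → IsCons (a · b)

-- Run p a b k: started on a, the program p halts with result b after
-- exactly k steps.  Conditionals and loops test whether the head of the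
-- current tree is nil (false) or a pair (true).

data Run : Prog → 𝔻 → 𝔻 → ℕ → Set where
  nil  : ∀ {a} → Run nil a nil 1
  id   : ∀ {a} → Run id a a 1
  hd   : ∀ {a} → Run hd a (head a) 1
  tl   : ∀ {a} → Run tl a (tail a) 1
  seq  : ∀ {p q a b c k l} → Run p a b k → Run q b c l →
         Run (p ⨾ q) a c (suc (k ℕ.+ l))
  pair : ∀ {p q a b c k l} → Run p a b k → Run q a c l →
         Run ⟨ p , q ⟩ a (b · c) (suc (k ℕ.+ l))
  then : ∀ {p q a b k} → IsCons (head a) → Run p a b k →
         Run (cond p q) a b (suc k)
  else : ∀ {p q a b k} → head a ≡ nil → Run q a b k →
         Run (cond p q) a b (suc k)
  stop : ∀ {p a} → head a ≡ nil → Run (while p) a a 1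
  loop : ∀ {p a b c k l} → IsCons (head a) → Run p a b k →
         Run (while p) b c l → Run (while p) a c (suc (k ℕ.+ l))

𝔼 : ∀ {k} → (Vec Bool k → ℚ) → ℚ
𝔼 {zero}  f = f []
𝔼 {suc k} f = ½ * (𝔼 (f ∘ (true ∷_)) + 𝔼 (f ∘ (false ∷_)))

-- Numbers are encoded in bijective binary.

encBool : Bool → 𝔻
encBool false = nil
encBool true  = nil · nil

encList : {A : Set} → (A → 𝔻) → List A → 𝔻
encList enc []       = nil
encList enc (x ∷ xs) = enc x · encList enc xs

encFun : {A : Set} {k : ℕ} → (A → 𝔻) → (Fin k → A) → 𝔻
encFun enc f = encList enc (List.tabulate f)

encVec : {A : Set} {k : ℕ} → (A → 𝔻) → Vec A k → 𝔻
encVec enc v = encList enc (Vec.toList v)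

encℕᵇ : ℕᵇ → 𝔻
encℕᵇ Binary.zero = nil
encℕᵇ 2[1+ b ]    = encBool false · encℕᵇ b
encℕᵇ 1+[2 b ]    = encBool true · encℕᵇ b

encℕ : ℕ → 𝔻
encℕ = encℕᵇ ∘ Binary.fromℕ

encℤ : ℤ → 𝔻
encℤ (+ k)    = encBool false · encℕ k
encℤ -[1+ k ] = encBool true · encℕ k

encℚ : ℚ → 𝔻
encℚ q = encℤ (↥ q) · encℤ (↧ q)

encFin : ∀ {k} → Fin k → 𝔻
encFin = encℕ ∘ toℕ

-- The root r is the vertex zero; the other vertices are suc i.  There
-- are m clients, and client j is served at the first vertex in Target j
-- on the path: the vertex j itself for ML, any vertex of G_j for MGL.

record Problem : Set₁ where
  field
    n       : ℕ
    d       : Fin (suc n) → Fin (suc n) → ℚ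
    m       : ℕ
    Target  : Fin m → Pred (Fin (suc n)) Level.zero
    Target? : ∀ j → Decidable (Target j)

  V : Set
  V = Fin (suc n)

  r : V
  r = zero

record MLInstance : Set where
  field
    n        : ℕ
    d        : Fin (suc n) → Fin (suc n) → ℚ
    isMetric : IsMetric _≡_ d
    integral : ∀ u v → ∃[ k ] d u v ≡ + k / 1

record MGLInstance : Set where
  field
    n        : ℕ
    d        : Fin (suc n) → Fin (suc n) → ℚ
    isMetric : IsMetric _≡_ d
    m        : ℕ
    G        : Fin m → Subset n

mlProblem : MLInstance → Problem
mlProblem I = record
  { n = n ; d = d ; m = n
  ; Target  = λ j v → suc j ≡ v
  ; Target? = λ j v → suc j Finₚ.≟ v
  } where open MLInstance I

mglProblem : MGLInstance → Problem
mglProblem I = record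
  { n = n ; d = d ; m = m
  ; Target  = λ j v → v Subset.∈ (outside ∷ G j)
  ; Target? = λ j v → v ∈? (outside ∷ G j)
  } where open MGLInstance I

encML : MLInstance → 𝔻
encML I = encFun (encFun encℚ) (MLInstance.d I)

encMGL : MGLInstance → 𝔻
encMGL I = encFun (encFun encℚ) d · encFun (encVec encBool) G
  where open MGLInstance I

data Rose (A : Set) : Set where
  node : A → List (Rose A) → Rose A

module _ {A : Set} where

  rootOf : Rose A → A
  rootOf (node v _) = v

  labels  : Rose A → List A
  labelsₗ : List (Rose A) → List A
  labels (node v ts) = v ∷ labelsₗ ts
  labelsₗ []         = []
  labelsₗ (t ∷ ts)   = labels t List.++ labelsₗ ts

  encRose  : (A → 𝔻) → Rose A → 𝔻
  encRoses : (A → 𝔻) → List (Rose A) → 𝔻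
  encRose enc (node v ts)  = enc v · encRoses enc ts
  encRoses enc []          = nil
  encRoses enc (t ∷ ts)    = encRose enc t · encRoses enc ts

module _ (I : Problem) where
  open Problem I

  pathLength : List V → ℚ
  pathLength []           = 0ℚ
  pathLength (_ ∷ [])     = 0ℚ
  pathLength (u ∷ v ∷ vs) = d u v + pathLength (v ∷ vs)

  -- The length of the part of the path before the first vertex in
  -- Target j; used only for paths that meet Target j.

  latency : Fin m → List V → ℚ
  latency j []           = 0ℚ
  latency j (_ ∷ [])     = 0ℚ
  latency j (u ∷ v ∷ vs) =
    if does (Target? j u) then 0ℚ else d u v + latency j (v ∷ vs)

  IsRootedPath : List V → Set
  IsRootedPath p = (∃[ vs ] p ≡ r ∷ vs) × Unique p

  IsSolution : List V → Set
  IsSolution p = IsRootedPath p × (∀ j → Any (Target j) p)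

  Solution : Set
  Solution = Σ (List V) IsSolution

  cost : List V → ℚ
  cost p = ∑[ j < m ] latency j p

  BoundsOptimalLatency : ℕ → Set
  BoundsOptimalLatency T =
    ∃[ p ] IsSolution p
         × (∀ q → IsSolution q → cost p ≤ cost q)
         × (∀ j → latency j p ≤ + T / 1)

  treeLength   : Rose V → ℚ
  branchLength : V → List (Rose V) → ℚ
  treeLength (node v ts)    = branchLength v ts
  branchLength v []         = 0ℚ
  branchLength v (t ∷ ts)   = (d v (rootOf t) + treeLength t) + branchLength v ts

-- The combinatorial objects that index the z-variables:
-- Within s is 𝒫_s or 𝒯_s.

record Family (I : Problem) : Set₁ where
  open Problem I using (V)
  field
    Member   : Set
    vertices : Member → List V
    Within   : ℚ → Member → Set
    encode   : Member → 𝔻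

paths : ∀ I → Family I
paths I = record
  { Member   = List V
  ; vertices = λ p → p
  ; Within   = λ s p → IsRootedPath I p × pathLength I p ≤ s
  ; encode   = encList encFin
  } where open Problem I

-- A tree containing r, drawn with r at the root.

trees : ∀ I → Family I
trees I = record
  { Member   = Rose V
  ; vertices = labels
  ; Within   = λ s Q → rootOf Q ≡ r × Unique (labels Q) × treeLength I Q ≤ s
  ; encode   = encRose encFin
  } where open Problem I

-- The index t : Fin T stands for the time 1 + t.

time : ∀ {T} → Fin T → ℚ
time t = + suc (toℕ t) / 1

total : {A : Set} → List (A × ℚ) → ℚ
total = List.foldr _+_ 0ℚ ∘ map proj₂

-- The exponentially long vector (z_{Q,t})_Q is given by a list of pairs
-- (Q , value); members not listed have value 0, and the values of
-- repeated entries add up.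

record Assignment (I : Problem) (F : Family I) (T : ℕ) : Set where
  open Problem I
  open Family F using (Member)
  field
    x : Fin m → Fin T → ℚ
    z : Fin T → List (Member × ℚ)

module _ {I : Problem} {F : Family I} {T : ℕ} (s : Assignment I F T) where
  open Problem I
  open Family F
  open Assignment s

  objective : ℚ
  objective = ∑[ j < m ] ∑[ t < T ] (time t * x j t)

  coverage : Fin m → Fin T → ℚ
  coverage j t = total (filter (any? (Target? j) ∘ vertices ∘ proj₁) (z t))

  servedBy : Fin m → Fin T → ℚ
  servedBy j t = ∑[ t′ < T ] (if does (t′ Finₚ.≤? t) then x j t′ else 0ℚ)

  -- The constraints common to LP2^{(a,b)} and LP′^{(a,b)}.

  record IsFeasible (a b : ℚ) : Set where
    field
      x≥0      : ∀ j t → 0ℚ ≤ x j t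
      z≥0      : ∀ t → All (λ (_ , w) → 0ℚ ≤ w) (z t)
      z-within : ∀ t → All (λ (Q , _) → Within (b * time t) Q) (z t)
      assigned : ∀ j → 1ℚ ≤ ∑[ t < T ] x j t
      capacity : ∀ t → total (z t) ≤ a
      covered  : ∀ j t → servedBy j t ≤ coverage j t

  encAssignment : 𝔻
  encAssignment =
    encFun (encFun encℚ) x · encFun (encList (λ (Q , w) → encode Q · encℚ w)) z

record Relaxation : Set₁ where
  field
    Instance  : Set
    problem   : Instance → Problem
    encodeI   : Instance → 𝔻
    family    : ∀ i → Family (problem i)
    Feasible  : ∀ {i T} → Assignment (problem i) (family i) T → (a b : ℚ) → Set

LP2 : (∀ I → Family I) → Relaxation
LP2 F = record
  { Instance = MLInstance
  ; problem  = mlProblem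
  ; encodeI  = encML
  ; family   = λ I → F (mlProblem I)
  ; Feasible = λ {I} s a b →
      let open MLInstance I; open Assignment s in
      IsFeasible s a b × (∀ j t → d (suc j) zero > time t → x j t ≡ 0ℚ)
  }

LP′ : (∀ I → Family I) → Relaxation
LP′ F = record
  { Instance = MGLInstance
  ; problem  = mglProblem
  ; encodeI  = encMGL
  ; family   = λ I → F (mglProblem I)
  ; Feasible = λ s a b → IsFeasible s a b
  }

record RoundingInput (R : Relaxation) : Set where
  open Relaxation R
  field
    inst     : Instance
    T        : ℕ
    T-bound  : BoundsOptimalLatency (problem inst) T
    ρ γ      : ℚ
    1≤ρ      : 1ℚ ≤ ρ
    1≤γ      : 1ℚ ≤ γ
    lp       : Assignment (problem inst) (family inst) T
    feasible : Feasible lp ρ γ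

  code : 𝔻
  code = encodeI inst · encℚ ρ · encℚ γ · encAssignment lp

  output : Solution (problem inst) → 𝔻
  output = encList encFin ∘ proj₁

  value : Solution (problem inst) → ℚ
  value = cost (problem inst) ∘ proj₁

  bound : ℚ → ℚ
  bound C = C * (ρ * γ) * objective lp

-- One program for all inputs, running in time c · (input size)^e and
-- producing a solution of cost at most C · ργ · Σ t x_{j,t}.

DeterministicRounding : Relaxation → ℚ → Set
DeterministicRounding R C =
  ∃[ p ] ∃[ c ] ∃[ e ] ((i : RoundingInput R) →
    let open RoundingInput i; N = c ℕ.* size code ℕ.^ e in
    Σ[ S ∈ Solution (Relaxation.problem R inst) ]
      (∃[ k ] k ℕ.≤ N × Run p code (output S) k)
      × value S ≤ bound C)

-- The same with a supply of fair coin flips as a second input.  N bounds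
-- both the running time, whatever the coins, and the number of coins.

RandomizedRounding : Relaxation → ℚ → Set
RandomizedRounding R C =
  ∃[ p ] ∃[ c ] ∃[ e ] ((i : RoundingInput R) →
    let open RoundingInput i; N = c ℕ.* size code ℕ.^ e in
    Σ[ S ∈ (Vec Bool N → Solution (Relaxation.problem R inst)) ]
      (∀ w → ∃[ k ] k ℕ.≤ N × Run p (code · encVec encBool w) (output (S w)) k)
      × 𝔼 (value ∘ S) ≤ bound C)

-- ML: let the weights of the paths for time t be multiples of 1/N.  By
-- the theorem of Bang-Jensen, Frank and Jackson the paths can be
-- rearranged into N branchings of the same total length, each vertex
-- lying on as many of them as on paths, but at most N.  Their doubled
-- preorders are closed tours whose average length is at most 2ργt and
-- which miss on average at most the demand D(t) = Σ_j (1 − Σ_{s≤t} x_{j,s})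
-- left by x.  A dynamic program over all tours finds a concatenation
-- of them whose latency is no worse than that of random tours for the
-- times 1, 2, 4, 8, … or for 1, 3, 6, 12, …; the cheaper one of these
-- costs at most 7/2 · 2ργ Σ_t D(t), and Σ_t D(t) ≤ Σ t x_{j,t}.  Rounding
-- the weights costs 41/40, and 41/40 · 7 < 3.59 · 2.  The preorder of a
-- tree is a path at most twice as long as the tree.
--
-- MGL: with R groups unserved, let t be the first time with 2 D(t) ≤ R.
-- At least R/2 groups are then covered by the trees for t, so some tree
-- for a time s serves R s / (2ρt) of them at a cost of 2γs.  Always append
-- a tree for which this ratio is best.  Each group served lowers the
-- potential Σ_t min(R, 2 D(t)) by at least t, hence the total latency is
-- at most 4ργ times its initial value, which is at most 2 Σ_t D(t).
--
-- Running times come from composing functions that carry a program and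
-- polynomial bounds for its time and output.  Distances are at most 2T
-- for ML, so all arithmetic on them can be unary.

module Submission where

module Rounding where

  open import Defs
  import Data.Bool.Base using (Bool; _∧_; _∨_; false; if_then_else_; not; true)
  open Data.Bool.Base
  import Data.Empty using (⊥; ⊥-elim)
  open Data.Empty
  import Data.Fin.Base as Fin using (Fin; fromℕ<; suc; toℕ; zero)
  open Fin using (Fin; zero; suc; toℕ)
  import Data.Fin.Properties as Finₚ using (_≟_; _≤?_; toℕ-fromℕ<; toℕ-injective; toℕ<n; toℕ≤pred[n])
  import Data.Fin.Subset as Subset using (outside)
  import Data.Integer.Base as ℤ using (+<+; +_; +≤+; -[1+_]; _*_; _+_; neg; nonNeg; nonPos; nonPos0; pos; ℤ)
  open ℤ using (ℤ; -[1+_])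
  import Data.Integer.Properties as ℤₚ using (*-cancelʳ-≤-pos; *-comm; *-identityʳ; *-monoʳ-≤-nonNeg; drop‿+≤+; pos-*)
  import Data.List.Base as List using (List; []; _++_; _ʳ++_; _∷_; concat; concatMap; downFrom; drop; filter; foldl; foldr; length; map; replicate; reverse; tabulate)
  open List using (List; []; _∷_; _++_; foldl; foldr; map; length; reverse; concat; concatMap; replicate; tabulate; downFrom; filter)
  import Data.List.Properties as Listₚ using (++-assoc; ++-identityʳ; ++-is-foldr; filter-++; filter-accept; filter-all; filter-reject; length-++; length-downFrom; length-filter; length-map; length-replicate; length-tabulate; map-++; map-is-foldr; map-tabulate; map-∘; reverse-++; reverse-foldl; reverse-involutive; tabulate-cong; unfold-reverse; ʳ++-defn; ∷-injective)
  import Data.List.Membership.Propositional using (_∈_; _∉_; find; lose)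
  open Data.List.Membership.Propositional
  import Data.List.Membership.Propositional.Properties as Membershipₚ using (∈-concat⁺′; ∈-concat⁻′; ∈-downFrom⁺; ∈-downFrom⁻; ∈-tabulate⁺)
  import Data.List.Membership.Propositional.Properties using (∈-++⁺ʳ; ∈-++⁺ˡ; ∈-++⁻; ∈-filter⁺; ∈-filter⁻; ∈-map⁺; ∈-map⁻)
  open Data.List.Membership.Propositional.Properties
  import Data.List.Relation.Unary.All as All using (All; []; _∷_; head; lookup; map; tabulate; tail)
  open All using (All; []; _∷_)
  import Data.List.Relation.Unary.All.Properties as Allₚ using (++⁺; ++⁻; ++⁻ʳ; ++⁻ˡ; concat⁺; filter⁺; map⁺; replicate⁺; tabulate⁺)
  import Data.List.Relation.Unary.AllPairs as AllPairs using (AllPairs; []; _∷_; map)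
  open AllPairs using (AllPairs; []; _∷_)
  import Data.List.Relation.Unary.AllPairs.Properties as AllPairsₚ using (applyDownFrom⁺₁; concat⁺; map⁺)
  import Data.List.Relation.Unary.Any as Any using (Any; any?; here; map; there)
  open Any using (Any; here; there; any?)
  import Data.List.Relation.Unary.Any.Properties as Anyₚ using (++⁻)
  import Data.List.Relation.Unary.Unique.Propositional using (Unique)
  open Data.List.Relation.Unary.Unique.Propositional
  import Data.List.Relation.Unary.Unique.Propositional.Properties as Uniqueₚ using (++⁺; downFrom⁺; filter⁺; map⁺; map⁻)
  import Data.Maybe.Base using (Maybe; just; nothing)
  open Data.Maybe.Base
  import Data.Nat.Base using (NonZero; _*_; _+_; _<_; _^_; _∸_; _≤_; nonTrivial; nonZero; pred; suc; s≤s; s≤s⁻¹; zero; z≤n; ℕ; ⌊_/2⌋)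
  open Data.Nat.Base
  import Data.Nat.Binary.Base as Bin using (1+[2_]; 2[1+_]; fromℕ; fromℕ'; suc; toℕ; zero; ℕᵇ)
  open Bin using (ℕᵇ; 2[1+_]; 1+[2_])
  import Data.Nat.Binary.Properties as Binₚ using (fromℕ≡fromℕ'; toℕ-fromℕ)
  import Data.Nat.Coprimality as Coprime using (1-coprimeTo; Coprime; sym)
  import Data.Nat.ListAction using () renaming (sum to sumᴸ)
  open Data.Nat.ListAction
  import Data.Nat.Properties using (*-cancelʳ-≤; *-comm; *-distribʳ-+; *-distribˡ-+; *-identityʳ; *-identityˡ; *-mono-≤; *-monoʳ-≤; *-monoˡ-≤; *-zeroʳ; +-assoc; +-cancelʳ-≡; +-cancelʳ-≤; +-cancelˡ-≤; +-comm; +-identityʳ; +-mono-≤; +-monoʳ-≤; +-monoˡ-≤; +-suc; +-∸-assoc; 0∸n≡0; <-irrefl; <-trans; <-≤-trans; <⇒≤; [m*n]*[o*p]≡[m*o]*[n*p]; ^-distribˡ-+-*; ^-identityʳ; ^-monoʳ-≤; ^-monoˡ-≤; m+n∸n≡m; m<m+n; m∸n+n≡m; m∸n≡0⇒m≤n; m∸n≤m; m≤m+n; m≤n+m; m≤n+m∸n; m≤n⇒m<n∨m≡n; m≤n⇒m∸n≡0; m≤n⇒m≤1+n; m≤n⇒m≤o+n; n∸n≡0; n≡⌊n+n/2⌋; n≢0⇒n>0; n≤0⇒n≡0; n≤1+n; suc-injective; ∸-monoˡ-≤; ≤-<-trans; ≤-antisym; ≤-refl; ≤-reflexive; ≤-trans;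 ≤ᵇ⇒≤; ≮⇒≥; ≰⇒>; ⌊n/2⌋+⌈n/2⌉≡n; ⌊n/2⌋-mono; ⌊n/2⌋≤n; ⌊n/2⌋≤⌈n/2⌉; module ≤-Reasoning)
  open Data.Nat.Properties
  import Data.Nat.Tactic.RingSolver using (solve-∀)
  open Data.Nat.Tactic.RingSolver
  import Data.Product.Base using (_,_; _×_; proj₁; proj₂; Σ; ∃-syntax)
  open Data.Product.Base
  import Data.Rational.Base as Q using (*<*; *≤*; -_; 0ℚ; 1ℚ; Positive; _*_; _+_; _-_; _/_; _≤_; _⊓_; _⊔_; mkℚ; nonNegative; positive; ½; ℚ; ↥_; ↧_)
  open Q using (ℚ; 0ℚ; 1ℚ; ½; ↥_; ↧_)
  import Data.Rational.Properties as Qₚ using (*-assoc; *-cancelˡ-≤-pos; *-comm; *-distribʳ-+; *-distribˡ-+; *-identityʳ; *-identityˡ; *-monoʳ-≤-nonNeg; *-monoˡ-≤-nonNeg; *-zeroʳ; *-zeroˡ; +-*-commutativeRing; +-assoc; +-comm; +-identityʳ; +-identityˡ; +-inverseʳ; +-mono-≤; +-monoʳ-≤; +-monoˡ-≤; <-≤-trans; <⇒≤; _≟_; _≤?_; drop-*≤*; neg-antimono-≤; normalize-coprime; p≤p⊔q; p≤q⇒p⊔q≡q; p≤q⊔p; p≥q⇒p⊓q≡q; p⊓q≤p; toℚᵘ-homo-*; toℚᵘ-injective; ≤-antisym; ≤-refl; ≤-reflexive; ≤-trans; ≰⇒>; ⊓-glb; ⊓-monoʳ-≤; ⊔-lub;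 ⊔-monoˡ-≤; module ≤-Reasoning)
  import Data.Rational.Unnormalised.Base as Qᵘ using (*≡*)
  import Data.Rational.Unnormalised.Properties as Qᵘₚ using (≃-trans)
  import Data.Sum.Base using ([_,_]′; _⊎_; inj₁; inj₂)
  open Data.Sum.Base
  import Data.Unit.Base using (tt; ⊤)
  open Data.Unit.Base
  import Data.Vec.Base as Vec using (Vec; _∷_; lookup; toList)
  import Data.Vec.Properties as Vecₚ using ([]=⇒lookup; lookup⇒[]=)
  import Function.Base using (_∘_; case_of_)
  open Function.Base
  import Function.Metric.Rational using (IsMetric)
  open Function.Metric.Rational
  import Level using (0ℓ)
  open Level
  import Relation.Binary.PropositionalEquality using (_≡_; _≢_; cong; cong₂; refl; subst; subst₂; sym; trans)
  open Relation.Binary.PropositionalEquality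
  import Relation.Nullary using (Dec; contradiction; does; no; yes; ¬_)
  open Relation.Nullary
  import Relation.Nullary.Decidable as Decidable using (map′)
  import Relation.Nullary.Decidable using (_×-dec_; _⊎-dec_; ¬?)
  open Relation.Nullary.Decidable
  import Tactic.RingSolver using () renaming (solve-∀ to ring-solve)
  open Tactic.RingSolver
  import Tactic.RingSolver.Core.AlmostCommutativeRing using (AlmostCommutativeRing; fromCommutativeRing)
  open Tactic.RingSolver.Core.AlmostCommutativeRing

  record Code (A : Set) : Set where
    field enc : A → 𝔻

  open Code ⦃ ... ⦄ public

  sz : {A : Set} ⦃ _ : Code A ⦄ → A → ℕ
  sz a = size (enc a)

  instance
    code-𝔻 : Code 𝔻
    code-𝔻 = record { enc = λ a → a }

    code-Bool : Code Bool
    code-Bool = record { enc = encBool }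

    code-List : {A : Set} ⦃ _ : Code A ⦄ → Code (List A)
    code-List = record { enc = encList enc }

    code-× : {A B : Set} ⦃ _ : Code A ⦄ ⦃ _ : Code B ⦄ → Code (A × B)
    code-× = record { enc = λ (a , b) → enc a · enc b }

  unary : ℕ → 𝔻
  unary zero    = nil
  unary (suc n) = nil · unary n

  instance
    code-ℕ : Code ℕ
    code-ℕ = record { enc = unary }

  size≥1 : ∀ d → 1 ≤ size d
  size≥1 nil     = s≤s z≤n
  size≥1 (_ · _) = s≤s z≤n

  size≢0 : ∀ d → NonZero (size d)
  size≢0 nil     = _
  size≢0 (_ · _) = _

  Bnd : {A : Set} ⦃ _ : Code A ⦄ → (A → ℕ) → Set
  Bnd g = ∃[ c ] ∃[ e ] (∀ a → g a ≤ c * sz a ^ e)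

  module _ {A : Set} ⦃ _ : Code A ⦄ where

    abstract

      bnd-≤ : {g h : A → ℕ} → (∀ a → g a ≤ h a) → Bnd h → Bnd g
      bnd-≤ g≤h (c , e , p) = c , e , λ a → ≤-trans (g≤h a) (p a)

      bnd-const : ∀ k → Bnd {A} (λ _ → k)
      bnd-const k = k , 0 , λ a → ≤-reflexive (sym (*-identityʳ k))

      bnd-sz : Bnd {A} sz
      bnd-sz = 1 , 1 , λ a → ≤-reflexive (sym (trans (*-identityˡ _) (^-identityʳ _)))

      private
        grow : ∀ (a : A) e e′ → sz a ^ e ≤ sz a ^ (e + e′)
        grow a e e′ = ^-monoʳ-≤ (sz a) ⦃ size≢0 (enc a) ⦄ (m≤m+n e e′)

        grow′ : ∀ (a : A) e e′ → sz a ^ e′ ≤ sz a ^ (e + e′)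
        grow′ a e e′ = ^-monoʳ-≤ (sz a) ⦃ size≢0 (enc a) ⦄ (m≤n+m e′ e)

      bnd-+ : {g h : A → ℕ} → Bnd g → Bnd h → Bnd (λ a → g a + h a)
      bnd-+ (c , e , p) (c′ , e′ , p′) = c + c′ , e + e′ , λ a →
        ≤-trans (+-mono-≤ (≤-trans (p a) (*-monoʳ-≤ c (grow a e e′)))
                          (≤-trans (p′ a) (*-monoʳ-≤ c′ (grow′ a e e′))))
                (≤-reflexive (sym (*-distribʳ-+ (sz a ^ (e + e′)) c c′)))

      bnd-* : {g h : A → ℕ} → Bnd g → Bnd h → Bnd (λ a → g a * h a)
      bnd-* (c , e , p) (c′ , e′ , p′) = c * c′ , e + e′ , λ a →
        ≤-trans (*-mono-≤ (p a) (p′ a))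
          (≤-reflexive (trans ([m*n]*[o*p]≡[m*o]*[n*p] c (sz a ^ e) c′ (sz a ^ e′))
                              (cong (c * c′ *_) (sym (^-distribˡ-+-* (sz a) e e′)))))

      bnd-^ : ∀ {h : A → ℕ} e → Bnd h → Bnd (λ a → h a ^ e)
      bnd-^ zero    b = bnd-const 1
      bnd-^ (suc e) b = bnd-* b (bnd-^ e b)

      bnd-poly : ∀ {h : A → ℕ} c e → Bnd h → Bnd (λ a → c * h a ^ e)
      bnd-poly c e b = bnd-* (bnd-const c) (bnd-^ e b)

  bnd-∘ : {A B : Set} ⦃ _ : Code A ⦄ ⦃ _ : Code B ⦄ {g : B → ℕ} {f : A → B} →
          Bnd g → Bnd (sz ∘ f) → Bnd (g ∘ f)
  bnd-∘ {f = f} (c , e , p) b = bnd-≤ (λ a → p (f a)) (bnd-poly c e b)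

  -- Trees share subterms, so the output size needs a bound of its own.

  record Poly {A B : Set} ⦃ _ : Code A ⦄ ⦃ _ : Code B ⦄ (f : A → B) : Set where
    field
      prog     : Prog
      clock    : A → ℕ
      clock-bnd : Bnd clock
      run      : ∀ a → ∃[ k ] k ≤ clock a × Run prog (enc a) (enc (f a)) k
      out-bnd  : Bnd (sz ∘ f)

  open Poly public

  module _ {A B : Set} ⦃ _ : Code A ⦄ ⦃ _ : Code B ⦄ where

    abstract

      extP : {f g : A → B} → (∀ a → f a ≡ g a) → Poly f → Poly g
      extP f≗g P = record
        { prog = prog P ; clock = clock P ; clock-bnd = clock-bnd P
        ; run = λ a → let (k , k≤ , r) = run P a in
            k , k≤ , subst (λ b → Run (prog P) _ (enc b) k) (f≗g a) r
        ; out-bnd = bnd-≤ (λ a → ≤-reflexive (cong sz (sym (f≗g a)))) (out-bnd P) }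

      stepsP : {f : A → B} (p : Prog) (k : ℕ) → (∀ a → Run p (enc a) (enc (f a)) k) →
               Bnd (sz ∘ f) → Poly f
      stepsP p k r o = record
        { prog = p ; clock = λ _ → k ; clock-bnd = bnd-const k
        ; run = λ a → k , ≤-refl , r a ; out-bnd = o }

      recodeP : {f : A → B} → (∀ a → enc (f a) ≡ enc a) → Poly f
      recodeP eq = stepsP id 1 (λ a → subst (λ d → Run id _ d 1) (sym (eq a)) id)
        (bnd-≤ (λ a → ≤-reflexive (cong size (eq a))) bnd-sz)

      constP : (b : B) → Poly {A} (λ _ → b)
      constP b = record
        { prog = constProg (enc b) ; clock = λ _ → proj₁ (constRun (enc b)) ; clock-bnd = bnd-const _
        ; run = λ a → _ , ≤-refl , proj₂ (constRun (enc b)) ; out-bnd = bnd-const _ }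
        where
        constProg : 𝔻 → Prog
        constProg nil     = nil
        constProg (a · b) = ⟨ constProg a , constProg b ⟩
        constRun : ∀ d → ∃[ k ] (∀ {a} → Run (constProg d) a d k)
        constRun nil     = _ , nil
        constRun (a · b) = _ , pair (proj₂ (constRun a)) (proj₂ (constRun b))

  idP : {A : Set} ⦃ _ : Code A ⦄ → Poly {A} (λ a → a)
  idP = recodeP (λ _ → refl)

  module _ {A B C : Set} ⦃ _ : Code A ⦄ ⦃ _ : Code B ⦄ ⦃ _ : Code C ⦄ where

    abstract

      infixr 9 _∘P_

      _∘P_ : {g : B → C} {f : A → B} → Poly g → Poly f → Poly (λ a → g (f a))
      _∘P_ {f = f} Q P = record
        { prog = prog P ⨾ prog Q
        ; clock = λ a → suc (clock P a + clock Q (f a))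
        ; clock-bnd = bnd-+ (bnd-const 1) (bnd-+ (clock-bnd P) (bnd-∘ (clock-bnd Q) (out-bnd P)))
        ; run = λ a → let (k , k≤ , r) = run P a ; (l , l≤ , r′) = run Q (f a) in
            suc (k + l) , s≤s (+-mono-≤ k≤ l≤) , seq r r′
        ; out-bnd = bnd-∘ (out-bnd Q) (out-bnd P) }

      pairP : {f : A → B} {g : A → C} → Poly f → Poly g → Poly (λ a → f a , g a)
      pairP P Q = record
        { prog = ⟨ prog P , prog Q ⟩
        ; clock = λ a → suc (clock P a + clock Q a)
        ; clock-bnd = bnd-+ (bnd-const 1) (bnd-+ (clock-bnd P) (clock-bnd Q))
        ; run = λ a → let (k , k≤ , r) = run P a ; (l , l≤ , r′) = run Q a in
            suc (k + l) , s≤s (+-mono-≤ k≤ l≤) , pair r r′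
        ; out-bnd = bnd-+ (bnd-const 1) (bnd-+ (out-bnd P) (out-bnd Q)) }

  module _ {A B C : Set} ⦃ _ : Code A ⦄ ⦃ _ : Code B ⦄ ⦃ _ : Code C ⦄ where

    abstract

      fstP : {f : A → B × C} → Poly f → Poly (λ a → proj₁ (f a))
      fstP P = stepsP {f = proj₁} hd 1 (λ _ → hd) (bnd-≤ (λ a → m≤n⇒m≤1+n (m≤m+n _ _)) bnd-sz) ∘P P

      sndP : {f : A → B × C} → Poly f → Poly (λ a → proj₂ (f a))
      sndP P = stepsP {f = proj₂} tl 1 (λ _ → tl) (bnd-≤ (λ a → m≤n⇒m≤1+n (m≤n+m _ _)) bnd-sz) ∘P P

  module _ {A B : Set} ⦃ _ : Code A ⦄ ⦃ _ : Code B ⦄ where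

    ₁P : Poly {A × B} (λ i → proj₁ i)
    ₁P = fstP idP

    ₂P : Poly {A × B} (λ i → proj₂ i)
    ₂P = sndP idP

  module _ {A B C : Set} ⦃ _ : Code A ⦄ ⦃ _ : Code B ⦄ ⦃ _ : Code C ⦄ where

    ₁₁P : Poly {(A × B) × C} (λ i → proj₁ (proj₁ i))
    ₁₁P = fstP ₁P

    ₁₂P : Poly {A × B × C} (λ i → proj₁ (proj₂ i))
    ₁₂P = fstP ₂P

    ₂₁P : Poly {(A × B) × C} (λ i → proj₂ (proj₁ i))
    ₂₁P = sndP ₁P

    ₂₂P : Poly {A × B × C} (λ i → proj₂ (proj₂ i))
    ₂₂P = sndP ₂P

  module _ {A B : Set} ⦃ _ : Code A ⦄ ⦃ _ : Code B ⦄ where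

    abstract

      ifP : {c : A → Bool} {f g : A → B} → Poly c → Poly f → Poly g →
            Poly (λ a → if c a then f a else g a)
      ifP {c} {f} {g} C P Q = record
        { prog = ⟨ prog C , id ⟩ ⨾ cond (tl ⨾ prog P) (tl ⨾ prog Q)
        ; clock = λ a → suc (suc (clock C a + 1) + (3 + (clock P a + clock Q a)))
        ; clock-bnd = bnd-+ (bnd-const 1) (bnd-+ (bnd-+ (bnd-const 1) (bnd-+ (clock-bnd C) (bnd-const 1)))
            (bnd-+ (bnd-const 3) (bnd-+ (clock-bnd P) (clock-bnd Q))))
        ; run = λ a → go a (c a) refl
        ; out-bnd = bnd-≤ (λ a → pick (c a)) (bnd-+ (out-bnd P) (out-bnd Q)) }
        where
        pick : ∀ {a} b → sz (if b then f a else g a) ≤ sz (f a) + sz (g a)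
        pick true  = m≤m+n _ _
        pick false = m≤n+m _ _
        bound : ∀ {k l m p} → k ≤ m → l ≤ p →
                suc (suc (k + 1) + suc (suc (1 + l))) ≤ suc (suc (m + 1) + (3 + p))
        bound k≤ l≤ = s≤s (+-mono-≤ (s≤s (+-monoˡ-≤ 1 k≤)) (s≤s (s≤s (s≤s l≤))))
        go : ∀ a b → c a ≡ b → ∃[ k ] k ≤ suc (suc (clock C a + 1) + (3 + (clock P a + clock Q a))) ×
             Run (⟨ prog C , id ⟩ ⨾ cond (tl ⨾ prog P) (tl ⨾ prog Q)) (enc a)
                 (enc (if b then f a else g a)) k
        go a b eq with run C a
        go a true eq | k , k≤ , r rewrite eq = let (l , l≤ , r′) = run P a in
          _ , bound k≤ (≤-trans l≤ (m≤m+n _ _)) , seq (pair r id) (then cons (seq tl r′))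
        go a false eq | k , k≤ , r rewrite eq = let (l , l≤ , r′) = run Q a in
          _ , bound k≤ (≤-trans l≤ (m≤n+m _ _)) , seq (pair r id) (else refl (seq tl r′))

  caseList : {X C : Set} → List X → C → (X → List X → C) → C
  caseList []       c f = c
  caseList (x ∷ xs) c f = f x xs

  module _ {A X : Set} ⦃ _ : Code A ⦄ ⦃ _ : Code X ⦄ where

    abstract

      nilP : Poly {A} {List X} (λ _ → [])
      nilP = constP []

      consP : {f : A → X} {g : A → List X} → Poly f → Poly g → Poly (λ a → f a ∷ g a)
      consP P Q = recodeP {f = λ (x , xs) → x ∷ xs} (λ _ → refl) ∘P pairP P Q

  module _ {A X C : Set} ⦃ _ : Code A ⦄ ⦃ _ : Code X ⦄ ⦃ _ : Code C ⦄ where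

    abstract

      caseListP : {xs : A → List X} {f : A → C} {g : A × X × List X → C} →
                  Poly xs → Poly f → Poly g →
                  Poly (λ a → caseList (xs a) (f a) (λ x r → g (a , x , r)))
      caseListP {xs} {f} {g} L P Q = record
        { prog = p
        ; clock = λ a → suc (suc (clock L a + 1) + (11 + slow a))
        ; clock-bnd = bnd-+ (bnd-const 1) (bnd-+ (bnd-+ (bnd-const 1) (bnd-+ (clock-bnd L) (bnd-const 1)))
            (bnd-+ (bnd-const 11) (bnd-+ (clock-bnd P)
              (bnd-poly cQ eQ (bnd-+ (bnd-const 1) (bnd-+ bnd-sz (out-bnd L)))))))
        ; run = λ a → let (k , k≤ , r) = run L a in go a (xs a) refl k≤ r
        ; out-bnd = bnd-≤ (λ a → size-case a (xs a) refl) (bnd-+ (out-bnd P)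
            (bnd-poly cO eO (bnd-+ (bnd-const 1) (bnd-+ bnd-sz (out-bnd L))))) }
        where
        p : Prog
        p = ⟨ prog L , id ⟩ ⨾ cond (⟨ tl , ⟨ hd ⨾ hd , hd ⨾ tl ⟩ ⟩ ⨾ prog Q) (tl ⨾ prog P)
        cQ eQ cO eO : ℕ
        cQ = proj₁ (clock-bnd Q)
        eQ = proj₁ (proj₂ (clock-bnd Q))
        cO = proj₁ (out-bnd Q)
        eO = proj₁ (proj₂ (out-bnd Q))
        size-case : ∀ a l → xs a ≡ l → sz (caseList l (f a) (λ x r → g (a , x , r)))
                    ≤ sz (f a) + cO * (1 + (sz a + sz (xs a))) ^ eO
        size-case a []      eq = m≤m+n _ _
        size-case a (x ∷ r) eq rewrite eq =
          ≤-trans (proj₂ (proj₂ (out-bnd Q)) (a , x , r)) (m≤n+m _ _)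
        slow : A → ℕ
        slow a = clock P a + cQ * (1 + (sz a + sz (xs a))) ^ eQ
        bound : ∀ {k l m n p} → k ≤ m → l ≤ p → n ≤ 11 →
                suc (suc (k + 1) + (n + l)) ≤ suc (suc (m + 1) + (11 + p))
        bound k≤ l≤ n≤ = s≤s (+-mono-≤ (s≤s (+-monoˡ-≤ 1 k≤)) (+-mono-≤ n≤ l≤))
        go : ∀ a l {k} → xs a ≡ l → k ≤ clock L a → Run (prog L) (enc a) (enc (xs a)) k →
             ∃[ k ] k ≤ suc (suc (clock L a + 1) + (11 + slow a)) ×
             Run p (enc a) (enc (caseList l (f a) (λ x r → g (a , x , r)))) k
        go a [] {k} eq k≤ r rewrite eq = let (l , l≤ , r′) = run P a in
          _ , bound k≤ (≤-trans l≤ (m≤m+n _ _)) (s≤s (s≤s (s≤s z≤n))) , seq (pair r id) (else refl (seq tl r′))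
        go a (x ∷ xs′) {k} eq k≤ r rewrite eq = let (l , l≤ , r′) = run Q (a , x , xs′) in
          _ , bound k≤ (≤-trans l≤ (≤-trans (proj₂ (proj₂ (clock-bnd Q)) (a , x , xs′)) (m≤n+m _ _))) ≤-refl
            , seq (pair r id) (then cons (seq (pair tl (pair (seq hd hd) (seq hd tl))) r′))

  prefixes : {X B : Set} → (B → X → B) → B → List X → (B → Set) → Set
  prefixes f b l Q = ∀ ys zs → l ≡ ys ++ zs → Q (foldl f b ys)

  module _ {A X B : Set} ⦃ _ : Code A ⦄ ⦃ _ : Code X ⦄ ⦃ _ : Code B ⦄ where

    abstract

      length≤sz : (l : List X) → length l ≤ sz l
      length≤sz []      = z≤n
      length≤sz (x ∷ l) = s≤s (≤-trans (length≤sz l) (m≤n+m _ _))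

      foldlP : {xs : A → List X} {b : A → B} {s : A × B × X → B} {g : A → ℕ} →
               Poly xs → Poly b → Poly s → Bnd g →
               (∀ a → prefixes (λ b x → s (a , b , x)) (b a) (xs a) (λ b → sz b ≤ g a)) →
               Poly (λ a → foldl (λ b x → s (a , b , x)) (b a) (xs a))
      foldlP {xs} {b} {s} {g} L I S G small = record
        { prog = ⟨ prog L , ⟨ id , prog I ⟩ ⟩ ⨾ (while body ⨾ (tl ⨾ tl))
        ; clock = λ a → suc (suc (clock L a + suc (1 + clock I a)) + suc (sz (xs a) * (21 + τ a) + 1 + 3))
        ; clock-bnd = bnd-+ (bnd-const 1) (bnd-+ (bnd-+ (bnd-const 1) (bnd-+ (clock-bnd L)
            (bnd-+ (bnd-const 2) (clock-bnd I)))) (bnd-+ (bnd-const 1) (bnd-+ (bnd-+ (bnd-* (out-bnd L)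
            (bnd-+ (bnd-const 21) (bnd-poly cS eS bnd-h))) (bnd-const 1)) (bnd-const 3))))
        ; run = λ a →
            let (k , k≤ , r) = run L a ; (l , l≤ , r′) = run I a
                (m , m≤ , r″) = loops a (xs a) (b a) (small a) ≤-refl in
            _ , s≤s (+-mono-≤ (s≤s (+-mono-≤ k≤ (s≤s (s≤s l≤))))
                  (s≤s (+-monoˡ-≤ 3 (≤-trans m≤ (+-monoˡ-≤ 1 (*-monoˡ-≤ (21 + τ a) (length≤sz (xs a)))))))) ,
            seq (pair r (pair id r′)) (seq r″ (seq tl tl))
        ; out-bnd = bnd-≤ (λ a → small a (xs a) [] (sym (Listₚ.++-identityʳ (xs a)))) G }
        where
        body : Prog
        body = ⟨ hd ⨾ tl , ⟨ tl ⨾ hd , ⟨ tl ⨾ hd , ⟨ tl ⨾ tl , hd ⨾ hd ⟩ ⟩ ⨾ prog S ⟩ ⟩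
        cS eS : ℕ
        cS = proj₁ (clock-bnd S)
        eS = proj₁ (proj₂ (clock-bnd S))
        h τ : A → ℕ
        h a = 2 + (sz a + (g a + sz (xs a)))
        τ a = cS * h a ^ eS
        bnd-h : Bnd h
        bnd-h = bnd-+ (bnd-const 2) (bnd-+ bnd-sz (bnd-+ G (out-bnd L)))
        loops : ∀ a l b → prefixes (λ b x → s (a , b , x)) b l (λ b → sz b ≤ g a) → sz l ≤ sz (xs a) →
                ∃[ k ] k ≤ length l * (21 + τ a) + 1 ×
                Run (while body) (enc l · (enc a · enc b))
                    (nil · (enc a · enc (foldl (λ b x → s (a , b , x)) b l))) k
        loops a []      b sm l≤ = 1 , ≤-refl , stop refl
        loops a (x ∷ l) b sm l≤ =
          let (k , k≤ , r) = run S (a , b , x)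
              (m , m≤ , r′) = loops a l (s (a , b , x)) (λ ys zs eq → sm (x ∷ ys) zs (cong (x ∷_) eq))
                                (≤-trans (m≤n⇒m≤1+n (m≤n+m _ _)) l≤)
              k≤′ = ≤-trans k≤ (≤-trans (proj₂ (proj₂ (clock-bnd S)) (a , b , x)) (*-monoʳ-≤ cS
                      (^-monoˡ-≤ eS (s≤s (≤-trans (≤-reflexive (+-suc (sz a) _)) (s≤s (+-monoʳ-≤ (sz a)
                        (+-mono-≤ (sm [] (x ∷ l) refl) (≤-trans (m≤n⇒m≤1+n (m≤m+n _ _)) l≤)))))))))
          in _ , ≤-trans (s≤s (+-mono-≤ (+-monoʳ-≤ 20 k≤′) m≤))
                         (≤-reflexive (sym (+-assoc (21 + τ a) (length l * (21 + τ a)) 1))) ,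
             loop cons
               (pair (seq hd tl) (pair (seq tl hd)
                 (seq (pair (seq tl hd) (pair (seq tl tl) (seq hd hd))) r))) r′

  instance
    code-⊤ : Code ⊤
    code-⊤ = record { enc = λ _ → nil }

  sz-++ : {X : Set} ⦃ _ : Code X ⦄ (xs ys : List X) → suc (sz (xs ++ ys)) ≡ sz xs + sz ys
  sz-++ []       ys = refl
  sz-++ (x ∷ xs) ys = cong suc (trans (sym (+-suc (sz x) _))
    (trans (cong (sz x +_) (sz-++ xs ys)) (sym (+-assoc (sz x) (sz xs) (sz ys)))))

  sz-++≤ : {X : Set} ⦃ _ : Code X ⦄ (xs ys : List X) → sz (xs ++ ys) ≤ sz xs + sz ys
  sz-++≤ xs ys = ≤-trans (n≤1+n _) (≤-reflexive (sz-++ xs ys))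

  sz-suffix : {X : Set} ⦃ _ : Code X ⦄ (xs ys : List X) → sz ys ≤ sz (xs ++ ys)
  sz-suffix []       ys = ≤-refl
  sz-suffix (x ∷ xs) ys = m≤n⇒m≤1+n (≤-trans (sz-suffix xs ys) (m≤n+m _ _))

  sz-prefix : {X : Set} ⦃ _ : Code X ⦄ (xs ys : List X) → sz xs ≤ sz (xs ++ ys)
  sz-prefix []       ys = size≥1 _
  sz-prefix (x ∷ xs) ys = s≤s (+-monoʳ-≤ (sz x) (sz-prefix xs ys))

  module _ {A X : Set} ⦃ _ : Code A ⦄ ⦃ _ : Code X ⦄ where

    bnd-elem : {h : A × X → ℕ} {xs : A → List X} → Bnd h → Poly xs →
               ∃[ H ] Bnd {A} H × (∀ a x → sz x ≤ sz (xs a) → h (a , x) ≤ H a)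
    bnd-elem {h} {xs} (c , e , p) L =
      (λ a → c * (1 + (sz a + sz (xs a))) ^ e) ,
      bnd-poly c e (bnd-+ (bnd-const 1) (bnd-+ bnd-sz (out-bnd L))) ,
      λ a x le → ≤-trans (p (a , x)) (*-monoʳ-≤ c (^-monoˡ-≤ e (s≤s (+-monoʳ-≤ (sz a) le))))

  module _ {A X B : Set} ⦃ _ : Code A ⦄ ⦃ _ : Code X ⦄ ⦃ _ : Code B ⦄ where

    foldl⁺P : {xs : A → List X} {b : A → B} {s : A × B × X → B} {h : A × X → ℕ} →
              Poly xs → Poly b → Poly s → Bnd h →
              (∀ a b x → sz (s (a , b , x)) ≤ sz b + h (a , x)) →
              Poly (λ a → foldl (λ b x → s (a , b , x)) (b a) (xs a))
    foldl⁺P {xs} {b} {s} {h} L I S Hb grow =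
      foldlP L I S (bnd-+ (out-bnd I) (bnd-* (out-bnd L) (proj₁ (proj₂ (bnd-elem Hb L)))))
        λ a ys zs eq → ≤-trans (go a ys (b a) (≤-trans (sz-prefix ys zs) (≤-reflexive (cong sz (sym eq)))))
          (+-monoʳ-≤ (sz (b a)) (*-monoˡ-≤ (H a) (≤-trans (length≤sz {A} {X} {B} ys)
            (≤-trans (sz-prefix ys zs) (≤-reflexive (cong sz (sym eq)))))))
      where
      H = proj₁ (bnd-elem Hb L)
      go : ∀ a ys b → sz ys ≤ sz (xs a) →
           sz (foldl (λ b x → s (a , b , x)) b ys) ≤ sz b + length ys * H a
      go a []       b le = m≤m+n _ _
      go a (y ∷ ys) b le = ≤-trans (go a ys _ (≤-trans (m≤n⇒m≤1+n (m≤n+m _ _)) le))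
        (≤-trans (+-monoˡ-≤ _ (≤-trans (grow a b y) (+-monoʳ-≤ (sz b)
                   (proj₂ (proj₂ (bnd-elem Hb L)) a y (≤-trans (m≤n⇒m≤1+n (m≤m+n _ _)) le)))))
          (≤-reflexive (+-assoc (sz b) (H a) _)))

  module _ {A X : Set} ⦃ _ : Code A ⦄ ⦃ _ : Code X ⦄ where

    reverseP : {xs : A → List X} → Poly xs → Poly (λ a → reverse (xs a))
    reverseP L = foldl⁺P L nilP (consP ₂₂P ₁₂P)
      (bnd-+ (bnd-const 1) (out-bnd ₂P))
      (λ a b x → ≤-reflexive (trans (cong suc (+-comm (sz x) (sz b))) (sym (+-suc (sz b) (sz x)))))

  module _ {A X B : Set} ⦃ _ : Code A ⦄ ⦃ _ : Code X ⦄ ⦃ _ : Code B ⦄ where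

    private
      swapP : {s : A × X × B → B} → Poly s → Poly {A × B × X} (λ (a , b , x) → s (a , x , b))
      swapP S = S ∘P pairP ₁P (pairP ₂₂P ₁₂P)

    foldrP : {xs : A → List X} {b : A → B} {s : A × X × B → B} {g : A → ℕ} →
             Poly xs → Poly b → Poly s → Bnd g →
             (∀ a ys zs → xs a ≡ ys ++ zs → sz (foldr (λ x b → s (a , x , b)) (b a) zs) ≤ g a) →
             Poly (λ a → foldr (λ x b → s (a , x , b)) (b a) (xs a))
    foldrP {xs} {b} {s} {g} L I S G small =
      extP (λ a → Listₚ.reverse-foldl _ (b a) (xs a))
        (foldlP (reverseP L) I (swapP S) G λ a ys zs eq →
          subst (λ r → sz r ≤ g a)
            (trans (sym (Listₚ.reverse-foldl (λ b x → s (a , x , b)) (b a) (reverse ys)))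
                   (cong (foldl _ (b a)) (Listₚ.reverse-involutive ys)))
            (small a (reverse zs) (reverse ys)
              (trans (sym (Listₚ.reverse-involutive (xs a)))
                (trans (cong reverse eq) (Listₚ.reverse-++ ys zs)))))

    foldr⁺P : {xs : A → List X} {b : A → B} {s : A × X × B → B} {h : A × X → ℕ} →
              Poly xs → Poly b → Poly s → Bnd h →
              (∀ a x b → sz (s (a , x , b)) ≤ sz b + h (a , x)) →
              Poly (λ a → foldr (λ x b → s (a , x , b)) (b a) (xs a))
    foldr⁺P {xs} {b} L I S H grow =
      extP (λ a → Listₚ.reverse-foldl _ (b a) (xs a))
        (foldl⁺P (reverseP L) I (swapP S) H λ a b x → grow a x b)

  module _ {A X Y : Set} ⦃ _ : Code A ⦄ ⦃ _ : Code X ⦄ ⦃ _ : Code Y ⦄ where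

    mapP : {xs : A → List X} {f : A × X → Y} → Poly f → Poly xs →
           Poly (λ a → map (λ x → f (a , x)) (xs a))
    mapP {xs} {f} F L = extP (λ a → sym (Listₚ.map-is-foldr (xs a)))
      (foldr⁺P L nilP (consP (F ∘P pairP ₁P ₁₂P) ₂₂P)
        (bnd-+ (bnd-const 1) (out-bnd F))
        λ a x b → ≤-reflexive (trans (cong suc (+-comm (sz (f (a , x))) (sz b))) (sym (+-suc (sz b) _))))

  module _ {A X : Set} ⦃ _ : Code A ⦄ ⦃ _ : Code X ⦄ where

    appendP : {xs ys : A → List X} → Poly xs → Poly ys → Poly (λ a → xs a ++ ys a)
    appendP {xs} {ys} L M = extP (λ a → sym (Listₚ.++-is-foldr (xs a) (ys a)))
      (foldr⁺P L M (consP ₁₂P ₂₂P)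
        (bnd-+ (bnd-const 1) (out-bnd ₂P))
        λ a x b → ≤-reflexive (trans (cong suc (+-comm (sz x) (sz b))) (sym (+-suc (sz b) _))))

  module _ {A X : Set} ⦃ _ : Code A ⦄ ⦃ _ : Code X ⦄ where

    concatP : {xss : A → List (List X)} → Poly xss → Poly (λ a → concat (xss a))
    concatP L = foldr⁺P L nilP (appendP ₁₂P ₂₂P)
      (out-bnd ₂P) λ a x b → ≤-trans (sz-++≤ x b) (≤-reflexive (+-comm (sz x) (sz b)))

    filterP : {xs : A → List X} {P : A × X → Set} {P? : ∀ ax → Dec (P ax)} →
              Poly (λ ax → does (P? ax)) → Poly xs → Poly (λ a → filter (λ x → P? (a , x)) (xs a))
    filterP {xs} {P} {P?} D L = extP (λ a → go a (xs a))
      (foldr⁺P L nilP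
        (ifP (D ∘P pairP ₁P ₁₂P)
             (consP ₁₂P ₂₂P) ₂₂P)
        (bnd-+ (bnd-const 1) (out-bnd ₂P))
        λ a x b → size-if (does (P? (a , x))) x b)
      where
      go : ∀ a l → foldr (λ x b → if does (P? (a , x)) then x ∷ b else b) [] l ≡ filter (λ x → P? (a , x)) l
      go a []      = refl
      go a (x ∷ l) with does (P? (a , x))
      ... | true  = cong (x ∷_) (go a l)
      ... | false = go a l
      size-if : ∀ c (x : X) b → sz (if c then x ∷ b else b) ≤ sz b + (1 + sz x)
      size-if true  x b = ≤-reflexive (trans (cong suc (+-comm (sz x) (sz b))) (sym (+-suc (sz b) _)))
      size-if false x b = m≤m+n _ _

    lengthP : {xs : A → List X} → Poly xs → Poly (λ a → length (xs a))
    lengthP {xs} L = extP (λ a → Listₚ.length-map _ (xs a))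
      (recodeP {f = length} ones ∘P mapP {f = λ _ → tt} (constP tt) L)
      where
      ones : ∀ l → unary (length l) ≡ encList (λ (_ : ⊤) → nil) l
      ones []      = refl
      ones (_ ∷ l) = cong (nil ·_) (ones l)

  module _ {A : Set} ⦃ _ : Code A ⦄ where

    onesP : {n : A → ℕ} → Poly n → Poly (λ a → replicate (n a) tt)
    onesP N = recodeP {f = λ n → replicate n tt} go ∘P N
      where
      go : ∀ n → encList (λ _ → nil) (replicate n tt) ≡ unary n
      go zero    = refl
      go (suc n) = cong (nil ·_) (go n)

    sucP : {n : A → ℕ} → Poly n → Poly (λ a → suc (n a))
    sucP N = stepsP {f = suc} ⟨ nil , id ⟩ 3 (λ _ → pair nil id)
      (bnd-+ (bnd-const 2) bnd-sz) ∘P N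

  module _ {A C : Set} ⦃ _ : Code A ⦄ ⦃ _ : Code C ⦄ where

    iterP : {n : A → ℕ} {b : A → C} {s : A × C → C} {h : A → ℕ} →
            Poly n → Poly b → Poly s → Bnd h → (∀ a b → sz (s (a , b)) ≤ sz b + h a) →
            Poly (λ a → foldl (λ b _ → s (a , b)) (b a) (replicate (n a) tt))
    iterP N I S H grow = foldl⁺P (onesP N) I (S ∘P pairP ₁P ₁₂P)
      (bnd-∘ H (out-bnd ₁P)) (λ a b _ → grow a b)

  caseℕ : {C : Set} → ℕ → C → (ℕ → C) → C
  caseℕ zero    z s = z
  caseℕ (suc n) z s = s n

  module _ {A C : Set} ⦃ _ : Code A ⦄ ⦃ _ : Code C ⦄ where

    caseℕP : {n : A → ℕ} {f : A → C} {g : A × ℕ → C} → Poly n → Poly f → Poly g →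
             Poly (λ a → caseℕ (n a) (f a) (λ m → g (a , m)))
    caseℕP {n} {f} {g} N P Q =
      extP (λ a → go (n a))
        (caseListP (onesP N) P (Q ∘P pairP ₁P (lengthP ₂₂P)))
      where
      go : ∀ {a} m → caseList (replicate m tt) (f a) (λ x r → g (a , length r)) ≡ caseℕ m (f a) (λ m → g (a , m))
      go zero    = refl
      go {a} (suc m) = cong (λ k → g (a , k)) (Listₚ.length-replicate m)

  isZero : ℕ → Bool
  isZero zero    = true
  isZero (suc _) = false

  -- Unlike the versions in the library these do not reduce on open terms,
  -- so that with can abstract over them.

  infix 4 _≟_ _≤?_

  _≟_ : (m n : ℕ) → Dec (m ≡ n)
  zero  ≟ zero  = yes refl
  zero  ≟ suc n = no λ ()
  suc m ≟ zero  = no λ ()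
  suc m ≟ suc n with m ≟ n
  ... | yes eq = yes (cong suc eq)
  ... | no neq = no (neq ∘ suc-injective)

  _≤?_ : (m n : ℕ) → Dec (m ≤ n)
  zero  ≤? n     = yes z≤n
  suc m ≤? zero  = no λ ()
  suc m ≤? suc n with m ≤? n
  ... | yes le = yes (s≤s le)
  ... | no nle = no (nle ∘ s≤s⁻¹)

  ≤?-∸ : ∀ m n → does (m ≤? n) ≡ isZero (m ∸ n)
  ≤?-∸ zero    n       = sym (cong isZero (0∸n≡0 n))
  ≤?-∸ (suc m) zero    = refl
  ≤?-∸ (suc m) (suc n) with m ≤? n | ≤?-∸ m n
  ... | yes _ | eq = eq
  ... | no _  | eq = eq

  ∸-≟ : ∀ m n → isZero ((m ∸ n) + (n ∸ m)) ≡ does (m ≟ n)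
  ∸-≟ zero    zero    = refl
  ∸-≟ zero    (suc n) = refl
  ∸-≟ (suc m) zero    = refl
  ∸-≟ (suc m) (suc n) with m ≟ n | ∸-≟ m n
  ... | yes _ | eq = eq
  ... | no _  | eq = eq

  foldl-replicate : {C : Set} (f : C → C) (m : ℕ) (b : C) →
    foldl (λ b _ → f b) (f b) (replicate m tt) ≡ f (foldl (λ b _ → f b) b (replicate m tt))
  foldl-replicate f zero    b = refl
  foldl-replicate f (suc m) b = foldl-replicate f m (f b)

  sz-ℕ : ∀ m n → sz (m + n) ≤ sz n + sz m
  sz-ℕ zero    n = m≤m+n _ _
  sz-ℕ (suc m) n = ≤-trans (+-monoʳ-≤ 2 (sz-ℕ m n)) (≤-reflexive
    (trans (sym (+-suc (suc (sz n)) (sz m))) (sym (+-suc (sz n) (suc (sz m))))))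

  module _ {A : Set} ⦃ _ : Code A ⦄ where

    predP : {n : A → ℕ} → Poly n → Poly (λ a → pred (n a))
    predP {n} N = extP (λ a → go (n a)) (caseℕP N (constP 0) ₂P)
      where
      go : ∀ m → caseℕ m 0 (λ m → m) ≡ pred m
      go zero    = refl
      go (suc m) = refl

    isZeroP : {n : A → ℕ} → Poly n → Poly (λ a → isZero (n a))
    isZeroP {n} N = extP (λ a → go (n a)) (caseℕP N (constP true) (constP false))
      where
      go : ∀ m → caseℕ m true (λ _ → false) ≡ isZero m
      go zero    = refl
      go (suc m) = refl

  module _ {A : Set} ⦃ _ : Code A ⦄ where

    addP : {m n : A → ℕ} → Poly m → Poly n → Poly (λ a → m a + n a)
    addP {m} {n} M N = extP (λ a → go (m a) (n a))
      (iterP M N (sucP ₂P) (bnd-const 2) λ a b → ≤-reflexive (+-comm 2 (sz b)))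
      where
      go : ∀ m n → foldl (λ b _ → suc b) n (replicate m tt) ≡ m + n
      go zero    n = refl
      go (suc m) n = trans (foldl-replicate suc m n) (cong suc (go m n))

  module _ {A : Set} ⦃ _ : Code A ⦄ where

    mulP : {m n : A → ℕ} → Poly m → Poly n → Poly (λ a → m a * n a)
    mulP {m} {n} M N = extP (λ a → go (m a) (n a))
      (iterP M (constP 0) (addP (N ∘P ₁P) ₂P) (out-bnd N) λ a b → sz-ℕ (n a) b)
      where
      go : ∀ m n → foldl (λ b _ → n + b) 0 (replicate m tt) ≡ m * n
      go zero    n = refl
      go (suc m) n = trans (foldl-replicate (n +_) m 0) (cong (n +_) (go m n))

    monusP : {m n : A → ℕ} → Poly m → Poly n → Poly (λ a → m a ∸ n a)
    monusP {m} {n} M N = extP (λ a → go (n a) (m a))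
      (iterP N M (predP ₂P) (bnd-const 0) λ { a zero → m≤m+n _ _ ; a (suc b) → ≤-trans (m≤n+m (sz b) 2) (m≤m+n _ 0) })
      where
      go : ∀ n m → foldl (λ b _ → pred b) m (replicate n tt) ≡ m ∸ n
      go zero    m = refl
      go (suc n) zero = trans (go n 0) (0∸n≡0 n)
      go (suc n) (suc m) = go n m

  module _ {A : Set} ⦃ _ : Code A ⦄ where

    leqP : {m n : A → ℕ} → Poly m → Poly n → Poly (λ a → does (m a ≤? n a))
    leqP {m} {n} M N = extP (λ a → sym (≤?-∸ (m a) (n a))) (isZeroP (monusP M N))

    eqP : {m n : A → ℕ} → Poly m → Poly n → Poly (λ a → does (m a ≟ n a))
    eqP {m} {n} M N = extP (λ a → ∸-≟ (m a) (n a)) (isZeroP (addP (monusP M N) (monusP N M)))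

    notP : {b : A → Bool} → Poly b → Poly (λ a → not (b a))
    notP {b} B = extP (λ a → go (b a)) (ifP B (constP false) (constP true))
      where
      go : ∀ c → (if c then false else true) ≡ not c
      go true  = refl
      go false = refl

  module _ {A : Set} ⦃ _ : Code A ⦄ where

    andP : {b c : A → Bool} → Poly b → Poly c → Poly (λ a → b a ∧ c a)
    andP {b} {c} B C = extP (λ a → go (b a)) (ifP B C (constP false))
      where
      go : ∀ {c} b → (if b then c else false) ≡ b ∧ c
      go true  = refl
      go false = refl

    orP : {b c : A → Bool} → Poly b → Poly c → Poly (λ a → b a ∨ c a)
    orP {b} {c} B C = extP (λ a → go (b a)) (ifP B (constP true) C)
      where
      go : ∀ {c} b → (if b then true else c) ≡ b ∨ c
      go true  = refl
      go false = refl

  sumP : {A : Set} ⦃ _ : Code A ⦄ {xs : A → List ℕ} → Poly xs → Poly (λ a → sumᴸ (xs a))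
  sumP L = foldr⁺P L (constP 0) (addP ₁₂P ₂₂P) (out-bnd ₂P)
    λ a x b → sz-ℕ x b

  module _ {A X : Set} ⦃ _ : Code A ⦄ ⦃ _ : Code X ⦄ where

    replicateP : {n : A → ℕ} {x : A → X} → Poly n → Poly x → Poly (λ a → replicate (n a) (x a))
    replicateP {n} {x} N E = extP (λ a → go (n a) (x a)) (mapP (E ∘P ₁P) (onesP N))
      where
      go : ∀ n (x : X) → map (λ _ → x) (replicate n tt) ≡ replicate n x
      go zero    x = refl
      go (suc n) x = cong (x ∷_) (go n x)

    anyP : {xs : A → List X} {P : A × X → Set} {P? : ∀ ax → Dec (P ax)} →
           Poly (λ ax → does (P? ax)) → Poly xs → Poly (λ a → does (any? (λ x → P? (a , x)) (xs a)))
    anyP {xs} {P} {P?} D L = extP (λ a → go a (xs a))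
      (foldr⁺P L (constP false) (orP (D ∘P pairP ₁P ₁₂P) ₂₂P)
        (bnd-const 2) λ a x b → small (does (P? (a , x))) b)
      where
      go : ∀ a l → foldr (λ x b → does (P? (a , x)) ∨ b) false l ≡ does (any? (λ x → P? (a , x)) l)
      go a []      = refl
      go a (x ∷ l) = cong (does (P? (a , x)) ∨_) (go a l)
      small : ∀ c b → sz (c ∨ b) ≤ sz b + 2
      small true  b = ≤-trans (+-monoˡ-≤ 2 (size≥1 (encBool b))) ≤-refl
      small false b = m≤m+n _ _

  breakAt : {X : Set} {P : X → Set} → (∀ x → Dec (P x)) → List X → List X × List X
  breakAt P? []       = [] , []
  breakAt P? (x ∷ xs) = if does (P? x) then ([] , x ∷ xs)
                        else (x ∷ proj₁ (breakAt P? xs) , proj₂ (breakAt P? xs))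

  breakAt-++ : {X : Set} {P : X → Set} (P? : ∀ x → Dec (P x)) (xs : List X) →
               proj₁ (breakAt P? xs) ++ proj₂ (breakAt P? xs) ≡ xs
  breakAt-++ P? []       = refl
  breakAt-++ P? (x ∷ xs) with does (P? x)
  ... | true  = refl
  ... | false = cong (x ∷_) (breakAt-++ P? xs)

  module _ {A X : Set} ⦃ _ : Code A ⦄ ⦃ _ : Code X ⦄ where

    breakAtP : {xs : A → List X} {P : A × X → Set} {P? : ∀ ax → Dec (P ax)} →
               Poly (λ ax → does (P? ax)) → Poly xs → Poly (λ a → breakAt (λ x → P? (a , x)) (xs a))
    breakAtP {xs} {P} {P?} D L = extP (λ a → go a (xs a))
      (foldr⁺P L (pairP nilP nilP)
        (ifP (D ∘P pairP ₁P x)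
             (pairP nilP (consP x (appendP l r))) (pairP (consP x l) r))
        (bnd-+ (bnd-const 2) (out-bnd ₂P))
        λ a x (l , r) → small (does (P? (a , x))) x l r)
      where
      x = ₁₂P
      l = fstP ₂₂P
      r = sndP ₂₂P
      step : A → X → List X × List X → List X × List X
      step a x (l , r) = if does (P? (a , x)) then ([] , x ∷ (l ++ r)) else (x ∷ l , r)
      go : ∀ a l → foldr (step a) ([] , []) l ≡ breakAt (λ x → P? (a , x)) l
      go a []      = refl
      go a (x ∷ l) rewrite go a l with does (P? (a , x))
      ... | true  = cong (λ k → [] , x ∷ k) (breakAt-++ _ l)
      ... | false = refl
      small : ∀ c (x : X) l r → sz (if c then ([] , x ∷ (l ++ r)) else (x ∷ l , r))
              ≤ sz (l , r) + (2 + sz x)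
      small true x l r = ≤-trans (≤-reflexive (cong (2 +_)
          (trans (sym (+-suc (sz x) _)) (trans (cong (sz x +_) (sz-++ l r)) (+-comm (sz x) _)))))
        (≤-trans (n≤1+n _) (≤-reflexive (cong suc (trans (cong suc (sym (+-suc _ (sz x)))) (sym (+-suc _ (suc (sz x))))))))
      small false x l r = ≤-trans (≤-reflexive (cong (2 +_) (trans (+-assoc (sz x) _ _) (+-comm (sz x) _))))
        (≤-trans (n≤1+n _) (≤-reflexive (cong suc (trans (cong suc (sym (+-suc _ (sz x)))) (sym (+-suc _ (suc (sz x))))))))

  -- Indices beyond the end refer to the last entry.
  nth : {X : Set} → X → List X → ℕ → X
  nth d []       k       = d
  nth d (x ∷ xs) zero    = x
  nth d (x ∷ xs) (suc k) = nth x xs k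

  module _ {A X : Set} ⦃ _ : Code A ⦄ ⦃ _ : Code X ⦄ where

    nthP : {d : A → X} {xs : A → List X} {k : A → ℕ} → Poly d → Poly xs → Poly k →
           Poly (λ a → nth (d a) (xs a) (k a))
    nthP {d} {xs} {k} D L K = extP (λ a → go (d a) (xs a) (k a))
      (sndP (foldl⁺P L (pairP (sucP K) D)
        (caseℕP (fstP b) b (pairP ₂P (sndP ₂₁P)))
        (out-bnd ₂P)
        λ a (m , c) x → small m c x))
      where
      b = ₁₂P
      step : ℕ × X → X → ℕ × X
      step (m , c) x = caseℕ m (m , c) (λ m′ → m′ , x)
      stay : ∀ c l → foldl step (0 , c) l ≡ (0 , c)
      stay c []      = refl
      stay c (x ∷ l) = stay c l
      go : ∀ d l k → proj₂ (foldl step (suc k , d) l) ≡ nth d l k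
      go d []      k       = refl
      go d (x ∷ l) zero    = cong proj₂ (stay x l)
      go d (x ∷ l) (suc k) = go x l k
      small : ∀ m (c : X) x → sz (caseℕ m (m , c) (λ m′ → m′ , x)) ≤ sz (m , c) + sz x
      small zero    c x = m≤m+n _ _
      small (suc m) c x = s≤s (≤-trans (+-monoˡ-≤ (sz x) (m≤n+m (sz m) 2))
        (+-monoˡ-≤ (sz x) (m≤m+n (2 + sz m) (sz c))))

  module _ {A X : Set} ⦃ _ : Code A ⦄ ⦃ _ : Code X ⦄ where

    concatMapP : {Y : Set} ⦃ _ : Code Y ⦄ {xs : A → List X} {f : A × X → List Y} →
                 Poly f → Poly xs → Poly (λ a → concatMap (λ x → f (a , x)) (xs a))
    concatMapP F L = concatP (mapP F L)

    dropHeadP : {xs : A → List X} → Poly xs → Poly (λ a → caseList (xs a) [] (λ _ r → r))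
    dropHeadP L = caseListP L nilP ₂₂P

  memP : {A : Set} ⦃ _ : Code A ⦄ {v : A → ℕ} {xs : A → List ℕ} →
         Poly v → Poly xs → Poly (λ a → does (any? (v a ≟_) (xs a)))
  memP V L = anyP {P? = λ (a , x) → _ ≟ x} (eqP (V ∘P ₁P) ₂P) L

  halfP : {A : Set} ⦃ _ : Code A ⦄ {n : A → ℕ} → Poly n → Poly (λ a → ⌊ n a /2⌋)
  halfP {A} {n} N = extP (λ a → trans (go (n a) 0) (+-identityʳ _)) (fstP (iterP N (pairP (constP 0) (constP false))
    (ifP ₂₂P (pairP (sucP ₁₂P) (constP false))
         (pairP ₁₂P (constP true))) (bnd-const 2) (λ a (h , p) → small h p)))
    where
    step : ℕ × Bool → ℕ × Bool
    step (h , p) = if p then (suc h , false) else (h , true)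
    go : ∀ n h → proj₁ (foldl (λ b _ → step b) (h , false) (replicate n tt)) ≡ ⌊ n /2⌋ + h
    go zero          h = refl
    go (suc zero)    h = refl
    go (suc (suc n)) h = trans (go n (suc h)) (+-suc ⌊ n /2⌋ h)
    small : ∀ h p → sz (step (h , p)) ≤ sz (h , p) + 2
    eq₁ : ∀ h → (3 + h + 1) + 2 ≡ (1 + (h + 3)) + 2
    eq₁ = solve-∀
    eq₂ : ∀ h → 1 + (h + 3) ≡ (1 + (h + 1)) + 2
    eq₂ = solve-∀
    small h true  = ≤-trans (m≤m+n _ 2) (≤-reflexive (eq₁ (sz h)))
    small h false = ≤-reflexive (eq₂ (sz h))

  -- Numbers are read in bijective binary, least significant digit first.

  digit : Bool → ℕ
  digit true  = 1
  digit false = 2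

  value-of : List Bool → ℕ
  value-of []       = 0
  value-of (b ∷ bs) = digit b + 2 * value-of bs

  low : List Bool → ℕ
  low bs = caseList bs 0 (λ b _ → digit b)

  high : List Bool → List Bool
  high bs = caseList bs [] (λ _ r → r)

  value-split : ∀ bs → value-of bs ≡ low bs + 2 * value-of (high bs)
  value-split []       = refl
  value-split (b ∷ bs) = refl

  low≤2 : ∀ bs → low bs ≤ 2
  low≤2 []           = z≤n
  low≤2 (true ∷ _)  = s≤s z≤n
  low≤2 (false ∷ _) = ≤-refl

  ≤-half : ∀ m n → m ≤ ⌊ n /2⌋ → m + m ≤ n
  ≤-half m n le = ≤-trans (+-mono-≤ le (≤-trans le (⌊n/2⌋≤⌈n/2⌉ n))) (≤-reflexive (⌊n/2⌋+⌈n/2⌉≡n n))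

  half-≤ : ∀ m n → m + m ≤ n → m ≤ ⌊ n /2⌋
  half-≤ m n le = ≤-trans (≤-reflexive (n≡⌊n+n/2⌋ m)) (⌊n/2⌋-mono le)

  ⌊+/2⌋ : ∀ n b → ⌊ n + (b + b) /2⌋ ≡ ⌊ n /2⌋ + b
  ⌊+/2⌋ n zero    = trans (cong ⌊_/2⌋ (+-identityʳ n)) (sym (+-identityʳ _))
  ⌊+/2⌋ n (suc b) = trans (cong ⌊_/2⌋ (eq n b)) (trans (cong suc (⌊+/2⌋ n b)) (sym (+-suc _ b)))
    where
    eq : ∀ n b → n + (suc b + suc b) ≡ suc (suc (n + (b + b)))
    eq = solve-∀

  module _ (N k : ℕ) where

    -- With (f , ds , ns) as state, k · ds ≥ N · ns has been reduced to
    -- f + k · ds ≥ N · (2 + ns); the offset 2N keeps f nonnegative.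

    Reduced : ℕ × List Bool × List Bool → Set
    Reduced (f , ds , ns) = N * (2 + value-of ns) ≤ f + k * value-of ds

    carry : ℕ × List Bool × List Bool → ℕ × List Bool × List Bool
    carry (f , ds , ns) = ⌊ f + (k * low ds + N * (2 ∸ low ns)) /2⌋ , high ds , high ns

    private
      identity₁ : ∀ N ν w → N * (2 + w) + N * (2 + w) + N * ν ≡ N * (2 + (ν + 2 * w)) + N * 2
      identity₁ = solve-∀

      identity₂ : ∀ f k δ v N a ν → f + (k * δ + N * a) + (k * v + k * v) + N * ν ≡ f + k * (δ + 2 * v) + N * (a + ν)
      identity₂ = solve-∀

      lhs : ∀ ns → N * (2 + value-of (high ns)) + N * (2 + value-of (high ns)) + N * low ns ≡
                    N * (2 + value-of ns) + N * 2
      lhs ns rewrite value-split ns = identity₁ N (low ns) (value-of (high ns))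

      rhs : ∀ f ds ns → f + (k * low ds + N * (2 ∸ low ns)) + (k * value-of (high ds) + k * value-of (high ds)) + N * low ns ≡
                        f + k * value-of ds + N * 2
      rhs f ds ns rewrite value-split ds =
        trans (identity₂ f k (low ds) (value-of (high ds)) N (2 ∸ low ns) (low ns))
              (cong (λ z → f + k * (low ds + 2 * value-of (high ds)) + N * z) (m∸n+n≡m (low≤2 ns)))

    carry⇒ : ∀ s → Reduced s → Reduced (carry s)
    carry⇒ (f , ds , ns) le =
      ≤-trans (half-≤ (N * (2 + value-of (high ns))) _ (+-cancelʳ-≤ (N * low ns) _ _
        (≤-trans (≤-reflexive (lhs ns)) (≤-trans (+-monoˡ-≤ (N * 2) le) (≤-reflexive (sym (rhs f ds ns)))))))
        (≤-reflexive (⌊+/2⌋ _ (k * value-of (high ds))))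

    carry⇐ : ∀ s → Reduced (carry s) → Reduced s
    carry⇐ (f , ds , ns) le = +-cancelʳ-≤ (N * 2) _ _
      (≤-trans (≤-reflexive (sym (lhs ns))) (≤-trans (+-monoˡ-≤ (N * low ns)
        (≤-half (N * (2 + value-of (high ns))) _ (≤-trans le (≤-reflexive (sym (⌊+/2⌋ _ (k * value-of (high ds))))))))
        (≤-reflexive (rhs f ds ns))))

    private
      Done : ℕ × List Bool × List Bool → Set
      Done (f , ds , ns) = ds ≡ [] × ns ≡ []

      run-carry : List Bool → ℕ × List Bool × List Bool → ℕ × List Bool × List Bool
      run-carry l s = foldl (λ s _ → carry s) s l

      carries⇒ : ∀ l s → Reduced s → Reduced (run-carry l s)
      carries⇒ []      s r = r
      carries⇒ (_ ∷ l) s r = carries⇒ l (carry s) (carry⇒ s r)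

      carries⇐ : ∀ l s → Reduced (run-carry l s) → Reduced s
      carries⇐ []      s r = r
      carries⇐ (_ ∷ l) s r = carry⇐ s (carries⇐ l (carry s) r)

      high-length : ∀ bs {m} → length bs ≤ suc m → length (high bs) ≤ m
      high-length []       le = z≤n
      high-length (_ ∷ bs) le = s≤s⁻¹ le

      none : (bs : List Bool) → length bs ≤ 0 → bs ≡ []
      none [] le = refl

      finished : ∀ l s → length (proj₁ (proj₂ s)) ≤ length l → length (proj₂ (proj₂ s)) ≤ length l → Done (run-carry l s)
      finished []      (f , ds , ns) d n = none ds d , none ns n
      finished (_ ∷ l) (f , ds , ns) d n = finished l _ (high-length ds d) (high-length ns n)

      done⇒ : ∀ s → Done s → Reduced s → N + N ≤ proj₁ s
      done⇒ (f , .[] , .[]) (refl , refl) r = ≤-trans (≤-reflexive (eq N)) (≤-trans r (≤-reflexive (eq′ f k)))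
        where
        eq : ∀ N → N + N ≡ N * 2
        eq = solve-∀
        eq′ : ∀ f k → f + k * 0 ≡ f
        eq′ = solve-∀

      done⇐ : ∀ s → Done s → N + N ≤ proj₁ s → Reduced s
      done⇐ (f , .[] , .[]) (refl , refl) r = ≤-trans (≤-reflexive (eq N)) (≤-trans r (≤-reflexive (eq′ f k)))
        where
        eq : ∀ N → N * 2 ≡ N + N
        eq = solve-∀
        eq′ : ∀ f k → f ≡ f + k * 0
        eq′ = solve-∀

      start : ∀ ds ns → Done (run-carry (ds ++ ns) (N + N , ds , ns))
      start ds ns = finished (ds ++ ns) _
        (≤-trans (m≤m+n _ _) (≤-reflexive (sym (Listₚ.length-++ ds))))
        (≤-trans (m≤n+m _ _) (≤-reflexive (sym (Listₚ.length-++ ds))))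

      shift : ∀ N v → N * (2 + v) ≡ N + N + N * v
      shift = solve-∀

    GeqDec : ∀ ds ns → Dec (N + N ≤ proj₁ (run-carry (ds ++ ns) (N + N , ds , ns)))
    GeqDec ds ns = N + N ≤? _

    Geq? : ∀ ds ns → Dec (N * value-of ns ≤ k * value-of ds)
    Geq? ds ns = Decidable.map′
      (λ le → +-cancelˡ-≤ (N + N) _ _ (subst (_≤ N + N + k * value-of ds) (shift N (value-of ns))
         (carries⇐ (ds ++ ns) _ (done⇐ _ (start ds ns) le))))
      (λ le → done⇒ _ (start ds ns) (carries⇒ (ds ++ ns) _
         (≤-trans (≤-reflexive (shift N (value-of ns))) (+-monoʳ-≤ (N + N) le))))
      (GeqDec ds ns)

  CarryState : Set
  CarryState = ℕ × List Bool × List Bool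

  sz-≤ : ∀ {m n} → m ≤ n → sz m ≤ sz n
  sz-≤ {n = n} z≤n = size≥1 (unary n)
  sz-≤ (s≤s le)    = +-monoʳ-≤ 2 (sz-≤ le)

  unary-size : ∀ m → sz m ≡ 1 + 2 * m
  unary-size zero    = refl
  unary-size (suc m) = trans (cong (2 +_) (unary-size m)) (eq m)
    where
    eq : ∀ m → 2 + (1 + 2 * m) ≡ 1 + 2 * suc m
    eq = solve-∀

  sz-high : ∀ bs → sz (high bs) ≤ sz bs
  sz-high []       = ≤-refl
  sz-high (b ∷ bs) = m≤n⇒m≤1+n (m≤n+m _ _)

  sz-carry : ∀ N k s → sz (carry N k s) ≤ sz s + (2 * sz k + 2 * sz N)
  sz-carry N k (f , ds , ns) = s≤s (≤-trans (+-mono-≤ (grow f k N (low≤2 ds) (m∸n≤m 2 (low ns)))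
      (s≤s (+-mono-≤ (sz-high ds) (sz-high ns)))) (≤-reflexive (eq (sz f) (2 * sz k + 2 * sz N) _)))
    where
    eq : ∀ x y z → x + y + z ≡ x + z + y
    eq = solve-∀
    eq′ : ∀ f p q → 1 + 2 * (f + (p * 2 + q * 2)) + 4 ≡ (1 + 2 * f) + (2 * (1 + 2 * p) + 2 * (1 + 2 * q))
    eq′ = solve-∀
    grow : ∀ f p q {δ ν} → δ ≤ 2 → ν ≤ 2 → sz ⌊ f + (p * δ + q * ν) /2⌋ ≤ sz f + (2 * sz p + 2 * sz q)
    grow f p q {δ} {ν} δ≤ ν≤ = ≤-trans (sz-≤ {n = f + (p * 2 + q * 2)} (≤-trans (⌊n/2⌋≤n _)
        (+-monoʳ-≤ f (+-mono-≤ (*-monoʳ-≤ p δ≤) (*-monoʳ-≤ q ν≤)))))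
      (≤-trans (≤-trans (≤-reflexive (unary-size _)) (m≤m+n _ 4)) (≤-reflexive (trans (eq′ f p q)
        (sym (cong₂ _+_ (unary-size f) (cong₂ (λ x y → 2 * x + 2 * y) (unary-size p) (unary-size q)))))))

  lowP : {A : Set} ⦃ _ : Code A ⦄ {bs : A → List Bool} → Poly bs → Poly (λ a → low (bs a))
  lowP L = caseListP L (constP 0) (digitP ∘P ₁₂P)
    where
    digitP : Poly digit
    digitP = extP (λ { true → refl ; false → refl }) (ifP idP (constP 1) (constP 2))

  carryP : Poly {(ℕ × ℕ) × CarryState} (λ ((N , k) , s) → carry N k s)
  carryP = pairP (halfP (addP f (addP (mulP k (lowP ds)) (mulP N (monusP (constP 2) (lowP ns))))))
                 (pairP (dropHeadP ds) (dropHeadP ns))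
    where
    I = (ℕ × ℕ) × CarryState
    N : Poly {I} (λ i → proj₁ (proj₁ i))
    N = ₁₁P
    k : Poly {I} (λ i → proj₂ (proj₁ i))
    k = ₂₁P
    f : Poly {I} (λ i → proj₁ (proj₂ i))
    f = ₁₂P
    ds : Poly {I} (λ i → proj₁ (proj₂ (proj₂ i)))
    ds = fstP ₂₂P
    ns : Poly {I} (λ i → proj₂ (proj₂ (proj₂ i)))
    ns = sndP ₂₂P

  GeqIn : Set
  GeqIn = (ℕ × ℕ) × (List Bool × List Bool)

  geqP : Poly {GeqIn} (λ ((N , k) , (ds , ns)) → does (Geq? N k ds ns))
  geqP = leqP (addP N N) (fstP (foldl⁺P (appendP ds ns) (pairP (addP N N) (pairP ds ns))
      (carryP ∘P pairP ₁₁P ₁₂P) bnd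
      λ ((N , k) , _) b _ → sz-carry N k b))
    where
    N : Poly {GeqIn} (λ i → proj₁ (proj₁ i))
    N = ₁₁P
    k : Poly {GeqIn} (λ i → proj₂ (proj₁ i))
    k = ₂₁P
    ds : Poly {GeqIn} (λ i → proj₁ (proj₂ i))
    ds = ₁₂P
    ns : Poly {GeqIn} (λ i → proj₂ (proj₂ i))
    ns = ₂₂P
    bnd : Bnd {GeqIn × Bool} (λ (((N , k) , _) , _) → 2 * sz k + 2 * sz N)
    bnd = bnd-+ (bnd-* (bnd-const 2) (out-bnd (k ∘P ₁P))) (bnd-* (bnd-const 2) (out-bnd (N ∘P ₁P)))

  search : {P : ℕ → Set} → (∀ k → Dec (P k)) → ℕ → ℕ
  search P? cap = foldl (λ k _ → if does (P? k) then k else suc k) 0 (replicate cap tt)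

  module _ {P : ℕ → Set} (P? : ∀ k → Dec (P k)) where

    private
      step : ℕ → ⊤ → ℕ
      step k _ = if does (P? k) then k else suc k

      fixed : ∀ k c → P k → foldl step k (replicate c tt) ≡ k
      fixed k zero    p = refl
      fixed k (suc c) p with P? k
      ... | yes _ = fixed k c p
      ... | no ¬p = contradiction p ¬p

      Spec : ℕ → ℕ → ℕ → Set
      Spec k top r = r ≤ top × (r ≡ top ⊎ P r) × (∀ k′ → k ≤ k′ → k′ < r → ¬ P k′)

      empty : ∀ {k k′ r} → k ≤ k′ → k′ < r → r ≡ k → ⊥
      empty le lt refl = <-irrefl refl (≤-<-trans le lt)

      spec : ∀ k c → Spec k (c + k) (foldl step k (replicate c tt))
      spec k zero    = ≤-refl , inj₁ refl , λ k′ le lt _ → empty le lt refl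
      spec k (suc c) with P? k
      ... | yes p = ≤-trans (≤-reflexive (fixed k c p)) (m≤n+m k (suc c)) ,
              inj₂ (subst P (sym (fixed k c p)) p) , λ k′ le lt _ → empty le lt (fixed k c p)
      ... | no ¬p = let (b , d , e) = spec (suc k) c in
              ≤-trans b (≤-reflexive (+-suc c k)) ,
              [ (λ eq → inj₁ (trans eq (+-suc c k))) , inj₂ ]′ d ,
              λ k′ le lt → case m≤n⇒m<n∨m≡n le of λ
                { (inj₁ k<k′) → e k′ k<k′ lt ; (inj₂ refl) → ¬p }

    search-≤ : ∀ cap → search P? cap ≤ cap
    search-≤ cap = ≤-trans (proj₁ (spec 0 cap)) (≤-reflexive (+-identityʳ cap))

    search-found : ∀ cap → search P? cap ≡ cap ⊎ P (search P? cap)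
    search-found cap = [ (λ eq → inj₁ (trans eq (+-identityʳ cap))) , inj₂ ]′ (proj₁ (proj₂ (spec 0 cap)))

    search-least : ∀ cap k → k < search P? cap → ¬ P k
    search-least cap k lt = proj₂ (proj₂ (spec 0 cap)) k z≤n lt

  -- ⌈ N · ns / ds ⌉, capped.

  quant : ℕ → ℕ → List Bool → List Bool → ℕ
  quant N cap ns ds = search (λ k → Geq? N k ds ns) cap

  quantP : {A : Set} ⦃ _ : Code A ⦄ {N cap : A → ℕ} {ns ds : A → List Bool} →
           Poly N → Poly cap → Poly ns → Poly ds → Poly (λ a → quant (N a) (cap a) (ns a) (ds a))
  quantP {A} {N} {cap} {ns} {ds} PN C E D =
    iterP C (constP 0) (ifP (geqP ∘P pairP (pairP (PN ∘P ₁P) ₂P) (pairP (D ∘P ₁P) (E ∘P ₁P)))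
                            ₂P (sucP ₂P))
      (bnd-const 2) λ a b → small (does (Geq? (N a) b (ds a) (ns a))) b
    where
    small : ∀ c b → sz (if c then b else suc b) ≤ sz b + 2
    small true  b = m≤m+n _ _
    small false b = ≤-reflexive (+-comm 2 (sz b))

  bitsᵇ : ℕᵇ → List Bool
  bitsᵇ Bin.zero = []
  bitsᵇ 2[1+ b ] = false ∷ bitsᵇ b
  bitsᵇ 1+[2 b ] = true ∷ bitsᵇ b

  bits : ℕ → List Bool
  bits k = bitsᵇ (Bin.fromℕ k)

  enc-bits : ∀ k → enc (bits k) ≡ encℕ k
  enc-bits k = go (Bin.fromℕ k)
    where
    go : ∀ b → enc (bitsᵇ b) ≡ encℕᵇ b
    go Bin.zero = refl
    go 2[1+ b ] = cong (encBool false ·_) (go b)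
    go 1+[2 b ] = cong (encBool true ·_) (go b)

  value-bits : ∀ k → value-of (bits k) ≡ k
  value-bits k = trans (go (Bin.fromℕ k)) (Binₚ.toℕ-fromℕ k)
    where
    go : ∀ b → value-of (bitsᵇ b) ≡ Bin.toℕ b
    go Bin.zero = refl
    go 2[1+ b ] = trans (cong (λ v → 2 + 2 * v) (go b)) (eq (Bin.toℕ b))
      where
      eq : ∀ v → 2 + 2 * v ≡ 2 * suc v
      eq = solve-∀
    go 1+[2 b ] = cong (λ v → 1 + 2 * v) (go b)

  incr : List Bool → List Bool
  incr []           = true ∷ []
  incr (true ∷ bs)  = false ∷ bs
  incr (false ∷ bs) = true ∷ incr bs

  bitsᵇ-suc : ∀ b → bitsᵇ (Bin.suc b) ≡ incr (bitsᵇ b)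
  bitsᵇ-suc Bin.zero = refl
  bitsᵇ-suc 2[1+ b ] = cong (true ∷_) (bitsᵇ-suc b)
  bitsᵇ-suc 1+[2 b ] = refl

  toBits : ℕ → List Bool
  toBits n = foldl (λ b _ → incr b) [] (replicate n tt)

  toBits≡bits : ∀ n → toBits n ≡ bits n
  toBits≡bits zero    = refl
  toBits≡bits (suc n) = trans (foldl-replicate incr n []) (trans (cong incr (toBits≡bits n))
    (trans (cong (incr ∘ bitsᵇ) (Binₚ.fromℕ≡fromℕ' n))
      (trans (sym (bitsᵇ-suc (Bin.fromℕ' n))) (cong bitsᵇ (sym (Binₚ.fromℕ≡fromℕ' (suc n)))))))

  enc-toBits : ∀ n → enc (toBits n) ≡ encℕ n
  enc-toBits n = trans (cong enc (toBits≡bits n)) (enc-bits n)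

  length-incr : ∀ bs → length (incr bs) ≤ suc (length bs)
  length-incr []           = ≤-refl
  length-incr (true ∷ bs)  = n≤1+n _
  length-incr (false ∷ bs) = s≤s (length-incr bs)

  sz-Bools : ∀ (bs : List Bool) → sz bs ≤ 1 + 4 * length bs
  sz-Bools []           = ≤-refl
  sz-Bools (true ∷ bs)  = ≤-trans (+-monoʳ-≤ 4 (sz-Bools bs)) (≤-reflexive (eq (length bs)))
    where
    eq : ∀ l → 4 + (1 + 4 * l) ≡ 1 + 4 * suc l
    eq = solve-∀
  sz-Bools (false ∷ bs) = ≤-trans (+-mono-≤ {2} {4} (s≤s (s≤s z≤n)) (sz-Bools bs)) (≤-reflexive (eq (length bs)))
    where
    eq : ∀ l → 4 + (1 + 4 * l) ≡ 1 + 4 * suc l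
    eq = solve-∀

  incrP : {A : Set} ⦃ _ : Code A ⦄ {bs : A → List Bool} → Poly bs → Poly (λ a → incr (bs a))
  incrP {A} {bs} L = extP (λ a → trans (go (bs a) true []) refl)
    (finishP ∘P foldl⁺P L (pairP (constP true) nilP) (ifP c
        (ifP b (pairP (constP false) (consP (constP false) acc)) (pairP (constP true) (consP (constP true) acc)))
        (pairP (constP false) (consP b acc))) (bnd-const 8) λ { a (c , acc) b → small c b acc })
    where
    c = fstP ₁₂P
    acc = sndP ₁₂P
    b = ₂₂P
    step : Bool × List Bool → Bool → Bool × List Bool
    step (c , acc) b = if c then (if b then (false , false ∷ acc) else (true , true ∷ acc)) else (false , b ∷ acc)
    finish : Bool × List Bool → List Bool
    finish (c , acc) = reverse (if c then true ∷ acc else acc)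
    finishP : Poly finish
    finishP = reverseP (ifP ₁P (consP (constP true) ₂P) ₂P)
    ripple : Bool → List Bool → List Bool
    ripple true  bs = incr bs
    ripple false bs = bs
    push : ∀ x (acc ys : List Bool) → reverse (x ∷ acc) ++ ys ≡ reverse acc ++ x ∷ ys
    push x acc ys = trans (sym (Listₚ.ʳ++-defn (x ∷ acc))) (Listₚ.ʳ++-defn acc)
    go : ∀ bs c acc → finish (foldl step (c , acc) bs) ≡ reverse acc ++ ripple c bs
    go []           true  acc = Listₚ.unfold-reverse true acc
    go []           false acc = sym (Listₚ.++-identityʳ _)
    go (true ∷ bs)  true  acc = trans (go bs false (false ∷ acc)) (push false acc bs)
    go (false ∷ bs) true  acc = trans (go bs true (true ∷ acc)) (push true acc (incr bs))
    go (b ∷ bs)     false acc = trans (go bs false (b ∷ acc)) (push b acc bs)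
    eq₁ : ∀ h → 2 + (2 + h) + 8 ≡ (1 + 3 + h) + 8
    eq₁ = solve-∀
    eq₂ : ∀ h → 1 + 3 + (4 + h) + 4 ≡ (1 + 3 + h) + 8
    eq₂ = solve-∀
    eq₃ : ∀ h → 1 + 1 + (4 + h) + 4 ≡ (1 + 1 + h) + 8
    eq₃ = solve-∀
    eq₄ : ∀ h → 1 + 1 + (2 + h) + 6 ≡ (1 + 1 + h) + 8
    eq₄ = solve-∀
    small : ∀ c b acc → sz (step (c , acc) b) ≤ sz (c , acc) + 8
    small true  true  acc = ≤-trans (m≤m+n _ 8) (≤-reflexive (eq₁ (sz acc)))
    small true  false acc = ≤-trans (m≤m+n _ 4) (≤-reflexive (eq₂ (sz acc)))
    small false true  acc = ≤-trans (m≤m+n _ 4) (≤-reflexive (eq₃ (sz acc)))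
    small false false acc = ≤-trans (m≤m+n _ 6) (≤-reflexive (eq₄ (sz acc)))

  toBitsP : {A : Set} ⦃ _ : Code A ⦄ {n : A → ℕ} → Poly n → Poly (λ a → toBits (n a))
  toBitsP {n = n} N = foldlP (onesP N) nilP (incrP ₁₂P)
    (bnd-+ (bnd-const 1) (bnd-* (bnd-const 4) (out-bnd (onesP N))))
    λ a ys zs eq → ≤-trans (sz-Bools _) (s≤s (*-monoʳ-≤ 4 (≤-trans (go ys [])
      (≤-trans (≤-reflexive (+-identityʳ (length ys))) (≤-trans (length≤ ys)
        (≤-trans (sz-prefix ys zs) (≤-reflexive (cong sz (sym eq)))))))))
    where
    length≤ : (l : List ⊤) → length l ≤ sz l
    length≤ []      = z≤n
    length≤ (x ∷ l) = s≤s (≤-trans (length≤ l) (n≤1+n _))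
    go : ∀ ys bs → length (foldl (λ b (_ : ⊤) → incr b) bs ys) ≤ length ys + length bs
    go []       bs = ≤-refl
    go (_ ∷ ys) bs = ≤-trans (go ys (incr bs)) (≤-trans (+-monoʳ-≤ (length ys) (length-incr bs))
      (≤-reflexive (+-suc (length ys) (length bs))))

  Sum : {X : Set} → (X → ℕ) → List X → ℕ
  Sum f []       = 0
  Sum f (x ∷ xs) = f x + Sum f xs

  ind : {P : Set} → Dec P → ℕ
  ind d = if does d then 1 else 0

  ind-yes : {P : Set} (d : Dec P) → P → ind d ≡ 1
  ind-yes (yes _) p = refl
  ind-yes (no ¬p) p = contradiction p ¬p

  ind-no : {P : Set} (d : Dec P) → ¬ P → ind d ≡ 0
  ind-no (yes p) ¬p = contradiction p ¬p
  ind-no (no _)  ¬p = refl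

  ind-pos : {P : Set} (d : Dec P) → 1 ≤ ind d → P
  ind-pos (yes p) _ = p

  ind≤1 : {P : Set} (d : Dec P) → ind d ≤ 1
  ind≤1 (yes _) = ≤-refl
  ind≤1 (no _)  = z≤n

  module _ {X : Set} where

    Sum-++ : ∀ (f : X → ℕ) xs ys → Sum f (xs ++ ys) ≡ Sum f xs + Sum f ys
    Sum-++ f []       ys = refl
    Sum-++ f (x ∷ xs) ys = trans (cong (f x +_) (Sum-++ f xs ys)) (sym (+-assoc (f x) _ _))

    Sum-mono : ∀ {f g : X → ℕ} xs → (∀ x → x ∈ xs → f x ≤ g x) → Sum f xs ≤ Sum g xs
    Sum-mono []       le = z≤n
    Sum-mono (x ∷ xs) le = +-mono-≤ (le x (here refl)) (Sum-mono xs (λ y y∈ → le y (there y∈)))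

    Sum-cong : ∀ {f g : X → ℕ} xs → (∀ x → x ∈ xs → f x ≡ g x) → Sum f xs ≡ Sum g xs
    Sum-cong []       eq = refl
    Sum-cong (x ∷ xs) eq = cong₂ _+_ (eq x (here refl)) (Sum-cong xs (λ y y∈ → eq y (there y∈)))

    Sum-pos : ∀ (f : X → ℕ) xs → 1 ≤ Sum f xs → ∃[ x ] x ∈ xs × 1 ≤ f x
    Sum-pos f (x ∷ xs) le with f x in eq
    ... | suc k = x , here refl , ≤-trans (s≤s z≤n) (≤-reflexive (sym eq))
    ... | zero  = let (y , y∈ , p) = Sum-pos f xs le in y , there y∈ , p

    Sum-∈ : ∀ (f : X → ℕ) {x xs} → x ∈ xs → f x ≤ Sum f xs
    Sum-∈ f (here refl) = m≤m+n _ _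
    Sum-∈ f (there x∈)  = ≤-trans (Sum-∈ f x∈) (m≤n+m _ _)

    Sum-map : ∀ {Y : Set} (f : X → ℕ) (g : Y → X) ys → Sum f (map g ys) ≡ Sum (f ∘ g) ys
    Sum-map f g []       = refl
    Sum-map f g (y ∷ ys) = cong (f (g y) +_) (Sum-map f g ys)

    Sum-partition : ∀ (f : X → ℕ) {P : X → Set} (P? : ∀ x → Dec (P x)) xs →
      Sum f (filter (λ x → ¬? (P? x)) xs) + Sum f (filter P? xs) ≡ Sum f xs
    Sum-partition f P? []       = refl
    Sum-partition f P? (x ∷ xs) with does (P? x)
    ... | true  = trans (eq (Sum f (filter (λ x → ¬? (P? x)) xs)) (f x) _) (cong (f x +_) (Sum-partition f P? xs))
      where
      eq : ∀ a b c → a + (b + c) ≡ b + (a + c)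
      eq = solve-∀
    ... | false = trans (+-assoc (f x) _ _) (cong (f x +_) (Sum-partition f P? xs))

    breakAt-found : {P : X → Set} (P? : ∀ x → Dec (P x)) {xs : List X} → Any P xs →
      ∃[ l ] ∃[ x ] ∃[ r ] breakAt P? xs ≡ (l , x ∷ r) × xs ≡ l ++ x ∷ r × P x × All (λ y → ¬ P y) l
    breakAt-found P? {x ∷ xs} any with P? x
    ... | yes p = [] , x , xs , refl , refl , p , []
    ... | no ¬p with any
    ...   | here p = contradiction p ¬p
    ...   | there any′ = let (l , y , r , eq , eq′ , p , al) = breakAt-found P? any′ in
              x ∷ l , y , r , cong (λ k → x ∷ proj₁ k , proj₂ k) eq , cong (x ∷_) eq′ , p , ¬p ∷ al

    breakAt-none : {P : X → Set} (P? : ∀ x → Dec (P x)) {xs : List X} → ¬ Any P xs → proj₂ (breakAt P? xs) ≡ []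
    breakAt-none P? {[]}     none = refl
    breakAt-none P? {x ∷ xs} none with P? x
    ... | yes p = contradiction (here p) none
    ... | no _  = breakAt-none P? (none ∘ there)

  -- Packing branchings (Bang-Jensen, Frank, Jackson), for a system of
  -- simple paths from the root 0.  A path is an identifier together with
  -- its vertices other than 0.  A branching is a list of entries
  -- (vertex , parent , identifier of the path that supplies the arc).

  Path Entry : Set
  Path  = ℕ × List ℕ
  Entry = ℕ × ℕ × ℕ

  vert par pid : Entry → ℕ
  vert e = proj₁ e
  par e  = proj₁ (proj₂ e)
  pid e  = proj₂ (proj₂ e)

  Contains : ℕ → List Entry → Set
  Contains v es = Any (λ e → vert e ≡ v) es

  contains? : ∀ v es → Dec (Contains v es)
  contains? v es = any? (λ e → vert e ≟ v) es

  Key : ℕ → ℕ → Entry → Set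
  Key b i e = vert e ≡ b × pid e ≡ i

  key? : ∀ b i e → Dec (Key b i e)
  key? b i e = vert e ≟ b ×-dec pid e ≟ i

  Fits : Entry → List Entry → Set
  Fits e es = (par e ≡ 0 ⊎ Contains (par e) es) × ¬ Contains (vert e) es

  fits? : ∀ e es → Dec (Fits e es)
  fits? e es = (par e ≟ 0 ⊎-dec contains? (par e) es) ×-dec ¬? (contains? (vert e) es)

  place : Entry → List (List Entry) → List (List Entry)
  place e O = caseList (proj₂ (breakAt (fits? e) O)) O λ es O′ →
    proj₁ (breakAt (fits? e) O) ++ (es ++ e ∷ []) ∷ O′

  reparent : ℕ → ℕ → ℕ → Entry → Entry
  reparent v b i e = if does (key? b i e) then (b , v , i) else e

  splice : ℕ → ℕ → ℕ → List Entry → Entry → List Entry → List Entry × List Entry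
  splice v b i L e R =
    if does (vert e ≟ v)
    then (L ++ e ∷ map (reparent v b i) R , map (λ e → v , par e , i) (filter (key? b i) R))
    else (L ++ (v , par e , i) ∷ (b , v , i) ∷ filter (λ e → ¬? (vert e ≟ v)) R , filter (λ e → vert e ≟ v) R)

  Stop : ℕ → ℕ → ℕ → Entry → Set
  Stop v b i e = vert e ≡ v ⊎ Key b i e

  stop? : ∀ v b i e → Dec (Stop v b i e)
  stop? v b i e = vert e ≟ v ⊎-dec key? b i e

  -- Subdivides the arc of path i into b by v; the second component is the
  -- arc into v that becomes superfluous.
  subdivide : ℕ → ℕ → ℕ → List Entry → List Entry × List Entry
  subdivide v b i es = caseList (proj₂ (breakAt (stop? v b i) es)) (es , [])
    (splice v b i (proj₁ (breakAt (stop? v b i) es)))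

  data Valid : List ℕ → List Entry → Set where
    []  : ∀ {S} → Valid S []
    add : ∀ {S v a q es} → a ∈ S → v ∉ S → Valid (v ∷ S) es → Valid S ((v , a , q) ∷ es)

  occ : ℕ → Entry → ℕ
  occ v e = ind (vert e ≟ v)

  valid-absent : ∀ {S es} → Valid S es → ∀ {v} → v ∈ S → ¬ Contains v es
  valid-absent (add a∈ v∉ V) v∈ (here refl) = v∉ v∈
  valid-absent (add a∈ v∉ V) v∈ (there c)   = valid-absent V (there v∈) c

  absent-occ : ∀ {v} es → ¬ Contains v es → Sum (occ v) es ≡ 0
  absent-occ []       ¬c = refl
  absent-occ {v} (e ∷ es) ¬c = cong₂ _+_ (ind-no (vert e ≟ v) (¬c ∘ here)) (absent-occ es (¬c ∘ there))

  absent-filter : ∀ {v} es → ¬ Contains v es → filter (λ e → vert e ≟ v) es ≡ []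
  absent-filter []       ¬c = refl
  absent-filter {v} (e ∷ es) ¬c with vert e ≟ v
  ... | yes p = contradiction (here p) ¬c
  ... | no _  = absent-filter es (¬c ∘ there)

  contains-occ : ∀ {v es} → Contains v es → 1 ≤ Sum (occ v) es
  contains-occ {v} {e ∷ es} (here eq) rewrite ind-yes (vert e ≟ v) eq = s≤s z≤n
  contains-occ {v} {e ∷ es} (there c) = ≤-trans (contains-occ c) (m≤n+m _ _)

  valid-occ≤1 : ∀ {S es v} → Valid S es → Sum (occ v) es ≤ 1
  valid-occ≤1 [] = z≤n
  valid-occ≤1 {v = v} (add {v = u} {es = es} a∈ u∉ V) with u ≟ v
  ... | yes refl = ≤-reflexive (cong suc (absent-occ es (valid-absent V (here refl))))
  ... | no _     = valid-occ≤1 V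

  valid-par : ∀ {S es e} → Valid S es → e ∈ es → par e ∈ S ⊎ Contains (par e) es
  valid-par (add a∈ v∉ V) (here refl) = inj₁ a∈
  valid-par (add a∈ v∉ V) (there e∈) with valid-par V e∈
  ... | inj₂ c            = inj₂ (there c)
  ... | inj₁ (here eq)    = inj₂ (here (sym eq))
  ... | inj₁ (there a∈′)  = inj₁ a∈′

  valid-par≢ : ∀ {S es e} → Valid S es → e ∈ es → par e ≢ vert e
  valid-par≢ (add a∈ v∉ V) (here refl) eq = v∉ (subst (_∈ _) eq a∈)
  valid-par≢ (add a∈ v∉ V) (there e∈)  eq = valid-par≢ V e∈ eq

  valid-filter : ∀ {S S′ v es} → Valid S es → (∀ {x} → x ∈ S′ → x ≡ v ⊎ x ∈ S) →
                 (∀ {x} → x ∈ S → x ∈ S′) → v ∈ S′ → Valid S′ (filter (λ e → ¬? (vert e ≟ v)) es)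
  valid-filter [] f g v∈ = []
  valid-filter {v = v} (add {v = u} a∈ u∉ V) f g v∈ with u ≟ v
  ... | yes refl = valid-filter V (λ x∈ → case f x∈ of λ { (inj₁ eq) → inj₁ eq ; (inj₂ x∈S) → inj₂ (there x∈S) })
                     (λ { (here refl) → v∈ ; (there x∈) → g x∈ }) v∈
  ... | no u≢v   = add (g a∈) (λ u∈ → case f u∈ of λ { (inj₁ eq) → u≢v eq ; (inj₂ u∈S) → u∉ u∈S })
                     (valid-filter V
                       (λ { (here eq) → inj₂ (here eq)
                          ; (there x∈) → case f x∈ of λ { (inj₁ eq) → inj₁ eq ; (inj₂ x∈S) → inj₂ (there x∈S) } })
                       (λ { (here eq) → here eq ; (there x∈) → there (g x∈) }) (there v∈))

  valid-reparent : ∀ {S v b i es} → Valid S es → v ∈ S → Valid S (map (reparent v b i) es)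
  valid-reparent [] v∈ = []
  valid-reparent {b = b} {i} (add {v = u} {q = q} a∈ u∉ V) v∈ with u ≟ b | q ≟ i
  ... | yes refl | yes refl = add v∈ u∉ (valid-reparent V (there v∈))
  ... | yes _    | no _     = add a∈ u∉ (valid-reparent V (there v∈))
  ... | no _     | yes _    = add a∈ u∉ (valid-reparent V (there v∈))
  ... | no _     | no _     = add a∈ u∉ (valid-reparent V (there v∈))

  valid-suffix : ∀ {S} L {X Y} → Valid S (L ++ X) →
    (∀ {S′} → (∀ {x} → x ∈ S → x ∈ S′) → (∀ {x} → x ∈ S′ → x ∈ S ⊎ Contains x L) → Valid S′ X → Valid S′ Y) →
    Valid S (L ++ Y)
  valid-suffix []      V k = k (λ x∈ → x∈) inj₁ V
  valid-suffix (e ∷ L) (add a∈ v∉ V) k = add a∈ v∉ (valid-suffix L V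
    λ up down → k (λ x∈ → up (there x∈)) λ x∈ → case down x∈ of λ
      { (inj₁ (here eq)) → inj₂ (here (sym eq)) ; (inj₁ (there x∈S)) → inj₁ x∈S ; (inj₂ c) → inj₂ (there c) })

  valid-snoc : ∀ {S e} es → Valid S es → par e ∈ S ⊎ Contains (par e) es → vert e ∉ S → ¬ Contains (vert e) es →
               Valid S (es ++ e ∷ [])
  valid-snoc []       []            (inj₁ a∈) v∉ ¬c = add a∈ v∉ []
  valid-snoc (x ∷ es) (add a∈ u∉ V) p v∉ ¬c = add a∈ u∉ (valid-snoc es V
    (case p of λ { (inj₁ a∈′) → inj₁ (there a∈′) ; (inj₂ (here eq)) → inj₁ (here (sym eq)) ; (inj₂ (there c)) → inj₂ c })
    (λ { (here eq) → ¬c (here (sym eq)) ; (there v∈) → v∉ v∈ }) (¬c ∘ there))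

  filter-single : ∀ {S v} es → Valid S es → let F = filter (λ e → vert e ≟ v) es in
    F ≡ [] ⊎ (∃[ e ] F ≡ e ∷ [] × e ∈ es × vert e ≡ v)
  filter-single [] V = inj₁ refl
  filter-single {v = v} (e ∷ es) (add a∈ u∉ V) with vert e ≟ v
  ... | yes refl = inj₂ (e , cong (e ∷_) (absent-filter es (valid-absent V (here refl))) , here refl , refl)
  ... | no _ with filter-single es V
  ...   | inj₁ eq = inj₁ eq
  ...   | inj₂ (e′ , eq , e∈ , p) = inj₂ (e′ , eq , there e∈ , p)

  -- The weight of a list of entries under an arbitrary h determines it up
  -- to order; all counting below is done through such weights.

  add-head : ∀ k {x y z w} → x + y ≡ z + w → k + x + y ≡ k + z + w
  add-head k {x} {y} {z} {w} eq = trans (+-assoc k x y) (trans (cong (k +_) eq) (sym (+-assoc k z w)))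

  reparent-weight : ∀ {S v b i es} → Valid S es → Any (Key b i) es →
    ∃[ a ] (b , a , i) ∈ es × filter (key? b i) es ≡ (b , a , i) ∷ [] ×
    (∀ (h : Entry → ℕ) → Sum h (map (reparent v b i) es) + h (b , a , i) ≡ Sum h es + h (b , v , i))
  reparent-weight {v = v} {b} {i} {es = (u , a , q) ∷ es} (add a∈ u∉ V) any with u ≟ b | q ≟ i
  ... | yes refl | yes refl = a , here refl , cong ((u , a , q) ∷_) (nokey es (valid-absent V (here refl))) , λ h →
          trans (cong (λ z → h (u , v , q) + z + h (u , a , q)) (cong (Sum h) (norep es (valid-absent V (here refl)))))
                (eq (h (u , v , q)) (Sum h es) (h (u , a , q)))
    where
    eq : ∀ x y z → x + y + z ≡ z + y + x
    eq = solve-∀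
    nokey : ∀ es → ¬ Contains u es → filter (key? u q) es ≡ []
    nokey []       ¬c = refl
    nokey (e ∷ es) ¬c with vert e ≟ u
    ... | yes p = contradiction (here p) ¬c
    ... | no _  = nokey es (¬c ∘ there)
    norep : ∀ es → ¬ Contains u es → map (reparent v u q) es ≡ es
    norep []       ¬c = refl
    norep (e ∷ es) ¬c with vert e ≟ u
    ... | yes p = contradiction (here p) ¬c
    ... | no _  = cong (e ∷_) (norep es (¬c ∘ there))
  ... | yes refl | no q≢i =
    let (a′ , e∈ , f , w) = reparent-weight V (case any of λ { (here (_ , p)) → contradiction p q≢i ; (there t) → t })
    in a′ , there e∈ , f , λ h → add-head (h (u , a , q)) (w h)
  ... | no u≢b | yes _ =
    let (a′ , e∈ , f , w) = reparent-weight V (case any of λ { (here (p , _)) → contradiction p u≢b ; (there t) → t })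
    in a′ , there e∈ , f , λ h → add-head (h (u , a , q)) (w h)
  ... | no u≢b | no _ =
    let (a′ , e∈ , f , w) = reparent-weight V (case any of λ { (here (p , _)) → contradiction p u≢b ; (there t) → t })
    in a′ , there e∈ , f , λ h → add-head (h (u , a , q)) (w h)

  record Subdivided (v b i : ℕ) (es : List Entry) (r : List Entry × List Entry) : Set where
    field
      {above}  : ℕ
      old∈     : (b , above , i) ∈ es
      valid    : Valid (0 ∷ []) (proj₁ r)
      weight   : ∀ (h : Entry → ℕ) →
                 Sum h (proj₁ r) + Sum h (proj₂ r) + h (b , above , i) ≡ Sum h es + (h (v , above , i) + h (b , v , i))
      freed    : proj₂ r ≡ [] ⊎ (∃[ e ] proj₂ r ≡ e ∷ [] × vert e ≡ v × (e ∈ es ⊎ par e ≡ above))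

  valid-drop : ∀ {S} L {X} → Valid S (L ++ X) → ∃[ S′ ] Valid S′ X
  valid-drop []      V = _ , V
  valid-drop (_ ∷ L) (add _ _ V) = valid-drop L V

  splice-spec : ∀ {v b i} L e R → Valid (0 ∷ []) (L ++ e ∷ R) → All (λ x → ¬ Stop v b i x) L → Stop v b i e →
                Any (Key b i) (L ++ e ∷ R) → v ≢ b → v ≢ 0 → Subdivided v b i (L ++ e ∷ R) (splice v b i L e R)
  splice-spec {v} {b} {i} L e@(u , a , q) R V before halt any v≢b v≢0 with u ≟ v
  ... | yes refl = record
      { old∈ = ∈-++⁺ʳ L (there (proj₁ (proj₂ rw)))
      ; valid = valid-suffix L V λ { _ _ (add a∈ u∉ W) → add a∈ u∉ (valid-reparent W (here refl)) }
      ; weight = λ h → trans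
          (cong₂ (λ x y → x + Sum h (map (λ e → v , par e , i) y) + h (b , above , i)) (Sum-++ h L _) (proj₁ (proj₂ (proj₂ rw))))
          (trans (eq₁ (Sum h L) (h e) (Sum h (map (reparent v b i) R)) (h (v , above , i)) (h (b , above , i)))
            (trans (cong (Sum h L + h e + h (v , above , i) +_) (proj₂ (proj₂ (proj₂ rw)) h))
              (trans (eq₂ (Sum h L) (h e) (h (v , above , i)) (Sum h R) (h (b , v , i)))
                (cong (_+ (h (v , above , i) + h (b , v , i))) (sym (Sum-++ h L _))))))
      ; freed = inj₂ (_ , cong (map (λ e → v , par e , i)) (proj₁ (proj₂ (proj₂ rw))) , refl , inj₂ refl) }
    where
    keyR : Any (Key b i) R
    keyR with Anyₚ.++⁻ L any
    ... | inj₁ k = ⊥-elim (go before k)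
      where
      go : ∀ {L} → All (λ x → ¬ Stop v b i x) L → ¬ Any (Key b i) L
      go (p ∷ ps) (here k)  = p (inj₂ k)
      go (p ∷ ps) (there k) = go ps k
    ... | inj₂ (here (p , _)) = contradiction p v≢b
    ... | inj₂ (there k) = k
    validR : ∃[ S ] Valid S R
    validR with valid-drop L V
    ... | _ , add _ _ W = _ , W
    rw = reparent-weight {v = v} (proj₂ validR) keyR
    above = proj₁ rw
    eq₁ : ∀ l x m y z → l + (x + m) + (y + 0) + z ≡ l + x + y + (m + z)
    eq₁ = solve-∀
    eq₂ : ∀ l x y r w → l + x + y + (r + w) ≡ l + (x + r) + (y + w)
    eq₂ = solve-∀
  ... | no u≢v with halt
  ...   | inj₁ u≡v = contradiction u≡v u≢v
  ...   | inj₂ (refl , refl) = record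
      { old∈ = ∈-++⁺ʳ L (here refl)
      ; valid = valid-suffix L V λ { _ down (add a∈ b∉ W) → add a∈ (v∉ down) (add (here refl) (λ { (here eq) → v≢b (sym eq) ; (there b∈) → b∉ b∈ })
          (valid-filter W (λ { (here eq) → inj₂ (here eq) ; (there (here eq)) → inj₁ eq ; (there (there x∈)) → inj₂ (there x∈) })
            (λ { (here eq) → here eq ; (there x∈) → there (there x∈) }) (there (here refl)))) }
      ; weight = λ h → trans (cong (λ x → x + Sum h (filter (λ e → vert e ≟ v) R) + h e) (Sum-++ h L _))
          (trans (eq₁ (Sum h L) (h (v , a , q)) (h (u , v , q)) (Sum h (filter (λ e → ¬? (vert e ≟ v)) R)) _ (h e))
            (trans (cong (λ x → Sum h L + (h e + x) + (h (v , a , q) + h (u , v , q))) (Sum-partition h (λ e → vert e ≟ v) R))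
              (cong (_+ (h (v , a , q) + h (u , v , q))) (sym (Sum-++ h L _)))))
      ; freed = case filter-single {v = v} R (proj₂ validR) of λ
          { (inj₁ eq) → inj₁ eq
          ; (inj₂ (e , eq , e∈ , p)) → inj₂ (e , eq , p , inj₁ (∈-++⁺ʳ L (there e∈))) } }
    where
    validR : ∃[ S ] Valid S R
    validR with valid-drop L V
    ... | _ , add _ _ W = _ , W
    v∉L : ∀ {L} → All (λ x → ¬ Stop v b i x) L → ¬ Contains v L
    v∉L (p ∷ ps) (here k)  = p (inj₁ k)
    v∉L (p ∷ ps) (there k) = v∉L ps k
    v∉ : ∀ {S′ : List ℕ} → (∀ {x} → x ∈ S′ → x ∈ 0 ∷ [] ⊎ Contains x L) → v ∉ S′
    v∉ down v∈ with down v∈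
    ... | inj₁ (here eq) = v≢0 eq
    ... | inj₂ c = v∉L before c
    eq₁ : ∀ l x y m k z → l + (x + (y + m)) + k + z ≡ l + (z + (m + k)) + (x + y)
    eq₁ = solve-∀

  subdivide-spec : ∀ {v b i es} → Valid (0 ∷ []) es → Any (Key b i) es → v ≢ b → v ≢ 0 →
                   Subdivided v b i es (subdivide v b i es)
  subdivide-spec {v} {b} {i} {es} V any v≢b v≢0 with breakAt-found (stop? v b i) (Any.map inj₂ any)
  ... | L , e , R , eq , refl , halt , before rewrite eq = splice-spec L e R V before halt any v≢b v≢0

  Total : (Entry → ℕ) → List (List Entry) → ℕ
  Total h O = Sum (Sum h) O

  AllValid : List (List Entry) → Set
  AllValid O = All (Valid (0 ∷ [])) O

  record Placed (e : Entry) (O O′ : List (List Entry)) : Set where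
    field
      valid  : AllValid O′
      weight : ∀ h → Total h O′ ≡ Total h O + h e
      same   : length O′ ≡ length O

  place-spec : ∀ {e O} → AllValid O → vert e ≢ 0 →
    (par e ≡ 0 × Total (occ (vert e)) O < length O) ⊎ Total (occ (vert e)) O < Total (occ (par e)) O →
    Placed e O (place e O)
  place-spec {e} {O} V v≢0 room with any? (fits? e) O
  ... | no none = ⊥-elim (<-irrefl refl (case room of λ
        { (inj₁ (eq , lt)) → <-≤-trans lt (full O none eq)
        ; (inj₂ lt) → <-≤-trans lt (Sum-mono O λ es es∈ → le es (none ∘ λ f → Any.map (λ { refl → f }) es∈) (All.lookup V es∈)) }))
    where
    full : ∀ O → ¬ Any (Fits e) O → par e ≡ 0 → length O ≤ Total (occ (vert e)) O
    full []       none eq = z≤n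
    full (es ∷ O) none eq with contains? (vert e) es
    ... | yes c = +-mono-≤ (contains-occ c) (full O (none ∘ there) eq)
    ... | no ¬c = contradiction (here (inj₁ eq , ¬c)) none
    le : ∀ es → ¬ Fits e es → Valid (0 ∷ []) es → Sum (occ (par e)) es ≤ Sum (occ (vert e)) es
    le es ¬f W with contains? (par e) es | contains? (vert e) es
    ... | no ¬c  | _      = ≤-trans (≤-reflexive (absent-occ es ¬c)) z≤n
    ... | yes _  | yes c  = ≤-trans (valid-occ≤1 W) (contains-occ c)
    ... | yes c  | no ¬c′ = contradiction (inj₂ c , ¬c′) ¬f
  ... | yes any with breakAt-found (fits? e) any
  ...   | L , es , R , eq , refl , (p , ¬c) , _ rewrite eq = record
      { valid = Allₚ.++⁺ (Allₚ.++⁻ˡ L V) (case Allₚ.++⁻ʳ L V of λ { (W ∷ Ws) → valid-snoc es W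
          (case p of λ { (inj₁ q) → inj₁ (here q) ; (inj₂ c) → inj₂ c }) (λ { (here q) → v≢0 q }) ¬c ∷ Ws })
      ; weight = λ h → trans (Sum-++ (Sum h) L _) (trans (cong (λ x → Sum (Sum h) L + (x + Sum (Sum h) R)) (Sum-++ h es (e ∷ [])))
          (trans (eq′ (Total h L) (Sum h es) (h e) (Total h R)) (cong (_+ h e) (sym (Sum-++ (Sum h) L _)))))
      ; same = trans (Listₚ.length-++ L) (sym (Listₚ.length-++ L)) }
    where
    eq′ : ∀ l x y r → l + (x + (y + 0) + r) ≡ l + (x + r) + y
    eq′ = solve-∀

  lastOf : ℕ → List ℕ → ℕ
  lastOf a xs = foldl (λ _ x → x) a xs

  memb? : ∀ x (I : List ℕ) → Dec (x ∈ I)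
  memb? x I = any? (x ≟_) I

  keep : List ℕ → List ℕ → List ℕ
  keep I = filter (λ x → memb? x I)

  settle : List (List Entry) → List Entry × List Entry → List (List Entry) → List (List Entry)
  settle L (es , fr) R = caseList fr (L ++ es ∷ R) (λ e _ → place e (L ++ es ∷ R))

  hasKey? : ∀ b i es → Dec (Any (Key b i) es)
  hasKey? b i es = any? (key? b i) es

  splitArc : ℕ → ℕ → ℕ → List (List Entry) → List (List Entry)
  splitArc v b i O = caseList (proj₂ (breakAt (hasKey? b i) O)) O λ es R →
    settle (proj₁ (breakAt (hasKey? b i) O)) (subdivide v b i es) R

  insertArc : List ℕ → ℕ → List (List Entry) → Path → List (List Entry)
  insertArc I v O (i , P) = caseList (proj₂ (breakAt (v ≟_) P)) O λ _ r →
    caseList (keep I r) (place (v , lastOf 0 (keep I (proj₁ (breakAt (v ≟_) P))) , i) O)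
      λ b _ → splitArc v b i O

  insertVertex : List Path → List ℕ × List (List Entry) → ℕ → List ℕ × List (List Entry)
  insertVertex Ps (I , O) v = v ∷ I , foldl (insertArc I v) O Ps

  branchings : ℕ → List ℕ → List Path → List (List Entry)
  branchings N order Ps = proj₂ (foldl (insertVertex Ps) ([] , replicate N []) order)

  chain : (Entry → ℕ) → ℕ → ℕ → List ℕ → ℕ
  chain h i a []       = 0
  chain h i a (w ∷ ws) = h (w , a , i) + chain h i w ws

  chain-++ : ∀ h i a xs ys → chain h i a (xs ++ ys) ≡ chain h i a xs + chain h i (lastOf a xs) ys
  chain-++ h i a []       ys = refl
  chain-++ h i a (x ∷ xs) ys = trans (cong (h (x , a , i) +_) (chain-++ h i x xs ys)) (sym (+-assoc (h (x , a , i)) _ _))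

  chain-pos : ∀ h i a xs → 1 ≤ chain h i a xs → ∃[ ys ] ∃[ w ] ∃[ zs ] xs ≡ ys ++ w ∷ zs × 1 ≤ h (w , lastOf a ys , i)
  chain-pos h i a (x ∷ xs) le with h (x , a , i) in eq
  ... | suc _ = [] , x , xs , refl , ≤-trans (s≤s z≤n) (≤-reflexive (sym eq))
  ... | zero  = let (ys , w , zs , eq′ , p) = chain-pos h i x xs le in x ∷ ys , w , zs , cong (x ∷_) eq′ , p

  chain-insert : ∀ h i l v b r → chain h i 0 (l ++ v ∷ b ∷ r) + h (b , lastOf 0 l , i) ≡
                 chain h i 0 (l ++ b ∷ r) + (h (v , lastOf 0 l , i) + h (b , v , i))
  chain-insert h i l v b r rewrite chain-++ h i 0 l (v ∷ b ∷ r) | chain-++ h i 0 l (b ∷ r) =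
    eq (chain h i 0 l) (h (v , lastOf 0 l , i)) (h (b , v , i)) (chain h i b r) (h (b , lastOf 0 l , i))
    where
    eq : ∀ c x y r z → c + (x + (y + r)) + z ≡ c + (z + r) + (x + y)
    eq = solve-∀

  lastOf-∈ : ∀ a xs → lastOf a xs ≡ a ⊎ lastOf a xs ∈ xs
  lastOf-∈ a []       = inj₁ refl
  lastOf-∈ a (x ∷ xs) with lastOf-∈ x xs
  ... | inj₁ eq = inj₂ (here eq)
  ... | inj₂ m  = inj₂ (there m)

  unique-split : ∀ {b : ℕ} l {r} ys {zs} → Unique (l ++ b ∷ r) → l ++ b ∷ r ≡ ys ++ b ∷ zs → l ≡ ys
  unique-split []      []       U eq = refl
  unique-split []      (y ∷ ys) (≢s ∷ U) refl = contradiction refl (All.lookup ≢s (∈-++⁺ʳ ys (here refl)))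
  unique-split (x ∷ l) []       (≢s ∷ U) refl = contradiction refl (All.lookup ≢s (∈-++⁺ʳ l (here refl)))
  unique-split (x ∷ l) (y ∷ ys) (≢s ∷ U) eq with Listₚ.∷-injective eq
  ... | refl , eq′ = cong (x ∷_) (unique-split l ys U eq′)

  unique-∉ : ∀ {b : ℕ} l {r} → Unique (l ++ b ∷ r) → b ∉ l × b ∉ r
  unique-∉ []      (≢s ∷ U) = (λ ()) , λ b∈ → All.lookup ≢s b∈ refl
  unique-∉ (x ∷ l) (≢s ∷ U) with unique-∉ l U
  ... | p , q = (λ { (here refl) → All.lookup ≢s (∈-++⁺ʳ l (here refl)) refl ; (there b∈) → p b∈ }) , q

  keep-∉ : ∀ {v} I xs → v ∉ xs → keep (v ∷ I) xs ≡ keep I xs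
  keep-∉ I []       v∉ = refl
  keep-∉ {v} I (x ∷ xs) v∉ with x ≟ v
  ... | yes refl = contradiction (here refl) v∉
  ... | no _ with does (memb? x I)
  ...   | true  = cong (x ∷_) (keep-∉ I xs (v∉ ∘ there))
  ...   | false = keep-∉ I xs (v∉ ∘ there)

  keep-∈ : ∀ I xs {x} → x ∈ keep I xs → x ∈ I × x ∈ xs
  keep-∈ I xs x∈ = let (p , q) = ∈-filter⁻ (λ x → memb? x I) {xs = xs} x∈ in q , p

  keep-old : ∀ {v} I l r → v ∉ I → keep I (l ++ v ∷ r) ≡ keep I l ++ keep I r
  keep-old I l r v∉ = trans (Listₚ.filter-++ (λ x → memb? x I) l _)
    (cong (keep I l ++_) (Listₚ.filter-reject (λ x → memb? x I) v∉))

  keep-new : ∀ {v} I l r → v ∉ l → v ∉ r → keep (v ∷ I) (l ++ v ∷ r) ≡ keep I l ++ v ∷ keep I r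
  keep-new {v} I l r v∉l v∉r = trans (Listₚ.filter-++ (λ x → memb? x (v ∷ I)) l _)
    (cong₂ _++_ (keep-∉ I l v∉l) (trans (Listₚ.filter-accept (λ x → memb? x (v ∷ I)) (here refl))
      (cong (v ∷_) (keep-∉ I r v∉r))))

  chain-occ≤ : ∀ {u} i a xs {ys} → Unique xs → (∀ {x} → x ∈ xs → x ∈ ys) → chain (occ u) i a xs ≤ ind (memb? u ys)
  chain-occ≤ i a []       U sub = z≤n
  chain-occ≤ {u} i a (x ∷ xs) {ys} (≢s ∷ U) sub with x ≟ u
  ... | no _ = chain-occ≤ i x xs U (sub ∘ there)
  ... | yes refl = ≤-reflexive (trans (cong suc (absent i x xs ≢s)) (sym (ind-yes (memb? x ys) (sub (here refl)))))
    where
    absent : ∀ i a xs → All (x ≢_) xs → chain (occ x) i a xs ≡ 0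
    absent i a []       [] = refl
    absent i a (y ∷ xs) (p ∷ ps) = cong₂ _+_ (ind-no (y ≟ x) (p ∘ sym)) (absent i y xs ps)

  chain-occ≥ : ∀ {u} i a xs → u ∈ xs → 1 ≤ chain (occ u) i a xs
  chain-occ≥ {u} i a (x ∷ xs) (here refl) rewrite ind-yes (x ≟ x) refl = s≤s z≤n
  chain-occ≥ {u} i a (x ∷ xs) (there u∈)  = ≤-trans (chain-occ≥ i x xs u∈) (m≤n+m _ _)

  chain-occ0 : ∀ {u} i a xs → u ∉ xs → chain (occ u) i a xs ≡ 0
  chain-occ0 i a []       u∉ = refl
  chain-occ0 {u} i a (x ∷ xs) u∉ = cong₂ _+_ (ind-no (x ≟ u) (u∉ ∘ here ∘ sym)) (chain-occ0 i x xs (u∉ ∘ there))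

  entry? : (e f : Entry) → Dec (e ≡ f)
  entry? (v , a , i) (w , b , j) = Decidable.map′
    (λ { (refl , refl , refl) → refl }) (λ { refl → refl , refl , refl }) (v ≟ w ×-dec a ≟ b ×-dec i ≟ j)

  GoodPath : Path → Set
  GoodPath (i , P) = Unique P × 0 ∉ P

  on : (Entry → ℕ) → List ℕ → Path → ℕ
  on h I (i , P) = chain h i 0 (keep I P)

  module Insertion (N : ℕ) (Ps : List Path) where

    cnt : ℕ → ℕ
    cnt u = Sum (λ p → ind (memb? u (proj₂ p))) Ps

    module _ (I : List ℕ) (v : ℕ) (v∉I : v ∉ I) (v≢0 : v ≢ 0) (0∉I : 0 ∉ I)
             (sorted : ∀ {u} → u ∈ I → cnt v ≤ cnt u) (v≤N : cnt v ≤ N) where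

      record State (done todo : List Path) (O : List (List Entry)) : Set where
        field
          valid  : AllValid O
          len    : length O ≡ N
          weight : ∀ h → Total h O ≡ Sum (on h (v ∷ I)) done + Sum (on h I) todo

      record Split (done todo : List Path) : Set where
        field
          perm  : ∀ f → Sum f done + Sum f todo ≡ Sum f Ps
          good₁ : All GoodPath done
          good₂ : All GoodPath todo
          apart : ∀ {p q} → p ∈ done → q ∈ todo → proj₁ p ≢ proj₁ q
          ids   : AllPairs (λ p q → proj₁ p ≢ proj₁ q) todo

      keep-unique : ∀ J p → GoodPath p → Unique (keep J (proj₂ p))
      keep-unique J p (U , _) = Uniqueₚ.filter⁺ (λ x → memb? x J) U

      private
        occ-v≤ : ∀ J q → GoodPath q → ∀ u → on (occ u) J q ≤ ind (memb? u (proj₂ q))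
        occ-v≤ J q g u = chain-occ≤ (proj₁ q) 0 (keep J (proj₂ q)) (keep-unique J q g) (proj₂ ∘ keep-∈ J (proj₂ q))

        occ-u≥ : ∀ {u} J q → u ∈ J → ind (memb? u (proj₂ q)) ≤ on (occ u) J q
        occ-u≥ {u} J (i , P) u∈J with memb? u P
        ... | no _   = z≤n
        ... | yes u∈ = chain-occ≥ i 0 (keep J P) (∈-filter⁺ (λ x → memb? x J) u∈ u∈J)

      module _ {done p todo O} (sp : Split done (p ∷ todo)) (st : State done (p ∷ todo) O) (v∈p : v ∈ proj₂ p) where
        open Split sp
        open State st

        few : Total (occ v) O < cnt v
        few = ≤-trans (≤-reflexive (cong suc (trans (weight (occ v)) (cong (Sum (on (occ v) (v ∷ I)) done +_) absent))))
          (≤-trans (s≤s (+-monoˡ-≤ 0 (Sum-mono done λ q q∈ → occ-v≤ (v ∷ I) q (All.lookup good₁ q∈) v)))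
            (≤-trans (≤-reflexive (trans (cong suc (+-identityʳ _)) (+-comm 1 _)))
              (≤-trans (+-monoʳ-≤ (Sum _ done) (≤-trans (≤-reflexive (sym (ind-yes (memb? v (proj₂ p)) v∈p))) (m≤m+n _ _)))
                (≤-reflexive (perm _)))))
          where
          absent : Sum (on (occ v) I) (p ∷ todo) ≡ 0
          absent = go (p ∷ todo)
            where
            go : ∀ qs → Sum (on (occ v) I) qs ≡ 0
            go []       = refl
            go (q ∷ qs) = cong₂ _+_ (chain-occ0 (proj₁ q) 0 (keep I (proj₂ q)) (v∉I ∘ proj₁ ∘ keep-∈ I (proj₂ q))) (go qs)

        many : ∀ {u} → u ∈ I → cnt v ≤ Total (occ u) O
        many {u} u∈ = ≤-trans (sorted u∈) (≤-trans (≤-reflexive (sym (perm _)))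
          (≤-trans (+-mono-≤ (Sum-mono done λ q _ → occ-u≥ (v ∷ I) q (there u∈))
                             (Sum-mono (p ∷ todo) λ q _ → occ-u≥ I q u∈))
            (≤-reflexive (sym (weight (occ u))))))

        inserted : ∀ {u} → 1 ≤ Total (occ u) O → u ≢ v → u ∈ I
        inserted {u} le u≢v with m≤n⇒m<n∨m≡n (z≤n {Sum (on (occ u) (v ∷ I)) done})
        ... | inj₁ lt = let (q , _ , pos) = Sum-pos (on (occ u) (v ∷ I)) done lt
                            (ys , w , zs , eq , pos′) = chain-pos (occ u) (proj₁ q) 0 (keep (v ∷ I) (proj₂ q)) pos
                        in case proj₁ (keep-∈ (v ∷ I) (proj₂ q) (subst (w ∈_) (sym eq) (∈-++⁺ʳ ys (here refl)))) of λ
                           { (here w≡v) → contradiction (trans (sym (ind-pos (w ≟ u) pos′)) w≡v) u≢v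
                           ; (there w∈) → subst (_∈ I) (ind-pos (w ≟ u) pos′) w∈ }
        ... | inj₂ 0≡ = let (q , _ , pos) = Sum-pos (on (occ u) I) (p ∷ todo)
                              (≤-trans le (≤-reflexive (trans (weight (occ u)) (cong (_+ Sum (on (occ u) I) (p ∷ todo)) (sym 0≡)))))
                            (ys , w , zs , eq , pos′) = chain-pos (occ u) (proj₁ q) 0 (keep I (proj₂ q)) pos
                        in subst (_∈ I) (ind-pos (w ≟ u) pos′)
                             (proj₁ (keep-∈ I (proj₂ q) (subst (w ∈_) (sym eq) (∈-++⁺ʳ ys (here refl)))))

        room : ∀ {a} {O′} → length O′ ≡ N → Total (occ v) O′ ≡ Total (occ v) O → (a ∈ I → Total (occ a) O′ ≡ Total (occ a) O) →
               a ≡ 0 ⊎ a ∈ I → (a ≡ 0 × Total (occ v) O′ < length O′) ⊎ Total (occ v) O′ < Total (occ a) O′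
        room len′ eq _   (inj₁ a≡0) = inj₁ (a≡0 , ≤-trans (s≤s (≤-reflexive eq)) (≤-trans few (≤-trans v≤N (≤-reflexive (sym len′)))))
        room len′ eq eqa (inj₂ a∈) = inj₂ (≤-trans (s≤s (≤-reflexive eq)) (≤-trans few (≤-trans (many a∈) (≤-reflexive (sym (eqa a∈))))))

        -- The parent recorded for b is its predecessor on p.
        identify : ∀ {l b r a} → keep I (proj₂ p) ≡ l ++ b ∷ r → ∀ {es} → es ∈ O → (b , a , proj₁ p) ∈ es → a ≡ lastOf 0 l
        identify {l} {b} {r} {a} split {es} es∈ e∈ with m≤n⇒m<n∨m≡n (z≤n {Sum (on h (v ∷ I)) done})
          where h = λ e → ind (entry? e (b , a , proj₁ p))
        ... | inj₁ lt = let (q , q∈ , pos) = Sum-pos (on h (v ∷ I)) done lt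
                            (ys , w , zs , eq , pos′) = chain-pos h (proj₁ q) 0 (keep (v ∷ I) (proj₂ q)) pos
                        in contradiction (cong pid (ind-pos (entry? (w , lastOf 0 ys , proj₁ q) (b , a , proj₁ p)) pos′)) (apart q∈ (here refl))
          where h = λ e → ind (entry? e (b , a , proj₁ p))
        ... | inj₂ 0≡ = case Sum-pos (on h I) (p ∷ todo) (≤-trans
            (≤-trans (≤-reflexive (sym (ind-yes (entry? (b , a , proj₁ p) (b , a , proj₁ p)) refl))) (≤-trans (Sum-∈ h e∈) (Sum-∈ (Sum h) es∈)))
            (≤-reflexive (trans (weight h) (cong (_+ Sum (on h I) (p ∷ todo)) (sym 0≡))))) of λ
          { (q , there q∈ , pos) →
              let (ys , w , zs , eq , pos′) = chain-pos h (proj₁ q) 0 (keep I (proj₂ q)) pos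
              in contradiction (sym (cong pid (ind-pos (entry? (w , lastOf 0 ys , proj₁ q) (b , a , proj₁ p)) pos′))) (All.lookup (head-ids ids) q∈)
          ; (q , here refl , pos) →
              let (ys , w , zs , eq , pos′) = chain-pos h (proj₁ q) 0 (keep I (proj₂ q)) pos
                  e≡ = ind-pos (entry? (w , lastOf 0 ys , proj₁ p) (b , a , proj₁ p)) pos′
              in trans (sym (cong par e≡)) (cong (lastOf 0) (sym
                   (unique-split l ys (subst Unique split (keep-unique I p (All.head good₂)))
                     (trans (sym split) (trans eq (cong (λ x → ys ++ x ∷ zs) (cong vert e≡))))))) }
          where
          h = λ e → ind (entry? e (b , a , proj₁ p))
          head-ids : ∀ {q qs} → AllPairs (λ p q → proj₁ p ≢ proj₁ q) (q ∷ qs) → All (λ r → proj₁ q ≢ proj₁ r) qs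
          head-ids (x ∷ _) = x

        arc-split : ∀ {l b r} → keep I (proj₂ p) ≡ l ++ b ∷ r → let i = proj₁ p ; a = lastOf 0 l in
          AllValid (splitArc v b i O) × length (splitArc v b i O) ≡ N ×
          (∀ h → Total h (splitArc v b i O) + h (b , a , i) ≡ Total h O + (h (v , a , i) + h (b , v , i)))
        arc-split {l} {b} {r} split with breakAt-found (hasKey? b (proj₁ p)) keyed
          where
          i = proj₁ p
          h = λ e → ind (key? b i e)
          used : 1 ≤ Total h O
          used = ≤-trans (≤-reflexive (sym (ind-yes (key? b i (b , lastOf 0 l , i)) (refl , refl))))
            (≤-trans (≤-trans (≤-trans (m≤m+n _ _) (m≤n+m _ (chain h i 0 l))) (≤-reflexive (sym (trans (cong (chain h i 0) split) (chain-++ h i 0 l (b ∷ r))))))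
              (≤-trans (≤-trans (m≤m+n _ _) (m≤n+m _ (Sum (on h (v ∷ I)) done))) (≤-reflexive (sym (weight h)))))
          keyed : Any (Any (Key b i)) O
          keyed = let (es , es∈ , pos) = Sum-pos (Sum h) O used ; (e , e∈ , pos′) = Sum-pos h es pos
                  in lose es∈ (lose e∈ (ind-pos (key? b i e) pos′))
        ... | L , es , R , eq , O≡ , key , _ rewrite eq = finish (Subdivided.freed sub)
          where
          i = proj₁ p
          a = lastOf 0 l
          b∈ : b ∈ I
          b∈ = proj₁ (keep-∈ I (proj₂ p) (subst (b ∈_) (sym split) (∈-++⁺ʳ l (here refl))))
          es∈ : es ∈ O
          es∈ = subst (es ∈_) (sym O≡) (∈-++⁺ʳ L (here refl))
          W = All.lookup valid es∈
          sub : Subdivided v b i es (subdivide v b i es)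
          sub = subdivide-spec W key (λ v≡b → v∉I (subst (_∈ I) (sym v≡b) b∈)) v≢0
          open Subdivided sub using (old∈) renaming (above to a₁; weight to sub-weight)
          a₁≡a : a₁ ≡ a
          a₁≡a = identify split es∈ old∈
          es′ = proj₁ (subdivide v b i es)
          fr = proj₂ (subdivide v b i es)
          O₁ = L ++ es′ ∷ R
          valid₁ : AllValid O₁
          valid₁ = let V = subst AllValid O≡ valid in
            Allₚ.++⁺ (Allₚ.++⁻ˡ L V) (case Allₚ.++⁻ʳ L V of λ { (_ ∷ Ws) → Subdivided.valid sub ∷ Ws })
          len₁ : length O₁ ≡ N
          len₁ = trans (trans (Listₚ.length-++ L) (sym (Listₚ.length-++ L))) (trans (cong length (sym O≡)) len)
          eq₁ : ∀ x e r f z → x + (e + r) + f + z ≡ x + r + (e + f + z)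
          eq₁ = solve-∀
          eq₂ : ∀ x r e y → x + r + (e + y) ≡ x + (e + r) + y
          eq₂ = solve-∀
          weight₁ : ∀ h → Total h O₁ + Sum h fr + h (b , a , i) ≡ Total h O + (h (v , a , i) + h (b , v , i))
          weight₁ h = subst (λ a → Total h O₁ + Sum h fr + h (b , a , i) ≡ Total h O + (h (v , a , i) + h (b , v , i))) a₁≡a
            (trans (cong (λ x → x + Sum h fr + h (b , a₁ , i)) (Sum-++ (Sum h) L _))
              (trans (eq₁ (Total h L) (Sum h es′) (Total h R) (Sum h fr) (h (b , a₁ , i)))
                (trans (cong (Total h L + Total h R +_) (sub-weight h))
                  (trans (eq₂ (Total h L) (Total h R) (Sum h es) (h (v , a₁ , i) + h (b , v , i)))
                    (cong (_+ (h (v , a₁ , i) + h (b , v , i))) (sym (trans (cong (Total h) O≡) (Sum-++ (Sum h) L _))))))))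
          Result : List (List Entry) → Set
          Result O′ = AllValid O′ × length O′ ≡ N ×
            (∀ h → Total h O′ + h (b , a , i) ≡ Total h O + (h (v , a , i) + h (b , v , i)))
          finish : fr ≡ [] ⊎ (∃[ e ] fr ≡ e ∷ [] × vert e ≡ v × (e ∈ es ⊎ par e ≡ a₁)) → Result (settle L (subdivide v b i es) R)
          finish (inj₁ none) = subst (λ f → Result (caseList f O₁ (λ e _ → place e O₁))) (sym none)
            (valid₁ , len₁ , λ h → trans (cong (_+ h (b , a , i)) (trans (sym (+-identityʳ _)) (cong (λ f → Total h O₁ + Sum h f) (sym none)))) (weight₁ h))
          finish (inj₂ (e , one , ve , src)) = subst (λ f → Result (caseList f O₁ (λ e _ → place e O₁))) (sym one)
            (Placed.valid pl , trans (Placed.same pl) len₁ ,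
             λ h → trans (cong (_+ h (b , a , i)) (trans (Placed.weight pl h)
               (trans (cong (Total h O₁ +_) (sym (+-identityʳ (h e)))) (cong (λ f → Total h O₁ + Sum h f) (sym one))))) (weight₁ h))
            where
            known : e ∈ es ⊎ par e ≡ a₁ → par e ≡ 0 ⊎ par e ∈ I
            known (inj₁ e∈) = case valid-par W e∈ of λ
              { (inj₁ (here eq)) → inj₁ eq
              ; (inj₂ c) → inj₂ (inserted (≤-trans (contains-occ c) (Sum-∈ (Sum (occ (par e))) es∈))
                                   (λ eq → valid-par≢ W e∈ (trans eq (sym ve)))) }
            known (inj₂ eq) with lastOf-∈ 0 l
            ... | inj₁ a≡0 = inj₁ (trans eq (trans a₁≡a a≡0))
            ... | inj₂ m = inj₂ (subst (_∈ I) (sym (trans eq a₁≡a))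
                      (proj₁ (keep-∈ I (proj₂ p) (subst (a ∈_) (sym split) (∈-++⁺ˡ m)))))
            same-v : Total (occ v) O₁ ≡ Total (occ v) O
            same-v = +-cancelʳ-≡ 1 _ _ (trans (sym (+-identityʳ _)) (trans (cong₂ (λ x y → Total (occ v) O₁ + x + y)
                (sym (trans (cong (Sum (occ v)) one) (cong (_+ 0) (ind-yes (vert e ≟ v) ve)))) (sym b≢v))
              (trans (weight₁ (occ v)) (cong₂ (λ x y → Total (occ v) O + (x + y)) (ind-yes (v ≟ v) refl) b≢v))))
              where
              b≢v : ind (b ≟ v) ≡ 0
              b≢v = ind-no (b ≟ v) (λ b≡v → v∉I (subst (_∈ I) b≡v b∈))
            same-a : par e ∈ I → Total (occ (par e)) O₁ ≡ Total (occ (par e)) O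
            same-a a∈ = +-cancelʳ-≡ (ind (b ≟ par e)) _ _ (trans (cong (_+ ind (b ≟ par e)) (trans (sym (+-identityʳ _))
                (cong (Total (occ (par e)) O₁ +_) (sym (trans (cong (Sum (occ (par e))) one) (cong (_+ 0)
                  (ind-no (vert e ≟ par e) (λ eq → v∉I (subst (_∈ I) (trans (sym eq) ve) a∈)))))))))
              (trans (weight₁ (occ (par e))) (cong (λ x → Total (occ (par e)) O + (x + ind (b ≟ par e)))
                (ind-no (v ≟ par e) (λ eq → v∉I (subst (_∈ I) (sym eq) a∈))))))
            pl : Placed e O₁ (place e O₁)
            pl = place-spec valid₁ (λ eq → v≢0 (trans (sym ve) eq))
              (subst (λ u → (par e ≡ 0 × Total (occ u) O₁ < length O₁) ⊎ Total (occ u) O₁ < Total (occ (par e)) O₁) (sym ve)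
                (room {par e} {O₁} len₁ same-v same-a (known src)))

      step : ∀ {done p todo O} → Split done (p ∷ todo) → State done (p ∷ todo) O →
             State (p ∷ done) todo (insertArc I v O p)
      step {done} {p@(i , P)} {todo} {O} sp st with any? (v ≟_) P
      ... | no v∉ rewrite breakAt-none (v ≟_) v∉ = record
        { valid = valid ; len = len
        ; weight = λ h → trans (weight h) (trans (eq (Sum (on h (v ∷ I)) done) (on h I p) _)
            (cong (λ x → chain h i 0 x + Sum (on h (v ∷ I)) done + Sum (on h I) todo) (sym (keep-∉ I P v∉)))) }
        where
        open State st
        eq : ∀ a b c → a + (b + c) ≡ b + a + c
        eq = solve-∀
      ... | yes v∈ with breakAt-found (v ≟_) v∈
      ...   | l , .v , r , eq , refl , refl , _ rewrite eq = go (keep I r) refl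
        where
        open State st
        open Split sp
        v∉ = unique-∉ l (proj₁ (All.head good₂))
        old : keep I P ≡ keep I l ++ keep I r
        old = keep-old I l r v∉I
        new : keep (v ∷ I) P ≡ keep I l ++ v ∷ keep I r
        new = keep-new I l r (proj₁ v∉) (proj₂ v∉)
        a = lastOf 0 (keep I l)
        a∈ : a ≡ 0 ⊎ a ∈ I
        a∈ with lastOf-∈ 0 (keep I l)
        ... | inj₁ eq = inj₁ eq
        ... | inj₂ m  = inj₂ (proj₁ (keep-∈ I l m))
        update : ∀ {O′} → (∀ h → Total h O′ + chain h i 0 (keep I P) ≡ Total h O + chain h i 0 (keep (v ∷ I) P)) →
                 ∀ h → Total h O′ ≡ on h (v ∷ I) p + Sum (on h (v ∷ I)) done + Sum (on h I) todo
        update {O′} eq h = +-cancelʳ-≡ (chain h i 0 (keep I P)) _ _ (trans (eq h) (trans (cong (_+ on h (v ∷ I) p) (weight h))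
          (eq₁ (Sum (on h (v ∷ I)) done) (on h I p) (Sum (on h I) todo) (on h (v ∷ I) p))))
          where
          eq₁ : ∀ d c t x → d + (c + t) + x ≡ x + d + t + c
          eq₁ = solve-∀
        go : ∀ r′ → keep I r ≡ r′ → State (p ∷ done) todo
               (caseList r′ (place (v , a , i) O) (λ b _ → splitArc v b i O))
        go [] eq = record
          { valid = Placed.valid pl ; len = trans (Placed.same pl) len
          ; weight = update {place (v , a , i) O} λ h →
              trans (cong₂ _+_ (Placed.weight pl h) (cong (chain h i 0) (trans old (cong (keep I l ++_) eq))))
                (trans (eq₂ (Total h O) (h (v , a , i)) (chain h i 0 (keep I l ++ [])))
                  (cong (Total h O +_) (sym (trans (cong (chain h i 0) (trans new (cong (λ x → keep I l ++ v ∷ x) eq)))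
                    (chain-snoc h))))) }
          where
          pl : Placed (v , a , i) O (place (v , a , i) O)
          pl = place-spec valid v≢0 (room sp st v∈ {a} {O} len refl (λ _ → refl) a∈)
          eq₂ : ∀ t x c → t + x + c ≡ t + (c + x)
          eq₂ = solve-∀
          chain-snoc : ∀ h → chain h i 0 (keep I l ++ v ∷ []) ≡ chain h i 0 (keep I l ++ []) + h (v , a , i)
          chain-snoc h = trans (chain-++ h i 0 (keep I l) (v ∷ []))
            (cong₂ _+_ (cong (chain h i 0) (sym (Listₚ.++-identityʳ (keep I l)))) (+-identityʳ (h (v , a , i))))
        go (b ∷ r″) eq = record
          { valid = proj₁ sub ; len = proj₁ (proj₂ sub)
          ; weight = update {splitArc v b i O} λ h → +-cancelʳ-≡ (h (b , a , i)) _ _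
              (trans (eq₂ (Total h (splitArc v b i O)) (chain h i 0 (keep I P)) (h (b , a , i)))
                (trans (cong₂ _+_ (proj₂ (proj₂ sub) h) (cong (chain h i 0) split))
                  (trans (eq₃ (Total h O) (h (v , a , i) + h (b , v , i)) (chain h i 0 (keep I l ++ b ∷ r″)))
                    (trans (cong (Total h O +_) (sym (chain-insert h i (keep I l) v b r″)))
                      (trans (sym (+-assoc (Total h O) _ (h (b , a , i))))
                        (cong (λ x → Total h O + chain h i 0 x + h (b , a , i))
                          (sym (trans new (cong (λ x → keep I l ++ v ∷ x) eq))))))))) }
          where
          split : keep I P ≡ keep I l ++ b ∷ r″
          split = trans old (cong (keep I l ++_) eq)
          sub = arc-split sp st v∈ split
          eq₂ : ∀ t c x → t + c + x ≡ t + x + c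
          eq₂ = solve-∀
          eq₃ : ∀ t x c → t + x + c ≡ t + (c + x)
          eq₃ = solve-∀

      sweep : ∀ todo {done O} → Split done todo → State done todo O →
              ∃[ done′ ] Split done′ [] × State done′ [] (foldl (insertArc I v) O todo)
      sweep []         sp st = _ , sp , st
      sweep (p ∷ todo) {done} sp st = sweep todo (record
        { perm  = λ f → trans (eq (f p) (Sum f done) (Sum f todo)) (perm f)
        ; good₁ = All.head good₂ ∷ good₁
        ; good₂ = All.tail good₂
        ; apart = λ { (here refl) q∈ → All.lookup (first ids) q∈ ; (there p∈) q∈ → apart p∈ (there q∈) }
        ; ids   = others ids }) (step sp st)
        where
        open Split sp
        eq : ∀ x d t → x + d + t ≡ d + (x + t)
        eq = solve-∀
        first : ∀ {q qs} → AllPairs (λ p q → proj₁ p ≢ proj₁ q) (q ∷ qs) → All (λ r → proj₁ q ≢ proj₁ r) qs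
        first (x ∷ _) = x
        others : ∀ {q qs} → AllPairs (λ p q → proj₁ p ≢ proj₁ q) (q ∷ qs) → AllPairs (λ p q → proj₁ p ≢ proj₁ q) qs
        others (_ ∷ x) = x

    record Built (I : List ℕ) (O : List (List Entry)) : Set where
      field
        valid  : AllValid O
        len    : length O ≡ N
        weight : ∀ h → Total h O ≡ Sum (on h I) Ps

    module _ (good : All GoodPath Ps) (ids : AllPairs (λ p q → proj₁ p ≢ proj₁ q) Ps) where

      insert-all : ∀ rest {I O} → Built I O → 0 ∉ I → All (_≢ 0) rest → All (λ v → cnt v ≤ N) rest → Unique rest →
        AllPairs (λ u v → cnt v ≤ cnt u) rest → (∀ {u v} → u ∈ I → v ∈ rest → u ≢ v × cnt v ≤ cnt u) →
        ∃[ I′ ] Built I′ (proj₂ (foldl (insertVertex Ps) (I , O) rest)) × (∀ {x} → x ∈ I ⊎ x ∈ rest → x ∈ I′)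
      insert-all [] B 0∉ _ _ _ _ _ = _ , B , λ { (inj₁ x∈) → x∈ }
      insert-all (v ∷ rest) {I} {O} B 0∉ (v≢0 ∷ ≢0s) (v≤ ∷ ≤s) (v∉ ∷ U) (s ∷ S) ord =
        let (done , sp , st) = sweep I v (λ v∈ → proj₁ (ord v∈ (here refl)) refl) v≢0 0∉
              (λ u∈ → proj₂ (ord u∈ (here refl))) v≤ Ps
              (record { perm = λ f → refl ; good₁ = [] ; good₂ = good ; apart = λ () ; ids = ids })
              (record { valid = Built.valid B ; len = Built.len B ; weight = Built.weight B })
            (I′ , B′ , f) = insert-all rest
              (record { valid = State.valid st ; len = State.len st
                      ; weight = λ h → trans (State.weight st h) (Split.perm sp (on h (v ∷ I))) })
              (λ { (here eq) → v≢0 (sym eq) ; (there 0∈) → 0∉ 0∈ }) ≢0s ≤s U S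
              (λ { (here refl) v∈ → All.lookup v∉ v∈ , All.lookup s v∈ ; (there u∈) v∈ → ord u∈ (there v∈) })
        in I′ , B′ , λ { (inj₁ x∈) → f (inj₁ (there x∈)) ; (inj₂ (here refl)) → f (inj₁ (here refl)) ; (inj₂ (there x∈)) → f (inj₂ x∈) }

      record Packing (O : List (List Entry)) : Set where
        field
          valid  : AllValid O
          len    : length O ≡ N
          weight : ∀ h → Total h O ≡ Sum (λ p → chain h (proj₁ p) 0 (proj₂ p)) Ps

      packing : ∀ order → All (_≢ 0) order → All (λ v → cnt v ≤ N) order → Unique order →
        AllPairs (λ u v → cnt v ≤ cnt u) order → (∀ {p x} → p ∈ Ps → x ∈ proj₂ p → x ∈ order) →
        Packing (branchings N order Ps)
      packing order ≢0s ≤s U S covers =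
        let (I , B , f) = insert-all order {[]} {replicate N []}
              (record { valid = Allₚ.replicate⁺ N [] ; len = Listₚ.length-replicate N
                      ; weight = λ h → trans (empty₁ h N) (sym (empty₂ h Ps)) })
              (λ ()) ≢0s ≤s U S (λ ())
        in record { valid = Built.valid B ; len = Built.len B
                  ; weight = λ h → trans (Built.weight B h) (Sum-cong Ps λ p p∈ → cong (chain h (proj₁ p) 0)
                      (Listₚ.filter-all (λ x → memb? x I) (All.tabulate λ x∈ → f (inj₂ (covers p∈ x∈))))) }
        where
        empty₁ : ∀ h n → Total h (replicate n []) ≡ 0
        empty₁ h zero    = refl
        empty₁ h (suc n) = empty₁ h n
        empty₂ : ∀ h (qs : List Path) → Sum (on h []) qs ≡ 0
        empty₂ h []       = refl
        empty₂ h (q ∷ qs) = cong₂ _+_ (cong (chain h (proj₁ q) 0) (no-member (proj₂ q))) (empty₂ h qs)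
          where
          no-member : ∀ xs → keep [] xs ≡ []
          no-member []       = refl
          no-member (x ∷ xs) = no-member xs

  Sum-+ : {X : Set} (f g : X → ℕ) (xs : List X) → Sum (λ x → f x + g x) xs ≡ Sum f xs + Sum g xs
  Sum-+ f g []       = refl
  Sum-+ f g (x ∷ xs) = trans (cong (f x + g x +_) (Sum-+ f g xs)) (eq (f x) (g x) (Sum f xs) (Sum g xs))
    where
    eq : ∀ a b c d → a + b + (c + d) ≡ a + c + (b + d)
    eq = solve-∀

  Sum-0 : {X : Set} (xs : List X) → Sum (λ _ → 0) xs ≡ 0
  Sum-0 []       = refl
  Sum-0 (_ ∷ xs) = Sum-0 xs

  Sum-const : {X : Set} (c : ℕ) (xs : List X) → Sum (λ _ → c) xs ≡ length xs * c
  Sum-const c []       = refl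
  Sum-const c (_ ∷ xs) = cong (c +_) (Sum-const c xs)

  Sum-swap : {X Y : Set} (f : X → Y → ℕ) (xs : List X) (ys : List Y) →
             Sum (λ x → Sum (f x) ys) xs ≡ Sum (λ y → Sum (λ x → f x y) xs) ys
  Sum-swap f []       ys = sym (Sum-0 ys)
  Sum-swap f (x ∷ xs) ys = trans (cong (Sum (f x) ys +_) (Sum-swap f xs ys)) (sym (Sum-+ (f x) _ ys))

  Sum-concat : {X : Set} (f : X → ℕ) (xss : List (List X)) → Sum f (concat xss) ≡ Sum (Sum f) xss
  Sum-concat f []         = refl
  Sum-concat f (xs ∷ xss) = trans (Sum-++ f xs _) (cong (Sum f xs +_) (Sum-concat f xss))

  Sum-replicate : {X : Set} (f : X → ℕ) (k : ℕ) (x : X) → Sum f (replicate k x) ≡ k * f x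
  Sum-replicate f zero    x = refl
  Sum-replicate f (suc k) x = cong (f x +_) (Sum-replicate f k x)

  clients : ℕ → List ℕ
  clients n = map suc (downFrom n)

  ∈-clients : ∀ {n u} → 0 < u → u ≤ n → u ∈ clients n
  ∈-clients {suc n} {suc u} _ le = ∈-map⁺ suc (Membershipₚ.∈-downFrom⁺ le)

  clients-pos : ∀ n → All (_≢ 0) (clients n)
  clients-pos n = Allₚ.map⁺ (All.tabulate λ _ ())

  clients-unique : ∀ n → Unique (clients n)
  clients-unique n = Uniqueₚ.map⁺ suc-injective
    (Uniqueₚ.downFrom⁺ n)

  length-clients : ∀ n → length (clients n) ≡ n
  length-clients n = trans (Listₚ.length-map suc (downFrom n)) (Listₚ.length-downFrom n)

  Sum-occurs : ∀ x V → Unique V → Sum (λ u → ind (x ≟ u)) V ≡ ind (memb? x V)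
  Sum-occurs x []      _ = refl
  Sum-occurs x (v ∷ V) (≢s ∷ U) with x ≟ v
  ... | no _     = Sum-occurs x V U
  ... | yes refl = cong suc (trans (Sum-occurs x V U) (ind-no (memb? x V) (λ x∈ → All.lookup ≢s x∈ refl)))

  count : ℕ → List (List ℕ) → ℕ
  count u Ls = Sum (λ P → ind (memb? u P)) Ls

  thin : ℕ → List (List ℕ) → List ℕ → List ℕ
  thin N Ls = filter (λ u → suc (count u Ls) ≤? N)

  trunc : ℕ → List (List ℕ) → List (List ℕ)
  trunc N Ls = foldl (λ acc P → acc ++ thin N acc P ∷ []) [] Ls

  ind-filter : ∀ {Q : ℕ → Set} (Q? : ∀ u → Dec (Q u)) u P → ind (memb? u (filter Q? P)) ≡ (if does (Q? u) then ind (memb? u P) else 0)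
  ind-filter Q? u P with memb? u P
  ... | no u∉ rewrite ind-no (memb? u (filter Q? P)) (u∉ ∘ proj₁ ∘ ∈-filter⁻ Q?) with does (Q? u)
  ...   | true  = refl
  ...   | false = refl
  ind-filter Q? u P | yes u∈ with Q? u
  ...   | yes q = ind-yes (memb? u (filter Q? P)) (∈-filter⁺ Q? u∈ q)
  ...   | no ¬q = ind-no (memb? u (filter Q? P)) (¬q ∘ proj₂ ∘ ∈-filter⁻ Q? {xs = P})

  module _ (N : ℕ) where

    private
      grow : List (List ℕ) → List ℕ → List (List ℕ)
      grow acc P = acc ++ thin N acc P ∷ []

      count-grow : ∀ u acc P → count u (grow acc P) ≡ count u acc + ind (memb? u (thin N acc P))
      count-grow u acc P = trans (Sum-++ _ acc _) (cong (count u acc +_) (+-identityʳ _))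

      step≤ : ∀ u acc P → count u acc ≤ N → count u (grow acc P) ≤ N
      step≤ u acc P le rewrite count-grow u acc P | ind-filter (λ u → suc (count u acc) ≤? N) u P with suc (count u acc) ≤? N
      ... | yes lt = ≤-trans (+-monoʳ-≤ (count u acc) (ind≤1 (memb? u P))) (≤-trans (≤-reflexive (+-comm _ 1)) lt)
      ... | no _   = ≤-trans (≤-reflexive (+-identityʳ _)) le

      step-full : ∀ u acc P → count u acc ≤ N → count u (grow acc P) ≡ N ⊎ count u (grow acc P) ≡ count u acc + ind (memb? u P)
      step-full u acc P le rewrite count-grow u acc P | ind-filter (λ u → suc (count u acc) ≤? N) u P with suc (count u acc) ≤? N
      ... | yes lt = inj₂ refl
      ... | no ≮  = inj₁ (trans (+-identityʳ _) (≤-antisym le (≮⇒≥ ≮)))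

      count-≤ : ∀ u acc Ls → count u acc ≤ N → count u (foldl grow acc Ls) ≤ N
      count-≤ u acc []       le = le
      count-≤ u acc (P ∷ Ls) le = count-≤ u (grow acc P) Ls (step≤ u acc P le)

      count-grows : ∀ u acc Ls → count u acc ≤ count u (foldl grow acc Ls)
      count-grows u acc []       = ≤-refl
      count-grows u acc (P ∷ Ls) = ≤-trans (≤-trans (m≤m+n _ _) (≤-reflexive (sym (count-grow u acc P)))) (count-grows u (grow acc P) Ls)

      count-full : ∀ u acc Ls → count u acc ≤ N → count u (foldl grow acc Ls) ≡ N ⊎ count u (foldl grow acc Ls) ≡ count u acc + count u Ls
      count-full u acc []       le = inj₂ (sym (+-identityʳ _))
      count-full u acc (P ∷ Ls) le with step-full u acc P le
      ... | inj₁ full = inj₁ (≤-antisym (count-≤ u (grow acc P) Ls (step≤ u acc P le))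
                          (≤-trans (≤-reflexive (sym full)) (count-grows u (grow acc P) Ls)))
      ... | inj₂ eq with count-full u (grow acc P) Ls (step≤ u acc P le)
      ...   | inj₁ full = inj₁ full
      ...   | inj₂ eq′ = inj₂ (trans eq′ (trans (cong (_+ count u Ls) eq) (+-assoc (count u acc) _ _)))

    trunc-≤ : ∀ u Ls → count u (trunc N Ls) ≤ N
    trunc-≤ u Ls = count-≤ u [] Ls z≤n

    trunc-deficit : ∀ u Ls → N ≤ (N ∸ count u Ls) + count u (trunc N Ls)
    trunc-deficit u Ls with count-full u [] Ls z≤n
    ... | inj₁ eq = ≤-trans (≤-reflexive (sym eq)) (m≤n+m _ _)
    ... | inj₂ eq = ≤-trans (m≤n+m∸n N (count u Ls)) (≤-reflexive (trans (+-comm (count u Ls) _) (cong ((N ∸ count u Ls) +_) (sym eq))))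

    trunc-All : ∀ {Q : List ℕ → Set} Ls → (∀ acc {P} → Q P → Q (thin N acc P)) → All Q Ls → All Q (trunc N Ls)
    trunc-All {Q} Ls f qs = go [] Ls [] qs
      where
      go : ∀ acc Ls → All Q acc → All Q Ls → All Q (foldl grow acc Ls)
      go acc []       as qs       = as
      go acc (P ∷ Ls) as (q ∷ qs) = go (grow acc P) Ls (Allₚ.++⁺ as (f acc q ∷ [])) qs

    trunc-Sum : ∀ (f : List ℕ → ℕ) Ls → (∀ acc P → f (thin N acc P) ≤ f P) → Sum f (trunc N Ls) ≤ Sum f Ls
    trunc-Sum f Ls le = go [] Ls
      where
      go : ∀ acc Ls → Sum f (foldl grow acc Ls) ≤ Sum f acc + Sum f Ls
      go acc []       = m≤m+n _ _
      go acc (P ∷ Ls) = ≤-trans (go (grow acc P) Ls) (≤-trans (+-monoˡ-≤ (Sum f Ls) (≤-trans (≤-reflexive (Sum-++ f acc _))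
        (+-monoʳ-≤ (Sum f acc) (≤-trans (≤-reflexive (+-identityʳ _)) (le acc P))))) (≤-reflexive (+-assoc (Sum f acc) _ _)))

  order : ℕ → ℕ → List (List ℕ) → List ℕ
  order n N Ls = concatMap (λ c → filter (λ u → count u Ls ≟ c) (clients n)) (downFrom (suc N))

  number : {X : Set} → ℕ → List X → List (ℕ × X)
  number k []       = []
  number k (P ∷ Ls) = (k , P) ∷ number (suc k) Ls

  number-All : ∀ {X : Set} {Q : X → Set} k Ls → All Q Ls → All (Q ∘ proj₂) (number k Ls)
  number-All k []       []       = []
  number-All k (P ∷ Ls) (q ∷ qs) = q ∷ number-All (suc k) Ls qs

  number-Sum : ∀ {X : Set} (f : X → ℕ) k Ls → Sum (f ∘ proj₂) (number k Ls) ≡ Sum f Ls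
  number-Sum f k []       = refl
  number-Sum f k (P ∷ Ls) = cong (f P +_) (number-Sum f (suc k) Ls)

  number-distinct : ∀ {X : Set} k (Ls : List X) → AllPairs (λ p q → proj₁ p ≢ proj₁ q) (number k Ls)
  number-distinct {X} k []       = []
  number-distinct {X} k (P ∷ Ls) = All.map (λ lt eq → <-irrefl eq lt) (later (suc k) Ls ≤-refl) ∷ number-distinct (suc k) Ls
    where
    later : ∀ j (Ls : List X) {k} → k < j → All (λ q → k < proj₁ q) (number j Ls)
    later j []       lt = []
    later j (P ∷ Ls) lt = lt ∷ later (suc j) Ls (m≤n⇒m≤1+n lt)

  module _ (n N : ℕ) (Ls : List (List ℕ)) where

    private
      block : ℕ → List ℕ
      block c = filter (λ u → count u Ls ≟ c) (clients n)

      count-block : ∀ {c u} → u ∈ block c → u ∈ clients n × count u Ls ≡ c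
      count-block {c} = ∈-filter⁻ (λ u → count u Ls ≟ c)

      R : ℕ → ℕ → Set
      R u v = u ≢ v × count v Ls ≤ count u Ls

      ordered : AllPairs R (order n N Ls)
      ordered = AllPairsₚ.concat⁺
        (Allₚ.map⁺ (All.tabulate λ {c} _ → inside c))
        (AllPairsₚ.map⁺ (AllPairs.map (λ {c} {c′} c>c′ →
          All.tabulate λ u∈ → All.tabulate λ v∈ → across c>c′ (proj₂ (count-block u∈)) (proj₂ (count-block v∈)))
          (AllPairsₚ.applyDownFrom⁺₁ (λ x → x) (suc N) (λ j<i _ → j<i))))
        where
        across : ∀ {c c′ u v} → c′ < c → count u Ls ≡ c → count v Ls ≡ c′ → R u v
        across lt eq eq′ = (λ { refl → <-irrefl (trans (sym eq′) eq) lt }) ,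
                           ≤-trans (≤-reflexive eq′) (≤-trans (<⇒≤ lt) (≤-reflexive (sym eq)))
        inside : ∀ c → AllPairs R (block c)
        inside c = go (block c) (Uniqueₚ.filter⁺ (λ u → count u Ls ≟ c) (clients-unique n)) (λ u∈ → proj₂ (count-block u∈))
          where
          go : ∀ xs → Unique xs → (∀ {u} → u ∈ xs → count u Ls ≡ c) → AllPairs R xs
          go []       _        _ = []
          go (x ∷ xs) (≢s ∷ U) f = All.tabulate (λ v∈ → All.lookup ≢s v∈ , ≤-reflexive (trans (f (there v∈)) (sym (f (here refl)))))
                                   ∷ go xs U (f ∘ there)

    order-∈⁻ : ∀ {u} → u ∈ order n N Ls → u ∈ clients n
    order-∈⁻ u∈ with Membershipₚ.∈-concat⁻′ (map block (downFrom (suc N))) u∈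
    ... | b , u∈b , b∈ with ∈-map⁻ block b∈
    ...   | c , _ , refl = proj₁ (count-block u∈b)

    order-∈⁺ : ∀ {u} → u ∈ clients n → count u Ls ≤ N → u ∈ order n N Ls
    order-∈⁺ {u} u∈ le = Membershipₚ.∈-concat⁺′
      (∈-filter⁺ (λ v → count v Ls ≟ count u Ls) u∈ refl)
      (∈-map⁺ block (Membershipₚ.∈-downFrom⁺ (s≤s le)))

    order-unique : Unique (order n N Ls)
    order-unique = AllPairs.map proj₁ ordered

    order-sorted : AllPairs (λ u v → count v Ls ≤ count u Ls) (order n N Ls)
    order-sorted = AllPairs.map proj₂ ordered

  forest : ℕ → ℕ → List (List ℕ) → List (List Entry)
  forest n N Ls = branchings N (order n N (trunc N Ls)) (number 0 (trunc N Ls))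

  ClientPath : ℕ → List ℕ → Set
  ClientPath n P = Unique P × All (_∈ clients n) P

  module _ (n N : ℕ) (Ls : List (List ℕ)) (good : All (ClientPath n) Ls) where

    private
      Ls′ = trunc N Ls
      Ps  = number 0 Ls′
      O   = forest n N Ls

      good′ : All (ClientPath n) Ls′
      good′ = trunc-All N Ls (λ acc (U , A) →
        Uniqueₚ.filter⁺ (λ u → suc (count u acc) ≤? N) U ,
        Allₚ.filter⁺ (λ u → suc (count u acc) ≤? N) A) good

      cnt≡ : ∀ u → Insertion.cnt N Ps u ≡ count u Ls′
      cnt≡ u = number-Sum (λ P → ind (memb? u P)) 0 Ls′

      packed : Insertion.Packing N Ps
        (All.map (λ (U , A) → U , λ 0∈ → All.lookup (clients-pos n) (All.lookup A 0∈) refl) (number-All 0 Ls′ good′))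
        (number-distinct 0 Ls′) O
      packed = Insertion.packing N Ps _ _ (order n N Ls′)
        (All.tabulate λ u∈ → All.lookup (clients-pos n) (order-∈⁻ n N Ls′ u∈))
        (All.tabulate λ {u} _ → ≤-trans (≤-reflexive (cnt≡ u)) (trunc-≤ N u Ls))
        (order-unique n N Ls′)
        (AllPairs.map (λ {u} {v} le → ≤-trans (≤-reflexive (cnt≡ v)) (≤-trans le (≤-reflexive (sym (cnt≡ u))))) (order-sorted n N Ls′))
        (λ {p} {x} p∈ x∈ → order-∈⁺ n N Ls′ (All.lookup (proj₂ (All.lookup (number-All 0 Ls′ good′) p∈)) x∈) (trunc-≤ N x Ls))

    open Insertion.Packing packed public renaming (valid to forest-valid; len to forest-length)

    forest-vertices : ∀ {es e} → es ∈ O → e ∈ es → vert e ∈ clients n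
    forest-vertices {es} {e} es∈ e∈ = case Sum-pos _ Ps (≤-trans (≤-reflexive (sym (ind-yes (vert e ≟ vert e) refl)))
        (≤-trans (Sum-∈ h e∈) (≤-trans (Sum-∈ (Sum h) es∈) (≤-reflexive (weight h))))) of λ
      { (p , p∈ , pos) → let (ys , w , zs , eq , pos′) = chain-pos h (proj₁ p) 0 (proj₂ p) pos in
          subst (_∈ clients n) (ind-pos (w ≟ vert e) pos′)
            (All.lookup (proj₂ (All.lookup (number-All 0 Ls′ good′) p∈)) (subst (w ∈_) (sym eq) (∈-++⁺ʳ ys (here refl)))) }
      where h = occ (vert e)

    tree-size : ∀ {es} → es ∈ O → Sum (λ u → Sum (occ u) es) (clients n) ≡ length es
    tree-size {es} es∈ = trans (Sum-swap (λ u e → occ u e) (clients n) es)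
      (trans (Sum-cong es λ e e∈ → trans (Sum-occurs (vert e) (clients n) (clients-unique n)) (ind-yes (memb? (vert e) (clients n)) (forest-vertices es∈ e∈)))
        (trans (Sum-const 1 es) (*-identityʳ _)))

    tree-size≤ : ∀ {es} → es ∈ O → length es ≤ n
    tree-size≤ {es} es∈ = ≤-trans (≤-reflexive (sym (tree-size es∈)))
      (≤-trans (Sum-mono (clients n) λ u _ → valid-occ≤1 (All.lookup forest-valid es∈))
        (≤-reflexive (trans (Sum-const 1 (clients n)) (trans (*-identityʳ _) (length-clients n)))))

    forest-gap : Sum (λ es → n ∸ length es) O ≤ Sum (λ u → N ∸ count u Ls) (clients n)
    forest-gap = +-cancelʳ-≤ (Sum length O) _ _ (begin
      Sum (λ es → n ∸ length es) O + Sum length O     ≡⟨ Sum-+ _ length O ⟨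
      Sum (λ es → (n ∸ length es) + length es) O      ≡⟨ Sum-cong O (λ es es∈ → m∸n+n≡m (tree-size≤ es∈)) ⟩
      Sum (λ _ → n) O                                 ≡⟨ trans (Sum-const n O) (cong (_* n) forest-length) ⟩
      N * n                                           ≡⟨ trans (*-comm N n) (cong (_* N) (sym (length-clients n))) ⟩
      length (clients n) * N                          ≡⟨ Sum-const N (clients n) ⟨
      Sum (λ _ → N) (clients n)                       ≤⟨ Sum-mono (clients n) (λ u _ → trunc-deficit N u Ls) ⟩
      Sum (λ u → (N ∸ count u Ls) + count u Ls′) (clients n)
                                                      ≡⟨ Sum-+ _ _ (clients n) ⟩
      Sum (λ u → N ∸ count u Ls) (clients n) + Sum (λ u → count u Ls′) (clients n)
                                                      ≤⟨ +-monoʳ-≤ _ covered′ ⟩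
      Sum (λ u → N ∸ count u Ls) (clients n) + Sum length O ∎)
      where
      open ≤-Reasoning
      covered′ : Sum (λ u → count u Ls′) (clients n) ≤ Sum length O
      covered′ = begin
        Sum (λ u → count u Ls′) (clients n)         ≡⟨ Sum-cong (clients n) (λ u _ → number-Sum (λ P → ind (memb? u P)) 0 Ls′) ⟨
        Sum (λ u → Sum (λ p → ind (memb? u (proj₂ p))) Ps) (clients n)
                                                    ≤⟨ Sum-mono (clients n) (λ u _ → Sum-mono Ps λ p _ → hit u p) ⟩
        Sum (λ u → Sum (λ p → chain (occ u) (proj₁ p) 0 (proj₂ p)) Ps) (clients n)
                                                    ≡⟨ Sum-cong (clients n) (λ u _ → weight (occ u)) ⟨
        Sum (λ u → Sum (λ es → Sum (occ u) es) O) (clients n)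
                                                    ≡⟨ Sum-swap _ (clients n) O ⟩
        Sum (λ es → Sum (λ u → Sum (occ u) es) (clients n)) O
                                                    ≡⟨ Sum-cong O (λ es es∈ → tree-size es∈) ⟩
        Sum length O                                ∎
        where
        hit : ∀ u p → ind (memb? u (proj₂ p)) ≤ chain (occ u) (proj₁ p) 0 (proj₂ p)
        hit u (i , P) with memb? u P
        ... | no _   = z≤n
        ... | yes u∈ = chain-occ≥ i 0 P u∈

  insertAfter : ℕ → ℕ → List ℕ → List ℕ
  insertAfter a v xs = caseList (proj₂ (breakAt (a ≟_) xs)) xs λ x r → proj₁ (breakAt (a ≟_) xs) ++ x ∷ v ∷ r

  tour : List Entry → List ℕ
  tour es = foldl (λ xs e → insertAfter (par e) (vert e) xs) (0 ∷ []) es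

  walk : List (List ℕ) → List ℕ
  walk plan = concat plan ++ 0 ∷ []

  FromRoot : List ℕ → Set
  FromRoot xs = ∃[ ys ] xs ≡ 0 ∷ ys

  walk-root : ∀ {plan} → All FromRoot plan → FromRoot (walk plan)
  walk-root []                = [] , refl
  walk-root ((_ , refl) ∷ _) = _ , refl

  dedup : List ℕ → List ℕ
  dedup []       = []
  dedup (x ∷ xs) = x ∷ filter (λ y → ¬? (x ≟ y)) (dedup xs)

  dedup-∈⁺ : ∀ {x} xs → x ∈ xs → x ∈ dedup xs
  dedup-∈⁺ (y ∷ xs) (here refl) = here refl
  dedup-∈⁺ {x} (y ∷ xs) (there x∈) with y ≟ x
  ... | yes refl = here refl
  ... | no y≢x   = there (∈-filter⁺ (λ z → ¬? (y ≟ z)) (dedup-∈⁺ xs x∈) y≢x)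

  dedup-∈⁻ : ∀ {x} xs → x ∈ dedup xs → x ∈ xs
  dedup-∈⁻ (y ∷ xs) (here eq)  = here eq
  dedup-∈⁻ (y ∷ xs) (there x∈) = there (dedup-∈⁻ xs (proj₁ (∈-filter⁻ (λ z → ¬? (y ≟ z)) x∈)))

  dedup-unique : ∀ xs → Unique (dedup xs)
  dedup-unique []       = []
  dedup-unique (x ∷ xs) = All.tabulate (λ y∈ → proj₂ (∈-filter⁻ (λ z → ¬? (x ≟ z)) {xs = dedup xs} y∈)) ∷
    Uniqueₚ.filter⁺ (λ z → ¬? (x ≟ z)) (dedup-unique xs)

  -- lat is the latency of a target along a walk, len the length of a walk
  -- starting at its first argument, and loop that of the walk closed up at
  -- its first argument.

  module Metric (d : ℕ → ℕ → ℕ) where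

    len : ℕ → List ℕ → ℕ
    len x []       = 0
    len x (y ∷ ys) = d x y + len y ys

    loop′ : ℕ → ℕ → List ℕ → ℕ
    loop′ x₀ x []       = d x x₀
    loop′ x₀ x (y ∷ ys) = d x y + loop′ x₀ y ys

    closed : List ℕ → ℕ
    closed []       = 0
    closed (x ∷ xs) = loop′ x x xs

    treeCost : List Entry → ℕ
    treeCost es = Sum (λ e → d (par e) (vert e)) es

    lat : {P : ℕ → Set} → (∀ x → Dec (P x)) → List ℕ → ℕ
    lat P? []           = 0
    lat P? (x ∷ [])     = 0
    lat P? (x ∷ y ∷ ys) = if does (P? x) then 0 else d x y + lat P? (y ∷ ys)

    planLat : {P : ℕ → Set} → (∀ x → Dec (P x)) → List (List ℕ) → ℕ
    planLat P? []         = 0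
    planLat P? (τ ∷ plan) = closed τ + (if does (any? P? τ) then 0 else planLat P? plan)

    chain-len : ∀ i a P → chain (λ e → d (par e) (vert e)) i a P ≡ len a P
    chain-len i a []       = refl
    chain-len i a (w ∷ ws) = cong (d a w +_) (chain-len i w ws)

    module _ (d-refl : ∀ x → d x x ≡ 0) (d-sym : ∀ x y → d x y ≡ d y x)
             (d-tri : ∀ x y z → d x z ≤ d x y + d y z) where

      len-filter : ∀ {Q : ℕ → Set} (Q? : ∀ x → Dec (Q x)) a P → len a (filter Q? P) ≤ len a P
      len-filter Q? a P = ≤-trans (skip a a P) (≤-reflexive (cong (_+ len a P) (d-refl a)))
        where
        skip : ∀ a b P → len a (filter Q? P) ≤ d a b + len b P
        skip a b []       = z≤n
        skip a b (x ∷ P) with does (Q? x)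
        ... | true  = ≤-trans (+-monoˡ-≤ _ (d-tri a b x)) (≤-trans (≤-reflexive (+-assoc (d a b) _ _)) (+-monoʳ-≤ (d a b)
                        (+-monoʳ-≤ (d b x) (≤-trans (skip x x P) (≤-reflexive (cong (_+ len x P) (d-refl x)))))))
        ... | false = ≤-trans (skip a x P) (≤-trans (+-monoˡ-≤ (len x P) (d-tri a b x)) (≤-reflexive (+-assoc (d a b) _ _)))

      insertAfter-spec : ∀ a v {x₀} xs → a ∈ x₀ ∷ xs → ∃[ ys ] insertAfter a v (x₀ ∷ xs) ≡ x₀ ∷ ys ×
        loop′ x₀ x₀ ys ≤ loop′ x₀ x₀ xs + (d a v + d a v) × (∀ {x} → x ≡ v ⊎ x ∈ x₀ ∷ xs → x ∈ x₀ ∷ ys) ×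
        (∀ {x} → x ∈ ys → x ≡ v ⊎ x ∈ xs)
      insertAfter-spec a v {x₀} xs a∈ with a ≟ x₀
      ... | yes refl = v ∷ xs , refl , insert x₀ x₀ xs , (λ { (inj₁ refl) → there (here refl) ; (inj₂ (here refl)) → here refl ; (inj₂ (there x∈)) → there (there x∈) }) ,
              λ { (here eq) → inj₁ eq ; (there x∈) → inj₂ x∈ }
        where
        insert : ∀ x₀ a r → d a v + loop′ x₀ v r ≤ loop′ x₀ a r + (d a v + d a v)
        insert x₀ a []      = ≤-trans (+-monoʳ-≤ (d a v) (≤-trans (d-tri v a x₀) (≤-reflexive (cong (_+ d a x₀) (d-sym v a))))) (≤-reflexive (eq (d a v) (d a x₀)))
          where
          eq : ∀ p q → p + (p + q) ≡ q + (p + p)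
          eq = solve-∀
        insert x₀ a (w ∷ r) = ≤-trans (+-monoʳ-≤ (d a v) (+-monoˡ-≤ (loop′ x₀ w r) (≤-trans (d-tri v a w) (≤-reflexive (cong (_+ d a w) (d-sym v a))))))
            (≤-reflexive (eq (d a v) (d a w) (loop′ x₀ w r)))
          where
          eq : ∀ p q r → p + (p + q + r) ≡ q + r + (p + p)
          eq = solve-∀
      ... | no a≢x₀ with a∈
      ...   | here eq = contradiction eq a≢x₀
      ...   | there a∈xs with breakAt-found (a ≟_) a∈xs
      ...     | l , .a , r , eq , refl , refl , _ rewrite eq = l ++ a ∷ v ∷ r , refl , go x₀ l ,
                  (λ { (inj₁ refl) → there (∈-++⁺ʳ l (there (here refl))) ; (inj₂ (here refl)) → here refl
                     ; (inj₂ (there x∈)) → there (case ∈-++⁻ l x∈ of λ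
                       { (inj₁ x∈l) → ∈-++⁺ˡ x∈l ; (inj₂ (here refl)) → ∈-++⁺ʳ l (here refl) ; (inj₂ (there x∈r)) → ∈-++⁺ʳ l (there (there x∈r)) }) }) ,
                  λ x∈ → case ∈-++⁻ l x∈ of λ
                    { (inj₁ x∈l) → inj₂ (∈-++⁺ˡ x∈l) ; (inj₂ (here refl)) → inj₂ (∈-++⁺ʳ l (here refl))
                    ; (inj₂ (there (here eq))) → inj₁ eq ; (inj₂ (there (there x∈r))) → inj₂ (∈-++⁺ʳ l (there x∈r)) }
        where
        insert : ∀ a r → d a v + loop′ x₀ v r ≤ loop′ x₀ a r + (d a v + d a v)
        insert a []      = ≤-trans (+-monoʳ-≤ (d a v) (≤-trans (d-tri v a x₀) (≤-reflexive (cong (_+ d a x₀) (d-sym v a))))) (≤-reflexive (eq′ (d a v) (d a x₀)))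
          where
          eq′ : ∀ p q → p + (p + q) ≡ q + (p + p)
          eq′ = solve-∀
        insert a (w ∷ r) = ≤-trans (+-monoʳ-≤ (d a v) (+-monoˡ-≤ (loop′ x₀ w r) (≤-trans (d-tri v a w) (≤-reflexive (cong (_+ d a w) (d-sym v a))))))
            (≤-reflexive (eq′ (d a v) (d a w) (loop′ x₀ w r)))
          where
          eq′ : ∀ p q r → p + (p + q + r) ≡ q + r + (p + p)
          eq′ = solve-∀
        go : ∀ x l → loop′ x₀ x (l ++ a ∷ v ∷ r) ≤ loop′ x₀ x (l ++ a ∷ r) + (d a v + d a v)
        go x []      = ≤-trans (+-monoʳ-≤ (d x a) (insert a r)) (≤-reflexive (sym (+-assoc (d x a) _ _)))
        go x (y ∷ l) = ≤-trans (+-monoʳ-≤ (d x y) (go y l)) (≤-reflexive (sym (+-assoc (d x y) _ _)))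

      -- Inserting each vertex right after its parent builds a preorder.
      tour-spec : ∀ es → Valid (0 ∷ []) es → FromRoot (tour es) × closed (tour es) ≤ treeCost es + treeCost es ×
        (∀ {x} → Contains x es → x ∈ tour es) × (∀ {x} → x ∈ tour es → x ≡ 0 ⊎ Contains x es)
      tour-spec es V = let (ys , eq , le , f , g) = go es V [] (λ x∈ → x∈) in
        (ys , eq) , subst (λ t → closed t ≤ treeCost es + treeCost es) (sym eq) (≤-trans le (≤-reflexive (cong (_+ (treeCost es + treeCost es)) (d-refl 0)))) ,
        (λ {x} c → subst (x ∈_) (sym eq) (f (inj₂ c))) ,
        λ {x} x∈ → case subst (x ∈_) eq x∈ of λ { (here eq) → inj₁ eq ; (there x∈′) → case g x∈′ of λ { (inj₂ c) → inj₂ c } }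
        where
        go : ∀ {S} es → Valid S es → ∀ xs → (∀ {x} → x ∈ S → x ∈ 0 ∷ xs) →
             ∃[ ys ] foldl (λ xs e → insertAfter (par e) (vert e) xs) (0 ∷ xs) es ≡ 0 ∷ ys ×
             loop′ 0 0 ys ≤ loop′ 0 0 xs + (treeCost es + treeCost es) ×
             (∀ {x} → x ∈ 0 ∷ xs ⊎ Contains x es → x ∈ 0 ∷ ys) × (∀ {x} → x ∈ ys → x ∈ xs ⊎ Contains x es)
        go [] V xs sub = xs , refl , ≤-reflexive (sym (+-identityʳ _)) , (λ { (inj₁ x∈) → x∈ }) , inj₁
        go ((v , a , q) ∷ es) (add a∈ v∉ V) xs sub with insertAfter-spec a v xs (sub a∈)
        ... | ys , eq , le , f , g rewrite eq with go es V ys (λ { (here eq) → f (inj₁ eq) ; (there x∈) → f (inj₂ (sub x∈)) })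
        ...   | zs , eq′ , le′ , f′ , g′ = zs , eq′ ,
                  ≤-trans le′ (≤-trans (+-monoˡ-≤ _ le) (≤-reflexive (eq″ (loop′ 0 0 xs) (d a v) (treeCost es)))) ,
                  (λ { (inj₁ x∈) → f′ (inj₁ (f (inj₂ x∈))) ; (inj₂ (here refl)) → f′ (inj₁ (f (inj₁ refl))) ; (inj₂ (there c)) → f′ (inj₂ c) }) ,
                  λ x∈ → case g′ x∈ of λ { (inj₂ c) → inj₂ (there c) ; (inj₁ x∈ys) → case g x∈ys of λ { (inj₁ refl) → inj₂ (here refl) ; (inj₂ x∈xs) → inj₁ x∈xs } }
          where
          eq″ : ∀ l x t → l + (x + x) + (t + t) ≡ l + (x + t + (x + t))
          eq″ = solve-∀

      module _ {P : ℕ → Set} (P? : ∀ x → Dec (P x)) where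

        lat-walk : ∀ {plan} → All FromRoot plan → lat P? (walk plan) ≤ planLat P? plan
        lat-walk [] = z≤n
        lat-walk {_ ∷ plan} ((xs , refl) ∷ roots) with walk plan in eq | walk-root roots | lat-walk roots
        ... | _ | W , refl | ih = subst (λ w → lat P? w ≤ planLat P? ((0 ∷ xs) ∷ plan))
                (trans (cong ((0 ∷ xs) ++_) (sym eq)) (sym (Listₚ.++-assoc (0 ∷ xs) (concat plan) (0 ∷ []))))
                (≤-trans (go 0 xs) (+-monoʳ-≤ (loop′ 0 0 xs) (branch (does (any? P? (0 ∷ xs))) ih)))
          where
          branch : ∀ b {x y} → x ≤ y → (if b then 0 else x) ≤ (if b then 0 else y)
          branch true  le = z≤n
          branch false le = le
          go : ∀ x xs → lat P? (x ∷ xs ++ 0 ∷ W) ≤ loop′ 0 x xs + (if does (any? P? (x ∷ xs)) then 0 else lat P? (0 ∷ W))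
          go x [] with does (P? x)
          ... | true  = z≤n
          ... | false = ≤-refl
          go x (y ∷ ys) with does (P? x)
          ... | true  = z≤n
          ... | false = ≤-trans (+-monoʳ-≤ (d x y) (go y ys)) (≤-reflexive (sym (+-assoc (d x y) _ _)))

        private
          lat-dedup′ : ∀ x y ys → lat P? (dedup (y ∷ ys)) ≤ lat P? (y ∷ ys) →
                       lat P? (dedup (x ∷ y ∷ ys)) ≤ lat P? (x ∷ y ∷ ys)
          lat-dedup′ x y ys ih with P? x in eq
          ... | yes _ = ≤-trans (≤-reflexive (start (filter (λ z → ¬? (x ≟ z)) (dedup (y ∷ ys))))) z≤n
            where
            start : ∀ zs → lat P? (x ∷ zs) ≡ 0
            start []       = refl
            start (z ∷ zs) rewrite eq = refl
          ... | no ¬p = ≤-trans (skip x (dedup (y ∷ ys))) (≤-trans (≤-reflexive at-x) (+-monoʳ-≤ (d x y) ih))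
            where
            at-x : lat P? (x ∷ dedup (y ∷ ys)) ≡ d x y + lat P? (dedup (y ∷ ys))
            at-x rewrite eq = refl
            -- Leaving out a vertex that is no target shortens the walk.
            shortcut : ∀ u zs → ¬ P u → lat P? (u ∷ zs) ≤ d u x + lat P? (x ∷ zs)
            shortcut u []       ¬pu = z≤n
            shortcut u (z ∷ zs) ¬pu rewrite eq with P? u
            ... | yes pu = contradiction pu ¬pu
            ... | no _ = ≤-trans (+-monoˡ-≤ _ (d-tri u x z)) (≤-reflexive (+-assoc (d u x) _ _))
            skip : ∀ u zs → lat P? (u ∷ filter (λ z → ¬? (x ≟ z)) zs) ≤ lat P? (u ∷ zs)
            skip u []       = ≤-refl
            skip u (z ∷ zs) with x ≟ z
            ... | no _ with does (P? u)
            ...   | true  = z≤n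
            ...   | false = +-monoʳ-≤ (d u z) (skip z zs)
            skip u (z ∷ zs) | yes refl with P? u in equ
            ... | yes _ = ≤-trans (≤-reflexive (start (filter (λ z → ¬? (x ≟ z)) zs))) z≤n
              where
              start : ∀ zs → lat P? (u ∷ zs) ≡ 0
              start []       = refl
              start (z ∷ zs) rewrite equ = refl
            ... | no ¬pu = ≤-trans (skip u zs) (shortcut u zs ¬pu)

        lat-dedup : ∀ xs → lat P? (dedup xs) ≤ lat P? xs
        lat-dedup []           = z≤n
        lat-dedup (x ∷ [])     = z≤n
        lat-dedup (x ∷ y ∷ ys) = lat-dedup′ x y ys (lat-dedup (y ∷ ys))

  -- A candidate is a closed tour together with the number of clients on it
  -- and a bound on its length.  An option adds a plan starting with such a
  -- tour, and a bound on the total latency that the rest of the plan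
  -- causes for the clients missed by the first tour.

  Cand Opt : Set
  Cand = ℕ × ℕ × List ℕ
  Opt  = (ℕ × ℕ) × ℕ × List (List ℕ)

  size-of price : Cand → ℕ
  size-of c = proj₁ c
  price c   = proj₁ (proj₂ c)

  value : ℕ → ℕ → Opt → ℕ
  value n k ((_ , c) , rest , _) = c * (n ∸ k) + rest

  plan : Opt → List (List ℕ)
  plan o = proj₂ (proj₂ o)

  pick : ℕ → ℕ → ℕ × List (List ℕ) → Opt → ℕ × List (List ℕ)
  pick n k b o = if does (proj₁ b ≤? value n k o) then b else (value n k o , plan o)

  best : ℕ → ℕ → List Opt → ℕ × List (List ℕ)
  best n k os = if does (n ≤? k) then (0 , [])
                else caseList os (0 , []) (λ o os → foldl (pick n k) (value n k o , plan o) os)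

  extend : ℕ → Cand → List Opt → List Opt
  extend n (k , c , τ) os = ((k , c) , proj₁ (best n k os) , τ ∷ proj₂ (best n k os)) ∷ os

  options : ℕ → List Cand → List Opt
  options n cs = foldr (extend n) [] cs

  solve : ℕ → List Cand → List (List ℕ)
  solve n cs = proj₂ (best n 0 (options n cs))

  module _ (n k : ℕ) where

    private
      fold-≤ : ∀ b os → proj₁ (foldl (pick n k) b os) ≤ proj₁ b × (∀ {o} → o ∈ os → proj₁ (foldl (pick n k) b os) ≤ value n k o)
      fold-≤ b []       = ≤-refl , λ ()
      fold-≤ b (o ∷ os) with proj₁ b ≤? value n k o
      ... | yes le = let (p , q) = fold-≤ b os in p , λ { (here refl) → ≤-trans p le ; (there o∈) → q o∈ }
      ... | no nle = let (p , q) = fold-≤ (value n k o , plan o) os in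
                     ≤-trans p (<⇒≤ (≰⇒> nle)) , λ { (here refl) → p ; (there o∈) → q o∈ }

      fold-is : ∀ b os → foldl (pick n k) b os ≡ b ⊎ (∃[ o ] o ∈ os × foldl (pick n k) b os ≡ (value n k o , plan o))
      fold-is b []       = inj₁ refl
      fold-is b (o ∷ os) with proj₁ b ≤? value n k o
      ... | yes _ = [ inj₁ , (λ (o , o∈ , eq) → inj₂ (o , there o∈ , eq)) ]′ (fold-is b os)
      ... | no _  = [ (λ eq → inj₂ (o , here refl , eq)) , (λ (o , o∈ , eq) → inj₂ (o , there o∈ , eq)) ]′ (fold-is (value n k o , plan o) os)

    best-≤ : ∀ {o os} → o ∈ os → proj₁ (best n k os) ≤ value n k o
    best-≤ {o} {o′ ∷ os} o∈ with n ≤? k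
    ... | yes _ = z≤n
    ... | no _ with o∈
    ...   | here refl = proj₁ (fold-≤ (value n k o′ , plan o′) os)
    ...   | there o∈′ = proj₂ (fold-≤ (value n k o′ , plan o′) os) o∈′

    best-full : ∀ os → n ≤ k → best n k os ≡ (0 , [])
    best-full os le with n ≤? k
    ... | yes _ = refl
    ... | no nle = contradiction le nle

    best-is : ∀ {o os} → o ∈ os → ¬ n ≤ k → ∃[ o′ ] o′ ∈ os × best n k os ≡ (value n k o′ , plan o′)
    best-is {os = o′ ∷ os} _ nle with n ≤? k
    ... | yes le = contradiction le nle
    ... | no _ with fold-is (value n k o′ , plan o′) os
    ...   | inj₁ eq = o′ , here refl , eq
    ...   | inj₂ (o″ , o∈ , eq) = o″ , there o∈ , eq

  data EndsFull (n : ℕ) : List Cand → Set where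
    []   : EndsFull n []
    last : ∀ {c} → n ≤ size-of c → EndsFull n (c ∷ [])
    cons : ∀ {c c′ cs} → EndsFull n (c′ ∷ cs) → EndsFull n (c ∷ c′ ∷ cs)

  endsFull-all : ∀ {n cs} → All (λ c → n ≤ size-of c) cs → EndsFull n cs
  endsFull-all []           = []
  endsFull-all (p ∷ [])     = last p
  endsFull-all (p ∷ q ∷ ps) = cons (endsFull-all (q ∷ ps))

  endsFull-++ : ∀ {n} cs {cs′ c} → EndsFull n (c ∷ cs′) → EndsFull n (cs ++ c ∷ cs′)
  endsFull-++ []            E = E
  endsFull-++ (_ ∷ [])      E = cons E
  endsFull-++ (_ ∷ c ∷ cs)  E = cons (endsFull-++ (c ∷ cs) E)

  module Plans (d : ℕ → ℕ → ℕ) (n : ℕ) where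

    open Metric d

    record GoodCand (c : Cand) : Set where
      field
        root   : FromRoot (proj₂ (proj₂ c))
        priced : closed (proj₂ (proj₂ c)) ≤ price c
        covers : n ≤ size-of c → ∀ {u} → u ∈ clients n → u ∈ proj₂ (proj₂ c)
        missed : ∀ {U} → Unique U → All (_∈ clients n) U →
                 length (filter (λ u → ¬? (memb? u (proj₂ (proj₂ c)))) U) ≤ n ∸ size-of c

    service : List (List ℕ) → ℕ → ℕ
    service π u = planLat (u ≟_) π

    record GoodPlan (c rest : ℕ) (π : List (List ℕ)) : Set where
      field
        roots  : All FromRoot π
        serves : ∀ {u} → u ∈ clients n → ∃[ τ ] τ ∈ π × u ∈ τ
        bound  : ∀ {U} → Unique U → All (_∈ clients n) U → Sum (service π) U ≤ c * length U + rest

    GoodOpt : Opt → Set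
    GoodOpt ((_ , c) , rest , π) = GoodPlan c rest π

    private
      split : ∀ τ π U → Sum (service (τ ∷ π)) U ≡
              closed τ * length U + Sum (service π) (filter (λ u → ¬? (memb? u τ)) U)
      split τ π []      = sym (trans (+-identityʳ _) (*-zeroʳ (closed τ)))
      split τ π (u ∷ U) with does (memb? u τ)
      ... | true  = trans (cong (closed τ + 0 +_) (split τ π U)) (eq (closed τ) (length U) _)
        where
        eq : ∀ a l s → a + 0 + (a * l + s) ≡ a * suc l + s
        eq = solve-∀
      ... | false = trans (cong (closed τ + service π u +_) (split τ π U)) (eq (closed τ) (length U) (service π u) _)
        where
        eq : ∀ a l x s → a + x + (a * l + s) ≡ a * suc l + (x + s)
        eq = solve-∀

    extend-good : ∀ {c} os → GoodCand c → (¬ n ≤ size-of c → ∃[ o ] o ∈ os) → All GoodOpt os →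
                  All GoodOpt (extend n c os)
    extend-good {k , c , τ} os G ne goods with n ≤? k in eq
    ... | yes n≤k = record
      { roots = root ∷ [] ; serves = λ u∈ → τ , here refl , covers n≤k u∈
      ; bound = λ {U} un al → ≤-trans (≤-reflexive (split τ [] U)) (+-mono-≤ (*-monoˡ-≤ (length U) priced)
                  (≤-reflexive (Sum-0 (filter (λ u → ¬? (memb? u τ)) U)))) } ∷ goods
      where open GoodCand G
    ... | no n≰k with best-is n k (proj₂ (ne n≰k)) n≰k
    ...   | ((k′ , c′) , rest , π) , o∈ , is rewrite eq | is = record
      { roots = root ∷ GoodPlan.roots O
      ; serves = λ u∈ → let (σ , σ∈ , u∈σ) = GoodPlan.serves O u∈ in σ , there σ∈ , u∈σ
      ; bound = λ {U} un al → ≤-trans (≤-reflexive (split τ π U)) (+-mono-≤ (*-monoˡ-≤ (length U) priced)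
          (≤-trans (GoodPlan.bound O (Uniqueₚ.filter⁺ (λ u → ¬? (memb? u τ)) un)
                                     (Allₚ.filter⁺ (λ u → ¬? (memb? u τ)) al))
            (+-monoˡ-≤ rest (*-monoʳ-≤ c′ (missed un al))))) } ∷ goods
      where
      open GoodCand G
      O = All.lookup goods o∈

    options-good : ∀ {cs} → All GoodCand cs → EndsFull n cs → All GoodOpt (options n cs)
    options-good []       []             = []
    options-good (G ∷ []) (last le)      = extend-good [] G (λ nle → contradiction le nle) []
    options-good (G ∷ Gs) (cons E)       = extend-good _ G (λ _ → _ , here refl) (options-good Gs E)

    solve-good : ∀ {cs} → All GoodCand cs → EndsFull n cs → (0 < n → ∃[ c ] c ∈ cs) →
                 All FromRoot (solve n cs) × (∀ {u} → u ∈ clients n → ∃[ τ ] τ ∈ solve n cs × u ∈ τ) ×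
                 Sum (service (solve n cs)) (clients n) ≤ proj₁ (best n 0 (options n cs))
    solve-good {cs} Gs E ne with n ≤? 0 in eq
    ... | yes n≤0 = [] , (λ u∈ → case subst (_ ∈_) none u∈ of λ ()) ,
                    ≤-reflexive (cong (Sum (service [])) none)
      where
      none : clients n ≡ []
      none = cong clients (n≤0⇒n≡0 n≤0)
    solve-good {cs} Gs E ne | no n≰0 with cs | Gs | E | ne (≰⇒> n≰0)
    ... | c ∷ cs | Gs | E | _ with best-is n 0 {os = options n (c ∷ cs)} (here refl) n≰0
    ...   | ((k′ , c′) , rest , π) , o∈ , is rewrite eq | is =
      let O = All.lookup (options-good Gs E) o∈ in
      GoodPlan.roots O , GoodPlan.serves O ,
      ≤-trans (GoodPlan.bound O (clients-unique n) (All.tabulate (λ u∈ → u∈)))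
        (≤-reflexive (cong (λ x → c′ * x + rest) (length-clients n)))

  module _ (n : ℕ) where

    restOf : Cand → List Cand → ℕ
    restOf c B = proj₁ (best n (size-of c) (options n B))

    rests : List Cand → List Cand → ℕ
    rests []      B = 0
    rests (c ∷ G) B = restOf c (G ++ B) + rests G B

    private
      keeps : ∀ X {Y o} → o ∈ options n Y → o ∈ options n (X ++ Y)
      keeps []      o∈ = o∈
      keeps (x ∷ X) o∈ = there (keeps X o∈)

    best-average : ∀ k G B {os} → (∀ {o} → o ∈ options n (G ++ B) → o ∈ os) →
                   length G * proj₁ (best n k os) ≤ Sum price G * (n ∸ k) + rests G B
    best-average k []      B sub = z≤n
    best-average k (c ∷ G) B {os} sub = ≤-trans
      (+-mono-≤ (best-≤ n k (sub (here refl))) (best-average k G B (sub ∘ there)))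
      (≤-reflexive (eq (price c) (n ∸ k) (restOf c (G ++ B)) (Sum price G) (rests G B)))
      where
      eq : ∀ p g r s t → p * g + r + (s * g + t) ≡ (p + s) * g + (r + t)
      eq = solve-∀

    rests-average : ∀ G mid G′ B → length G′ * rests G (mid ++ G′ ++ B) ≤
                    Sum price G′ * Sum (λ c → n ∸ size-of c) G + length G * rests G′ B
    rests-average []      mid G′ B = ≤-trans (≤-reflexive (*-zeroʳ (length G′))) z≤n
    rests-average (c ∷ G) mid G′ B = ≤-trans (≤-reflexive (*-distribˡ-+ (length G′) _ _))
      (≤-trans (+-mono-≤ (best-average (size-of c) G′ B {options n (G ++ mid ++ G′ ++ B)} (keeps G ∘ keeps mid)) (rests-average G mid G′ B))
        (≤-reflexive (eq (Sum price G′) (n ∸ size-of c) (rests G′ B) _ (length G))))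
      where
      eq : ∀ s g r t l → s * g + r + (s * t + l * r) ≡ s * (g + t) + (r + l * r)
      eq = solve-∀

    rests-full : ∀ G B → All (λ c → n ≤ size-of c) G → rests G B ≡ 0
    rests-full []      B []       = refl
    rests-full (c ∷ G) B (p ∷ ps) = cong₂ _+_ (cong proj₁ (best-full n (size-of c) (options n (G ++ B)) p)) (rests-full G B ps)

  later : {X : Set} → (ℕ → List X) → ℕ → ℕ → List X
  later G zero    t = []
  later G (suc f) t = G t ++ later G f (suc t)

  later-drop : {X : Set} (G : ℕ → List X) (j f t : ℕ) → ∃[ mid ] later G (j + f) t ≡ mid ++ later G f (j + t)
  later-drop G zero    f t = [] , refl
  later-drop G (suc j) f t = let (mid , eq) = later-drop G j f (suc t) in
    G t ++ mid , trans (cong (G t ++_) (trans eq (cong (λ x → mid ++ later G f x) (+-suc j t)))) (sym (Listₚ.++-assoc (G t) mid _))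

  ℚ-ring : AlmostCommutativeRing 0ℓ 0ℓ
  ℚ-ring = fromCommutativeRing Qₚ.+-*-commutativeRing (λ x → isZeroℚ (0ℚ Qₚ.≟ x))
    where
    isZeroℚ : ∀ {x} → Dec (0ℚ ≡ x) → Maybe (0ℚ ≡ x)
    isZeroℚ (yes p) = just p
    isZeroℚ (no _)  = nothing

  coprime-1 : ∀ n → Coprime.Coprime n 1
  coprime-1 n = Coprime.sym (Coprime.1-coprimeTo n)

  /1-mkℚ : ∀ n → ℤ.+ n Q./ 1 ≡ Q.mkℚ (ℤ.+ n) 0 (coprime-1 n)
  /1-mkℚ n = Qₚ.normalize-coprime (coprime-1 n)

  abstract

    ι : ℕ → ℚ
    ι n = Q.mkℚ (ℤ.+ n) 0 (coprime-1 n)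

    ι-/1 : ∀ n → ι n ≡ ℤ.+ n Q./ 1
    ι-/1 n = sym (/1-mkℚ n)

    ↥ι : ∀ n → ↥ (ι n) ≡ ℤ.+ n
    ↥ι n = refl

    ↧ι : ∀ n → ↧ (ι n) ≡ ℤ.+ 1
    ↧ι n = refl

    ι-+ : ∀ m n → ι (m + n) ≡ ι m Q.+ ι n
    ι-+ m n = sym (trans (cong (Q._/ 1) (cong₂ ℤ._+_ (ℤₚ.*-identityʳ (ℤ.+ m)) (ℤₚ.*-identityʳ (ℤ.+ n)))) (/1-mkℚ (m + n)))

    ι-* : ∀ m n → ι (m * n) ≡ ι m Q.* ι n
    ι-* m n = sym (trans (cong (Q._/ 1) (sym (ℤₚ.pos-* m n))) (/1-mkℚ (m * n)))

    ι-mono : ∀ {m n} → m ≤ n → ι m Q.≤ ι n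
    ι-mono le = Q.*≤* (ℤₚ.*-monoʳ-≤-nonNeg (ℤ.+ 1) (ℤ.+≤+ le))

    ι-cancel : ∀ {m n} → ι m Q.≤ ι n → m ≤ n
    ι-cancel {m} {n} le = ℤₚ.drop‿+≤+ (ℤₚ.*-cancelʳ-≤-pos (ℤ.+ m) (ℤ.+ n) (ℤ.+ 1) (Qₚ.drop-*≤* le))

  ι0 : ι 0 ≡ 0ℚ
  ι0 = ι-/1 0

  ι1 : ι 1 ≡ 1ℚ
  ι1 = ι-/1 1

  ι≥0 : ∀ n → 0ℚ Q.≤ ι n
  ι≥0 n = subst (Q._≤ ι n) ι0 (ι-mono {0} {n} z≤n)

  /1≥0 : ∀ n → 0ℚ Q.≤ ℤ.+ n Q./ 1
  /1≥0 n = subst (0ℚ Q.≤_) (ι-/1 n) (ι≥0 n)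

  ι-positive : ∀ {n} → 0 < n → Q.Positive (ι n)
  ι-positive {n} 0<n = Q.positive (Qₚ.<-≤-trans (Q.*<* (ℤ.+<+ (s≤s z≤n))) (subst (Q._≤ ι n) ι1 (ι-mono {1} {n} 0<n)))

  *-monoʳ-Q : ∀ {r x y} → 0ℚ Q.≤ r → x Q.≤ y → r Q.* x Q.≤ r Q.* y
  *-monoʳ-Q {r} 0≤r = Qₚ.*-monoˡ-≤-nonNeg r ⦃ Q.nonNegative 0≤r ⦄

  *-monoˡ-Q : ∀ {r x y} → 0ℚ Q.≤ r → x Q.≤ y → x Q.* r Q.≤ y Q.* r
  *-monoˡ-Q {r} 0≤r = Qₚ.*-monoʳ-≤-nonNeg r ⦃ Q.nonNegative 0≤r ⦄

  *≥0 : ∀ {x y} → 0ℚ Q.≤ x → 0ℚ Q.≤ y → 0ℚ Q.≤ x Q.* y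
  *≥0 {x} 0≤x 0≤y = Qₚ.≤-trans (Qₚ.≤-reflexive (sym (Qₚ.*-zeroʳ x))) (*-monoʳ-Q 0≤x 0≤y)

  +≥0 : ∀ {x y} → 0ℚ Q.≤ x → 0ℚ Q.≤ y → 0ℚ Q.≤ x Q.+ y
  +≥0 0≤x 0≤y = Qₚ.+-mono-≤ 0≤x 0≤y

  ≤-plus : ∀ x {r} → 0ℚ Q.≤ r → x Q.≤ x Q.+ r
  ≤-plus x 0≤r = Qₚ.≤-trans (Qₚ.≤-reflexive (sym (Qₚ.+-identityʳ x))) (Qₚ.+-monoʳ-≤ x 0≤r)

  -- The cost of jumping from time s to time t is t · g s, and w s bounds
  -- the cost from s on.  The two routes 0 → 1 → 2 → 4 → 8 → … and
  -- 0 → 1 → 3 → 6 → 12 → … together cost at most 7 ∑ g.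

  module Routes (g w S : ℕ → ℚ) (T : ℕ)
    (g≥0 : ∀ t → 0ℚ Q.≤ g t) (antitone : ∀ {s t} → s ≤ t → g t Q.≤ g s)
    (jump : ∀ {s t} → s < t → w s Q.≤ ι t Q.* g s Q.+ w t) (arrived : ∀ {t} → T ≤ t → w t Q.≤ 0ℚ)
    (S-step : ∀ t → S t ≡ g t Q.+ S (suc t)) (S≥0 : ∀ t → 0ℚ Q.≤ S t) where

    private
      block : ∀ m b → ι m Q.* g (b + m) Q.+ S (b + m) Q.≤ S b
      block zero    b = Qₚ.≤-reflexive (trans (cong (λ z → z Q.* g (b + 0) Q.+ S (b + 0)) ι0) (trans (eq (g (b + 0)) (S (b + 0))) (cong S (+-identityʳ b))))
        where
        eq : ∀ x y → 0ℚ Q.* x Q.+ y ≡ y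
        eq = ring-solve ℚ-ring
      block (suc m) b rewrite +-suc b m | S-step b = Qₚ.≤-trans
        (Qₚ.≤-reflexive (trans (cong (λ z → z Q.* g (suc (b + m)) Q.+ S (suc (b + m))) (trans (ι-+ 1 m) (cong (Q._+ ι m) ι1))) (eq (ι m) (g (suc (b + m))) _)))
        (Qₚ.+-mono-≤ (antitone (m≤n⇒m≤1+n (m≤m+n b m))) (block m (suc b)))
        where
        eq : ∀ i x y → (1ℚ Q.+ i) Q.* x Q.+ y ≡ x Q.+ (i Q.* x Q.+ y)
        eq = ring-solve ℚ-ring

      7ℚ 4ℚ : ℚ
      7ℚ = ℤ.+ 7 Q./ 1
      4ℚ = ℤ.+ 4 Q./ 1

      double : ∀ a → ι (a + a) ≡ (ℤ.+ 2 Q./ 1) Q.* ι a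
      double a = trans (ι-+ a a) (eq (ι a))
        where
        eq : ∀ x → x Q.+ x ≡ (ℤ.+ 2 Q./ 1) Q.* x
        eq = ring-solve ℚ-ring

      both : ∀ f a → 1 ≤ a → T ≤ f + (a + a) →
             w (a + a) Q.+ w (a + a + a) Q.≤ 7ℚ Q.* S (a + a) Q.+ 4ℚ Q.* (ι a Q.* g (a + a))
      both zero    a 1≤a T≤ = Qₚ.≤-trans (Qₚ.+-mono-≤ (arrived T≤) (arrived (≤-trans T≤ (m≤m+n _ _))))
        (+≥0 (*≥0 (/1≥0 7) (S≥0 (a + a))) (*≥0 (/1≥0 4) (*≥0 (ι≥0 a) (g≥0 (a + a)))))
      both (suc f) a 1≤a T≤ = begin
        w a₂ Q.+ w a₃
          ≤⟨ Qₚ.+-mono-≤ (jump {a₂} {a₄} (m<m+n a₂ (≤-trans 1≤a (m≤m+n a a)))) (jump {a₃} {a₆} a₃<a₆) ⟩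
        (ι a₄ Q.* g a₂ Q.+ w a₄) Q.+ (ι a₆ Q.* g a₃ Q.+ w a₆)
          ≡⟨ cong₂ (λ x y → (x Q.* g a₂ Q.+ w a₄) Q.+ (y Q.* g a₃ Q.+ w a₆)) ι₄ ι₆ ⟩
        (4ℚ Q.* i Q.* g a₂ Q.+ w a₄) Q.+ ((ℤ.+ 6 Q./ 1) Q.* i Q.* g a₃ Q.+ w a₆)
          ≡⟨ eq₁ i (g a₂) (g a₃) (w a₄) (w a₆) ⟩
        4ℚ Q.* (i Q.* g a₂) Q.+ (ℤ.+ 6 Q./ 1) Q.* (i Q.* g a₃) Q.+ (w a₄ Q.+ w a₆)
          ≤⟨ Qₚ.+-monoʳ-≤ (4ℚ Q.* (i Q.* g a₂) Q.+ (ℤ.+ 6 Q./ 1) Q.* (i Q.* g a₃)) (both f a₂ (≤-trans 1≤a (m≤m+n a a)) T≤′) ⟩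
        4ℚ Q.* (i Q.* g a₂) Q.+ (ℤ.+ 6 Q./ 1) Q.* (i Q.* g a₃) Q.+ (7ℚ Q.* S a₄ Q.+ 4ℚ Q.* (ι a₂ Q.* g a₄))
          ≡⟨ cong (λ x → 4ℚ Q.* (i Q.* g a₂) Q.+ (ℤ.+ 6 Q./ 1) Q.* (i Q.* g a₃) Q.+ (7ℚ Q.* S a₄ Q.+ 4ℚ Q.* (x Q.* g a₄))) (double a) ⟩
        4ℚ Q.* (i Q.* g a₂) Q.+ (ℤ.+ 6 Q./ 1) Q.* (i Q.* g a₃) Q.+ (7ℚ Q.* S a₄ Q.+ 4ℚ Q.* ((ℤ.+ 2 Q./ 1) Q.* i Q.* g a₄))
          ≡⟨ eq₂ i (g a₂) (g a₃) (g a₄) (S a₄) ⟩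
        4ℚ Q.* (i Q.* g a₂) Q.+ (ℤ.+ 6 Q./ 1) Q.* (i Q.* g a₃) Q.+ 7ℚ Q.* (i Q.* g a₄ Q.+ S a₄) Q.+ i Q.* g a₄
          ≤⟨ Qₚ.+-mono-≤ (Qₚ.+-monoʳ-≤ (4ℚ Q.* (i Q.* g a₂) Q.+ (ℤ.+ 6 Q./ 1) Q.* (i Q.* g a₃)) (*-monoʳ-Q (/1≥0 7) second))
                         (*-monoʳ-Q (ι≥0 a) (antitone a₃≤a₄)) ⟩
        4ℚ Q.* (i Q.* g a₂) Q.+ (ℤ.+ 6 Q./ 1) Q.* (i Q.* g a₃) Q.+ 7ℚ Q.* S a₃ Q.+ i Q.* g a₃
          ≡⟨ eq₃ i (g a₂) (g a₃) (S a₃) ⟩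
        7ℚ Q.* (i Q.* g a₃ Q.+ S a₃) Q.+ 4ℚ Q.* (i Q.* g a₂)
          ≤⟨ Qₚ.+-monoˡ-≤ (4ℚ Q.* (i Q.* g a₂)) (*-monoʳ-Q (/1≥0 7) (block a a₂)) ⟩
        7ℚ Q.* S a₂ Q.+ 4ℚ Q.* (i Q.* g a₂) ∎
        where
        open Qₚ.≤-Reasoning
        i  = ι a
        a₂ = a + a
        a₃ = a + a + a
        a₄ = a₂ + a₂
        a₆ = a₂ + a₂ + a₂
        a₃≡ : a₃ + a ≡ a₄
        a₃≡ = +-assoc a₂ a a
        a₃≤a₄ : a₃ ≤ a₄
        a₃≤a₄ = ≤-trans (m≤m+n a₃ a) (≤-reflexive a₃≡)
        a₃<a₆ : a₃ < a₆
        a₃<a₆ = ≤-trans (+-mono-≤ 1≤a (≤-refl {a₃})) (≤-trans (≤-reflexive (trans (+-comm a a₃) a₃≡)) (m≤m+n a₄ a₂))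
        T≤′ : T ≤ f + (a₂ + a₂)
        T≤′ = ≤-trans T≤ (≤-trans (≤-reflexive (sym (+-suc f a₂))) (+-monoʳ-≤ f (+-monoˡ-≤ a₂ (≤-trans 1≤a (m≤m+n a a)))))
        second : i Q.* g a₄ Q.+ S a₄ Q.≤ S a₃
        second = subst (λ x → i Q.* g x Q.+ S x Q.≤ S a₃) a₃≡ (block a a₃)
        ι₄ : ι a₄ ≡ 4ℚ Q.* i
        ι₄ = trans (double a₂) (trans (cong ((ℤ.+ 2 Q./ 1) Q.*_) (double a)) (eq i))
          where
          eq : ∀ x → (ℤ.+ 2 Q./ 1) Q.* ((ℤ.+ 2 Q./ 1) Q.* x) ≡ (ℤ.+ 4 Q./ 1) Q.* x
          eq = ring-solve ℚ-ring
        ι₆ : ι a₆ ≡ (ℤ.+ 6 Q./ 1) Q.* i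
        ι₆ = trans (ι-+ a₄ a₂) (trans (cong₂ Q._+_ ι₄ (double a)) (eq i))
          where
          eq : ∀ x → (ℤ.+ 4 Q./ 1) Q.* x Q.+ (ℤ.+ 2 Q./ 1) Q.* x ≡ (ℤ.+ 6 Q./ 1) Q.* x
          eq = ring-solve ℚ-ring
        eq₁ : ∀ i p q x y → ((ℤ.+ 4 Q./ 1) Q.* i Q.* p Q.+ x) Q.+ ((ℤ.+ 6 Q./ 1) Q.* i Q.* q Q.+ y) ≡
              (ℤ.+ 4 Q./ 1) Q.* (i Q.* p) Q.+ (ℤ.+ 6 Q./ 1) Q.* (i Q.* q) Q.+ (x Q.+ y)
        eq₁ = ring-solve ℚ-ring
        eq₂ : ∀ i p q r s → (ℤ.+ 4 Q./ 1) Q.* (i Q.* p) Q.+ (ℤ.+ 6 Q./ 1) Q.* (i Q.* q) Q.+ ((ℤ.+ 7 Q./ 1) Q.* s Q.+ (ℤ.+ 4 Q./ 1) Q.* ((ℤ.+ 2 Q./ 1) Q.* i Q.* r)) ≡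
              (ℤ.+ 4 Q./ 1) Q.* (i Q.* p) Q.+ (ℤ.+ 6 Q./ 1) Q.* (i Q.* q) Q.+ (ℤ.+ 7 Q./ 1) Q.* (i Q.* r Q.+ s) Q.+ i Q.* r
        eq₂ = ring-solve ℚ-ring
        eq₃ : ∀ i p q s → (ℤ.+ 4 Q./ 1) Q.* (i Q.* p) Q.+ (ℤ.+ 6 Q./ 1) Q.* (i Q.* q) Q.+ (ℤ.+ 7 Q./ 1) Q.* s Q.+ i Q.* q ≡
              (ℤ.+ 7 Q./ 1) Q.* (i Q.* q Q.+ s) Q.+ (ℤ.+ 4 Q./ 1) Q.* (i Q.* p)
        eq₃ = ring-solve ℚ-ring

    private
      leap : ∀ {s} t → s < t → w s Q.≤ (ℤ.+ t Q./ 1) Q.* g s Q.+ w t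
      leap {s} t lt = subst (λ x → w s Q.≤ x Q.* g s Q.+ w t) (ι-/1 t) (jump lt)

    two-routes : (ℤ.+ 2 Q./ 1) Q.* w 0 Q.≤ 7ℚ Q.* S 0
    two-routes = begin
      2ℚ Q.* w 0
        ≤⟨ *-monoʳ-Q (/1≥0 2) (leap {0} 1 (s≤s z≤n)) ⟩
      2ℚ Q.* ((ℤ.+ 1 Q./ 1) Q.* g 0 Q.+ w 1)
        ≡⟨ eq₁ (g 0) (w 1) ⟩
      2ℚ Q.* g 0 Q.+ (w 1 Q.+ w 1)
        ≤⟨ Qₚ.+-monoʳ-≤ (2ℚ Q.* g 0) (Qₚ.+-mono-≤ (leap {1} 2 ≤-refl) (leap {1} 3 (s≤s (s≤s z≤n)))) ⟩
      2ℚ Q.* g 0 Q.+ (((ℤ.+ 2 Q./ 1) Q.* g 1 Q.+ w 2) Q.+ ((ℤ.+ 3 Q./ 1) Q.* g 1 Q.+ w 3))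
        ≡⟨ eq₂ (g 0) (g 1) (w 2) (w 3) ⟩
      2ℚ Q.* g 0 Q.+ (ℤ.+ 5 Q./ 1) Q.* g 1 Q.+ (w 2 Q.+ w 3)
        ≤⟨ Qₚ.+-monoʳ-≤ (2ℚ Q.* g 0 Q.+ (ℤ.+ 5 Q./ 1) Q.* g 1) (subst (λ x → w 2 Q.+ w 3 Q.≤ 7ℚ Q.* S 2 Q.+ 4ℚ Q.* (x Q.* g 2)) ι1 (both T 1 ≤-refl (m≤m+n T 2))) ⟩
      2ℚ Q.* g 0 Q.+ (ℤ.+ 5 Q./ 1) Q.* g 1 Q.+ (7ℚ Q.* S 2 Q.+ 4ℚ Q.* (1ℚ Q.* g 2))
        ≤⟨ Qₚ.+-monoʳ-≤ (2ℚ Q.* g 0 Q.+ (ℤ.+ 5 Q./ 1) Q.* g 1) (Qₚ.+-monoʳ-≤ (7ℚ Q.* S 2)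
             (*-monoʳ-Q (/1≥0 4) (*-monoʳ-Q (/1≥0 1) (antitone z≤n)))) ⟩
      2ℚ Q.* g 0 Q.+ (ℤ.+ 5 Q./ 1) Q.* g 1 Q.+ (7ℚ Q.* S 2 Q.+ 4ℚ Q.* (1ℚ Q.* g 0))
        ≤⟨ ≤-plus (2ℚ Q.* g 0 Q.+ (ℤ.+ 5 Q./ 1) Q.* g 1 Q.+ (7ℚ Q.* S 2 Q.+ 4ℚ Q.* (1ℚ Q.* g 0))) (+≥0 (g≥0 0) (*≥0 (/1≥0 2) (g≥0 1))) ⟩
      (2ℚ Q.* g 0 Q.+ (ℤ.+ 5 Q./ 1) Q.* g 1 Q.+ (7ℚ Q.* S 2 Q.+ 4ℚ Q.* (1ℚ Q.* g 0))) Q.+ (g 0 Q.+ 2ℚ Q.* g 1)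
        ≡⟨ eq₃ (g 0) (g 1) (S 2) ⟩
      7ℚ Q.* (g 0 Q.+ (g 1 Q.+ S 2))
        ≡⟨ cong (7ℚ Q.*_) (trans (cong (g 0 Q.+_) (sym (S-step 1))) (sym (S-step 0))) ⟩
      7ℚ Q.* S 0 ∎
      where
      open Qₚ.≤-Reasoning
      2ℚ = ℤ.+ 2 Q./ 1
      eq₁ : ∀ p x → (ℤ.+ 2 Q./ 1) Q.* ((ℤ.+ 1 Q./ 1) Q.* p Q.+ x) ≡ (ℤ.+ 2 Q./ 1) Q.* p Q.+ (x Q.+ x)
      eq₁ = ring-solve ℚ-ring
      eq₂ : ∀ p q x y → (ℤ.+ 2 Q./ 1) Q.* p Q.+ (((ℤ.+ 2 Q./ 1) Q.* q Q.+ x) Q.+ ((ℤ.+ 3 Q./ 1) Q.* q Q.+ y)) ≡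
            (ℤ.+ 2 Q./ 1) Q.* p Q.+ (ℤ.+ 5 Q./ 1) Q.* q Q.+ (x Q.+ y)
      eq₂ = ring-solve ℚ-ring
      eq₃ : ∀ p q s → ((ℤ.+ 2 Q./ 1) Q.* p Q.+ (ℤ.+ 5 Q./ 1) Q.* q Q.+ ((ℤ.+ 7 Q./ 1) Q.* s Q.+ (ℤ.+ 4 Q./ 1) Q.* (1ℚ Q.* p))) Q.+ (p Q.+ (ℤ.+ 2 Q./ 1) Q.* q) ≡
            (ℤ.+ 7 Q./ 1) Q.* (p Q.+ (q Q.+ s))
      eq₃ = ring-solve ℚ-ring

  at : {X : Set} → List (List X) → ℕ → List X
  at []       i       = []
  at (g ∷ gs) zero    = g
  at (g ∷ gs) (suc i) = at gs i

  later-shift : {X : Set} (G : ℕ → List X) (f t : ℕ) → later (G ∘ suc) f t ≡ later G f (suc t)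
  later-shift G zero    t = refl
  later-shift G (suc f) t = cong (G (suc t) ++_) (later-shift G f (suc t))

  concat-later : {X : Set} (gs : List (List X)) → concat gs ≡ later (at gs) (length gs) 0
  concat-later []       = refl
  concat-later (g ∷ gs) = cong (g ++_) (trans (concat-later gs) (later-shift (at (g ∷ gs)) (length gs) 0))

  at-beyond : {X : Set} (gs : List (List X)) {i : ℕ} → length gs ≤ i → at gs i ≡ []
  at-beyond []       le       = refl
  at-beyond (g ∷ gs) (s≤s le) = at-beyond gs le

  at-∈ : {X : Set} (gs : List (List X)) {i : ℕ} → i < length gs → at gs i ∈ gs
  at-∈ (g ∷ gs) {zero}  lt       = here refl
  at-∈ (g ∷ gs) {suc i} (s≤s lt) = there (at-∈ gs lt)

  Sum-zero : {X : Set} (f : X → ℕ) (xs : List X) → Sum f xs ≤ 0 → ∀ {x} → x ∈ xs → f x ≡ 0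
  Sum-zero f xs le x∈ = n≤0⇒n≡0 (≤-trans (Sum-∈ f x∈) le)

  positive⇒suc : ∀ {s t} → s < t → ∃[ k ] t ≡ suc k
  positive⇒suc {t = suc k} _ = k , refl

  module Schedule (n N : ℕ) (N>0 : 0 < N) (gs : List (List Cand)) (C : ℚ) (D R : ℕ → ℚ)
    (lengths : ∀ {i} → i < length gs → length (at gs i) ≡ N)
    (prices  : ∀ {i} → i < length gs → ι (Sum price (at gs i)) Q.≤ C Q.* ι (suc i) Q.* ι N)
    (gaps    : ∀ {i} → i < length gs → ι (Sum (λ c → n ∸ size-of c) (at gs i)) Q.≤ ι N Q.* D (suc i))
    (C≥0 : 0ℚ Q.≤ C) (D≥0 : ∀ t → 0ℚ Q.≤ D t) (D-antitone : ∀ {s t} → s ≤ t → D t Q.≤ D s)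
    (D-start : D 0 ≡ ι n) (D-end : ∀ {t} → length gs ≤ t → D t ≡ 0ℚ)
    (R-step : ∀ t → R t ≡ D t Q.+ R (suc t)) (R≥0 : ∀ t → 0ℚ Q.≤ R t) where

    private
      T = length gs
      G = at gs

      rest-after : ℕ → List Cand
      rest-after i = later G (T ∸ suc i) (suc i)

      V : ℕ
      V = proj₁ (best n 0 (options n (concat gs)))

      w : ℕ → ℚ
      w zero    = ι (N * V)
      w (suc i) = ι (rests n (G i) (rest-after i))

      g S : ℕ → ℚ
      g t = C Q.* ι N Q.* D t
      S t = C Q.* ι N Q.* R t

      CN≥0 : 0ℚ Q.≤ C Q.* ι N
      CN≥0 = *≥0 C≥0 (ι≥0 N)

      suffix : ∀ {i j} → i ≤ j → j < T → ∃[ mid ] later G (T ∸ i) i ≡ mid ++ G j ++ rest-after j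
      suffix {i} {j} i≤j j<T =
        let (mid , eq) = later-drop G (j ∸ i) (suc (T ∸ suc j)) i in
        mid , trans (cong (λ f → later G f i) (sym count≡)) (trans eq (cong (λ x → mid ++ later G (suc (T ∸ suc j)) x) (m∸n+n≡m i≤j)))
        where
        count≡ : (j ∸ i) + suc (T ∸ suc j) ≡ T ∸ i
        count≡ = trans (cong ((j ∸ i) +_) (sym (+-∸-assoc 1 j<T))) (trans (+-comm (j ∸ i) (T ∸ j))
          (trans (sym (+-∸-assoc (T ∸ j) i≤j)) (cong (_∸ i) (m∸n+n≡m (<⇒≤ j<T)))))

      all-suffix : ∀ {j} → j < T → ∃[ mid ] concat gs ≡ mid ++ G j ++ rest-after j
      all-suffix j<T = let (mid , eq) = suffix z≤n j<T in mid , trans (concat-later gs) eq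

      full : ∀ {i} → i < T → T ≤ suc i → All (λ c → n ≤ size-of c) (G i)
      full {i} i<T T≤ = All.tabulate λ c∈ → m∸n≡0⇒m≤n (Sum-zero (λ c → n ∸ size-of c) (G i) none c∈)
        where
        none : Sum (λ c → n ∸ size-of c) (G i) ≤ 0
        none = ι-cancel {n = 0} (Qₚ.≤-trans (gaps i<T) (Qₚ.≤-reflexive (trans (trans (cong (ι N Q.*_) (D-end T≤)) (Qₚ.*-zeroʳ (ι N))) (sym ι0))))

      arrived : ∀ {t} → T ≤ t → w t Q.≤ 0ℚ
      arrived {zero} T≤0 = Qₚ.≤-reflexive (trans (cong (λ v → ι (N * v)) V≡0) (trans (cong ι (*-zeroʳ N)) ι0))
        where
        empty : ∀ (gs : List (List Cand)) → length gs ≤ 0 → gs ≡ []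
        empty [] _ = refl
        V≡0 : V ≡ 0
        V≡0 rewrite empty gs T≤0 with does (n ≤? 0)
        ... | true  = refl
        ... | false = refl
      arrived {suc i} T≤ with suc i ≤? T
      ... | yes i<T = Qₚ.≤-reflexive (trans (cong ι (rests-full n (G i) (rest-after i) (full i<T T≤))) ι0)
      ... | no i≮T = Qₚ.≤-reflexive (trans (cong (λ x → ι (rests n x (rest-after i))) (at-beyond gs (≮⇒≥ i≮T))) ι0)

      w≥0 : ∀ t → 0ℚ Q.≤ w t
      w≥0 zero    = ι≥0 (N * V)
      w≥0 (suc i) = ι≥0 (rests n (G i) (rest-after i))

      g≥0 : ∀ t → 0ℚ Q.≤ g t
      g≥0 t = *≥0 CN≥0 (D≥0 t)

      divide : ∀ {x y} → ι N Q.* x Q.≤ ι N Q.* y → x Q.≤ y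
      divide = Qₚ.*-cancelˡ-≤-pos (ι N) ⦃ ι-positive N>0 ⦄

      jump-within : ∀ {s j} → s < suc j → j < T → w s Q.≤ ι (suc j) Q.* g s Q.+ w (suc j)
      jump-within {zero} {j} _ j<T = begin
        ι (N * V)                                    ≤⟨ ι-mono N*V≤ ⟩
        ι (Sum price (G j) * n + rests n (G j) (rest-after j)) ≡⟨ trans (ι-+ (Sum price (G j) * n) _) (cong (Q._+ w (suc j)) (ι-* (Sum price (G j)) n)) ⟩
        ι (Sum price (G j)) Q.* ι n Q.+ w (suc j)    ≤⟨ Qₚ.+-monoˡ-≤ (w (suc j)) (*-monoˡ-Q (ι≥0 n) (prices j<T)) ⟩
        C Q.* ι (suc j) Q.* ι N Q.* ι n Q.+ w (suc j) ≡⟨ cong (Q._+ w (suc j)) (trans (eq C (ι (suc j)) (ι N) (ι n)) (cong (λ x → ι (suc j) Q.* (C Q.* ι N Q.* x)) (sym D-start))) ⟩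
        ι (suc j) Q.* g 0 Q.+ w (suc j)              ∎
        where
        open Qₚ.≤-Reasoning
        eq : ∀ c t m k → c Q.* t Q.* m Q.* k ≡ t Q.* (c Q.* m Q.* k)
        eq = ring-solve ℚ-ring
        N*V≤ : N * V ≤ Sum price (G j) * n + rests n (G j) (rest-after j)
        N*V≤ = let (mid , e) = all-suffix j<T in
          ≤-trans (≤-reflexive (cong₂ _*_ (sym (lengths j<T)) (cong (λ x → proj₁ (best n 0 (options n x))) e)))
            (best-average n 0 (G j) (rest-after j) (prefix mid))
          where
          prefix : ∀ X {Y o} → o ∈ options n Y → o ∈ options n (X ++ Y)
          prefix []      o∈ = o∈
          prefix (x ∷ X) o∈ = there (prefix X o∈)
      jump-within {suc i} {j} (s≤s i<j) j<T = divide (begin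
        ι N Q.* w (suc i)                             ≡⟨ ι-* N _ ⟨
        ι (N * rests n (G i) (rest-after i))          ≤⟨ ι-mono Nw≤ ⟩
        ι (Sum price (G j) * gap + N * rests n (G j) (rest-after j)) ≡⟨ trans (ι-+ (Sum price (G j) * gap) _) (cong₂ Q._+_ (ι-* (Sum price (G j)) gap) (ι-* N _)) ⟩
        ι (Sum price (G j)) Q.* ι gap Q.+ ι N Q.* w (suc j) ≤⟨ Qₚ.+-monoˡ-≤ (ι N Q.* w (suc j)) (Qₚ.≤-trans (*-monoˡ-Q (ι≥0 gap) (prices j<T))
                                                                 (*-monoʳ-Q (*≥0 (*≥0 C≥0 (ι≥0 (suc j))) (ι≥0 N)) (gaps i<T))) ⟩
        C Q.* ι (suc j) Q.* ι N Q.* (ι N Q.* D (suc i)) Q.+ ι N Q.* w (suc j) ≡⟨ eq C (ι (suc j)) (ι N) (D (suc i)) (w (suc j)) ⟩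
        ι N Q.* (ι (suc j) Q.* g (suc i) Q.+ w (suc j)) ∎)
        where
        open Qₚ.≤-Reasoning
        gap = Sum (λ c → n ∸ size-of c) (G i)
        i<T : i < T
        i<T = <-trans i<j j<T
        eq : ∀ c t m δ x → c Q.* t Q.* m Q.* (m Q.* δ) Q.+ m Q.* x ≡ m Q.* (t Q.* (c Q.* m Q.* δ) Q.+ x)
        eq = ring-solve ℚ-ring
        Nw≤ : N * rests n (G i) (rest-after i) ≤ Sum price (G j) * gap + N * rests n (G j) (rest-after j)
        Nw≤ = let (mid , e) = suffix i<j j<T in
          ≤-trans (≤-reflexive (cong₂ _*_ (sym (lengths j<T)) (cong (rests n (G i)) e)))
            (≤-trans (rests-average n (G i) mid (G j) (rest-after j))
              (≤-reflexive (cong (λ x → Sum price (G j) * gap + x * rests n (G j) (rest-after j)) (lengths i<T))))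

      jump : ∀ {s t} → s < t → w s Q.≤ ι t Q.* g s Q.+ w t
      jump {s} {suc j} s<t with suc j ≤? T | suc s ≤? T
      ... | yes j<T | _ = jump-within s<t j<T
      ... | no _ | no s≮T = Qₚ.≤-trans (arrived (≮⇒≥ s≮T)) (+≥0 (*≥0 (ι≥0 (suc j)) (g≥0 s)) (w≥0 (suc j)))
      ... | no j≮T | yes s<T with positive⇒suc s<T
      ...   | k , eqT = Qₚ.≤-trans (jump-within {s} {k} (subst (s <_) eqT s<T) (≤-reflexive (sym eqT)))
                (Qₚ.+-mono-≤ (*-monoˡ-Q (g≥0 s) (ι-mono (≤-trans (≤-reflexive (sym eqT)) (<⇒≤ (≰⇒> j≮T)))))
                  (Qₚ.≤-trans (arrived (≤-reflexive eqT)) (w≥0 (suc j))))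

    schedule-cost : (ℤ.+ 2 Q./ 1) Q.* ι V Q.≤ (ℤ.+ 7 Q./ 1) Q.* (C Q.* R 0)
    schedule-cost = divide (begin
      ι N Q.* ((ℤ.+ 2 Q./ 1) Q.* ι V)         ≡⟨ trans (eq₁ (ι N) (ι V)) (cong ((ℤ.+ 2 Q./ 1) Q.*_) (sym (ι-* N V))) ⟩
      (ℤ.+ 2 Q./ 1) Q.* w 0                   ≤⟨ Routes.two-routes g w S T g≥0 (λ le → *-monoʳ-Q CN≥0 (D-antitone le)) jump arrived
                                                 (λ t → trans (cong (C Q.* ι N Q.*_) (R-step t)) (Qₚ.*-distribˡ-+ (C Q.* ι N) (D t) _)) (λ t → *≥0 CN≥0 (R≥0 t)) ⟩
      (ℤ.+ 7 Q./ 1) Q.* S 0                   ≡⟨ eq₂ C (ι N) (R 0) ⟩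
      ι N Q.* ((ℤ.+ 7 Q./ 1) Q.* (C Q.* R 0)) ∎)
      where
      open Qₚ.≤-Reasoning
      eq₁ : ∀ m v → m Q.* ((ℤ.+ 2 Q./ 1) Q.* v) ≡ (ℤ.+ 2 Q./ 1) Q.* (m Q.* v)
      eq₁ = ring-solve ℚ-ring
      eq₂ : ∀ c m r → (ℤ.+ 7 Q./ 1) Q.* (c Q.* m Q.* r) ≡ m Q.* ((ℤ.+ 7 Q./ 1) Q.* (c Q.* r))
      eq₂ = ring-solve ℚ-ring

    ends-full : EndsFull n (concat gs)
    ends-full = go gs refl
      where
      go : ∀ gs′ → gs ≡ gs′ → EndsFull n (concat gs)
      go []        eq = subst (EndsFull n ∘ concat) (sym eq) []
      go (g ∷ gs′) eq with positive⇒suc {0} {T} (≤-trans (s≤s z≤n) (≤-reflexive (cong length (sym eq))))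
      ... | k , eqT with all-suffix {k} (≤-reflexive (sym eqT))
      ...   | mid , e = subst (EndsFull n) (sym e) (at-end (G k) (lengths {k} (≤-reflexive (sym eqT)))
                (full {k} (≤-reflexive (sym eqT)) (≤-reflexive eqT)))
        where
        after : rest-after k ≡ []
        after = cong (λ f → later G f (suc k)) (trans (cong (_∸ suc k) eqT) (n∸n≡0 (suc k)))
        at-end : ∀ l → length l ≡ N → All (λ c → n ≤ size-of c) l → EndsFull n (mid ++ l ++ rest-after k)
        at-end []      N≡0 _ = contradiction (subst (0 <_) (sym N≡0) N>0) λ ()
        at-end (c ∷ l) _  ps = endsFull-++ mid (subst (EndsFull n)
          (trans (sym (Listₚ.++-identityʳ (c ∷ l))) (cong ((c ∷ l) ++_) (sym after))) (endsFull-all ps))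

  natBits : ℤ → List Bool
  natBits (ℤ.+ k)  = bits k
  natBits -[1+ k ] = bits k

  numBits denBits : ℚ → List Bool
  numBits q = natBits (↥ q)
  denBits q = natBits (↧ q)

  -- The number of copies of a path of weight w: ⌈ N w ⌉, but at most N.
  mult : ℕ → ℚ → ℕ
  mult N w = quant N N (numBits w) (denBits w)

  fraction : ∀ {q} → 0ℚ Q.≤ q → ∃[ m ] ∃[ k ] value-of (numBits q) ≡ m × value-of (denBits q) ≡ suc k × ι (suc k) Q.* q ≡ ι m
  fraction {Q.mkℚ (ℤ.+ m) k c} _ = m , k , value-bits m , value-bits (suc k) ,
    trans (cong (Q._* Q.mkℚ (ℤ.+ m) k c) (trans (ι-/1 (suc k)) (/1-mkℚ (suc k))))
      (trans (Qₚ.toℚᵘ-injective (Qᵘₚ.≃-trans (Qₚ.toℚᵘ-homo-* (Q.mkℚ (ℤ.+ suc k) 0 (coprime-1 (suc k))) (Q.mkℚ (ℤ.+ m) k c)) (Qᵘ.*≡* eq)))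
        (sym (trans (ι-/1 m) (/1-mkℚ m))))
    where
    eq : (ℤ.+ suc k ℤ.* ℤ.+ m) ℤ.* ℤ.+ 1 ≡ ℤ.+ m ℤ.* ℤ.+ (1 * suc k)
    eq = trans (ℤₚ.*-identityʳ _) (trans (ℤₚ.*-comm (ℤ.+ suc k) (ℤ.+ m)) (cong (λ x → ℤ.+ m ℤ.* ℤ.+ x) (sym (*-identityˡ (suc k)))))
  fraction {Q.mkℚ -[1+ m ] k c} (Q.*≤* ())

  module _ {q : ℚ} (q≥0 : 0ℚ Q.≤ q) where

    private
      m = proj₁ (fraction q≥0)
      k = proj₁ (proj₂ (fraction q≥0))
      num≡ = proj₁ (proj₂ (proj₂ (fraction q≥0)))
      den≡ = proj₁ (proj₂ (proj₂ (proj₂ (fraction q≥0))))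
      q≡   = proj₂ (proj₂ (proj₂ (proj₂ (fraction q≥0))))

      scale : ∀ N → ι (suc k) Q.* (ι N Q.* q) ≡ ι (N * m)
      scale N = trans (eq (ι (suc k)) (ι N) q) (trans (cong (ι N Q.*_) q≡) (sym (ι-* N m)))
        where
        eq : ∀ a b c → a Q.* (b Q.* c) ≡ b Q.* (a Q.* c)
        eq = ring-solve ℚ-ring

    exceeds : ∀ N j → N * value-of (numBits q) ≤ j * value-of (denBits q) → ι N Q.* q Q.≤ ι j
    exceeds N j le rewrite num≡ | den≡ = Qₚ.*-cancelˡ-≤-pos (ι (suc k)) ⦃ ι-positive {suc k} (s≤s z≤n) ⦄
      (subst₂ Q._≤_ (sym (scale N)) (trans (ι-* j (suc k)) (Qₚ.*-comm (ι j) (ι (suc k)))) (ι-mono le))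

    below : ∀ N j → ¬ (N * value-of (numBits q) ≤ j * value-of (denBits q)) → ι j Q.≤ ι N Q.* q
    below N j nle rewrite num≡ | den≡ = Qₚ.*-cancelˡ-≤-pos (ι (suc k)) ⦃ ι-positive {suc k} (s≤s z≤n) ⦄
      (subst₂ Q._≤_ (trans (ι-* j (suc k)) (Qₚ.*-comm (ι j) (ι (suc k)))) (sym (scale N)) (ι-mono (<⇒≤ (≰⇒> nle))))

    mult-large : ∀ N → mult N q ≡ N ⊎ ι N Q.* q Q.≤ ι (mult N q)
    mult-large N with search-found (λ j → Geq? N j (denBits q) (numBits q)) N
    ... | inj₁ eq = inj₁ eq
    ... | inj₂ le = inj₂ (exceeds N (mult N q) le)

    mult-small : ∀ N → ι (mult N q) Q.≤ ι N Q.* q Q.+ 1ℚ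
    mult-small N with mult N q in eq
    ... | zero  = Qₚ.≤-trans (Qₚ.≤-reflexive ι0) (+≥0 (*≥0 (ι≥0 N) q≥0) (/1≥0 1))
    ... | suc j = Qₚ.≤-trans (Qₚ.≤-reflexive (trans (cong ι (+-comm 1 j)) (trans (ι-+ j 1) (cong (ι j Q.+_) ι1))))
        (Qₚ.+-monoˡ-≤ 1ℚ (below N j (search-least (λ j → Geq? N j (denBits q) (numBits q)) N j (≤-reflexive (sym eq)))))

  Weighted : Set
  Weighted = List ℕ × ℚ

  copies : ℕ → List Weighted → List (List ℕ)
  copies N z = concatMap (λ (P , w) → replicate (mult N w) P) z

  cov : ℕ → List Weighted → ℚ
  cov u z = total (filter (λ (P , _) → memb? u P) z)

  Sum-copies : ∀ (f : List ℕ → ℕ) N z → Sum f (copies N z) ≡ Sum (λ (P , w) → mult N w * f P) z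
  Sum-copies f N z = trans (Sum-concat f (map (λ (P , w) → replicate (mult N w) P) z))
    (trans (Sum-map (Sum f) (λ (P , w) → replicate (mult N w) P) z)
      (Sum-cong z (λ (P , w) _ → Sum-replicate f (mult N w) P)))

  copies-All : ∀ {Q : List ℕ → Set} N {z} → All (Q ∘ proj₁) z → All Q (copies N z)
  copies-All N []       = []
  copies-All N {(P , w) ∷ z} (q ∷ qs) = Allₚ.++⁺ (Allₚ.replicate⁺ (mult N w) q) (copies-All N qs)

  copies-cover : ∀ N u {z} → All (λ (_ , w) → 0ℚ Q.≤ w) z →
                 N ≤ count u (copies N z) ⊎ ι N Q.* cov u z Q.≤ ι (count u (copies N z))
  copies-cover N u {z} nonneg = subst (λ c → N ≤ c ⊎ ι N Q.* cov u z Q.≤ ι c) (sym (Sum-copies (λ P → ind (memb? u P)) N z)) (go nonneg)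
    where
    f : Weighted → ℕ
    f (P , w) = mult N w * ind (memb? u P)
    go : ∀ {z} → All (λ (_ , w) → 0ℚ Q.≤ w) z → N ≤ Sum f z ⊎ ι N Q.* cov u z Q.≤ ι (Sum f z)
    go [] = inj₂ (Qₚ.≤-trans (Qₚ.≤-reflexive (Qₚ.*-zeroʳ (ι N))) (ι≥0 0))
    go {(P , w) ∷ z} (w≥0 ∷ nn) with memb? u P | go nn
    ... | no _  | inj₁ le = inj₁ (≤-trans le (m≤n+m _ _))
    ... | yes _ | inj₁ le = inj₁ (≤-trans le (m≤n+m _ _))
    ... | no _  | inj₂ le = inj₂ (subst (λ x → ι N Q.* cov u z Q.≤ ι (x + Sum f z)) (sym (*-zeroʳ (mult N w))) le)
    ... | yes _ | inj₂ le with mult-large w≥0 N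
    ...   | inj₁ eq = inj₁ (≤-trans (≤-reflexive (trans (sym eq) (sym (*-identityʳ (mult N w))))) (m≤m+n _ _))
    ...   | inj₂ le′ = inj₂ (begin
      ι N Q.* (w Q.+ cov u z)              ≡⟨ Qₚ.*-distribˡ-+ (ι N) w (cov u z) ⟩
      ι N Q.* w Q.+ ι N Q.* cov u z        ≤⟨ Qₚ.+-mono-≤ le′ le ⟩
      ι (mult N w) Q.+ ι (Sum f z)         ≡⟨ ι-+ (mult N w) (Sum f z) ⟨
      ι (mult N w + Sum f z)               ≡⟨ cong (λ x → ι (x + Sum f z)) (*-identityʳ (mult N w)) ⟨
      ι (mult N w * 1 + Sum f z)           ∎)
      where open Qₚ.≤-Reasoning

  deficit-bound : ∀ N u {z δ} → All (λ (_ , w) → 0ℚ Q.≤ w) z → 0ℚ Q.≤ δ → 1ℚ Q.≤ cov u z Q.+ δ →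
                  ι (N ∸ count u (copies N z)) Q.≤ ι N Q.* δ
  deficit-bound N u {z} {δ} nonneg δ≥0 full = case copies-cover N u nonneg of λ
    { (inj₁ le) → zero-case le
    ; (inj₂ le) → case N ≤? c of λ
      { (yes N≤c) → zero-case N≤c
      ; (no N≰c)  → Qₚ.≤-trans (Qₚ.≤-reflexive (eq (ι (N ∸ c)) (ι c))) (Qₚ.≤-trans (Qₚ.+-monoˡ-≤ (Q.- ι c)
          (Qₚ.≤-trans (Qₚ.≤-reflexive (trans (sym (ι-+ (N ∸ c) c)) (trans (cong ι (m∸n+n≡m (<⇒≤ (≰⇒> N≰c)))) (sym (Qₚ.*-identityʳ (ι N))))))
            (Qₚ.≤-trans (*-monoʳ-Q (ι≥0 N) full) (Qₚ.≤-trans (Qₚ.≤-reflexive (Qₚ.*-distribˡ-+ (ι N) (cov u z) δ)) (Qₚ.+-monoˡ-≤ (ι N Q.* δ) le)))))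
          (Qₚ.≤-reflexive (eq′ (ι c) (ι N Q.* δ)))) } }
    where
    c = count u (copies N z)
    zero-case : N ≤ c → ι (N ∸ c) Q.≤ ι N Q.* δ
    zero-case le = Qₚ.≤-trans (Qₚ.≤-reflexive (trans (cong ι (m≤n⇒m∸n≡0 le)) ι0)) (*≥0 (ι≥0 N) δ≥0)
    eq : ∀ a b → a ≡ a Q.+ b Q.+ (Q.- b)
    eq = ring-solve ℚ-ring
    eq′ : ∀ a b → a Q.+ b Q.+ (Q.- a) ≡ b
    eq′ = ring-solve ℚ-ring

  SumQ : {X : Set} → (X → ℚ) → List X → ℚ
  SumQ f []       = 0ℚ
  SumQ f (x ∷ xs) = f x Q.+ SumQ f xs

  SumQ-mono : {X : Set} {f g : X → ℚ} (xs : List X) → (∀ x → x ∈ xs → f x Q.≤ g x) → SumQ f xs Q.≤ SumQ g xs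
  SumQ-mono []       le = Qₚ.≤-refl
  SumQ-mono (x ∷ xs) le = Qₚ.+-mono-≤ (le x (here refl)) (SumQ-mono xs (λ y y∈ → le y (there y∈)))

  SumQ≥0 : {X : Set} {f : X → ℚ} (xs : List X) → (∀ x → x ∈ xs → 0ℚ Q.≤ f x) → 0ℚ Q.≤ SumQ f xs
  SumQ≥0 []       nn = Qₚ.≤-refl
  SumQ≥0 (x ∷ xs) nn = +≥0 (nn x (here refl)) (SumQ≥0 xs (λ y y∈ → nn y (there y∈)))

  SumQ-* : {X : Set} (c : ℚ) (f : X → ℚ) (xs : List X) → SumQ (λ x → c Q.* f x) xs ≡ c Q.* SumQ f xs
  SumQ-* c f []       = sym (Qₚ.*-zeroʳ c)
  SumQ-* c f (x ∷ xs) = trans (cong (c Q.* f x Q.+_) (SumQ-* c f xs)) (sym (Qₚ.*-distribˡ-+ c (f x) _))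

  SumQ-+ : {X : Set} (f g : X → ℚ) (xs : List X) → SumQ (λ x → f x Q.+ g x) xs ≡ SumQ f xs Q.+ SumQ g xs
  SumQ-+ f g []       = refl
  SumQ-+ f g (x ∷ xs) = trans (cong ((f x Q.+ g x) Q.+_) (SumQ-+ f g xs)) (eq (f x) (g x) (SumQ f xs) (SumQ g xs))
    where
    eq : ∀ a b c d → a Q.+ b Q.+ (c Q.+ d) ≡ a Q.+ c Q.+ (b Q.+ d)
    eq = ring-solve ℚ-ring

  ι-Sum : {X : Set} (f : X → ℕ) (xs : List X) → ι (Sum f xs) ≡ SumQ (ι ∘ f) xs
  ι-Sum f []       = ι0
  ι-Sum f (x ∷ xs) = trans (ι-+ (f x) _) (cong (ι (f x) Q.+_) (ι-Sum f xs))

  SumQ-const : {X : Set} (xs : List X) → SumQ (λ _ → 1ℚ) xs ≡ ι (length xs)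
  SumQ-const []       = sym ι0
  SumQ-const (_ ∷ xs) = trans (cong (1ℚ Q.+_) (SumQ-const xs)) (trans (cong (Q._+ ι (length xs)) (sym ι1)) (sym (ι-+ 1 (length xs))))

  -- Demand r is served by the amounts xs at the times 1, 2, …; deficit is
  -- what is left after time t.

  pos : ℚ → ℚ
  pos r = r Q.⊔ 0ℚ

  deficit tails : ℚ → List ℚ → ℕ → ℚ
  deficit r xs       zero    = pos r
  deficit r []       (suc t) = 0ℚ
  deficit r (x ∷ xs) (suc t) = deficit (r Q.- x) xs t
  tails r []       zero    = pos r
  tails r []       (suc t) = 0ℚ
  tails r (x ∷ xs) zero    = pos r Q.+ tails (r Q.- x) xs zero
  tails r (x ∷ xs) (suc t) = tails (r Q.- x) xs t

  sumℚ : List ℚ → ℚ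
  sumℚ = SumQ (λ x → x)

  prefix : List ℚ → ℕ → ℚ
  prefix xs       zero    = 0ℚ
  prefix []       (suc t) = 0ℚ
  prefix (x ∷ xs) (suc t) = x Q.+ prefix xs t

  delay : List ℚ → ℚ
  delay []       = 0ℚ
  delay (x ∷ xs) = x Q.+ (delay xs Q.+ sumℚ xs)

  pos≥0 : ∀ r → 0ℚ Q.≤ pos r
  pos≥0 r = Qₚ.p≤q⊔p r 0ℚ

  deficit≥0 : ∀ r xs t → 0ℚ Q.≤ deficit r xs t
  deficit≥0 r xs       zero    = pos≥0 r
  deficit≥0 r []       (suc t) = Qₚ.≤-refl
  deficit≥0 r (x ∷ xs) (suc t) = deficit≥0 (r Q.- x) xs t

  tails≥0 : ∀ r xs t → 0ℚ Q.≤ tails r xs t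
  tails≥0 r []       zero    = pos≥0 r
  tails≥0 r []       (suc t) = Qₚ.≤-refl
  tails≥0 r (x ∷ xs) zero    = +≥0 (pos≥0 r) (tails≥0 (r Q.- x) xs zero)
  tails≥0 r (x ∷ xs) (suc t) = tails≥0 (r Q.- x) xs t

  tails-step : ∀ r xs t → tails r xs t ≡ deficit r xs t Q.+ tails r xs (suc t)
  tails-step r []       zero    = sym (Qₚ.+-identityʳ (pos r))
  tails-step r []       (suc t) = refl
  tails-step r (x ∷ xs) zero    = refl
  tails-step r (x ∷ xs) (suc t) = tails-step (r Q.- x) xs t

  minus-≤ : ∀ r {x} → 0ℚ Q.≤ x → r Q.- x Q.≤ r
  minus-≤ r {x} x≥0 = Qₚ.≤-trans (Qₚ.+-monoʳ-≤ r (Qₚ.neg-antimono-≤ x≥0)) (Qₚ.≤-reflexive (Qₚ.+-identityʳ r))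

  deficit-step : ∀ r xs t → All (0ℚ Q.≤_) xs → deficit r xs (suc t) Q.≤ deficit r xs t
  deficit-step r []       zero    _          = pos≥0 r
  deficit-step r []       (suc t) _          = Qₚ.≤-refl
  deficit-step r (x ∷ xs) zero    (x≥0 ∷ _)  = Qₚ.⊔-monoˡ-≤ 0ℚ (minus-≤ r x≥0)
  deficit-step r (x ∷ xs) (suc t) (_ ∷ xs≥0) = deficit-step (r Q.- x) xs t xs≥0

  deficit-antitone : ∀ r xs {s t} → All (0ℚ Q.≤_) xs → s ≤ t → deficit r xs t Q.≤ deficit r xs s
  deficit-antitone r xs {s} {t} nn le = go t le
    where
    go : ∀ t → s ≤ t → deficit r xs t Q.≤ deficit r xs s
    go t le with m≤n⇒m<n∨m≡n le
    ... | inj₂ refl = Qₚ.≤-refl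
    go (suc t) _ | inj₁ (s≤s lt) = Qₚ.≤-trans (deficit-step r xs t nn) (go t lt)

  sub-add : ∀ {r x y} → r Q.≤ x Q.+ y → r Q.- x Q.≤ y
  sub-add {r} {x} {y} le = Qₚ.≤-trans (Qₚ.+-monoˡ-≤ (Q.- x) le) (Qₚ.≤-reflexive (eq x y))
    where
    eq : ∀ x y → x Q.+ y Q.+ (Q.- x) ≡ y
    eq = ring-solve ℚ-ring

  pos-zero : ∀ {r} → r Q.≤ 0ℚ → pos r ≡ 0ℚ
  pos-zero = Qₚ.p≤q⇒p⊔q≡q

  deficit-end : ∀ r xs {t} → All (0ℚ Q.≤_) xs → r Q.≤ sumℚ xs → length xs ≤ t → deficit r xs t ≡ 0ℚ
  deficit-end r []       {zero}  _ r≤ le       = pos-zero r≤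
  deficit-end r []       {suc t} _ r≤ le       = refl
  deficit-end r (x ∷ xs) {suc t} (_ ∷ nn) r≤ (s≤s le) = deficit-end (r Q.- x) xs nn (sub-add r≤) le

  deficit-covers : ∀ r xs {t} → t ≤ length xs → r Q.≤ prefix xs t Q.+ deficit r xs t
  deficit-covers r xs       {zero}  le = Qₚ.≤-trans (Qₚ.p≤p⊔q r 0ℚ) (Qₚ.≤-reflexive (sym (Qₚ.+-identityˡ (pos r))))
  deficit-covers r (x ∷ xs) {suc t} (s≤s le) = Qₚ.≤-trans (Qₚ.≤-reflexive (eq r x))
    (Qₚ.≤-trans (Qₚ.+-monoʳ-≤ x (deficit-covers (r Q.- x) xs le)) (Qₚ.≤-reflexive (sym (Qₚ.+-assoc x (prefix xs t) _))))
    where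
    eq : ∀ r x → r ≡ x Q.+ (r Q.- x)
    eq = ring-solve ℚ-ring

  sumℚ≥0 : ∀ {xs} → All (0ℚ Q.≤_) xs → 0ℚ Q.≤ sumℚ xs
  sumℚ≥0 {xs} nn = SumQ≥0 xs (λ x x∈ → All.lookup nn x∈)

  tails-delay : ∀ r xs → All (0ℚ Q.≤_) xs → r Q.≤ sumℚ xs → tails r xs 0 Q.≤ delay xs
  tails-delay r []       _ r≤ = Qₚ.≤-reflexive (pos-zero r≤)
  tails-delay r (x ∷ xs) (x≥0 ∷ nn) r≤ = Qₚ.≤-trans
    (Qₚ.+-mono-≤ (Qₚ.⊔-lub r≤ (+≥0 x≥0 (sumℚ≥0 nn))) (tails-delay (r Q.- x) xs nn (sub-add r≤)))
    (Qₚ.≤-reflexive (eq x (sumℚ xs) (delay xs)))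
    where
    eq : ∀ x s e → x Q.+ s Q.+ e ≡ x Q.+ (e Q.+ s)
    eq = ring-solve ℚ-ring

  unique-length : ∀ {xs ys : List ℕ} → Unique xs → (∀ {x} → x ∈ xs → x ∈ ys) → length xs ≤ length ys
  unique-length {xs} {ys} U sub = begin
    length xs                                   ≡⟨ trans (Sum-const 1 xs) (*-identityʳ _) ⟨
    Sum (λ _ → 1) xs                            ≤⟨ Sum-mono xs (λ x x∈ → ≤-trans (≤-reflexive (sym (ind-yes (x ≟ x) refl))) (Sum-∈ (λ y → ind (y ≟ x)) (sub x∈))) ⟩
    Sum (λ x → Sum (λ y → ind (y ≟ x)) ys) xs   ≡⟨ Sum-swap (λ x y → ind (y ≟ x)) xs ys ⟩
    Sum (λ y → Sum (λ x → ind (y ≟ x)) xs) ys   ≤⟨ Sum-mono ys (λ y _ → ≤-trans (≤-reflexive (Sum-occurs y xs U)) (ind≤1 (memb? y xs))) ⟩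
    Sum (λ _ → 1) ys                            ≡⟨ trans (Sum-const 1 ys) (*-identityʳ _) ⟩
    length ys                                   ∎
    where open ≤-Reasoning

  valid-unique : ∀ {S es} → Valid S es → Unique (map vert es)
  valid-unique [] = []
  valid-unique {es = (v , a , q) ∷ es} (add a∈ v∉ V) = Allₚ.map⁺ (All.tabulate λ {e} e∈ eq →
    valid-absent V (here refl) (Any.map (λ { refl → sym eq }) e∈)) ∷ valid-unique V

  module Candidates (d : ℕ → ℕ → ℕ) (n N : ℕ) where

    open Metric d

    cand : List Entry → Cand
    cand es = length es , treeCost es + treeCost es , tour es

    cands : List Weighted → List Cand
    cands z = map cand (forest n N (copies N z))

    module _ (d-refl : ∀ x → d x x ≡ 0) (d-sym : ∀ x y → d x y ≡ d y x)
             (d-tri : ∀ x y z → d x z ≤ d x y + d y z) where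

      open Plans d n

      cand-good : ∀ {es} → Valid (0 ∷ []) es → (∀ {e} → e ∈ es → vert e ∈ clients n) → GoodCand (cand es)
      cand-good {es} V inside = record
        { root = proj₁ ts ; priced = proj₁ (proj₂ ts)
        ; covers = λ n≤ {u} u∈ → case memb? u (tour es) of λ
            { (yes u∈τ) → u∈τ
            ; (no u∉τ) → contradiction (≤-trans (nonempty (∈-filter⁺ (λ u → ¬? (memb? u (tour es))) u∈ u∉τ))
                (≤-trans (few (clients-unique n) (All.tabulate λ x∈ → x∈)) (≤-reflexive (m≤n⇒m∸n≡0 n≤)))) λ () }
        ; missed = few }
        where
        ts = tour-spec d-refl d-sym d-tri es V
        nonempty : ∀ {x} {xs : List ℕ} → x ∈ xs → 1 ≤ length xs
        nonempty (here _)  = s≤s z≤n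
        nonempty (there _) = s≤s z≤n
        few : ∀ {U} → Unique U → All (_∈ clients n) U → length (filter (λ u → ¬? (memb? u (tour es))) U) ≤ n ∸ length es
        few {U} un al = ≤-trans (≤-reflexive (sym (m+n∸n≡m _ (length es)))) (∸-monoˡ-≤ (length es) (begin
          length F + length es                 ≡⟨ cong (length F +_) (Listₚ.length-map vert es) ⟨
          length F + length (map vert es)      ≡⟨ Listₚ.length-++ F ⟨
          length (F ++ map vert es)            ≤⟨ unique-length (Uniqueₚ.++⁺
                                                    (Uniqueₚ.filter⁺ (λ u → ¬? (memb? u (tour es))) un)
                                                    (valid-unique V) disjoint) within ⟩
          length (clients n)                   ≡⟨ length-clients n ⟩
          n                                    ∎))
          where
          open ≤-Reasoning
          F = filter (λ u → ¬? (memb? u (tour es))) U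
          at-vert : ∀ {x} → x ∈ map vert es → ∃[ e ] e ∈ es × x ≡ vert e
          at-vert = ∈-map⁻ vert
          disjoint : ∀ {x} → ¬ (x ∈ F × x ∈ map vert es)
          disjoint (x∈F , x∈v) = let (e , e∈ , eq) = at-vert x∈v in
            proj₂ (∈-filter⁻ (λ u → ¬? (memb? u (tour es))) {xs = U} x∈F)
              (proj₁ (proj₂ (proj₂ ts)) (Any.map (λ { refl → sym eq }) e∈))
          within : ∀ {x} → x ∈ F ++ map vert es → x ∈ clients n
          within x∈ with ∈-++⁻ F x∈
          ... | inj₁ x∈F = All.lookup al (proj₁ (∈-filter⁻ (λ u → ¬? (memb? u (tour es))) {xs = U} x∈F))
          ... | inj₂ x∈v = let (e , e∈ , eq) = at-vert x∈v in subst (_∈ clients n) (sym eq) (inside e∈)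

      module _ (z : List Weighted) (paths-ok : All (ClientPath n ∘ proj₁) z) (nonneg : All (λ (_ , w) → 0ℚ Q.≤ w) z) where

        private
          Ls = copies N z
          good : All (ClientPath n) Ls
          good = copies-All N paths-ok

        cands-good : All GoodCand (cands z)
        cands-good = Allₚ.map⁺ (All.tabulate λ es∈ →
          cand-good (All.lookup (forest-valid n N Ls good) es∈) (forest-vertices n N Ls good es∈))

        cands-length : length (cands z) ≡ N
        cands-length = trans (Listₚ.length-map cand (forest n N Ls)) (forest-length n N Ls good)

        cands-gap : ∀ (δ : ℕ → ℚ) → (∀ u → 0ℚ Q.≤ δ u) → (∀ {u} → u ∈ clients n → 1ℚ Q.≤ cov u z Q.+ δ u) →
                    ι (Sum (λ c → n ∸ size-of c) (cands z)) Q.≤ ι N Q.* SumQ δ (clients n)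
        cands-gap δ δ≥0 full = begin
          ι (Sum (λ c → n ∸ size-of c) (cands z))                   ≡⟨ cong ι (Sum-map (λ c → n ∸ size-of c) cand (forest n N Ls)) ⟩
          ι (Sum (λ es → n ∸ length es) (forest n N Ls))            ≤⟨ ι-mono (forest-gap n N Ls good) ⟩
          ι (Sum (λ u → N ∸ count u Ls) (clients n))                ≡⟨ ι-Sum _ (clients n) ⟩
          SumQ (λ u → ι (N ∸ count u Ls)) (clients n)               ≤⟨ SumQ-mono (clients n) (λ u u∈ → deficit-bound N u nonneg (δ≥0 u) (full u∈)) ⟩
          SumQ (λ u → ι N Q.* δ u) (clients n)                      ≡⟨ SumQ-* (ι N) δ (clients n) ⟩
          ι N Q.* SumQ δ (clients n)                                ∎
          where open Qₚ.≤-Reasoning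

        cands-price : ∀ (B : ℚ) → 0ℚ Q.≤ B → All (λ (P , _) → ι (len 0 P) Q.≤ B) z →
                      ι (Sum price (cands z)) Q.≤ (ℤ.+ 2 Q./ 1) Q.* ((ι N Q.* total z Q.+ ι (length z)) Q.* B)
        cands-price B B≥0 short = begin
          ι (Sum price (cands z))             ≡⟨ cong ι (trans (Sum-map price cand (forest n N Ls)) (Sum-+ treeCost treeCost (forest n N Ls))) ⟩
          ι (TC + TC)                         ≡⟨ trans (ι-+ TC TC) (eq₁ (ι TC)) ⟩
          (ℤ.+ 2 Q./ 1) Q.* ι TC              ≤⟨ *-monoʳ-Q (/1≥0 2) (Qₚ.≤-trans (ι-mono TC≤) (Qₚ.≤-trans (Qₚ.≤-reflexive (cong ι (Sum-copies (len 0) N z))) (bound short nonneg))) ⟩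
          (ℤ.+ 2 Q./ 1) Q.* ((ι N Q.* total z Q.+ ι (length z)) Q.* B) ∎
          where
          open Qₚ.≤-Reasoning
          TC = Sum treeCost (forest n N Ls)
          eq₁ : ∀ x → x Q.+ x ≡ (ℤ.+ 2 Q./ 1) Q.* x
          eq₁ = ring-solve ℚ-ring
          TC≤ : TC ≤ Sum (len 0) Ls
          TC≤ = ≤-trans (≤-reflexive (trans (weight n N Ls good (λ e → d (par e) (vert e)))
                  (trans (Sum-cong (number 0 (trunc N Ls)) (λ (i , P) _ → chain-len i 0 P)) (number-Sum (len 0) 0 (trunc N Ls)))))
                (trunc-Sum N (len 0) Ls (λ acc P → len-filter d-refl d-sym d-tri (λ u → suc (count u acc) ≤? N) 0 P))
          bound : ∀ {z} → All (λ (P , _) → ι (len 0 P) Q.≤ B) z → All (λ (_ , w) → 0ℚ Q.≤ w) z →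
                  ι (Sum (λ (P , w) → mult N w * len 0 P) z) Q.≤ (ι N Q.* total z Q.+ ι (length z)) Q.* B
          bound [] [] = Qₚ.≤-reflexive (trans ι0 (sym (trans (cong (Q._* B) (trans (cong₂ Q._+_ (Qₚ.*-zeroʳ (ι N)) ι0) refl)) (Qₚ.*-zeroˡ B))))
          bound {(P , w) ∷ z} (s ∷ ss) (w≥0 ∷ nn) = begin
            ι (mult N w * len 0 P + R)                        ≡⟨ trans (ι-+ (mult N w * len 0 P) R) (cong (Q._+ ι R) (ι-* (mult N w) (len 0 P))) ⟩
            ι (mult N w) Q.* ι (len 0 P) Q.+ ι R              ≤⟨ Qₚ.+-mono-≤ (Qₚ.≤-trans (*-monoʳ-Q (ι≥0 (mult N w)) s) (*-monoˡ-Q B≥0 (mult-small w≥0 N))) (bound ss nn) ⟩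
            (ι N Q.* w Q.+ 1ℚ) Q.* B Q.+ (ι N Q.* total z Q.+ ι (length z)) Q.* B
                                                              ≡⟨ eq₂ (ι N) w B (total z) (ι (length z)) ⟩
            (ι N Q.* (w Q.+ total z) Q.+ (1ℚ Q.+ ι (length z))) Q.* B
                                                              ≡⟨ cong (λ x → (ι N Q.* (w Q.+ total z) Q.+ x) Q.* B) (trans (cong (Q._+ ι (length z)) (sym ι1)) (sym (ι-+ 1 (length z)))) ⟩
            (ι N Q.* (w Q.+ total z) Q.+ ι (suc (length z))) Q.* B ∎
            where
            R = Sum (λ (P , w) → mult N w * len 0 P) z
            eq₂ : ∀ m w b t l → (m Q.* w Q.+ 1ℚ) Q.* b Q.+ (m Q.* t Q.+ l) Q.* b ≡ (m Q.* (w Q.+ t) Q.+ (1ℚ Q.+ l)) Q.* b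
            eq₂ = ring-solve ℚ-ring

  at-map : {X Y : Set} (f : List X → List Y) (zs : List (List X)) {i : ℕ} → i < length zs → at (map f zs) i ≡ f (at zs i)
  at-map f (z ∷ zs) {zero}  lt       = refl
  at-map f (z ∷ zs) {suc i} (s≤s lt) = at-map f zs lt

  -- With 40 (M + 1) branchings for lists of at most M paths, rounding the
  -- weights up to multiples of the reciprocal costs a factor 41/40.
  grain : ℕ → ℕ
  grain M = 40 * suc M

  module RoundPaths (d : ℕ → ℕ → ℕ) (d-refl : ∀ x → d x x ≡ 0) (d-sym : ∀ x y → d x y ≡ d y x)
    (d-tri : ∀ x y z → d x z ≤ d x y + d y z) (n M : ℕ) (zs : List (List Weighted)) (xs : ℕ → List ℚ) (ρ L : ℚ)
    (few      : ∀ {z} → z ∈ zs → length z ≤ M)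
    (paths-ok : ∀ {z} → z ∈ zs → All (ClientPath n ∘ proj₁) z)
    (nonneg   : ∀ {z} → z ∈ zs → All (λ (_ , w) → 0ℚ Q.≤ w) z)
    (short    : ∀ {i} → i < length zs → All (λ (P , _) → ι (Metric.len d 0 P) Q.≤ L Q.* ι (suc i)) (at zs i))
    (capacity : ∀ {z} → z ∈ zs → total z Q.≤ ρ)
    (x≥0      : ∀ {u} → u ∈ clients n → All (0ℚ Q.≤_) (xs u))
    (x-length : ∀ {u} → u ∈ clients n → length (xs u) ≡ length zs)
    (assigned : ∀ {u} → u ∈ clients n → 1ℚ Q.≤ sumℚ (xs u))
    (covered  : ∀ {u i} → u ∈ clients n → i < length zs → prefix (xs u) (suc i) Q.≤ cov u (at zs i))
    (1≤ρ : 1ℚ Q.≤ ρ) (L≥0 : 0ℚ Q.≤ L) where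

    open Candidates d n (grain M)
    open Plans d n

    π : List (List ℕ)
    π = solve n (concat (map cands zs))

    private
      N = grain M
      gs = map cands zs

      C : ℚ
      C = (ℤ.+ 41 Q./ 20) Q.* (ρ Q.* L)

      ρ≥0 : 0ℚ Q.≤ ρ
      ρ≥0 = Qₚ.≤-trans (/1≥0 1) 1≤ρ

      41/20≥0 : 0ℚ Q.≤ ℤ.+ 41 Q./ 20
      41/20≥0 = Q.*≤* (ℤ.+≤+ z≤n)

      C≥0 : 0ℚ Q.≤ C
      C≥0 = *≥0 41/20≥0 (*≥0 ρ≥0 L≥0)

      D R : ℕ → ℚ
      D t = SumQ (λ u → deficit 1ℚ (xs u) t) (clients n)
      R t = SumQ (λ u → tails 1ℚ (xs u) t) (clients n)

      len≡ : length gs ≡ length zs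
      len≡ = Listₚ.length-map cands zs

      bounded : ∀ {i} → i < length gs → i < length zs
      bounded {i} = subst (i <_) len≡

      prices : ∀ {i} → i < length gs → ι (Sum price (at gs i)) Q.≤ C Q.* ι (suc i) Q.* ι N
      prices {i} lt = begin
        ι (Sum price (at gs i))           ≡⟨ cong (ι ∘ Sum price) (at-map cands zs i<) ⟩
        ι (Sum price (cands (at zs i)))   ≤⟨ cands-price d-refl d-sym d-tri (at zs i) (paths-ok z∈) (nonneg z∈) (L Q.* ι (suc i)) B≥0 (short i<) ⟩
        (ℤ.+ 2 Q./ 1) Q.* ((ι N Q.* total (at zs i) Q.+ ι (length (at zs i))) Q.* (L Q.* ι (suc i)))
                                          ≤⟨ *-monoʳ-Q (/1≥0 2) (*-monoˡ-Q B≥0 (Qₚ.+-mono-≤ (*-monoʳ-Q (ι≥0 N) (capacity z∈))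
                                               (Qₚ.≤-trans (ι-mono (m≤n⇒m≤1+n (few z∈))) (Qₚ.≤-trans (Qₚ.≤-reflexive (sym (Qₚ.*-identityʳ m))) (*-monoʳ-Q (ι≥0 (suc M)) 1≤ρ))))) ⟩
        (ℤ.+ 2 Q./ 1) Q.* ((ι N Q.* ρ Q.+ m Q.* ρ) Q.* (L Q.* ι (suc i)))
                                          ≡⟨ cong (λ x → (ℤ.+ 2 Q./ 1) Q.* ((x Q.* ρ Q.+ m Q.* ρ) Q.* (L Q.* ι (suc i)))) N≡ ⟩
        (ℤ.+ 2 Q./ 1) Q.* (((ℤ.+ 40 Q./ 1) Q.* m Q.* ρ Q.+ m Q.* ρ) Q.* (L Q.* ι (suc i)))
                                          ≡⟨ eq m ρ L (ι (suc i)) ⟩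
        C Q.* ι (suc i) Q.* ((ℤ.+ 40 Q./ 1) Q.* m) ≡⟨ cong (C Q.* ι (suc i) Q.*_) N≡ ⟨
        C Q.* ι (suc i) Q.* ι N           ∎
        where
        open Qₚ.≤-Reasoning
        i< = bounded lt
        z∈ = at-∈ zs i<
        m = ι (suc M)
        B≥0 : 0ℚ Q.≤ L Q.* ι (suc i)
        B≥0 = *≥0 L≥0 (ι≥0 (suc i))
        N≡ : ι N ≡ (ℤ.+ 40 Q./ 1) Q.* m
        N≡ = trans (ι-* 40 (suc M)) (cong (Q._* m) (ι-/1 40))
        eq : ∀ m ρ L t → (ℤ.+ 2 Q./ 1) Q.* (((ℤ.+ 40 Q./ 1) Q.* m Q.* ρ Q.+ m Q.* ρ) Q.* (L Q.* t)) ≡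
             (ℤ.+ 41 Q./ 20) Q.* (ρ Q.* L) Q.* t Q.* ((ℤ.+ 40 Q./ 1) Q.* m)
        eq = ring-solve ℚ-ring

      gaps : ∀ {i} → i < length gs → ι (Sum (λ c → n ∸ size-of c) (at gs i)) Q.≤ ι N Q.* D (suc i)
      gaps {i} lt = subst (λ G → ι (Sum (λ c → n ∸ size-of c) G) Q.≤ ι N Q.* D (suc i)) (sym (at-map cands zs i<))
        (cands-gap d-refl d-sym d-tri (at zs i) (paths-ok z∈) (nonneg z∈) (λ u → deficit 1ℚ (xs u) (suc i)) (λ u → deficit≥0 1ℚ (xs u) (suc i))
          (λ {u} u∈ → Qₚ.≤-trans (deficit-covers 1ℚ (xs u) (≤-trans i< (≤-reflexive (sym (x-length u∈)))))
                        (Qₚ.+-monoˡ-≤ (deficit 1ℚ (xs u) (suc i)) (covered u∈ i<))))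
        where
        i< = bounded lt
        z∈ = at-∈ zs i<

      lengths : ∀ {i} → i < length gs → length (at gs i) ≡ N
      lengths {i} lt = trans (cong length (at-map cands zs i<)) (cands-length d-refl d-sym d-tri (at zs i) (paths-ok z∈) (nonneg z∈))
        where
        i< = bounded lt
        z∈ = at-∈ zs i<

      D-start : D 0 ≡ ι n
      D-start = trans (SumQ-const (clients n)) (cong ι (length-clients n))

      SumQ-zero : ∀ (us : List ℕ) {f} → (∀ {u} → u ∈ us → f u ≡ 0ℚ) → SumQ f us ≡ 0ℚ
      SumQ-zero []       z = refl
      SumQ-zero (u ∷ us) z = cong₂ Q._+_ (z (here refl)) (SumQ-zero us (z ∘ there))

      R-step : ∀ t → R t ≡ D t Q.+ R (suc t)
      R-step t = trans (SumQ-cong (clients n)) (SumQ-+ (λ u → deficit 1ℚ (xs u) t) (λ u → tails 1ℚ (xs u) (suc t)) (clients n))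
        where
        SumQ-cong : ∀ us → SumQ (λ u → tails 1ℚ (xs u) t) us ≡ SumQ (λ u → deficit 1ℚ (xs u) t Q.+ tails 1ℚ (xs u) (suc t)) us
        SumQ-cong []       = refl
        SumQ-cong (u ∷ us) = cong₂ Q._+_ (tails-step 1ℚ (xs u) t) (SumQ-cong us)

      module Sch = Schedule n N (s≤s z≤n) gs C D R lengths prices gaps C≥0
        (λ t → SumQ≥0 (clients n) (λ u _ → deficit≥0 1ℚ (xs u) t))
        (λ le → SumQ-mono (clients n) (λ u u∈ → deficit-antitone 1ℚ (xs u) (x≥0 u∈) le)) D-start
        (λ {t} le → SumQ-zero (clients n) (λ {u} u∈ → deficit-end 1ℚ (xs u) (x≥0 u∈) (assigned u∈)
          (≤-trans (≤-reflexive (trans (x-length u∈) (sym len≡))) le)))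
        R-step (λ t → SumQ≥0 (clients n) (λ u _ → tails≥0 1ℚ (xs u) t))

      all-good : All GoodCand (concat gs)
      all-good = Allₚ.concat⁺ (Allₚ.map⁺ (All.tabulate λ {z} z∈ → cands-good d-refl d-sym d-tri z (paths-ok z∈) (nonneg z∈)))

      some : 0 < n → ∃[ c ] c ∈ concat gs
      some 0<n = go zs refl
        where
        u∈ = ∈-clients {n} {1} (s≤s z≤n) 0<n
        go : ∀ zs′ → zs ≡ zs′ → ∃[ c ] c ∈ concat gs
        go [] eq = contradiction (Qₚ.≤-trans (assigned u∈) (Qₚ.≤-reflexive (cong sumℚ (none (xs 1) (trans (x-length u∈) (cong length eq))))))
                     (λ { (Q.*≤* (ℤ.+≤+ ())) })
          where
          none : ∀ (l : List ℚ) → length l ≡ 0 → l ≡ []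
          none [] _ = refl
        go (z ∷ zs′) eq = first (cands z) (cands-length d-refl d-sym d-tri z (paths-ok z∈) (nonneg z∈)) refl
          where
          z∈ : z ∈ zs
          z∈ = subst (z ∈_) (sym eq) (here refl)
          first : ∀ l → length l ≡ N → cands z ≡ l → ∃[ c ] c ∈ concat gs
          first (c ∷ l) _ e = c , subst (λ y → c ∈ concat (map cands y)) (sym eq) (subst (λ l → c ∈ l ++ concat (map cands zs′)) (sym e) (here refl))

      solved = solve-good all-good Sch.ends-full some

    π-roots : All FromRoot π
    π-roots = proj₁ solved

    π-serves : ∀ {u} → u ∈ clients n → ∃[ τ ] τ ∈ π × u ∈ τ
    π-serves = proj₁ (proj₂ solved)

    π-cost : ι (Sum (service π) (clients n)) Q.≤ (ℤ.+ 287 Q./ 40) Q.* (ρ Q.* L) Q.* SumQ (λ u → delay (xs u)) (clients n)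
    π-cost = begin
      ι (Sum (service π) (clients n))                  ≤⟨ ι-mono (proj₂ (proj₂ solved)) ⟩
      ι V                                              ≡⟨ eq₁ (ι V) ⟩
      ½ Q.* ((ℤ.+ 2 Q./ 1) Q.* ι V)                    ≤⟨ *-monoʳ-Q ½≥0 Sch.schedule-cost ⟩
      ½ Q.* ((ℤ.+ 7 Q./ 1) Q.* (C Q.* R 0))            ≤⟨ *-monoʳ-Q ½≥0 (*-monoʳ-Q (/1≥0 7) (*-monoʳ-Q C≥0
                                                            (SumQ-mono (clients n) (λ u u∈ → tails-delay 1ℚ (xs u) (x≥0 u∈) (assigned u∈))))) ⟩
      ½ Q.* ((ℤ.+ 7 Q./ 1) Q.* (C Q.* SumQ (λ u → delay (xs u)) (clients n)))
                                                       ≡⟨ eq₂ (ρ Q.* L) (SumQ (λ u → delay (xs u)) (clients n)) ⟩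
      (ℤ.+ 287 Q./ 40) Q.* (ρ Q.* L) Q.* SumQ (λ u → delay (xs u)) (clients n) ∎
      where
      open Qₚ.≤-Reasoning
      V = proj₁ (best n 0 (options n (concat gs)))
      ½≥0 : 0ℚ Q.≤ ½
      ½≥0 = Q.*≤* (ℤ.+≤+ z≤n)
      eq₁ : ∀ v → v ≡ ½ Q.* ((ℤ.+ 2 Q./ 1) Q.* v)
      eq₁ = ring-solve ℚ-ring
      eq₂ : ∀ c s → ½ Q.* ((ℤ.+ 7 Q./ 1) Q.* ((ℤ.+ 41 Q./ 20) Q.* c Q.* s)) ≡ (ℤ.+ 287 Q./ 40) Q.* c Q.* s
      eq₂ = ring-solve ℚ-ring

    conclusion : All FromRoot π × (∀ {u} → u ∈ clients n → ∃[ τ ] τ ∈ π × u ∈ τ) ×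
                 ι (Sum (service π) (clients n)) Q.≤ (ℤ.+ 287 Q./ 40) Q.* (ρ Q.* L) Q.* SumQ (λ u → delay (xs u)) (clients n)
    conclusion = π-roots , π-serves , π-cost

  SumP : {A X : Set} ⦃ _ : Code A ⦄ ⦃ _ : Code X ⦄ {xs : A → List X} {f : A × X → ℕ} →
         Poly f → Poly xs → Poly (λ a → Sum (λ x → f (a , x)) (xs a))
  SumP {xs = xs} {f} F L = extP (λ a → go a (xs a)) (sumP (mapP F L))
    where
    go : ∀ a l → sumᴸ (map (λ x → f (a , x)) l) ≡ Sum (λ x → f (a , x)) l
    go a []      = refl
    go a (x ∷ l) = cong (f (a , x) +_) (go a l)

  module _ {A : Set} ⦃ _ : Code A ⦄ where

    countP : {u : A → ℕ} {Ls : A → List (List ℕ)} → Poly u → Poly Ls → Poly (λ a → count (u a) (Ls a))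
    countP U L = SumP {f = λ (a , P) → if does (memb? _ P) then 1 else 0}
      (ifP (memP (U ∘P ₁P) ₂P) (constP 1) (constP 0)) L

  sz-filter : {X : Set} ⦃ _ : Code X ⦄ {P : X → Set} (P? : ∀ x → Dec (P x)) (xs : List X) → sz (filter P? xs) ≤ sz xs
  sz-filter P? []       = ≤-refl
  sz-filter P? (x ∷ xs) with does (P? x)
  ... | true  = s≤s (+-monoʳ-≤ (sz x) (sz-filter P? xs))
  ... | false = m≤n⇒m≤1+n (≤-trans (sz-filter P? xs) (m≤n+m _ _))

  sz-snoc : {X : Set} ⦃ _ : Code X ⦄ (xs : List X) (x : X) → sz (xs ++ x ∷ []) ≤ sz xs + (2 + sz x)
  sz-snoc xs x = ≤-trans (sz-++≤ xs (x ∷ [])) (+-monoʳ-≤ (sz xs) (s≤s (≤-reflexive (+-comm (sz x) 1))))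

  truncP : Poly {ℕ × List (List ℕ)} (λ (N , Ls) → trunc N Ls)
  truncP = foldl⁺P ₂P nilP (appendP acc (consP thinP nilP)) (bnd-+ (bnd-const 2) (out-bnd ₂P))
    λ (N , _) acc P → ≤-trans (sz-snoc acc (thin N acc P)) (+-monoʳ-≤ (sz acc) (+-monoʳ-≤ 2 (sz-filter (λ u → suc (count u acc) ≤? N) P)))
    where
    I = (ℕ × List (List ℕ)) × List (List ℕ) × List ℕ
    acc : Poly {I} (λ i → proj₁ (proj₂ i))
    acc = ₁₂P
    thinP : Poly {I} (λ ((N , _) , acc , P) → thin N acc P)
    thinP = filterP {P? = λ (((N , _) , acc , P) , u) → suc (count u acc) ≤? N}
      (leqP (sucP (countP ₂P (acc ∘P ₁P))) (fstP ₁₁P)) ₂₂P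

  downFromP : {A : Set} ⦃ _ : Code A ⦄ {n : A → ℕ} → Poly n → Poly (λ a → downFrom (n a))
  downFromP {n = n} N = extP (λ a → go (n a) 0 refl)
    (foldlP (onesP N) nilP (consP (lengthP acc) acc)
      (bnd-+ (bnd-const 1) (bnd-* (out-bnd (onesP N)) (bnd-+ (bnd-const 2) (bnd-* (bnd-const 2) (out-bnd (onesP N))))))
      λ a ys zs eq → ≤-trans (≤-reflexive (cong sz (list ys []))) (≤-trans (small (length ys + 0))
        (s≤s (*-mono-≤ (len ys zs eq) (+-monoʳ-≤ 2 (*-monoʳ-≤ 2 (len ys zs eq)))))))
    where
    acc = ₁₂P
    step : List ℕ → ⊤ → List ℕ
    step acc _ = length acc ∷ acc
    len : ∀ {l : List ⊤} ys zs → l ≡ ys ++ zs → length ys + 0 ≤ sz l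
    len ys zs refl = ≤-trans (≤-reflexive (+-identityʳ _)) (≤-trans (length≤sz {⊤} {⊤} {⊤} ys) (sz-prefix ys zs))
    list : ∀ (ys : List ⊤) acc → foldl step (downFrom (length acc)) ys ≡ downFrom (length ys + length acc)
    list []       acc = refl
    list (_ ∷ ys) acc = trans (cong (λ x → foldl step (x ∷ downFrom (length acc)) ys) (Listₚ.length-downFrom (length acc)))
      (trans (list ys (0 ∷ acc)) (cong downFrom (+-suc (length ys) (length acc))))
    go : ∀ n k → k ≡ 0 → foldl step [] (replicate n tt) ≡ downFrom n
    go n _ _ = trans (list (replicate n tt) []) (cong downFrom (trans (+-identityʳ _) (Listₚ.length-replicate n)))
    small : ∀ m → sz (downFrom m) ≤ 1 + m * (2 + 2 * m)
    small m = go′ m ≤-refl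
      where
      go′ : ∀ j → j ≤ m → sz (downFrom j) ≤ 1 + j * (2 + 2 * m)
      go′ zero    _  = ≤-refl
      go′ (suc j) le = s≤s (≤-trans (+-mono-≤ (≤-trans (≤-reflexive (unary-size j)) (+-mono-≤ (≤-refl {1}) (*-monoʳ-≤ 2 (≤-trans (n≤1+n j) le)))) (go′ j (≤-trans (n≤1+n j) le)))
        (≤-reflexive (eq (2 * m) (j * (2 + 2 * m)))))
        where
        eq : ∀ x y → 1 + x + (1 + y) ≡ 2 + x + y
        eq = solve-∀

  clientsP : {A : Set} ⦃ _ : Code A ⦄ {n : A → ℕ} → Poly n → Poly (λ a → clients (n a))
  clientsP N = mapP (sucP ₂P) (downFromP N)

  orderP : Poly {(ℕ × ℕ) × List (List ℕ)} (λ ((n , N) , Ls) → order n N Ls)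
  orderP = concatMapP (filterP {P? = λ ((((n , N) , Ls) , c) , u) → count u Ls ≟ c}
      (eqP (countP ₂P (sndP ₁₁P)) ₂₁P) (clientsP (fstP ₁₁P)))
    (downFromP (sucP ₂₁P))

  numberP : {A X : Set} ⦃ _ : Code A ⦄ ⦃ _ : Code X ⦄ {Ls : A → List X} → Poly Ls → Poly (λ a → number 0 (Ls a))
  numberP {X = X} {Ls} L = extP (λ a → go (Ls a) [])
    (foldlP L nilP (appendP acc (consP (pairP (lengthP acc) ₂₂P) nilP))
      (bnd-+ (bnd-const 1) (bnd-* (out-bnd L) (bnd-+ (bnd-const 3) (bnd-+ (bnd-* (bnd-const 2) (out-bnd L)) (out-bnd L)))))
      λ a ys zs eq → ≤-trans (≤-reflexive (cong sz (go ys []))) (≤-trans (small (sz (Ls a)) 0 ys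
          (≤-trans (≤-reflexive (+-identityʳ _)) (≤-trans (length≤sz {⊤} {X} {⊤} ys) (pre ys zs eq))) (pre ys zs eq))
        (s≤s (*-monoˡ-≤ _ (≤-trans (length≤sz {⊤} {X} {⊤} ys) (pre ys zs eq))))))
    where
    acc = ₁₂P
    pre : ∀ {l : List X} ys zs → l ≡ ys ++ zs → sz ys ≤ sz l
    pre ys zs refl = sz-prefix ys zs
    step : List (ℕ × X) → X → List (ℕ × X)
    step acc P = acc ++ (length acc , P) ∷ []
    go : ∀ Ls acc → foldl step acc Ls ≡ acc ++ number (length acc) Ls
    go []       acc = sym (Listₚ.++-identityʳ acc)
    go (P ∷ Ls) acc = trans (go Ls (step acc P)) (trans (Listₚ.++-assoc acc _ _)
      (cong (λ k → acc ++ (length acc , P) ∷ number k Ls) (trans (Listₚ.length-++ acc) (+-comm _ 1))))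
    small : ∀ B k ys → length ys + k ≤ B → sz ys ≤ B → sz (number k ys) ≤ 1 + length ys * (3 + (2 * B + B))
    small B k []       _  _  = ≤-refl
    small B k (P ∷ ys) le le′ = s≤s (≤-trans (+-mono-≤ (s≤s (+-mono-≤ (≤-trans (≤-reflexive (unary-size k)) (s≤s (*-monoʳ-≤ 2 (≤-trans (m≤n+m k (suc (length ys))) le))))
                                                        (≤-trans (m≤n⇒m≤1+n (m≤m+n (sz P) (sz ys))) le′)))
        (small B (suc k) ys (≤-trans (≤-reflexive (+-suc (length ys) k)) le) (≤-trans (m≤n⇒m≤1+n (m≤n+m (sz ys) (sz P))) le′)))
      (≤-reflexive (eq (2 * B) B (length ys * (3 + (2 * B + B))))))
      where
      eq : ∀ x y z → suc (1 + x + y) + (1 + z) ≡ 3 + (x + y) + z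
      eq = solve-∀

  module _ {A : Set} ⦃ _ : Code A ⦄ where

    wkP : {X B : Set} ⦃ _ : Code X ⦄ ⦃ _ : Code B ⦄ {f : A → B} → Poly f → Poly {A × X} (λ i → f (proj₁ i))
    wkP P = P ∘P ₁P

    containsP : {v : A → ℕ} {es : A → List Entry} → Poly v → Poly es → Poly (λ a → does (contains? (v a) (es a)))
    containsP {v} V L = anyP {P? = λ (a , e) → vert e ≟ v a} (eqP ₁₂P (wkP V)) L

    fitsP : {e : A → Entry} {es : A → List Entry} → Poly e → Poly es → Poly (λ a → does (fits? (e a) (es a)))
    fitsP E L = andP (orP (eqP (fstP (sndP E)) (constP 0)) (containsP (fstP (sndP E)) L)) (notP (containsP (fstP E) L))

  module _ {A : Set} ⦃ _ : Code A ⦄ {e : A → Entry} {O : A → List (List Entry)} (E : Poly e) (P : Poly O) where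

    private
      br : Poly (λ a → breakAt (fits? (e a)) (O a))
      br = breakAtP {P? = λ (a , es) → fits? (e a) es} (fitsP (wkP E) ₂P) P

    placeP : Poly (λ a → place (e a) (O a))
    placeP = caseListP (sndP br) P
      (appendP (fstP (wkP br)) (consP (appendP ₁₂P (consP (wkP E) nilP)) ₂₂P))

  module _ {A : Set} ⦃ _ : Code A ⦄ where

    keyP : {b i : A → ℕ} {e : A → Entry} → Poly b → Poly i → Poly e → Poly (λ a → does (key? (b a) (i a) (e a)))
    keyP B I E = andP (eqP (fstP E) B) (eqP (sndP (sndP E)) I)

    reparentP : {v b i : A → ℕ} {e : A → Entry} → Poly v → Poly b → Poly i → Poly e → Poly (λ a → reparent (v a) (b a) (i a) (e a))
    reparentP V B I E = ifP (keyP B I E) (pairP B (pairP V I)) E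

    settleP : {L : A → List (List Entry)} {s : A → List Entry × List Entry} {R : A → List (List Entry)} →
              Poly L → Poly s → Poly R → Poly (λ a → settle (L a) (s a) (R a))
    settleP {L} {s} {R} P S Q = caseListP (sndP S) O₁ (placeP ₁₂P (wkP O₁))
      where
      O₁ : Poly (λ a → L a ++ proj₁ (s a) ∷ R a)
      O₁ = appendP P (consP (fstP S) Q)

  module _ {A : Set} ⦃ _ : Code A ⦄ {v b i : A → ℕ} (V : Poly v) (B : Poly b) (I : Poly i) where

    spliceP : {L R : A → List Entry} {e : A → Entry} → Poly L → Poly e → Poly R →
              Poly (λ a → splice (v a) (b a) (i a) (L a) (e a) (R a))
    spliceP {L} {R} {e} P E Q = ifP (eqP (fstP E) V) (pairP (appendP P (consP E moved)) freed)
        (pairP (appendP P (consP (pairP V (pairP (fstP (sndP E)) I)) (consP (pairP B (pairP V I)) kept))) removed)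
      where
      moved : Poly (λ a → map (reparent (v a) (b a) (i a)) (R a))
      moved = mapP {f = λ (a , x) → reparent (v a) (b a) (i a) x} (reparentP (wkP V) (wkP B) (wkP I) ₂P) Q
      freed : Poly (λ a → map (λ x → v a , par x , i a) (filter (key? (b a) (i a)) (R a)))
      freed = mapP {f = λ (a , x) → v a , par x , i a} (pairP (wkP V) (pairP (fstP ₂₂P) (wkP I)))
        (filterP {P? = λ (a , x) → key? (b a) (i a) x} (keyP (wkP B) (wkP I) ₂P) Q)
      kept : Poly (λ a → filter (λ x → ¬? (vert x ≟ v a)) (R a))
      kept = filterP {P? = λ (a , x) → ¬? (vert x ≟ v a)} (notP (eqP ₁₂P (wkP V))) Q
      removed : Poly (λ a → filter (λ x → vert x ≟ v a) (R a))
      removed = filterP {P? = λ (a , x) → vert x ≟ v a} (eqP ₁₂P (wkP V)) Q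

  module _ {A : Set} ⦃ _ : Code A ⦄ {v b i : A → ℕ} (V : Poly v) (B : Poly b) (I : Poly i) where

    subdivideP : {es : A → List Entry} → Poly es → Poly (λ a → subdivide (v a) (b a) (i a) (es a))
    subdivideP {es} L = caseListP (sndP br) (pairP L nilP)
        (spliceP (wkP V) (wkP B) (wkP I) (fstP (wkP br)) ₁₂P ₂₂P)
      where
      br : Poly (λ a → breakAt (stop? (v a) (b a) (i a)) (es a))
      br = breakAtP {P? = λ (a , e) → stop? (v a) (b a) (i a) e} (orP (eqP ₁₂P (wkP V)) (keyP (wkP B) (wkP I) ₂P)) L

  module _ {A : Set} ⦃ _ : Code A ⦄ {v b i : A → ℕ} (V : Poly v) (B : Poly b) (I : Poly i) where

    splitArcP : {O : A → List (List Entry)} → Poly O → Poly (λ a → splitArc (v a) (b a) (i a) (O a))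
    splitArcP {O} P = caseListP (sndP br) P
        (settleP (fstP (wkP br)) (subdivideP (wkP V) (wkP B) (wkP I) ₁₂P) ₂₂P)
      where
      br : Poly (λ a → breakAt (hasKey? (b a) (i a)) (O a))
      br = breakAtP {P? = λ (a , es) → hasKey? (b a) (i a) es}
        (anyP {P? = λ ((a , es) , e) → key? (b a) (i a) e} (keyP (wkP (wkP B)) (wkP (wkP I)) ₂P) ₂P) P

  lastOfP : {A : Set} ⦃ _ : Code A ⦄ {xs : A → List ℕ} → Poly xs → Poly (λ a → lastOf 0 (xs a))
  lastOfP L = foldl⁺P L (constP 0) ₂₂P (out-bnd ₂P) (λ a b x → m≤n+m (sz x) (sz b))

  keepP : {A : Set} ⦃ _ : Code A ⦄ {I xs : A → List ℕ} → Poly I → Poly xs → Poly (λ a → keep (I a) (xs a))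
  keepP {I = I} J L = filterP {P? = λ (a , x) → memb? x (I a)} (memP ₂P (J ∘P ₁P)) L

  insertArcP : {A : Set} ⦃ _ : Code A ⦄ {I : A → List ℕ} {v : A → ℕ} {O : A → List (List Entry)} {p : A → Path} →
               Poly I → Poly v → Poly O → Poly p → Poly (λ a → insertArc (I a) (v a) (O a) (p a))
  insertArcP {v = v} {p = p} J V O P = caseListP (sndP br) O
      (caseListP (keepP (wkP J) ₂₂P)
        (placeP (pairP (wkP V) (pairP (lastOfP (keepP (wkP J) (fstP (wkP br)))) (wkP (fstP P)))) (wkP O))
        (splitArcP (wkP (wkP V)) ₁₂P (wkP (wkP (fstP P))) (wkP (wkP O))))
    where
    br : Poly (λ a → breakAt (v a ≟_) (proj₂ (p a)))
    br = breakAtP {P? = λ (a , x) → v a ≟ x} (eqP (wkP V) ₂P) (sndP P)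

  sz-∈ : {X : Set} ⦃ _ : Code X ⦄ {x : X} {xs : List X} → x ∈ xs → sz x ≤ sz xs
  sz-∈ (here refl) = m≤n⇒m≤1+n (m≤m+n _ _)
  sz-∈ (there x∈)  = m≤n⇒m≤1+n (≤-trans (sz-∈ x∈) (m≤n+m _ _))

  Small : ℕ → Entry → Set
  Small B e = sz (vert e) ≤ B × sz (par e) ≤ B × sz (pid e) ≤ B

  record Fit (B K m : ℕ) (O : List (List Entry)) : Set where
    field
      small   : All (All (Small B)) O
      width   : length O ≤ K
      entries : Sum length O ≤ m

  sz-fit : ∀ {B K m O} → Fit B K m O → sz O ≤ 1 + 2 * K + m * (3 + 3 * B)
  sz-fit {B} {K} {m} {O} F = ≤-trans (go O (Fit.small F))
    (s≤s (+-mono-≤ (*-monoʳ-≤ 2 (Fit.width F)) (*-monoˡ-≤ (3 + 3 * B) (Fit.entries F))))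
    where
    row : ∀ es → All (Small B) es → sz es ≤ 1 + length es * (3 + 3 * B)
    row []       []                  = ≤-refl
    row (e ∷ es) ((v , a , i) ∷ ss) = s≤s (≤-trans (+-mono-≤ (s≤s (+-mono-≤ v (s≤s (+-mono-≤ a i)))) (row es ss)) (≤-reflexive (eq B _)))
      where
      eq : ∀ b l → 1 + (b + (1 + (b + b))) + (1 + l) ≡ 3 + 3 * b + l
      eq = solve-∀
    go : ∀ O → All (All (Small B)) O → sz O ≤ 1 + (2 * length O + Sum length O * (3 + 3 * B))
    go []       []       = ≤-refl
    go (es ∷ O) (s ∷ ss) = s≤s (≤-trans (+-mono-≤ (row es s) (go O ss)) (≤-reflexive (eq (length es) (length O) (Sum length O) (3 + 3 * B))))
      where
      eq : ∀ l k s c → 1 + l * c + (1 + (2 * k + s * c)) ≡ 2 * suc k + (l + s) * c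
      eq = solve-∀

  breakAt-All : ∀ {X : Set} {P Q : X → Set} (P? : ∀ x → Dec (P x)) {xs} → All Q xs →
                All Q (proj₁ (breakAt P? xs)) × All Q (proj₂ (breakAt P? xs))
  breakAt-All {Q = Q} P? {xs} qs = Allₚ.++⁻ (proj₁ (breakAt P? xs)) (subst (All Q) (sym (breakAt-++ P? xs)) qs)

  place-fit : ∀ {B K m e O} → Small B e → Fit B K m O → Fit B K (suc m) (place e O)
  place-fit {B} {K} {m} {e} {O} s F with proj₂ (breakAt (fits? e) O) | breakAt-All (fits? e) (Fit.small F) | breakAt-++ (fits? e) O
  ... | []     | _ | _ = record { small = Fit.small F ; width = Fit.width F ; entries = m≤n⇒m≤1+n (Fit.entries F) }
  ... | es ∷ R | sL , (ses ∷ sR) | eq = record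
    { small = Allₚ.++⁺ sL (Allₚ.++⁺ ses (s ∷ []) ∷ sR)
    ; width = ≤-trans (≤-reflexive (trans (trans (Listₚ.length-++ L) (sym (Listₚ.length-++ L))) (cong length eq))) (Fit.width F)
    ; entries = ≤-trans (≤-reflexive (trans (Sum-++ length L _) (trans (cong (λ x → Sum length L + (x + Sum length R)) (Listₚ.length-++ es))
        (trans (eq′ (Sum length L) (length es) (Sum length R)) (cong suc (trans (sym (Sum-++ length L _)) (cong (Sum length) eq))))))) (s≤s (Fit.entries F)) }
    where
    L = proj₁ (breakAt (fits? e) O)
    eq′ : ∀ l x r → l + (x + 1 + r) ≡ suc (l + (x + r))
    eq′ = solve-∀

  splice-fit : ∀ {B v b i} L e R → sz v ≤ B → sz b ≤ B → sz i ≤ B → All (Small B) L → Small B e → All (Small B) R →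
    let r = splice v b i L e R in
    All (Small B) (proj₁ r) × All (Small B) (proj₂ r) × length (proj₁ r) ≤ suc (length (L ++ e ∷ R))
  splice-fit {B} {v} {b} {i} L e R v≤ b≤ i≤ sL se sR with does (vert e ≟ v)
  ... | true  = Allₚ.++⁺ sL (se ∷ Allₚ.map⁺ (All.map re sR)) ,
                Allₚ.map⁺ (All.map (λ s → v≤ , proj₁ (proj₂ s) , i≤) (Allₚ.filter⁺ (key? b i) sR)) ,
                ≤-trans (≤-reflexive (trans (Listₚ.length-++ L) (trans (cong (λ x → length L + suc x) (Listₚ.length-map (reparent v b i) R))
                  (sym (Listₚ.length-++ L))))) (n≤1+n _)
    where
    re : ∀ {x} → Small B x → Small B (reparent v b i x)
    re {x} s with does (key? b i x)
    ... | true  = b≤ , v≤ , i≤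
    ... | false = s
  ... | false = Allₚ.++⁺ sL ((v≤ , proj₁ (proj₂ se) , i≤) ∷ (b≤ , v≤ , i≤) ∷ Allₚ.filter⁺ (λ x → ¬? (vert x ≟ v)) sR) ,
                Allₚ.filter⁺ (λ x → vert x ≟ v) sR ,
                ≤-trans (≤-reflexive (Listₚ.length-++ L)) (≤-trans (+-monoʳ-≤ (length L) (s≤s (s≤s (Listₚ.length-filter (λ x → ¬? (vert x ≟ v)) R))))
                  (≤-reflexive (trans (+-suc (length L) _) (cong suc (sym (Listₚ.length-++ L))))))

  subdivide-fit : ∀ {B v b i es} → sz v ≤ B → sz b ≤ B → sz i ≤ B → All (Small B) es →
    let r = subdivide v b i es in
    All (Small B) (proj₁ r) × All (Small B) (proj₂ r) × length (proj₁ r) ≤ suc (length es)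
  subdivide-fit {B} {v} {b} {i} {es} v≤ b≤ i≤ ses
    with proj₂ (breakAt (stop? v b i) es) | breakAt-All (stop? v b i) ses | breakAt-++ (stop? v b i) es
  ... | []    | _ | _ = ses , [] , n≤1+n _
  ... | e ∷ R | sL , (se ∷ sR) | eq = let (p , q , r) = splice-fit (proj₁ (breakAt (stop? v b i) es)) e R v≤ b≤ i≤ sL se sR in
          p , q , ≤-trans r (s≤s (≤-reflexive (cong length eq)))

  splitArc-fit : ∀ {B K m v b i O} → sz v ≤ B → sz b ≤ B → sz i ≤ B → Fit B K m O → Fit B K (2 + m) (splitArc v b i O)
  splitArc-fit {B} {K} {m} {v} {b} {i} {O} v≤ b≤ i≤ F
    with proj₂ (breakAt (hasKey? b i) O) | breakAt-All (hasKey? b i) (Fit.small F) | breakAt-++ (hasKey? b i) O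
  ... | []     | _ | _ = record { small = Fit.small F ; width = Fit.width F ; entries = m≤n⇒m≤o+n 2 (Fit.entries F) }
  ... | es ∷ R | sL , (ses ∷ sR) | eq = settled (proj₂ (subdivide v b i es)) (proj₁ (proj₂ sub))
    where
    L = proj₁ (breakAt (hasKey? b i) O)
    sub = subdivide-fit {B} {v} {b} {i} {es} v≤ b≤ i≤ ses
    O₁ = L ++ proj₁ (subdivide v b i es) ∷ R
    fit₁ : Fit B K (suc m) O₁
    fit₁ = record
      { small = Allₚ.++⁺ sL (proj₁ sub ∷ sR)
      ; width = ≤-trans (≤-reflexive (trans (trans (Listₚ.length-++ L) (sym (Listₚ.length-++ L))) (cong length eq))) (Fit.width F)
      ; entries = ≤-trans (≤-reflexive (Sum-++ length L _)) (≤-trans (+-monoʳ-≤ (Sum length L) (+-monoˡ-≤ (Sum length R) (proj₂ (proj₂ sub))))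
          (≤-trans (≤-reflexive (trans (+-suc (Sum length L) _) (cong suc (trans (sym (Sum-++ length L _)) (cong (Sum length) eq))))) (s≤s (Fit.entries F)))) }
    settled : ∀ fr → All (Small B) fr → Fit B K (2 + m) (caseList fr O₁ (λ e _ → place e O₁))
    settled []       _       = record { small = Fit.small fit₁ ; width = Fit.width fit₁ ; entries = m≤n⇒m≤1+n (Fit.entries fit₁) }
    settled (e ∷ fr) (s ∷ _) = place-fit s fit₁

  insertArc-fit : ∀ {B K m O} I v p → sz v ≤ B → sz p ≤ B → Fit B K m O → Fit B K (2 + m) (insertArc I v O p)
  insertArc-fit {B} {K} {m} {O} I v (i , P) v≤ p≤ F
    with proj₂ (breakAt (v ≟_) P) | breakAt-All (v ≟_) {P} (All.tabulate (λ {x} x∈ → sz-∈ x∈)) 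
  ... | []    | _ = looser F
    where
    looser : Fit B K m O → Fit B K (2 + m) O
    looser F = record { small = Fit.small F ; width = Fit.width F ; entries = m≤n⇒m≤o+n 2 (Fit.entries F) }
  ... | _ ∷ r | sl , (_ ∷ sr) with keep I r | Allₚ.filter⁺ (λ x → memb? x I) sr
  ...   | []    | _ = let F′ = place-fit (v≤ , last≤ , i≤) F in
            record { small = Fit.small F′ ; width = Fit.width F′ ; entries = m≤n⇒m≤1+n (Fit.entries F′) }
    where
    l = proj₁ (breakAt (v ≟_) P)
    i≤ : sz i ≤ B
    i≤ = ≤-trans (m≤n⇒m≤1+n (m≤m+n (sz i) (sz P))) p≤
    P≤ : sz P ≤ B
    P≤ = ≤-trans (m≤n⇒m≤1+n (m≤n+m (sz P) (sz i))) p≤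
    last≤ : sz (lastOf 0 (keep I l)) ≤ B
    last≤ with lastOf-∈ 0 (keep I l)
    ... | inj₁ eq = ≤-trans (≤-reflexive (cong sz eq)) (≤-trans (size≥1 (enc P)) P≤)
    ... | inj₂ m∈ = ≤-trans (All.lookup (Allₚ.filter⁺ (λ x → memb? x I) sl) m∈) P≤
  ...   | b ∷ _ | sb ∷ _ = splitArc-fit v≤ (≤-trans sb (≤-trans (m≤n⇒m≤1+n (m≤n+m (sz P) (sz i))) p≤))
            (≤-trans (m≤n⇒m≤1+n (m≤m+n (sz i) (sz P))) p≤) F

  sweep-fit : ∀ {B K m O} I v Ps → sz v ≤ B → sz Ps ≤ B → Fit B K m O → Fit B K (length Ps * 2 + m) (foldl (insertArc I v) O Ps)
  sweep-fit I v []       v≤ Ps≤ F = F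
  sweep-fit {B} {K} {m} {O} I v (p ∷ Ps) v≤ Ps≤ F = subst (λ k → Fit B K k (foldl (insertArc I v) O (p ∷ Ps))) (eq (length Ps * 2) m)
    (sweep-fit I v Ps v≤ (≤-trans (m≤n⇒m≤1+n (m≤n+m (sz Ps) (sz p))) Ps≤)
      (insertArc-fit I v p v≤ (≤-trans (m≤n⇒m≤1+n (m≤m+n (sz p) (sz Ps))) Ps≤) F))
    where
    eq : ∀ l m → l + (2 + m) ≡ 2 + l + m
    eq = solve-∀

  initial-fit : ∀ O → Fit (sz O) (sz O) (sz O) O
  initial-fit O = record
    { small = All.tabulate (λ {es} es∈ → All.tabulate λ {e} e∈ → parts e (≤-trans (sz-∈ e∈) (sz-∈ es∈)))
    ; width = length≤sz {⊤} {List Entry} {⊤} O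
    ; entries = go O }
    where
    parts : ∀ e → sz e ≤ sz O → Small (sz O) e
    parts (v , a , i) le = ≤-trans (m≤n⇒m≤1+n (m≤m+n (sz v) _)) le ,
      ≤-trans (m≤n⇒m≤1+n (≤-trans (m≤n⇒m≤1+n (m≤m+n (sz a) (sz i))) (m≤n+m _ (sz v)))) le ,
      ≤-trans (m≤n⇒m≤1+n (≤-trans (m≤n⇒m≤1+n (m≤n+m (sz i) (sz a))) (m≤n+m _ (sz v)))) le
    go : ∀ O → Sum length O ≤ sz O
    go []       = z≤n
    go (es ∷ O) = m≤n⇒m≤1+n (+-mono-≤ (length≤sz {⊤} {Entry} {⊤} es) (go O))

  fit-mono : ∀ {B B′ K K′ m m′ O} → B ≤ B′ → K ≤ K′ → m ≤ m′ → Fit B K m O → Fit B′ K′ m′ O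
  fit-mono B≤ K≤ m≤ F = record
    { small = All.map (All.map λ (v , a , i) → ≤-trans v B≤ , ≤-trans a B≤ , ≤-trans i B≤) (Fit.small F)
    ; width = ≤-trans (Fit.width F) K≤ ; entries = ≤-trans (Fit.entries F) m≤ }

  SweepIn : Set
  SweepIn = (List ℕ × ℕ) × (List (List Entry) × List Path)

  sweepP : Poly {SweepIn} (λ ((I , v) , (O , Ps)) → foldl (insertArc I v) O Ps)
  sweepP = foldlP ₂₂P ₁₂P stepP size-bound bound
    where
    stepP : Poly {SweepIn × List (List Entry) × Path} (λ (((I , v) , _) , O , p) → insertArc I v O p)
    stepP = insertArcP (fstP ₁₁P) (sndP ₁₁P) ₁₂P ₂₂P
    size-bound : Bnd {SweepIn} (λ i → 1 + 2 * sz i + (sz i * 2 + sz i) * (3 + 3 * sz i))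
    size-bound = bnd-+ (bnd-+ (bnd-const 1) (bnd-* (bnd-const 2) bnd-sz)) (bnd-* (bnd-+ (bnd-* bnd-sz (bnd-const 2)) bnd-sz) (bnd-+ (bnd-const 3) (bnd-* (bnd-const 3) bnd-sz)))
    bound : ∀ (i : SweepIn) → let ((I , v) , (O , Ps)) = i in
            prefixes (insertArc I v) O Ps (λ O′ → sz O′ ≤ 1 + 2 * sz i + (sz i * 2 + sz i) * (3 + 3 * sz i))
    bound i@((I , v) , (O , Ps)) ys zs refl = sz-fit (fit-mono ≤-refl ≤-refl
        (+-monoˡ-≤ (sz i) (*-monoˡ-≤ 2 (≤-trans (length≤sz {⊤} {Path} {⊤} ys) ys≤)))
        (sweep-fit {sz i} {sz i} {sz i} I v ys v≤ ys≤ (fit-mono O≤ O≤ O≤ (initial-fit O))))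
      where
      rest≤ : sz (O , ys ++ zs) ≤ sz i
      rest≤ = m≤n⇒m≤1+n (m≤n+m _ (sz (I , v)))
      O≤ : sz O ≤ sz i
      O≤ = ≤-trans (m≤n⇒m≤1+n (m≤m+n (sz O) _)) rest≤
      ys≤ : sz ys ≤ sz i
      ys≤ = ≤-trans (sz-prefix ys zs) (≤-trans (m≤n⇒m≤1+n (m≤n+m (sz (ys ++ zs)) (sz O))) rest≤)
      v≤ : sz v ≤ sz i
      v≤ = ≤-trans (m≤n⇒m≤1+n (m≤n+m (sz v) (sz I))) (m≤n⇒m≤1+n (m≤m+n (sz (I , v)) _))

  insertVertexP : {A : Set} ⦃ _ : Code A ⦄ {Ps : A → List Path} {s : A → List ℕ × List (List Entry)} {v : A → ℕ} →
                  Poly Ps → Poly s → Poly v → Poly (λ a → insertVertex (Ps a) (s a) (v a))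
  insertVertexP P S V = pairP (consP V (fstP S)) (sweepP ∘P pairP (pairP (fstP S) V) (pairP (sndP S) P))

  BranchIn : Set
  BranchIn = (ℕ × List ℕ) × List Path

  branchingsP : Poly {BranchIn} (λ ((N , order) , Ps) → branchings N order Ps)
  branchingsP = sndP (foldlP ₂₁P (pairP nilP (replicateP ₁₁P nilP)) stepP size-bound bound)
    where
    stepP : Poly {BranchIn × (List ℕ × List (List Entry)) × ℕ} (λ ((_ , Ps) , s , v) → insertVertex Ps s v)
    stepP = insertVertexP ₂₁P ₁₂P ₂₂P
    size-bound : Bnd {BranchIn} (λ i → 1 + ((sz i + 1) + (1 + 2 * sz i + (sz i * (sz i * 2)) * (3 + 3 * sz i))))
    size-bound = bnd-+ (bnd-const 1) (bnd-+ (bnd-+ bnd-sz (bnd-const 1)) (bnd-+ (bnd-+ (bnd-const 1) (bnd-* (bnd-const 2) bnd-sz))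
        (bnd-* (bnd-* bnd-sz (bnd-* bnd-sz (bnd-const 2))) (bnd-+ (bnd-const 3) (bnd-* (bnd-const 3) bnd-sz)))))
    bound : ∀ (i : BranchIn) → let ((N , order) , Ps) = i in
            prefixes (insertVertex Ps) ([] , replicate N []) order
              (λ s → sz s ≤ 1 + ((sz i + 1) + (1 + 2 * sz i + (sz i * (sz i * 2)) * (3 + 3 * sz i))))
    bound i@((N , order) , Ps) ys zs refl = s≤s (+-mono-≤
        (≤-trans (seen ys []) (+-monoˡ-≤ 1 ys≤))
        (sz-fit (fit-mono ≤-refl ≤-refl (≤-trans (≤-reflexive (+-identityʳ _)) (*-mono-≤ (≤-trans (length≤sz {⊤} {ℕ} {⊤} ys) ys≤) (*-monoˡ-≤ 2 (≤-trans (length≤sz {⊤} {Path} {⊤} Ps) Ps≤))))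
          (go ys ys≤ [] (replicate N []) 0 start))))
      where
      order≤ : sz (ys ++ zs) ≤ sz i
      order≤ = ≤-trans (m≤n⇒m≤1+n (m≤n+m _ (sz N))) (m≤n⇒m≤1+n (m≤m+n _ (sz Ps)))
      ys≤ : sz ys ≤ sz i
      ys≤ = ≤-trans (sz-prefix ys zs) order≤
      Ps≤ : sz Ps ≤ sz i
      Ps≤ = m≤n⇒m≤1+n (m≤n+m (sz Ps) _)
      N≤ : N ≤ sz i
      N≤ = ≤-trans (≤-trans (m≤m+n N (N + 0)) (≤-trans (n≤1+n _) (≤-reflexive (sym (unary-size N))))) (≤-trans (m≤n⇒m≤1+n (m≤m+n (sz N) _)) (m≤n⇒m≤1+n (m≤m+n _ (sz Ps))))
      seen : ∀ ys I {O} → sz (proj₁ (foldl (insertVertex Ps) (I , O) ys)) ≤ sz ys + sz I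
      seen []       I = n≤1+n _
      seen (y ∷ ys) I = ≤-trans (seen ys (y ∷ I)) (≤-reflexive (eq (sz ys) (sz y) (sz I)))
        where
        eq : ∀ a b c → a + suc (b + c) ≡ suc (b + a) + c
        eq = solve-∀
      start : Fit (sz i) (sz i) 0 (replicate N [])
      start = record { small = Allₚ.replicate⁺ N [] ; width = ≤-trans (≤-reflexive (Listₚ.length-replicate N)) N≤
                     ; entries = ≤-reflexive (trans (Sum-replicate length N []) (*-zeroʳ N)) }
      go : ∀ ys → sz ys ≤ sz i → ∀ I O m → Fit (sz i) (sz i) m O →
           Fit (sz i) (sz i) (length ys * (length Ps * 2) + m) (proj₂ (foldl (insertVertex Ps) (I , O) ys))
      go []       le I O m F = F
      go (y ∷ ys) le I O m F = subst (λ k → Fit (sz i) (sz i) k (proj₂ (foldl (insertVertex Ps) (I , O) (y ∷ ys)))) (eq (length ys * (length Ps * 2)) (length Ps * 2) m)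
        (go ys (≤-trans (m≤n⇒m≤1+n (m≤n+m (sz ys) (sz y))) le) (y ∷ I) _ (length Ps * 2 + m)
          (sweep-fit I y Ps (≤-trans (m≤n⇒m≤1+n (m≤m+n (sz y) (sz ys))) le) Ps≤ F))
        where
        eq : ∀ a b c → a + (b + c) ≡ b + a + c
        eq = solve-∀

  instance
    code-ℚ : Code ℚ
    code-ℚ = record { enc = encℚ }

  dist : List (List ℕ) → ℕ → ℕ → ℕ
  dist D u v = nth 0 (nth [] D u) v

  Table : Set
  Table = List (List ℕ)

  module _ {A : Set} ⦃ _ : Code A ⦄ where

    forestP : {n N : A → ℕ} {Ls : A → List (List ℕ)} → Poly n → Poly N → Poly Ls → Poly (λ a → forest (n a) (N a) (Ls a))
    forestP {N = N} {Ls} P M L = branchingsP ∘P pairP (pairP M (orderP ∘P pairP (pairP P M) tr)) (numberP tr)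
      where
      tr : Poly (λ a → trunc (N a) (Ls a))
      tr = truncP ∘P pairP M L

    distP : {D : A → Table} {u v : A → ℕ} → Poly D → Poly u → Poly v → Poly (λ a → dist (D a) (u a) (v a))
    distP D U V = nthP (constP 0) (nthP nilP D U) V

    insertAfterP : {u v : A → ℕ} {xs : A → List ℕ} → Poly u → Poly v → Poly xs → Poly (λ a → insertAfter (u a) (v a) (xs a))
    insertAfterP {u} {xs = xs} U V L = caseListP (sndP br) L
        (appendP (fstP (wkP br)) (consP ₁₂P (consP (wkP V) ₂₂P)))
      where
      br : Poly (λ a → breakAt (u a ≟_) (xs a))
      br = breakAtP {P? = λ (a , x) → u a ≟ x} (eqP (wkP U) ₂P) L

  tourP : {A : Set} ⦃ _ : Code A ⦄ {es : A → List Entry} → Poly es → Poly (λ a → tour (es a))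
  tourP {A} L = foldl⁺P L (consP (constP 0) nilP) (insertAfterP (fstP (sndP e)) (fstP e) ₁₂P)
    (bnd-+ (bnd-const 1) (out-bnd (fstP {A = A × Entry} ₂P))) (λ _ xs e → grow (par e) (vert e) xs)
    where
    e : Poly {A × List ℕ × Entry} (λ i → proj₂ (proj₂ i))
    e = ₂₂P
    grow : ∀ a v xs → sz (insertAfter a v xs) ≤ sz xs + (1 + sz v)
    grow a v xs with proj₂ (breakAt (a ≟_) xs) | breakAt-++ (a ≟_) xs
    ... | []    | _  = m≤m+n _ _
    ... | x ∷ r | eq = s≤s⁻¹ (≤-trans (≤-reflexive (trans (sz-++ l (x ∷ v ∷ r)) (trans (eq′ (sz l) (sz x) (sz v) (sz r))
          (cong (_+ (1 + sz v)) (sym (trans (cong (suc ∘ sz) (sym eq)) (sz-++ l (x ∷ r)))))))) ≤-refl)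
      where
      l = proj₁ (breakAt (a ≟_) xs)
      eq′ : ∀ l x v r → l + suc (x + suc (v + r)) ≡ l + suc (x + r) + (1 + v)
      eq′ = solve-∀

  Setting : Set
  Setting = Table × (ℕ × ℕ)

  module _ {A : Set} ⦃ _ : Code A ⦄ {D : A → Table} {es : A → List Entry} (T : Poly D) (L : Poly es) where

    private
      costP : Poly (λ a → Metric.treeCost (dist (D a)) (es a))
      costP = SumP {f = λ (a , e) → dist (D a) (par e) (vert e)} (distP (wkP T) (fstP ₂₂P) ₁₂P) L

    candP : {n N : A → ℕ} → Poly (λ a → Candidates.cand (dist (D a)) (n a) (N a) (es a))
    candP = pairP (lengthP L) (pairP (addP costP costP) (tourP L))

  numBitsP : {A : Set} ⦃ _ : Code A ⦄ {q : A → ℚ} → Poly q → Poly (λ a → numBits (q a))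
  numBitsP P = stepsP {f = numBits} (hd ⨾ tl) 3 (λ q → subst (λ d → Run (hd ⨾ tl) (encℚ q) d 3) (sym (enc-nat (↥ q))) (seq hd tl))
      (bnd-≤ (λ q → ≤-trans (≤-reflexive (cong size (enc-nat (↥ q)))) (≤-trans (size-tail (encℤ (↥ q))) (m≤n⇒m≤1+n (m≤m+n _ _)))) bnd-sz) ∘P P
    where
    enc-nat : ∀ i → enc (natBits i) ≡ tail (encℤ i)
    enc-nat (ℤ.+ k)  = enc-bits k
    enc-nat -[1+ k ] = enc-bits k
    size-tail : ∀ d → size (tail d) ≤ size d
    size-tail nil     = ≤-refl
    size-tail (_ · b) = m≤n⇒m≤1+n (m≤n+m _ _)

  denBitsP : {A : Set} ⦃ _ : Code A ⦄ {q : A → ℚ} → Poly q → Poly (λ a → denBits (q a))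
  denBitsP P = stepsP {f = denBits} (tl ⨾ tl) 3 (λ q → subst (λ d → Run (tl ⨾ tl) (encℚ q) d 3) (sym (enc-nat (↧ q))) (seq tl tl))
      (bnd-≤ (λ q → ≤-trans (≤-reflexive (cong size (enc-nat (↧ q)))) (≤-trans (size-tail (encℤ (↧ q))) (m≤n⇒m≤1+n (m≤n+m _ _)))) bnd-sz) ∘P P
    where
    enc-nat : ∀ i → enc (natBits i) ≡ tail (encℤ i)
    enc-nat (ℤ.+ k)  = enc-bits k
    enc-nat -[1+ k ] = enc-bits k
    size-tail : ∀ d → size (tail d) ≤ size d
    size-tail nil     = ≤-refl
    size-tail (_ · b) = m≤n⇒m≤1+n (m≤n+m _ _)

  module _ {A : Set} ⦃ _ : Code A ⦄ where

    copiesP : {N : A → ℕ} {z : A → List Weighted} → Poly N → Poly z → Poly (λ a → copies (N a) (z a))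
    copiesP {N} M Z = concatMapP {f = λ (a , (P , w)) → replicate (mult (N a) w) P}
      (replicateP (quantP (wkP M) (wkP M) (numBitsP w) (denBitsP w)) ₁₂P) Z
      where
      w : Poly {A × Weighted} (λ i → proj₂ (proj₂ i))
      w = ₂₂P

    candsP : {D : A → Table} {n N : A → ℕ} {z : A → List Weighted} → Poly D → Poly n → Poly N → Poly z →
             Poly (λ a → Candidates.cands (dist (D a)) (n a) (N a) (z a))
    candsP {D} {n} {N} T P M Z = mapP {f = λ (a , es) → Candidates.cand (dist (D a)) (n a) (N a) es}
      (candP (wkP T) ₂P {λ (a , _) → n a} {λ (a , _) → N a}) (forestP P M (copiesP M Z))

  Found : Set
  Found = ℕ × List (List ℕ)

  module _ {A : Set} ⦃ _ : Code A ⦄ {n k : A → ℕ} (N : Poly n) (K : Poly k) where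

    valueP : {o : A → Opt} → Poly o → Poly (λ a → value (n a) (k a) (o a))
    valueP O = addP (mulP (sndP (fstP O)) (monusP N K)) (fstP (sndP O))

    foundP : {o : A → Opt} → Poly o → Poly {A} {Found} (λ a → value (n a) (k a) (o a) , plan (o a))
    foundP O = pairP (valueP O) (sndP (sndP O))

    pickP : {b : A → Found} {o : A → Opt} → Poly b → Poly o → Poly (λ a → pick (n a) (k a) (b a) (o a))
    pickP B O = ifP (leqP (fstP B) (valueP O)) B (foundP O)

  module _ {A : Set} ⦃ _ : Code A ⦄ {n k : A → ℕ} (N : Poly n) (K : Poly k) where

    private
      scanP : Poly {A × Opt × List Opt} (λ (a , o , os) → foldl (pick (n a) (k a)) (value (n a) (k a) o , plan o) os)
      scanP = foldl⁺P ₂₂P (foundP (wkP N) (wkP K) ₁₂P)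
        (pickP (wkP (wkP N)) (wkP (wkP K)) ₁₂P ₂₂P)
        (out-bnd (foundP (wkP {X = Opt} (wkP {X = Opt × List Opt} N)) (wkP (wkP K)) ₂P))
        λ (a , _) b o → grow (n a) (k a) b o
        where
        grow : ∀ n k b o → sz (pick n k b o) ≤ sz b + sz {Found} (value n k o , plan o)
        grow n k b o with does (proj₁ b ≤? value n k o)
        ... | true  = m≤m+n _ _
        ... | false = m≤n+m _ (sz b)

    bestP : {os : A → List Opt} → Poly os → Poly (λ a → best (n a) (k a) (os a))
    bestP L = ifP (leqP N K) (constP (0 , [])) (caseListP L (constP (0 , [])) scanP)

  extendP : {A : Set} ⦃ _ : Code A ⦄ {n : A → ℕ} {c : A → Cand} {os : A → List Opt} →
            Poly n → Poly c → Poly os → Poly (λ a → extend (n a) (c a) (os a))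
  extendP {n = n} {c} {os} N C O = consP (pairP (pairP (fstP C) (fstP (sndP C))) (pairP (fstP b) (consP (sndP (sndP C)) (sndP b)))) O
    where
    b : Poly (λ a → best (n a) (size-of (c a)) (os a))
    b = bestP N (fstP C) O

  best-from : ∀ n k os → best n k os ≡ (0 , []) ⊎ (∃[ o ] o ∈ os × best n k os ≡ (value n k o , plan o))
  best-from n k []       with does (n ≤? k)
  ... | true  = inj₁ refl
  ... | false = inj₁ refl
  best-from n k (o ∷ os) = case n ≤? k of λ
    { (yes le) → inj₁ (best-full n k (o ∷ os) le)
    ; (no nle) → inj₂ (best-is n k (here refl) nle) }

  optionsP : Poly {ℕ × List Cand} (λ (n , cs) → options n cs)
  optionsP = foldrP ₂P nilP (extendP ₁₁P ₁₂P ₂₂P)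
      (bnd-+ (bnd-const 1) (bnd-* bnd-sz (bnd-+ (bnd-const 5) (bnd-+ (bnd-* (bnd-const 3) bnd-sz) (bnd-* (bnd-const 2) (bnd-* bnd-sz bnd-sz))))))
      λ { i@(n , cs) ys zs refl → let zs≤ = ≤-trans (sz-suffix ys zs) (m≤n⇒m≤1+n (m≤n+m _ (sz n))) in
          ≤-trans (total-size (sz i) (options n zs) (All.map (λ {o} → each i zs zs≤ (m≤n⇒m≤1+n (≤-trans (≤n n) (m≤m+n (sz n) _))) {o}) (limits n zs)))
            (s≤s (*-monoˡ-≤ _ (≤-trans (≤-reflexive (length-options n zs)) (≤-trans (length≤sz {⊤} {Cand} {⊤} zs) zs≤)))) }
    where
    ≤n : ∀ n → n ≤ sz n
    ≤n n = ≤-trans (m≤m+n n (n + 0)) (≤-trans (n≤1+n _) (≤-reflexive (sym (unary-size n))))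
    Limit : ℕ → List Cand → Opt → Set
    Limit n zs ((k , c) , rest , pl) = sz (k , c) ≤ sz zs × c * n + rest ≤ n * Sum price zs × sz pl ≤ sz zs
    limits : ∀ n zs → All (Limit n zs) (options n zs)
    limits n []             = []
    limits n (cd@(k , c , τ) ∷ zs) = new ∷ All.map (λ {o} (p , q , r) → weaken p , ≤-trans q (*-monoʳ-≤ n (m≤n+m _ c)) , weaken r) (limits n zs)
      where
      weaken : ∀ {x} → x ≤ sz zs → x ≤ sz (cd ∷ zs)
      weaken le = m≤n⇒m≤1+n (≤-trans le (m≤n+m _ (sz cd)))
      kc≤ : sz (k , c) ≤ sz (cd ∷ zs)
      kc≤ = s≤s (≤-trans (+-monoʳ-≤ (sz k) (≤-trans (m≤m+n (sz c) (sz τ)) (n≤1+n _))) (≤-trans (n≤1+n _) (m≤m+n (sz cd) (sz zs))))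
      τ≤ : ∀ {x} → x ≤ sz zs → suc (sz τ + x) ≤ sz (cd ∷ zs)
      τ≤ le = s≤s (+-mono-≤ (m≤n⇒m≤1+n (≤-trans (m≤n⇒m≤1+n (m≤n+m (sz τ) (sz c))) (m≤n+m _ (sz k)))) le)
      new : Limit n (cd ∷ zs) ((k , c) , proj₁ (best n k (options n zs)) , τ ∷ proj₂ (best n k (options n zs)))
      new with best-from n k (options n zs)
      ... | inj₁ eq rewrite eq = kc≤ , ≤-trans (≤-reflexive (trans (+-identityʳ _) (*-comm c n))) (*-monoʳ-≤ n (m≤m+n c _)) , τ≤ (size≥1 (enc zs))
      ... | inj₂ (o , o∈ , eq) rewrite eq = let (p , q , r) = All.lookup (limits n zs) o∈ in
            kc≤ , ≤-trans (+-mono-≤ (≤-reflexive (*-comm c n)) (≤-trans (+-monoˡ-≤ _ (*-monoʳ-≤ (proj₂ (proj₁ o)) (m∸n≤m n k))) q))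
                    (≤-reflexive (sym (*-distribˡ-+ n c _))) , τ≤ r
    prices≤ : ∀ zs → Sum price zs ≤ sz zs
    prices≤ []                 = z≤n
    prices≤ ((k , c , τ) ∷ zs) = m≤n⇒m≤1+n (+-mono-≤ (m≤n⇒m≤1+n (≤-trans (m≤n⇒m≤1+n (≤-trans (≤n c) (m≤m+n (sz c) (sz τ)))) (m≤n+m _ (sz k)))) (prices≤ zs))
    each : ∀ (i : ℕ × List Cand) zs → sz zs ≤ sz i → ∀ {n} → n ≤ sz i → ∀ {o} → Limit n zs o → sz o ≤ 4 + (3 * sz i + 2 * (sz i * sz i))
    each i zs zs≤ {n} n≤ {(k , c) , rest , pl} (p , q , r) = ≤-trans (s≤s (+-mono-≤ (≤-trans p zs≤) (s≤s (+-mono-≤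
        (≤-trans (≤-reflexive (unary-size rest)) (s≤s (*-monoʳ-≤ 2 (≤-trans (m≤n+m rest (c * n)) (≤-trans q (*-mono-≤ n≤ (≤-trans (prices≤ zs) zs≤)))))))
        (≤-trans r zs≤))))) (≤-trans (m≤m+n _ (1 + sz i)) (≤-reflexive (eq (sz i) (2 * (sz i * sz i)))))
      where
      eq : ∀ s t → suc (s + suc (suc t + s)) + (1 + s) ≡ 4 + (3 * s + t)
      eq = solve-∀
    length-options : ∀ n zs → length (options n zs) ≡ length zs
    length-options n []       = refl
    length-options n (z ∷ zs) = cong suc (length-options n zs)
    total-size : ∀ s os → All (λ o → sz o ≤ 4 + (3 * s + 2 * (s * s))) os → sz os ≤ 1 + length os * (5 + (3 * s + 2 * (s * s)))
    total-size s []       []       = ≤-refl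
    total-size s (o ∷ os) (p ∷ ps) = s≤s (≤-trans (+-mono-≤ p (total-size s os ps)) (≤-reflexive (+-suc (4 + (3 * s + 2 * (s * s))) _)))

  solveP : Poly {ℕ × List Cand} (λ (n , cs) → solve n cs)
  solveP = sndP (bestP ₁P (constP 0) optionsP)

  dedupP : Poly {List ℕ} dedup
  dedupP = extP go (foldr⁺P idP nilP (consP x (filterP {P? = λ ((_ , x , _) , y) → ¬? (x ≟ y)} (notP (eqP (x ∘P ₁P) ₂P)) ₂₂P))
      (bnd-+ (bnd-const 1) (out-bnd ₂P))
      λ a x b → ≤-trans (s≤s (+-monoʳ-≤ (sz x) (sz-filter (λ y → ¬? (x ≟ y)) b))) (≤-reflexive (trans (cong suc (+-comm (sz x) (sz b))) (sym (+-suc (sz b) (sz x))))))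
    where
    x : Poly {List ℕ × ℕ × List ℕ} (λ i → proj₁ (proj₂ i))
    x = ₁₂P
    go : ∀ l → foldr (λ x b → x ∷ filter (λ y → ¬? (x ≟ y)) b) [] l ≡ dedup l
    go []      = refl
    go (x ∷ l) = cong (λ b → x ∷ filter (λ y → ¬? (x ≟ y)) b) (go l)

  walkP : Poly {List (List ℕ)} walk
  walkP = appendP (concatP idP) (constP (0 ∷ []))

  finishP : Poly {List (List ℕ)} (λ π → map toBits (dedup (walk π)))
  finishP = mapP {f = λ (_ , v) → toBits v} (toBitsP ₂P) (dedupP ∘P walkP)

  -- Vertex labels and distances are read in binary, up to a bound.

  readLabel : ℕ → List Bool → ℕ
  readLabel n ℓ = quant 1 n ℓ (true ∷ [])

  readDist : ℕ → ℚ → ℕ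
  readDist cap q = quant 1 cap (numBits q) (denBits q)

  RawPath : Set
  RawPath = List (List Bool)

  readPath : ℕ → RawPath → List ℕ
  readPath n p = map (readLabel n) (caseList p [] (λ _ r → r))

  readTable : ℕ → List (List ℚ) → Table
  readTable cap = map (map (readDist cap))

  readWeighted : ℕ → List (RawPath × ℚ) → List Weighted
  readWeighted n = map (λ (p , w) → readPath n p , w)

  module _ {A : Set} ⦃ _ : Code A ⦄ where

    readPathP : {n : A → ℕ} {p : A → RawPath} → Poly n → Poly p → Poly (λ a → readPath (n a) (p a))
    readPathP {n} N P = mapP {f = λ (a , ℓ) → readLabel (n a) ℓ} (quantP (constP 1) (wkP N) ₂P (constP (true ∷ []))) (dropHeadP P)

    readTableP : {cap : A → ℕ} {m : A → List (List ℚ)} → Poly cap → Poly m → Poly (λ a → readTable (cap a) (m a))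
    readTableP {cap} C M = mapP {f = λ (a , row) → map (readDist (cap a)) row}
      (mapP {f = λ ((a , _) , q) → readDist (cap a) q}
        (quantP (constP 1) (wkP (wkP C)) (numBitsP ₂P) (denBitsP ₂P)) ₂P) M

  module _ {A : Set} ⦃ _ : Code A ⦄ where

    readWeightedP : {n : A → ℕ} {z : A → List (RawPath × ℚ)} → Poly n → Poly z → Poly (λ a → readWeighted (n a) (z a))
    readWeightedP {n} N Z = mapP {f = λ (a , (p , w)) → readPath (n a) p , w}
      (pairP (readPathP (wkP N) ₁₂P) ₂₂P) Z

  RawML : Set
  RawML = List (List ℚ) × List (List (RawPath × ℚ))

  setting : RawML → Setting
  setting (m , zs) = readTable (length zs + length zs) m , (pred (length m) , grain (length (concat zs)))

  roundWith : Setting → List (List (RawPath × ℚ)) → List (List Bool)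
  roundWith (D , (n , N)) zs = map toBits (dedup (walk (solve n (concatMap (λ z → Candidates.cands (dist D) n N (readWeighted n z)) zs))))

  roundWithP : {A : Set} ⦃ _ : Code A ⦄ {D : A → Table} {n N : A → ℕ} {zs : A → List (List (RawPath × ℚ))} →
               Poly D → Poly n → Poly N → Poly zs → Poly (λ a → roundWith (D a , (n a , N a)) (zs a))
  roundWithP {D = D} {n} {N} T P M Z = finishP ∘P solveP ∘P pairP P
    (concatMapP {f = λ (a , z) → Candidates.cands (dist (D a)) (n a) (N a) (readWeighted (n a) z)}
      (candsP (wkP T) (wkP P) (wkP M) (readWeightedP (wkP P) ₂P)) Z)

  roundML : RawML → List (List Bool)
  roundML i = roundWith (setting i) (proj₂ i)

  roundMLP : Poly roundML
  roundMLP = roundWithP (readTableP (addP (lengthP zs) (lengthP zs)) ₁P) (predP (lengthP ₁P))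
      (mulP (constP 40) (sucP (lengthP (concatP zs)))) zs
    where
    zs : Poly {RawML} proj₂
    zs = ₂P

  clamp : ∀ n → ℕ → Fin (suc n)
  clamp n       zero    = zero
  clamp zero    (suc k) = zero
  clamp (suc n) (suc k) = suc (clamp n k)

  clamp-toℕ : ∀ {n} (v : Fin (suc n)) → clamp n (toℕ v) ≡ v
  clamp-toℕ {zero}  zero    = refl
  clamp-toℕ {suc n} zero    = refl
  clamp-toℕ {suc n} (suc v) = cong suc (clamp-toℕ v)

  toℕ-clamp : ∀ {n k} → k ≤ n → toℕ (clamp n k) ≡ k
  toℕ-clamp {n}     {zero}  _        = refl
  toℕ-clamp {suc n} {suc k} (s≤s le) = cong suc (toℕ-clamp le)

  nth-clamp : {X : Set} (e : X) (n : ℕ) (f : Fin (suc n) → X) (k : ℕ) → nth e (tabulate f) k ≡ f (clamp n k)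
  nth-clamp e n       f zero    = refl
  nth-clamp e zero    f (suc k) = refl
  nth-clamp e (suc n) f (suc k) = nth-clamp (f zero) n (f ∘ suc) k

  nth-toℕ : {X : Set} (e : X) {n : ℕ} (f : Fin n → X) (j : Fin n) → nth e (tabulate f) (toℕ j) ≡ f j
  nth-toℕ e {suc n} f j = trans (nth-clamp e n f (toℕ j)) (cong f (clamp-toℕ j))

  module Embed (P : Problem) (isMetric : IsMetric _≡_ (Problem.d P)) (dℕ : ℕ → ℕ → ℕ)
    (embed : ∀ u v → ι (dℕ u v) ≡ Problem.d P (clamp (Problem.n P) u) (clamp (Problem.n P) v)) where

    open Problem P
    open Metric dℕ
    private module M = IsMetric isMetric

    dℕ-refl : ∀ x → dℕ x x ≡ 0
    dℕ-refl x = n≤0⇒n≡0 (ι-cancel (Qₚ.≤-reflexive (trans (embed x x) (trans (M.≈⇒0 refl) (sym ι0)))))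

    dℕ-sym : ∀ x y → dℕ x y ≡ dℕ y x
    dℕ-sym x y = ≤-antisym (ι-cancel (Qₚ.≤-reflexive eq)) (ι-cancel (Qₚ.≤-reflexive (sym eq)))
      where
      eq : ι (dℕ x y) ≡ ι (dℕ y x)
      eq = trans (embed x y) (trans (M.sym (clamp n x) (clamp n y)) (sym (embed y x)))

    dℕ-tri : ∀ x y z → dℕ x z ≤ dℕ x y + dℕ y z
    dℕ-tri x y z = ι-cancel (subst₂ Q._≤_ (sym (embed x z)) (sym (trans (ι-+ (dℕ x y) (dℕ y z)) (cong₂ Q._+_ (embed x y) (embed y z))))
      (M.triangle (clamp n x) (clamp n y) (clamp n z)))

    embed-Fin : ∀ u v → ι (dℕ (toℕ u) (toℕ v)) ≡ d u v
    embed-Fin u v = trans (embed (toℕ u) (toℕ v)) (cong₂ d (clamp-toℕ u) (clamp-toℕ v))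

    len-embed : ∀ u vs → pathLength P (u ∷ vs) ≡ ι (len (toℕ u) (map toℕ vs))
    len-embed u []       = sym ι0
    len-embed u (v ∷ vs) = trans (cong₂ Q._+_ (sym (embed-Fin u v)) (len-embed v vs)) (sym (ι-+ (dℕ (toℕ u) (toℕ v)) _))

    lat-embed : ∀ j {H : ℕ → Set} (hit? : ∀ x → Dec (H x)) → (∀ v → does (Target? j v) ≡ does (hit? (toℕ v))) →
                ∀ vs → latency P j vs ≡ ι (lat hit? (map toℕ vs))
    lat-embed j hit? same []           = sym ι0
    lat-embed j hit? same (u ∷ [])     = sym ι0
    lat-embed j hit? same (u ∷ v ∷ vs) = trans
      (cong₂ (λ b x → if b then 0ℚ else d u v Q.+ x) (same u) (lat-embed j hit? same (v ∷ vs))) (branch (does (hit? (toℕ u))))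
      where
      L = lat hit? (map toℕ (v ∷ vs))
      branch : ∀ b → (if b then 0ℚ else d u v Q.+ ι L) ≡ ι (if b then 0 else dℕ (toℕ u) (toℕ v) + L)
      branch true  = sym ι0
      branch false = trans (cong (Q._+ ι L) (sym (embed-Fin u v))) (sym (ι-+ (dℕ (toℕ u) (toℕ v)) L))

    module Output (π : List (List ℕ)) (roots : All FromRoot π) (inside : All (All (_≤ n)) π) where

      out : List ℕ
      out = dedup (walk π)

      out≤ : All (_≤ n) out
      out≤ = All.tabulate λ x∈ → case ∈-++⁻ (concat π) (dedup-∈⁻ (walk π) x∈) of λ
        { (inj₁ x∈π)        → All.lookup (Allₚ.concat⁺ inside) x∈π
        ; (inj₂ (here eq)) → subst (_≤ n) (sym eq) z≤n }

      vertices : List V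
      vertices = map (clamp n) out

      toℕ-vertices : map toℕ vertices ≡ out
      toℕ-vertices = go out out≤
        where
        go : ∀ xs → All (_≤ n) xs → map toℕ (map (clamp n) xs) ≡ xs
        go []       []       = refl
        go (x ∷ xs) (p ∷ ps) = cong₂ _∷_ (toℕ-clamp p) (go xs ps)

      rooted : IsRootedPath P vertices
      rooted = starts (walk π) (walk-root roots) , Uniqueₚ.map⁻ (subst Unique (sym toℕ-vertices) (dedup-unique (walk π)))
        where
        starts : ∀ w → FromRoot w → ∃[ vs ] map (clamp n) (dedup w) ≡ r ∷ vs
        starts w (ys , refl) = _ , refl

      visits : ∀ {x τ} → x ∈ τ → τ ∈ π → clamp n x ∈ vertices
      visits x∈ τ∈ = ∈-map⁺ (clamp n) (dedup-∈⁺ (walk π) (∈-++⁺ˡ (Membershipₚ.∈-concat⁺′ x∈ τ∈)))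

      output-code : encList encFin vertices ≡ enc (map toBits out)
      output-code = trans (go vertices) (cong (λ l → enc (map toBits l)) toℕ-vertices)
        where
        go : ∀ vs → encList encFin vs ≡ enc (map toBits (map toℕ vs))
        go []       = refl
        go (v ∷ vs) = cong₂ _·_ (sym (enc-toBits (toℕ v))) (go vs)

      latency≤ : ∀ j {H : ℕ → Set} (hit? : ∀ x → Dec (H x)) → (∀ v → does (Target? j v) ≡ does (hit? (toℕ v))) →
                 latency P j vertices Q.≤ ι (planLat hit? π)
      latency≤ j hit? same = Qₚ.≤-trans (Qₚ.≤-reflexive (trans (lat-embed j hit? same vertices) (cong (ι ∘ lat hit?) toℕ-vertices)))
        (ι-mono (≤-trans (lat-dedup dℕ-refl dℕ-sym dℕ-tri hit? (walk π)) (lat-walk dℕ-refl dℕ-sym dℕ-tri hit? roots)))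

  solve-All : ∀ {Q : List ℕ → Set} n cs → All (λ c → Q (proj₂ (proj₂ c))) cs → All Q (solve n cs)
  solve-All {Q} n cs qs = from-best 0 (options n cs) (opts cs qs)
    where
    from-best : ∀ k os → All (λ o → All Q (plan o)) os → All Q (proj₂ (best n k os))
    from-best k os ps with best-from n k os
    ... | inj₁ eq = subst (All Q ∘ proj₂) (sym eq) []
    ... | inj₂ (o , o∈ , eq) = subst (All Q ∘ proj₂) (sym eq) (All.lookup ps o∈)
    opts : ∀ cs → All (λ c → Q (proj₂ (proj₂ c))) cs → All (λ o → All Q (plan o)) (options n cs)
    opts []       []       = []
    opts ((k , c , τ) ∷ cs) (q ∷ qs) = (q ∷ from-best k (options n cs) (opts cs qs)) ∷ opts cs qs

  sum-mono : ∀ {n} {f g : Fin n → ℚ} → (∀ i → f i Q.≤ g i) → sum f Q.≤ sum g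
  sum-mono {zero}  le = Qₚ.≤-refl
  sum-mono {suc n} le = Qₚ.+-mono-≤ (le zero) (sum-mono (le ∘ suc))

  sum-eq : ∀ {n} {f g : Fin n → ℚ} → (∀ i → f i ≡ g i) → sum f ≡ sum g
  sum-eq {zero}  eq = refl
  sum-eq {suc n} eq = cong₂ Q._+_ (eq zero) (sum-eq (eq ∘ suc))

  sum-clients : ∀ n (f : ℕ → ℚ) → sum {n} (λ j → f (suc (toℕ j))) ≡ SumQ f (clients n)
  sum-clients zero    f = refl
  sum-clients (suc n) f = trans (last-out n (f ∘ suc)) (trans (Qₚ.+-comm _ (f (suc n))) (cong (f (suc n) Q.+_) (sum-clients n f)))
    where
    last-out : ∀ n (g : ℕ → ℚ) → sum {suc n} (g ∘ toℕ) ≡ sum {n} (g ∘ toℕ) Q.+ g n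
    last-out zero    g = trans (Qₚ.+-identityʳ (g 0)) (sym (Qₚ.+-identityˡ (g 0)))
    last-out (suc n) g = trans (cong (g 0 Q.+_) (last-out n (g ∘ suc))) (sym (Qₚ.+-assoc (g 0) _ _))

  sumℚ-tabulate : ∀ {T} (f : Fin T → ℚ) → sumℚ (tabulate f) ≡ sum f
  sumℚ-tabulate {zero}  f = refl
  sumℚ-tabulate {suc T} f = cong (f zero Q.+_) (sumℚ-tabulate (f ∘ suc))

  time-ι : ∀ {T} (t : Fin T) → time t ≡ ι (suc (toℕ t))
  time-ι t = sym (ι-/1 (suc (toℕ t)))

  delay-tabulate : ∀ {T} (f : Fin T → ℚ) → delay (tabulate f) ≡ sum (λ t → time t Q.* f t)
  delay-tabulate {zero}  f = refl
  delay-tabulate {suc T} f = trans (cong₂ Q._+_ (sym (Qₚ.*-identityˡ (f zero)))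
      (cong₂ Q._+_ (delay-tabulate (f ∘ suc)) (sumℚ-tabulate (f ∘ suc)))) (cong (1ℚ Q.* f zero Q.+_) (go (f ∘ suc)))
    where
    go : ∀ {T} (g : Fin T → ℚ) → sum (λ t → time t Q.* g t) Q.+ sum g ≡ sum (λ t → time (suc t) Q.* g t)
    go g = trans (join time g) (sum-eq (λ t → trans (eq (time t) (g t)) (cong (Q._* g t) (later-time t))))
      where
      join : ∀ {T} (k g : Fin T → ℚ) → sum (λ t → k t Q.* g t) Q.+ sum g ≡ sum (λ t → k t Q.* g t Q.+ g t)
      join {zero}  k g = refl
      join {suc T} k g = trans (shuffle (k zero Q.* g zero) _ (g zero) _) (cong ((k zero Q.* g zero Q.+ g zero) Q.+_) (join (k ∘ suc) (g ∘ suc)))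
        where
        shuffle : ∀ a b c e → a Q.+ b Q.+ (c Q.+ e) ≡ a Q.+ c Q.+ (b Q.+ e)
        shuffle = ring-solve ℚ-ring
      eq : ∀ a b → a Q.* b Q.+ b ≡ (1ℚ Q.+ a) Q.* b
      eq = ring-solve ℚ-ring
      later-time : ∀ {T} (t : Fin T) → 1ℚ Q.+ time t ≡ time (suc t)
      later-time t = trans (cong₂ Q._+_ (sym ι1) (time-ι t)) (trans (sym (ι-+ 1 (suc (toℕ t)))) (sym (time-ι (suc t))))

  prefix-tabulate : ∀ {T} (f : Fin T → ℚ) (t : Fin T) →
                    prefix (tabulate f) (suc (toℕ t)) ≡ sum (λ t′ → if does (t′ Finₚ.≤? t) then f t′ else 0ℚ)
  prefix-tabulate f zero    = cong (f zero Q.+_) (zeros (f ∘ suc))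
    where
    zeros : ∀ {T} (g : Fin T → ℚ) → 0ℚ ≡ sum {T} (λ t′ → 0ℚ)
    zeros {zero}  g = refl
    zeros {suc T} g = trans (zeros (g ∘ suc)) (sym (Qₚ.+-identityˡ _))
  prefix-tabulate f (suc t) = cong (f zero Q.+_) (trans (prefix-tabulate (f ∘ suc) t) (sum-eq λ t′ → shift-≤? t′ t))
    where
    shift-≤? : ∀ {T} (t′ t : Fin T) {x : ℚ} → (if does (t′ Finₚ.≤? t) then x else 0ℚ) ≡ (if does (suc t′ Finₚ.≤? suc t) then x else 0ℚ)
    shift-≤? zero    t = refl
    shift-≤? (suc a) t = refl

  at-tabulate : {X : Set} {T : ℕ} (f : Fin T → List X) (t : Fin T) → at (tabulate f) (toℕ t) ≡ f t
  at-tabulate f zero    = refl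
  at-tabulate f (suc t) = at-tabulate (f ∘ suc) t

  quant-bits : ∀ cap {k} → k ≤ cap → quant 1 cap (bits k) (true ∷ []) ≡ k
  quant-bits cap {k} le = ≤-antisym upper lower
    where
    one : ∀ j → j * value-of (true ∷ []) ≡ j
    one j = *-identityʳ j
    goal : 1 * value-of (bits k) ≡ k
    goal = trans (*-identityˡ _) (value-bits k)
    P? = λ j → Geq? 1 j (true ∷ []) (bits k)
    upper : quant 1 cap (bits k) (true ∷ []) ≤ k
    upper with suc k ≤? search P? cap
    ... | no ≮  = ≮⇒≥ ≮
    ... | yes lt = contradiction (≤-reflexive (trans goal (sym (one k)))) (search-least P? cap k lt)
    lower : k ≤ quant 1 cap (bits k) (true ∷ [])
    lower with search-found P? cap
    ... | inj₁ eq = ≤-trans le (≤-reflexive (sym eq))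
    ... | inj₂ p  = ≤-trans (≤-reflexive (sym goal)) (≤-trans p (≤-reflexive (one _)))

  readLabel-bits : ∀ n {k} → k ≤ n → readLabel n (bits k) ≡ k
  readLabel-bits n {k} le = quant-bits n le

  readDist-ι : ∀ cap {k} → k ≤ cap → ∀ {q} → q ≡ ι k → readDist cap q ≡ k
  readDist-ι cap {k} le {q} eq = trans
    (cong₂ (λ a b → quant 1 cap (natBits a) (natBits b)) (trans (cong ↥_ eq) (↥ι k)) (trans (cong ↧_ eq) (↧ι k)))
    (quant-bits cap le)

  latency-far : ∀ (P : Problem) → IsMetric _≡_ (Problem.d P) → ∀ j {v} → (∀ {w} → Problem.Target P j w → v ≡ w) →
                ∀ u vs → Any (Problem.Target P j) (u ∷ vs) → Problem.d P u v Q.≤ latency P j (u ∷ vs)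
  latency-far P isMetric j {v} only u []       (here t) = Qₚ.≤-reflexive (IsMetric.≈⇒0 isMetric (sym (only t)))
  latency-far P isMetric j {v} only u (w ∷ vs) any with Problem.Target? P j u
  ... | yes t = Qₚ.≤-reflexive (IsMetric.≈⇒0 isMetric (sym (only t)))
  ... | no ¬t with any
  ...   | here t = contradiction t ¬t
  ...   | there any′ = Qₚ.≤-trans (IsMetric.triangle isMetric u w v)
            (Qₚ.+-monoʳ-≤ (Problem.d P u w) (latency-far P isMetric j only w vs any′))

  encList-map : {A B : Set} (e : B → 𝔻) (f : A → B) (xs : List A) → encList e (map f xs) ≡ encList (e ∘ f) xs
  encList-map e f []       = refl
  encList-map e f (x ∷ xs) = cong (e (f x) ·_) (encList-map e f xs)

  encList-cong : {A : Set} {e e′ : A → 𝔻} (xs : List A) → (∀ x → e x ≡ e′ x) → encList e xs ≡ encList e′ xs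
  encList-cong []       eq = refl
  encList-cong (x ∷ xs) eq = cong₂ _·_ (eq x) (encList-cong xs eq)

  ≤-clients : ∀ {n u} → u ∈ clients n → u ≤ n
  ≤-clients {n} u∈ with ∈-map⁻ suc u∈
  ... | k , k∈ , refl = Membershipₚ.∈-downFrom⁻ k∈

  label : ∀ {n} → Fin n → List Bool
  label v = bits (toℕ v)

  module RoundML (I : MLInstance) (T : ℕ) (T-bound : BoundsOptimalLatency (mlProblem I) T)
    (x : Fin (MLInstance.n I) → Fin T → ℚ) (z : Fin T → List (List (Fin (suc (MLInstance.n I))) × ℚ)) (ρ L : ℚ)
    (1≤ρ : 1ℚ Q.≤ ρ) (L≥0 : 0ℚ Q.≤ L)
    (x≥0 : ∀ j t → 0ℚ Q.≤ x j t)
    (z≥0 : ∀ t → All (λ (_ , w) → 0ℚ Q.≤ w) (z t))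
    (within : ∀ t → All (λ (p , _) → IsRootedPath (mlProblem I) p × pathLength (mlProblem I) p Q.≤ L Q.* time t) (z t))
    (assigned : ∀ j → 1ℚ Q.≤ sum (x j))
    (capacity : ∀ t → total (z t) Q.≤ ρ)
    (covered : ∀ j t → sum (λ t′ → if does (t′ Finₚ.≤? t) then x j t′ else 0ℚ) Q.≤
                       total (filter (λ (p , _) → any? (suc j Finₚ.≟_) p) (z t))) where

    open MLInstance I
    private
      P = mlProblem I
      open Problem P using (V)

    rawEntry : List V × ℚ → RawPath × ℚ
    rawEntry (p , w) = map label p , w

    raw : RawML
    raw = tabulate (λ u → tabulate (d u)) , tabulate (λ t → map rawEntry (z t))

    private
      zs₀ = proj₂ raw
      D = proj₁ (setting raw)
      cap = length zs₀ + length zs₀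
      M = length (concat zs₀)
      N = grain M

      T≡ : length zs₀ ≡ T
      T≡ = Listₚ.length-tabulate _

      n≡ : pred (length (proj₁ raw)) ≡ n
      n≡ = cong pred (Listₚ.length-tabulate (λ u → tabulate (d u)))

      far : ∀ v → d zero v Q.≤ ι T
      far zero    = Qₚ.≤-trans (Qₚ.≤-reflexive (IsMetric.≈⇒0 isMetric refl)) (ι≥0 T)
      far (suc j) = reach T-bound
        where
        reach : BoundsOptimalLatency P T → d zero (suc j) Q.≤ ι T
        reach (.(zero ∷ vs) , (((vs , refl) , _) , hits) , _ , small) =
          Qₚ.≤-trans (latency-far P isMetric j (λ t → t) zero vs (hits j)) (Qₚ.≤-trans (small j) (Qₚ.≤-reflexive (sym (ι-/1 T))))

      in-range : ∀ u v {k} → d u v ≡ ι k → k ≤ cap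
      in-range u v {k} eq = ι-cancel (begin
        ι k                        ≡⟨ eq ⟨
        d u v                      ≤⟨ IsMetric.triangle isMetric u zero v ⟩
        d u zero Q.+ d zero v      ≡⟨ cong (Q._+ d zero v) (IsMetric.sym isMetric u zero) ⟩
        d zero u Q.+ d zero v      ≤⟨ Qₚ.+-mono-≤ (far u) (far v) ⟩
        ι T Q.+ ι T                ≡⟨ ι-+ T T ⟨
        ι (T + T)                  ≡⟨ cong (λ t → ι (t + t)) T≡ ⟨
        ι cap                      ∎)
        where open Qₚ.≤-Reasoning

      entry : ∀ u v → ι (readDist cap (d u v)) ≡ d u v
      entry u v = let (k , eq) = integral u v ; eq′ = trans eq (sym (ι-/1 k)) in
        trans (cong ι (readDist-ι cap (in-range u v eq′) eq′)) (sym eq′)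

      embed : ∀ u v → ι (dist D u v) ≡ d (clamp n u) (clamp n v)
      embed u v = trans (cong ι (trans (cong (λ D → nth 0 (nth [] D u) v) table≡)
          (trans (cong (λ row → nth 0 row v) (nth-clamp [] n (λ u → tabulate (λ v → readDist cap (d u v))) u))
            (nth-clamp 0 n (λ v → readDist cap (d (clamp n u) v)) v)))) (entry (clamp n u) (clamp n v))
        where
        table≡ : D ≡ tabulate (λ u → tabulate (λ v → readDist cap (d u v)))
        table≡ = trans (Listₚ.map-tabulate (λ u → tabulate (d u)) (map (readDist cap)))
          (Listₚ.tabulate-cong (λ u → Listₚ.map-tabulate (d u) (readDist cap)))

      open Embed P isMetric (dist D) embed

      entries : List V × ℚ → Weighted
      entries (p , w) = map toℕ (List.drop 1 p) , w

      read-map : ∀ (ps : List V) → map (readLabel n) (map label ps) ≡ map toℕ ps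
      read-map []       = refl
      read-map (v ∷ ps) = cong₂ _∷_ (readLabel-bits n (Finₚ.toℕ≤pred[n] v)) (read-map ps)

      read-entries : ∀ z → readWeighted n (map rawEntry z) ≡ map entries z
      read-entries []              = refl
      read-entries (([] , w) ∷ z)     = cong (_ ∷_) (read-entries z)
      read-entries ((v ∷ p , w) ∷ z) = cong₂ _∷_ (cong (_, w) (read-map p)) (read-entries z)

      zs : List (List Weighted)
      zs = tabulate (λ t → map entries (z t))

      zs≡ : map (readWeighted n) zs₀ ≡ zs
      zs≡ = trans (Listₚ.map-tabulate _ (readWeighted n)) (Listₚ.tabulate-cong (λ t → read-entries (z t)))

      length-zs : length zs ≡ T
      length-zs = Listₚ.length-tabulate _

      zs-All : ∀ {Q : List Weighted → Set} → (∀ t → Q (map entries (z t))) → ∀ {l} → l ∈ zs → Q l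
      zs-All {Q} f l∈ = All.lookup (Allₚ.tabulate⁺ f) l∈

      few : ∀ {l} → l ∈ zs → length l ≤ M
      few = zs-All {λ l → length l ≤ M} λ t → ≤-trans (≤-reflexive (trans (Listₚ.length-map entries (z t)) (sym (Listₚ.length-map rawEntry (z t)))))
          (longest (tabulate (λ t → map rawEntry (z t))) (Membershipₚ.∈-tabulate⁺ t))
        where
        longest : ∀ {X : Set} {l : List X} ls → l ∈ ls → length l ≤ length (concat ls)
        longest (l ∷ ls) (here refl) = ≤-trans (m≤m+n _ _) (≤-reflexive (sym (Listₚ.length-++ l)))
        longest (l ∷ ls) (there l∈)  = ≤-trans (longest ls l∈) (≤-trans (m≤n+m _ (length l)) (≤-reflexive (sym (Listₚ.length-++ l))))

      client : ∀ {p} → IsRootedPath P p → ClientPath n (map toℕ (List.drop 1 p))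
      client ((vs , refl) , (≢s ∷ U)) = Uniqueₚ.map⁺ Finₚ.toℕ-injective U ,
        Allₚ.map⁺ (All.tabulate λ {v} v∈ → ∈-clients (n≢0⇒n>0 (λ eq → All.lookup ≢s v∈ (sym (Finₚ.toℕ-injective eq)))) (Finₚ.toℕ≤pred[n] v))

      paths-ok : ∀ {l} → l ∈ zs → All (ClientPath n ∘ proj₁) l
      paths-ok = zs-All {λ l → All (ClientPath n ∘ proj₁) l} λ t → Allₚ.map⁺ (All.map (client ∘ proj₁) (within t))

      nonneg : ∀ {l} → l ∈ zs → All (λ (_ , w) → 0ℚ Q.≤ w) l
      nonneg = zs-All {λ l → All (λ (_ , w) → 0ℚ Q.≤ w) l} λ t → Allₚ.map⁺ (z≥0 t)

      index : ∀ {i} → i < length zs → ∃[ t ] toℕ {T} t ≡ i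
      index {i} lt = let lt′ = subst (i <_) length-zs lt in Fin.fromℕ< lt′ , Finₚ.toℕ-fromℕ< lt′

      short : ∀ {i} → i < length zs → All (λ (p , _) → ι (Metric.len (dist D) 0 p) Q.≤ L Q.* ι (suc i)) (at zs i)
      short {i} lt with index lt
      ... | t , refl = subst (All (λ (p , _) → ι (Metric.len (dist D) 0 p) Q.≤ L Q.* ι (suc i)))
          (sym (at-tabulate (λ t → map entries (z t)) t)) (Allₚ.map⁺ (All.map (λ {q} → bound {proj₁ q}) (within t)))
        where
        bound : ∀ {p} → IsRootedPath P p × pathLength P p Q.≤ L Q.* time t →
                ι (Metric.len (dist D) 0 (map toℕ (List.drop 1 p))) Q.≤ L Q.* ι (suc (toℕ t))
        bound (((vs , refl) , _) , le) = subst₂ Q._≤_ (len-embed zero vs) (cong (L Q.*_) (time-ι t)) le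

      total-map : ∀ z → total (map entries z) ≡ total z
      total-map []            = refl
      total-map ((p , w) ∷ z) = cong (w Q.+_) (total-map z)

      cap-ok : ∀ {l} → l ∈ zs → total l Q.≤ ρ
      cap-ok = zs-All {λ l → total l Q.≤ ρ} λ t → Qₚ.≤-trans (Qₚ.≤-reflexive (total-map (z t))) (capacity t)

      same : ∀ (j : Fin n) v → does (suc j Finₚ.≟ v) ≡ does (suc (toℕ j) ≟ toℕ v)
      same j v = agree (suc j Finₚ.≟ v) (suc (toℕ j) ≟ toℕ v)
        where
        agree : (a : Dec (suc j ≡ v)) (b : Dec (suc (toℕ j) ≡ toℕ v)) → does a ≡ does b
        agree (yes _)    (yes _)   = refl
        agree (no _)     (no _)    = refl
        agree (yes refl) (no neq)  = contradiction refl neq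
        agree (no neq)   (yes eq)  = contradiction (Finₚ.toℕ-injective eq) neq

      same-any : ∀ j vs → does (any? (suc j Finₚ.≟_) vs) ≡ does (memb? (suc (toℕ j)) (map toℕ vs))
      same-any j []       = refl
      same-any j (v ∷ vs) = cong₂ _∨_ (same j v) (same-any j vs)

      cover-map : ∀ j {z} → All (λ (p , _) → ∃[ vs ] p ≡ zero ∷ vs) z →
                  total (filter (λ (p , _) → any? (suc j Finₚ.≟_) p) z) ≡ cov (suc (toℕ j)) (map entries z)
      cover-map j [] = refl
      cover-map j {(.(zero ∷ vs) , w) ∷ z} ((vs , refl) ∷ roots)
        with does (any? (suc j Finₚ.≟_) vs) | does (memb? (suc (toℕ j)) (map toℕ vs)) | same-any j vs
      ... | true  | true  | _ = cong (w Q.+_) (cover-map j roots)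
      ... | false | false | _ = cover-map j roots

      xs : ℕ → List ℚ
      xs u = nth [] (tabulate (λ j → tabulate (x j))) (pred u)

      xs-at : ∀ j → xs (suc (toℕ j)) ≡ tabulate (x j)
      xs-at = nth-toℕ [] (λ j → tabulate (x j))

      which : ∀ {u} → u ∈ clients n → ∃[ j ] u ≡ suc (toℕ {n} j)
      which u∈ with ∈-map⁻ suc u∈
      ... | k , k∈ , refl = let k<n = Membershipₚ.∈-downFrom⁻ k∈ in
              Fin.fromℕ< k<n , cong suc (sym (Finₚ.toℕ-fromℕ< k<n))

      xs-prop : ∀ {Q : List ℚ → Set} → (∀ j → Q (tabulate (x j))) → ∀ {u} → u ∈ clients n → Q (xs u)
      xs-prop {Q} f u∈ with which u∈
      ... | j , refl = subst Q (sym (xs-at j)) (f j)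

      covered′ : ∀ {u i} → u ∈ clients n → i < length zs → prefix (xs u) (suc i) Q.≤ cov u (at zs i)
      covered′ u∈ lt with which u∈ | index lt
      ... | j , refl | t , refl = subst₂ Q._≤_
          (trans (sym (prefix-tabulate (x j) t)) (cong (λ l → prefix l (suc (toℕ t))) (sym (xs-at j))))
          (trans (cover-map j (All.map (λ (r , _) → proj₁ r) (within t))) (cong (cov (suc (toℕ j))) (sym (at-tabulate (λ t → map entries (z t)) t))))
          (covered j t)

      cands : List Weighted → List Cand
      cands = Candidates.cands (dist D) n N

      π : List (List ℕ)
      π = solve n (concat (map cands zs))

      conclusion : All FromRoot π × (∀ {u} → u ∈ clients n → ∃[ τ ] τ ∈ π × u ∈ τ) ×
                   ι (Sum (λ u → Metric.planLat (dist D) (u ≟_) π) (clients n)) Q.≤ (ℤ.+ 287 Q./ 40) Q.* (ρ Q.* L) Q.* SumQ (λ u → delay (xs u)) (clients n)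
      conclusion = RoundPaths.conclusion (dist D) dℕ-refl dℕ-sym dℕ-tri n M zs xs ρ L few paths-ok nonneg short cap-ok
        (xs-prop {All (0ℚ Q.≤_)} (λ j → Allₚ.tabulate⁺ (x≥0 j)))
        (xs-prop {λ l → length l ≡ length zs} (λ j → trans (Listₚ.length-tabulate (x j)) (sym length-zs)))
        (xs-prop {λ l → 1ℚ Q.≤ sumℚ l} (λ j → Qₚ.≤-trans (assigned j) (Qₚ.≤-reflexive (sym (sumℚ-tabulate (x j))))))
        covered′ 1≤ρ L≥0

      inside : All (All (_≤ n)) π
      inside = solve-All n (concat (map cands zs)) (Allₚ.concat⁺ (Allₚ.map⁺ (All.tabulate λ {l} l∈ →
        let good = copies-All N (paths-ok l∈) in
        Allₚ.map⁺ (All.tabulate λ {es} es∈ → All.tabulate λ {v} v∈ →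
          case proj₂ (proj₂ (proj₂ (Metric.tour-spec (dist D) dℕ-refl dℕ-sym dℕ-tri es (All.lookup (forest-valid n N (copies N l) good) es∈)))) v∈ of λ
            { (inj₁ refl) → z≤n
            ; (inj₂ c) → contained (forest-vertices n N (copies N l) good es∈) c }))))
        where
        contained : ∀ {es v} → (∀ {e} → e ∈ es → vert e ∈ clients n) → Contains v es → v ≤ n
        contained inn c with find c
        ... | e , e∈ , refl = ≤-clients (inn e∈)

      open Output π (proj₁ conclusion) inside

    solution : Solution P
    solution = vertices , rooted , λ j →
      let (τ , τ∈ , u∈) = proj₁ (proj₂ conclusion) (∈-clients (s≤s z≤n) (Finₚ.toℕ<n j)) in
      Any.map (λ eq → trans (sym (clamp-toℕ (suc j))) eq) (visits u∈ τ∈)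

    solution-code : encList encFin (proj₁ solution) ≡ enc (roundML raw)
    solution-code = trans output-code (cong enc (trans (cong (λ cs → map toBits (dedup (walk (solve n (concat cs)))))
        (trans (cong (map cands) (sym zs≡)) (sym (Listₚ.map-∘ zs₀)))) (cong finish (sym n≡))))
      where
      finish : ℕ → List (List Bool)
      finish m = map toBits (dedup (walk (solve m (concatMap (λ z → Candidates.cands (dist D) m N (readWeighted m z)) zs₀))))

    solution-cost : cost P (proj₁ solution) Q.≤ (ℤ.+ 287 Q./ 40) Q.* (ρ Q.* L) Q.* sum (λ j → sum (λ t → time t Q.* x j t))
    solution-cost = begin
      sum {n} (λ j → latency P j vertices)                                ≤⟨ sum-mono {n} (λ j → latency≤ j (suc (toℕ j) ≟_) (same j)) ⟩
      sum {n} (λ j → ι (planLat (suc (toℕ j) ≟_) π))                      ≡⟨ sum-clients n (λ u → ι (planLat (u ≟_) π)) ⟩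
      SumQ (λ u → ι (planLat (u ≟_) π)) (clients n)                   ≡⟨ ι-Sum (λ u → planLat (u ≟_) π) (clients n) ⟨
      ι (Sum (λ u → planLat (u ≟_) π) (clients n))                    ≤⟨ proj₂ (proj₂ conclusion) ⟩
      (ℤ.+ 287 Q./ 40) Q.* (ρ Q.* L) Q.* SumQ (delay ∘ xs) (clients n) ≡⟨ cong ((ℤ.+ 287 Q./ 40) Q.* (ρ Q.* L) Q.*_)
          (trans (sym (sum-clients n (delay ∘ xs))) (sum-eq {n} (λ j → trans (cong delay (xs-at j)) (delay-tabulate (x j))))) ⟩
      (ℤ.+ 287 Q./ 40) Q.* (ρ Q.* L) Q.* sum (λ j → sum (λ t → time t Q.* x j t)) ∎
      where
      open Qₚ.≤-Reasoning
      open Metric (dist D)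

    result : Σ (Solution P) λ S → encList encFin (proj₁ S) ≡ enc (roundML raw) ×
             cost P (proj₁ S) Q.≤ (ℤ.+ 287 Q./ 40) Q.* (ρ Q.* L) Q.* sum (λ j → sum (λ t → time t Q.* x j t))
    result = solution , solution-code , solution-cost

  instance
    code-Rose : {A : Set} ⦃ _ : Code A ⦄ → Code (Rose A)
    code-Rose = record { enc = encRose enc }

  encFun-enc : {A B : Set} {k : ℕ} (e : A → 𝔻) ⦃ _ : Code B ⦄ (g : A → B) (f : Fin k → A) →
               (∀ a → e a ≡ enc (g a)) → encFun e f ≡ enc (tabulate (λ i → g (f i)))
  encFun-enc e g f eq = trans (encList-cong (tabulate f) eq) (trans (sym (encList-map enc g (tabulate f)))
    (cong enc (Listₚ.map-tabulate f g)))

  encList-enc : {A B : Set} (e : A → 𝔻) ⦃ _ : Code B ⦄ (g : A → B) (xs : List A) → (∀ a → e a ≡ enc (g a)) → encList e xs ≡ enc (map g xs)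
  encList-enc e g xs eq = trans (encList-cong xs eq) (sym (encList-map enc g xs))

  enc-label : ∀ {n} (v : Fin n) → encFin v ≡ enc (label v)
  enc-label v = sym (enc-bits (toℕ v))

  matrix : ∀ {k} → (Fin k → Fin k → ℚ) → List (List ℚ)
  matrix d = tabulate (λ u → tabulate (d u))

  enc-matrix : ∀ {k} (d : Fin k → Fin k → ℚ) → encFun (encFun encℚ) d ≡ enc (matrix d)
  enc-matrix d = encFun-enc (encFun encℚ) tabulate d (λ _ → refl)

  instance
    code-input : {R : Relaxation} → Code (RoundingInput R)
    code-input = record { enc = RoundingInput.code }

  -- The coins are ignored.

  module _ {R : Relaxation} (C : ℚ) (f : RoundingInput R → List (List Bool)) (F : Poly f)
    (S : ∀ i → Solution (Relaxation.problem R (RoundingInput.inst i)))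
    (S-code : ∀ i → RoundingInput.output i (S i) ≡ enc (f i))
    (S-cost : ∀ i → RoundingInput.value i (S i) Q.≤ RoundingInput.bound i C) where

    deterministic : DeterministicRounding R C
    deterministic = prog F , proj₁ (clock-bnd F) , proj₁ (proj₂ (clock-bnd F)) , λ i →
      let (k , k≤ , r) = run F i in
      S i , (k , ≤-trans k≤ (proj₂ (proj₂ (clock-bnd F)) i) , subst (λ o → Run (prog F) _ o k) (sym (S-code i)) r) , S-cost i

    𝔼-const : ∀ k (q : ℚ) → 𝔼 {k} (λ _ → q) ≡ q
    𝔼-const zero    q = refl
    𝔼-const (suc k) q = trans (cong (½ Q.*_) (cong₂ Q._+_ (𝔼-const k q) (𝔼-const k q))) (eq q)
      where
      eq : ∀ q → ½ Q.* (q Q.+ q) ≡ q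
      eq = ring-solve ℚ-ring

    randomized : RandomizedRounding R C
    randomized = hd ⨾ prog F , proj₁ b , proj₁ (proj₂ b) , λ i →
      let (k , k≤ , r) = run F i in
      (λ _ → S i) ,
      (λ w → suc (1 + k) , ≤-trans (s≤s (s≤s k≤)) (proj₂ (proj₂ b) i) , seq hd (subst (λ o → Run (prog F) _ o k) (sym (S-code i)) r)) ,
      Qₚ.≤-trans (Qₚ.≤-reflexive (𝔼-const (proj₁ b * sz i ^ proj₁ (proj₂ b)) (RoundingInput.value i (S i)))) (S-cost i)
      where
      b : Bnd (λ i → 2 + clock F i)
      b = bnd-+ (bnd-const 2) (clock-bnd F)

  rawPathsML : RoundingInput (LP2 paths) → RawML
  rawPathsML i = matrix (MLInstance.d (RoundingInput.inst i)) ,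
    tabulate (λ t → map (λ (p , w) → map label p , w) (Assignment.z (RoundingInput.lp i) t))

  weighted-code : ∀ {k} {n : ℕ} (z : Fin k → List (List (Fin n) × ℚ)) →
    encFun (encList (λ (Q , w) → encList encFin Q · encℚ w)) z ≡ enc (tabulate (λ t → map (λ (p , w) → map label p , w) (z t)))
  weighted-code z = encFun-enc _ (map (λ (p , w) → map label p , w)) z λ l →
    encList-enc _ (λ (p , w) → map label p , w) l (λ (p , w) → cong (_· encℚ w) (encList-enc encFin label p enc-label))

  size-hd : ∀ d → size (head d) ≤ size d
  size-hd nil     = ≤-refl
  size-hd (a · b) = m≤n⇒m≤1+n (m≤m+n _ _)

  size-tl : ∀ d → size (tail d) ≤ size d
  size-tl nil     = ≤-refl
  size-tl (a · b) = m≤n⇒m≤1+n (m≤n+m _ _)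

  -- The code of an input is (instance · (ρ · (γ · (x · z)))).
  selectP : {A B C : Set} ⦃ _ : Code A ⦄ ⦃ _ : Code B ⦄ ⦃ _ : Code C ⦄ (f : A → B × C) →
            (∀ a → enc (f a) ≡ head (enc a) · tail (tail (tail (tail (enc a))))) → Poly f
  selectP f eq = stepsP ⟨ hd , tl ⨾ (tl ⨾ (tl ⨾ tl)) ⟩ 9
    (λ a → subst (λ d → Run ⟨ hd , tl ⨾ (tl ⨾ (tl ⨾ tl)) ⟩ (enc a) d 9) (sym (eq a)) (pair hd (seq tl (seq tl (seq tl tl)))))
    (bnd-≤ (λ a → ≤-trans (≤-reflexive (cong size (eq a))) (s≤s (+-mono-≤ (size-hd (enc a))
      (≤-trans (size-tl _) (≤-trans (size-tl _) (≤-trans (size-tl _) (size-tl (enc a))))))))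
      (bnd-+ (bnd-const 1) (bnd-+ bnd-sz bnd-sz)))

  γ-scale : ∀ {γ} → 1ℚ Q.≤ γ → 0ℚ Q.≤ γ
  γ-scale = Qₚ.≤-trans (/1≥0 1)

  objective≥0 : ∀ {m T} (x : Fin m → Fin T → ℚ) → (∀ j t → 0ℚ Q.≤ x j t) → 0ℚ Q.≤ sum (λ j → sum (λ t → time t Q.* x j t))
  objective≥0 x nn = sum≥0 (λ j → sum≥0 (λ t → *≥0 (/1≥0 (suc (toℕ t))) (nn j t)))
    where
    sum≥0 : ∀ {n} {f : Fin n → ℚ} → (∀ i → 0ℚ Q.≤ f i) → 0ℚ Q.≤ sum f
    sum≥0 {zero}  nn = Qₚ.≤-refl
    sum≥0 {suc n} nn = +≥0 (nn zero) (sum≥0 (nn ∘ suc))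

  paths-rounding : DeterministicRounding (LP2 paths) ((ℤ.+ 359 Q./ 100) Q.* (ℤ.+ 2 Q./ 1))
  paths-rounding = deterministic ((ℤ.+ 359 Q./ 100) Q.* (ℤ.+ 2 Q./ 1)) (roundML ∘ rawPathsML)
    (roundMLP ∘P selectP rawPathsML (λ i → cong₂ _·_ (sym (enc-matrix (MLInstance.d (RoundingInput.inst i)))) (sym (weighted-code (Assignment.z (RoundingInput.lp i))))))
    (λ i → proj₁ (result i)) (λ i → proj₁ (proj₂ (result i))) cheap
    where
    result : ∀ i → let open RoundingInput i in Σ (Solution (mlProblem inst)) λ S → output S ≡ enc (roundML (rawPathsML i)) ×
             RoundingInput.value i S Q.≤ (ℤ.+ 287 Q./ 40) Q.* (ρ Q.* γ) Q.* objective lp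
    result i = RoundML.result inst T T-bound x z ρ γ 1≤ρ (γ-scale 1≤γ) x≥0 z≥0 z-within assigned capacity covered
      where
      open RoundingInput i
      open Assignment lp
      open IsFeasible (proj₁ feasible)
    cheap : ∀ i → RoundingInput.value i (proj₁ (result i)) Q.≤ RoundingInput.bound i ((ℤ.+ 359 Q./ 100) Q.* (ℤ.+ 2 Q./ 1))
    cheap i = Qₚ.≤-trans (proj₂ (proj₂ (result i)))
      (*-monoˡ-Q (objective≥0 x x≥0) (*-monoˡ-Q (*≥0 (γ-scale 1≤ρ) (γ-scale 1≤γ)) 7·175≤7·18))
      where
      open RoundingInput i
      open Assignment lp
      open IsFeasible (proj₁ feasible)
      7·175≤7·18 : ℤ.+ 287 Q./ 40 Q.≤ (ℤ.+ 359 Q./ 100) Q.* (ℤ.+ 2 Q./ 1)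
      7·175≤7·18 = Q.*≤* (ℤ.+≤+ (≤ᵇ⇒≤ _ _ tt))

  kids : {A : Set} → Rose A → List (Rose A)
  kids (node _ ts) = ts

  encRoses-encList : {A : Set} (e : A → 𝔻) (ts : List (Rose A)) → encRoses e ts ≡ encList (encRose e) ts
  encRoses-encList e []       = refl
  encRoses-encList e (t ∷ ts) = cong (encRose e t ·_) (encRoses-encList e ts)

  labelsₗ-++ : {A : Set} (ts us : List (Rose A)) → labelsₗ (ts ++ us) ≡ labelsₗ ts ++ labelsₗ us
  labelsₗ-++ []       us = refl
  labelsₗ-++ (t ∷ ts) us = trans (cong (labels t ++_) (labelsₗ-++ ts us)) (sym (Listₚ.++-assoc (labels t) _ _))

  module _ {A : Set} ⦃ _ : Code A ⦄ where

    sz-node : ∀ (v : A) ts → sz (node v ts) ≡ suc (sz v + sz ts)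
    sz-node v ts = cong (λ d → suc (sz v + size d)) (encRoses-encList enc ts)

    rootOfP : {C : Set} ⦃ _ : Code C ⦄ {t : C → Rose A} → Poly t → Poly (λ c → rootOf (t c))
    rootOfP P = stepsP {f = rootOf} hd 1 (λ { (node v ts) → hd }) (bnd-≤ (λ { (node v ts) → m≤n⇒m≤1+n (m≤m+n _ _) }) bnd-sz) ∘P P

    kidsP : {C : Set} ⦃ _ : Code C ⦄ {t : C → Rose A} → Poly t → Poly (λ c → kids (t c))
    kidsP P = stepsP {f = kids} tl 1 (λ { (node v ts) → subst (λ d → Run tl (enc (node v ts)) d 1) (encRoses-encList enc ts) tl })
      (bnd-≤ (λ { (node v ts) → ≤-trans (m≤n⇒m≤1+n (m≤n+m _ (sz v))) (≤-reflexive (sym (sz-node v ts))) }) bnd-sz) ∘P P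

    private
      Work : Set
      Work = List (Rose A) × List A

      visit : Rose A × List (Rose A) × List A → Work
      visit (t , rest , out) = kids t ++ rest , rootOf t ∷ out

      visitP : Poly visit
      visitP = pairP (appendP (kidsP ₁P) ₁₂P) (consP (rootOfP ₁P) ₂₂P)

      body : Prog
      body = ⟨ hd ⨾ hd , ⟨ hd ⨾ tl , tl ⟩ ⟩ ⨾ prog visitP

      c = proj₁ (clock-bnd visitP)
      e = proj₁ (proj₂ (clock-bnd visitP))

      shrink : ∀ (t : Rose A) rest out → let (stack′ , out′) = visit (t , rest , out) in
               suc (suc (sz stack′ + sz out′)) ≡ sz (t ∷ rest) + sz out
      shrink (node v ts) rest out = trans (cong (λ k → suc (k + suc (sz v + sz out))) (sz-++ ts rest))
        (trans (eq (sz ts) (sz rest) (sz v) (sz out)) (cong (λ k → suc (k + sz rest) + sz out) (sym (sz-node v ts))))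
        where
        eq : ∀ a b v o → suc (a + b + suc (v + o)) ≡ suc (suc (v + a) + b) + o
        eq = solve-∀

      traverse : ∀ m stack out → sz stack + sz out ≤ m → ∀ S → m ≤ S →
                 ∃[ k ] k ≤ m * (11 + c * suc S ^ e) + 1 ×
                 Run (while body) (enc stack · enc out) (nil · enc (List._ʳ++_ (labelsₗ stack) out)) k
      traverse m       []                   out le S m≤ = 1 , m≤n+m 1 _ , stop refl
      traverse zero    (t ∷ rest)           out () S m≤
      traverse (suc m) (t@(node v ts) ∷ rest) out le S m≤ =
        let (k , k≤ , r) = run visitP (t , rest , out)
            le′ = ≤-trans (n≤1+n _) (s≤s⁻¹ (≤-trans (≤-reflexive (shrink t rest out)) le))
            (l , l≤ , r′) = traverse m (ts ++ rest) (v ∷ out) le′ S (≤-trans (n≤1+n m) m≤)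
            small : sz (t , rest , out) ≤ suc S
            small = ≤-trans (≤-reflexive (cong suc (+-suc (sz t) (sz rest + sz out)))) (s≤s (≤-trans (≤-reflexive (cong suc (sym (+-assoc (sz t) _ _)))) (≤-trans le m≤)))
            k≤′ = ≤-trans k≤ (≤-trans (proj₂ (proj₂ (clock-bnd visitP)) (t , rest , out)) (*-monoʳ-≤ c (^-monoˡ-≤ e small)))
        in _ , ≤-trans (s≤s (+-mono-≤ (+-monoʳ-≤ 10 k≤′) l≤)) (≤-reflexive (sym (+-assoc (11 + c * suc S ^ e) (m * (11 + c * suc S ^ e)) 1))) ,
           loop cons (seq (pair (seq hd hd) (pair (seq hd tl) tl)) r)
             (subst (λ o → Run (while body) (enc (ts ++ rest) · enc (v ∷ out)) (nil · enc o) l)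
               (trans (cong (λ x → List._ʳ++_ x (v ∷ out)) (labelsₗ-++ ts rest)) refl) r′)

      reversed : Rose A → List A
      reversed t = reverse (labels t)

      sz-reverse : ∀ (xs ys : List A) → suc (sz (List._ʳ++_ xs ys)) ≡ sz xs + sz ys
      sz-reverse []       ys = refl
      sz-reverse (x ∷ xs) ys = trans (sz-reverse xs (x ∷ ys)) (eq (sz xs) (sz x) (sz ys))
        where
        eq : ∀ a b c → a + suc (b + c) ≡ suc (b + a) + c
        eq = solve-∀

      sz-labels : ∀ (ts : List (Rose A)) → sz (labelsₗ ts) ≤ sz ts
      sz-labels []                = ≤-refl
      sz-labels (node v us ∷ ts) = s≤s (≤-trans (+-monoʳ-≤ (sz v) (≤-trans (sz-++≤ (labelsₗ us) (labelsₗ ts)) (+-mono-≤ (sz-labels us) (sz-labels ts))))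
        (≤-trans (≤-reflexive (sym (+-assoc (sz v) _ _))) (+-monoˡ-≤ (sz ts) (≤-trans (n≤1+n _) (≤-reflexive (sym (sz-node v us)))))))

      reversedP : Poly reversed
      reversedP = record
        { prog = ⟨ ⟨ id , nil ⟩ , nil ⟩ ⨾ (while body ⨾ tl)
        ; clock = λ t → suc (5 + suc ((m t * (11 + c * suc (m t) ^ e) + 1) + 1))
        ; clock-bnd = bnd-+ (bnd-const 1) (bnd-+ (bnd-const 5) (bnd-+ (bnd-const 1) (bnd-+ (bnd-+ (bnd-* bnd-m
            (bnd-+ (bnd-const 11) (bnd-poly c e (bnd-+ (bnd-const 1) bnd-m)))) (bnd-const 1)) (bnd-const 1))))
        ; run = λ t → let (k , k≤ , r) = traverse (m t) (t ∷ []) [] ≤-refl (m t) ≤-refl in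
            _ , s≤s (+-monoʳ-≤ 5 (s≤s (+-monoˡ-≤ 1 k≤))) ,
            seq (pair (pair id nil) nil) (seq (subst (λ o → Run (while body) ((enc t · nil) · nil) (nil · enc o) k)
              (cong reverse (Listₚ.++-identityʳ (labels t))) r) tl)
        ; out-bnd = bnd-≤ (λ t → ≤-trans (n≤1+n _) (≤-trans (≤-reflexive (sz-reverse (labels t) [])) (+-monoˡ-≤ 1
            (≤-trans (≤-reflexive (cong sz (sym (Listₚ.++-identityʳ (labels t))))) (sz-labels (t ∷ [])))))) (bnd-+ (bnd-+ (bnd-const 1) (bnd-+ bnd-sz (bnd-const 1))) (bnd-const 1)) }
        where
        m : Rose A → ℕ
        m t = sz (t ∷ []) + 1
        bnd-m : Bnd m
        bnd-m = bnd-+ (bnd-+ (bnd-const 1) (bnd-+ bnd-sz (bnd-const 1))) (bnd-const 1)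

    labelsP : {C : Set} ⦃ _ : Code C ⦄ {t : C → Rose A} → Poly t → Poly (λ c → labels (t c))
    labelsP P = extP (λ c → Listₚ.reverse-involutive _) (reverseP (reversedP ∘P P))

  mapRose  : {A B : Set} → (A → B) → Rose A → Rose B
  mapRoses : {A B : Set} → (A → B) → List (Rose A) → List (Rose B)
  mapRose f (node v ts) = node (f v) (mapRoses f ts)
  mapRoses f []         = []
  mapRoses f (t ∷ ts)   = mapRose f t ∷ mapRoses f ts

  labels-map  : {A B : Set} (f : A → B) (t : Rose A) → labels (mapRose f t) ≡ map f (labels t)
  labelsₗ-map : {A B : Set} (f : A → B) (ts : List (Rose A)) → labelsₗ (mapRoses f ts) ≡ map f (labelsₗ ts)
  labels-map f (node v ts) = cong (f v ∷_) (labelsₗ-map f ts)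
  labelsₗ-map f []         = refl
  labelsₗ-map f (t ∷ ts)   = trans (cong₂ _++_ (labels-map f t) (labelsₗ-map f ts)) (sym (Listₚ.map-++ f (labels t) _))

  encRose-map  : {A B : Set} (e : A → 𝔻) (e′ : B → 𝔻) (f : A → B) → (∀ a → e a ≡ e′ (f a)) → ∀ t → encRose e t ≡ encRose e′ (mapRose f t)
  encRoses-map : {A B : Set} (e : A → 𝔻) (e′ : B → 𝔻) (f : A → B) → (∀ a → e a ≡ e′ (f a)) → ∀ ts → encRoses e ts ≡ encRoses e′ (mapRoses f ts)
  encRose-map e e′ f eq (node v ts)  = cong₂ _·_ (eq v) (encRoses-map e e′ f eq ts)
  encRoses-map e e′ f eq []          = refl
  encRoses-map e e′ f eq (t ∷ ts)    = cong₂ _·_ (encRose-map e e′ f eq t) (encRoses-map e e′ f eq ts)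

  RawTree : Set
  RawTree = Rose (List Bool)

  flatten : List (RawTree × ℚ) → List (RawPath × ℚ)
  flatten = map (λ (Q , w) → labels Q , w)

  flattenP : {A : Set} ⦃ _ : Code A ⦄ {zs : A → List (List (RawTree × ℚ))} → Poly zs → Poly (λ a → map flatten (zs a))
  flattenP L = mapP {f = λ (_ , z) → flatten z} (mapP {f = λ (_ , (Q , w)) → labels Q , w} (pairP (labelsP ₁₂P) ₂₂P) ₂P) L

  rawTrees : ∀ {k n} → (Fin k → List (Rose (Fin n) × ℚ)) → List (List (RawTree × ℚ))
  rawTrees z = tabulate (λ t → map (λ (Q , w) → mapRose label Q , w) (z t))

  trees-code : ∀ {k n} (z : Fin k → List (Rose (Fin n) × ℚ)) →
    encFun (encList (λ (Q , w) → encRose encFin Q · encℚ w)) z ≡ enc (rawTrees z)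
  trees-code z = encFun-enc _ (map (λ (Q , w) → mapRose label Q , w)) z λ l →
    encList-enc _ (λ (Q , w) → mapRose label Q , w) l (λ (Q , w) → cong (_· encℚ w) (encRose-map encFin enc label enc-label Q))

  module Preorder (P : Problem) (isMetric : IsMetric _≡_ (Problem.d P)) where

    open Problem P
    private module M = IsMetric isMetric

    through : V → List V → V → ℚ
    through u []       w = d u w
    through u (x ∷ xs) w = d u x Q.+ through x xs w

    through-start : ∀ u v xs w → through u xs w Q.≤ d u v Q.+ through v xs w
    through-start u v []       w = M.triangle u v w
    through-start u v (x ∷ xs) w = Qₚ.≤-trans (Qₚ.+-monoˡ-≤ (through x xs w) (M.triangle u v x))
      (Qₚ.≤-reflexive (Qₚ.+-assoc (d u v) (d v x) (through x xs w)))

    pathLength≤through : ∀ u xs w → pathLength P (u ∷ xs) Q.≤ through u xs w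
    pathLength≤through u []       w = M.nonNegative
    pathLength≤through u (x ∷ xs) w = Qₚ.+-monoʳ-≤ (d u x) (pathLength≤through x xs w)

    2ℚ : ℚ
    2ℚ = ℤ.+ 2 Q./ 1

    preorder≤ : ∀ v ts rest w → through v (labelsₗ ts ++ rest) w Q.≤ 2ℚ Q.* branchLength P v ts Q.+ through v rest w
    preorder≤ v []                rest w = Qₚ.≤-reflexive (sym (trans (cong (Q._+ through v rest w) (Qₚ.*-zeroʳ 2ℚ)) (Qₚ.+-identityˡ _)))
    preorder≤ v (node x us ∷ ts) rest w = begin
      d v x Q.+ through x ((labelsₗ us ++ labelsₗ ts) ++ rest) w
        ≡⟨ cong (λ l → d v x Q.+ through x l w) (Listₚ.++-assoc (labelsₗ us) (labelsₗ ts) rest) ⟩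
      d v x Q.+ through x (labelsₗ us ++ (labelsₗ ts ++ rest)) w
        ≤⟨ Qₚ.+-monoʳ-≤ (d v x) (preorder≤ x us (labelsₗ ts ++ rest) w) ⟩
      d v x Q.+ (2ℚ Q.* B Q.+ through x (labelsₗ ts ++ rest) w)
        ≤⟨ Qₚ.+-monoʳ-≤ (d v x) (Qₚ.+-monoʳ-≤ (2ℚ Q.* B) (Qₚ.≤-trans (through-start x v (labelsₗ ts ++ rest) w)
             (Qₚ.+-mono-≤ (Qₚ.≤-reflexive (M.sym x v)) (preorder≤ v ts rest w)))) ⟩
      d v x Q.+ (2ℚ Q.* B Q.+ (d v x Q.+ (2ℚ Q.* B′ Q.+ through v rest w)))
        ≡⟨ eq (d v x) B B′ (through v rest w) ⟩
      2ℚ Q.* (d v x Q.+ B Q.+ B′) Q.+ through v rest w ∎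
      where
      open Qₚ.≤-Reasoning
      B = branchLength P x us
      B′ = branchLength P v ts
      eq : ∀ x b c r → x Q.+ ((ℤ.+ 2 Q./ 1) Q.* b Q.+ (x Q.+ ((ℤ.+ 2 Q./ 1) Q.* c Q.+ r))) ≡ (ℤ.+ 2 Q./ 1) Q.* (x Q.+ b Q.+ c) Q.+ r
      eq = ring-solve ℚ-ring

    tree-closed : ∀ v ts → through v (labelsₗ ts) v Q.≤ 2ℚ Q.* treeLength P (node v ts)
    tree-closed v ts = subst (λ l → through v l v Q.≤ 2ℚ Q.* branchLength P v ts) (Listₚ.++-identityʳ (labelsₗ ts))
      (Qₚ.≤-trans (preorder≤ v ts [] v) (Qₚ.≤-reflexive (trans (cong (2ℚ Q.* branchLength P v ts Q.+_) (M.≈⇒0 refl)) (Qₚ.+-identityʳ _))))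

    tree-path : ∀ Q → pathLength P (labels Q) Q.≤ 2ℚ Q.* treeLength P Q
    tree-path (node v ts) = Qₚ.≤-trans (pathLength≤through v (labelsₗ ts) v) (tree-closed v ts)

  rawTreesML : RoundingInput (LP2 trees) → List (List ℚ) × List (List (RawTree × ℚ))
  rawTreesML i = matrix (MLInstance.d (RoundingInput.inst i)) , rawTrees (Assignment.z (RoundingInput.lp i))

  rawTreesMLP : Poly rawTreesML
  rawTreesMLP = selectP rawTreesML λ i →
    cong₂ _·_ (sym (enc-matrix (MLInstance.d (RoundingInput.inst i)))) (sym (trees-code (Assignment.z (RoundingInput.lp i))))

  flattenML : List (List ℚ) × List (List (RawTree × ℚ)) → RawML
  flattenML (m , zs) = m , map flatten zs

  trees-rounding-ML : RandomizedRounding (LP2 trees) (ℤ.+ 287 Q./ 20)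
  trees-rounding-ML = randomized (ℤ.+ 287 Q./ 20) (roundML ∘ flattenML ∘ rawTreesML)
    (roundMLP ∘P pairP ₁P (flattenP ₂P) ∘P rawTreesMLP)
    (λ i → proj₁ (M.result i)) (λ i → trans (proj₁ (proj₂ (M.result i))) (cong (λ zs → enc (roundML (matrix (MLInstance.d (RoundingInput.inst i)) , zs))) (M.raw≡ i))) cheap
    where
    module M (i : RoundingInput (LP2 trees)) where
      open RoundingInput i
      open Assignment lp
      open IsFeasible (proj₁ feasible)
      private
        P = mlProblem inst
        open Problem P using (V)

      unfold : Rose V × ℚ → List V × ℚ
      unfold (Q , w) = labels Q , w

      L : ℚ
      L = (ℤ.+ 2 Q./ 1) Q.* γ

      within : ∀ t → All (λ (p , _) → IsRootedPath P p × pathLength P p Q.≤ L Q.* time t) (map unfold (z t))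
      within t = Allₚ.map⁺ (All.map (λ {q} → path {proj₁ q}) (z-within t))
        where
        path : ∀ {Q} → rootOf Q ≡ zero × Unique (labels Q) × treeLength P Q Q.≤ γ Q.* time t →
               IsRootedPath P (labels Q) × pathLength P (labels Q) Q.≤ L Q.* time t
        path {node v ts} (refl , U , le) = ((_ , refl) , U) ,
          Qₚ.≤-trans (Preorder.tree-path P (MLInstance.isMetric inst) (node v ts))
            (Qₚ.≤-trans (*-monoʳ-Q (/1≥0 2) le) (Qₚ.≤-reflexive (sym (Qₚ.*-assoc (ℤ.+ 2 Q./ 1) γ (time t)))))

      total-unfold : ∀ z → total (map unfold z) ≡ total z
      total-unfold []            = refl
      total-unfold ((Q , w) ∷ z) = cong (w Q.+_) (total-unfold z)

      cover-unfold : ∀ j z → total (filter (λ (Q , _) → any? (suc j Finₚ.≟_) (labels Q)) z) ≡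
                             total (filter (λ (p , _) → any? (suc j Finₚ.≟_) p) (map unfold z))
      cover-unfold j []            = refl
      cover-unfold j ((Q , w) ∷ z) with does (any? (suc j Finₚ.≟_) (labels Q))
      ... | true  = cong (w Q.+_) (cover-unfold j z)
      ... | false = cover-unfold j z

      unfolded : RawML
      unfolded = matrix (MLInstance.d inst) , tabulate (λ t → map (λ (p , w) → map label p , w) (map unfold (z t)))

      result : Σ (Solution P) λ S → output S ≡ enc (roundML unfolded) × RoundingInput.value i S Q.≤ (ℤ.+ 287 Q./ 40) Q.* (ρ Q.* L) Q.* objective lp
      result = RoundML.result inst T T-bound x (λ t → map unfold (z t)) ρ L 1≤ρ (*≥0 (/1≥0 2) (γ-scale 1≤γ)) x≥0
        (λ t → Allₚ.map⁺ (z≥0 t)) within assigned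
        (λ t → Qₚ.≤-trans (Qₚ.≤-reflexive (total-unfold (z t))) (capacity t))
        (λ j t → Qₚ.≤-trans (covered j t) (Qₚ.≤-reflexive (cover-unfold j (z t))))

      raw≡ : proj₂ unfolded ≡ map flatten (rawTrees z)
      raw≡ = trans (Listₚ.tabulate-cong (λ t → each (z t))) (sym (Listₚ.map-tabulate _ flatten))
        where
        each : ∀ z → map (λ (p , w) → map label p , w) (map unfold z) ≡ flatten (map (λ (Q , w) → mapRose label Q , w) z)
        each []            = refl
        each ((Q , w) ∷ z) = cong₂ _∷_ (cong (_, w) (sym (labels-map label Q))) (each z)

    cheap : ∀ i → RoundingInput.value i (proj₁ (M.result i)) Q.≤ RoundingInput.bound i (ℤ.+ 287 Q./ 20)
    cheap i = Qₚ.≤-trans (proj₂ (proj₂ (M.result i))) (Qₚ.≤-reflexive (eq ρ γ (objective lp)))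
      where
      open RoundingInput i
      eq : ∀ ρ γ o → (ℤ.+ 287 Q./ 40) Q.* (ρ Q.* ((ℤ.+ 2 Q./ 1) Q.* γ)) Q.* o ≡ (ℤ.+ 287 Q./ 20) Q.* (ρ Q.* γ) Q.* o
      eq = ring-solve ℚ-ring

  Group : Set
  Group = List Bool

  isTrue? : ∀ b → Dec (b ≡ true)
  isTrue? true  = yes refl
  isTrue? false = no λ ()

  Hit : Group → ℕ → Set
  Hit g v = nth false (false ∷ g) v ≡ true

  hit? : ∀ g v → Dec (Hit g v)
  hit? g v = isTrue? (nth false (false ∷ g) v)

  hits? : ∀ g τ → Dec (Any (Hit g) τ)
  hits? g τ = any? (hit? g) τ

  Choice : Set
  Choice = ℕ × List ℕ

  gain : List Group → Choice → ℕ
  gain U (_ , τ) = Sum (λ g → ind (hits? g τ)) U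

  unhit : List ℕ → List Group → List Group
  unhit τ = filter (λ g → ¬? (hits? g τ))

  better : List Group → Choice → Choice → Choice
  better U b c = if does (suc (gain U b * proj₁ c) ≤? gain U c * proj₁ b) then c else b

  select : List Group → Choice → List Choice → Choice
  select U c cs = foldl (better U) c cs

  greedy : List Choice → ℕ → List Group → List (List ℕ)
  greedy cs zero    U = []
  greedy cs (suc k) U = caseList cs [] λ c cs′ →
    proj₂ (select U c cs′) ∷ greedy cs k (unhit (proj₂ (select U c cs′)) U)

  choices : List (List Weighted) → List Choice
  choices zs = concatMap (λ (i , z) → map (λ (p , _) → suc i , p) z) (number 0 zs)

  number-∈ : {X : Set} (k : ℕ) (xss : List (List X)) {i : ℕ} → i < length xss → (k + i , at xss i) ∈ number k xss
  number-∈ k (xs ∷ xss) {zero}  lt       = here (cong (_, xs) (+-identityʳ k))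
  number-∈ k (xs ∷ xss) {suc i} (s≤s lt) = there (subst (λ j → (j , at xss i) ∈ number (suc k) xss) (sym (+-suc k i)) (number-∈ (suc k) xss lt))

  ∈-number : {X : Set} (k : ℕ) (xss : List (List X)) {j : ℕ} {xs : List X} → (j , xs) ∈ number k xss →
             ∃[ i ] i < length xss × j ≡ k + i × xs ≡ at xss i
  ∈-number k (x ∷ xss) (here refl) = 0 , s≤s z≤n , sym (+-identityʳ k) , refl
  ∈-number k (x ∷ xss) (there m) = let (i , lt , eq , eq′) = ∈-number (suc k) xss m in suc i , s≤s lt , trans eq (sym (+-suc k i)) , eq′

  choices-∈ : ∀ zs {i p w} → i < length zs → (p , w) ∈ at zs i → (suc i , p) ∈ choices zs
  choices-∈ zs {i} lt pw∈ = Membershipₚ.∈-concat⁺′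
    (∈-map⁺ (λ (p , _) → suc i , p) pw∈) (∈-map⁺ (λ (i , z) → map (λ (p , _) → suc i , p) z) (number-∈ 0 zs lt))

  ∈-choices : ∀ zs {c} → c ∈ choices zs → ∃[ i ] ∃[ w ] i < length zs × proj₁ c ≡ suc i × (proj₂ c , w) ∈ at zs i
  ∈-choices zs c∈ with Membershipₚ.∈-concat⁻′ (map (λ (i , z) → map (λ (p , _) → suc i , p) z) (number 0 zs)) c∈
  ... | l , c∈l , l∈ with ∈-map⁻ (λ (i , z) → map (λ (p , _) → suc i , p) z) l∈
  ...   | (j , z) , jz∈ , refl with ∈-map⁻ (λ (p , _) → suc j , p) c∈l | ∈-number 0 zs jz∈
  ...     | (p , w) , pw∈ , refl | i , lt , refl , refl = i , w , lt , refl , pw∈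

  module _ (U : List Group) where

    private
      _≼_ : Choice → Choice → Set
      c ≼ b = gain U c * proj₁ b ≤ gain U b * proj₁ c

      better-≽ : ∀ b c → b ≼ better U b c × c ≼ better U b c × (better U b c ≡ b ⊎ better U b c ≡ c)
      better-≽ b c with suc (gain U b * proj₁ c) ≤? gain U c * proj₁ b
      ... | yes lt = <⇒≤ lt , ≤-refl , inj₂ refl
      ... | no ≮  = ≤-refl , ≮⇒≥ ≮ , inj₁ refl

      ≼-trans : ∀ {c b b′} → 0 < proj₁ b → c ≼ b → b ≼ b′ → c ≼ b′
      ≼-trans {t , τ} {suc s , σ} {r , θ} _ p q = *-cancelʳ-≤ _ _ (suc s) (begin
        gain U (t , τ) * r * suc s  ≡⟨ eq (gain U (t , τ)) r (suc s) ⟩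
        gain U (t , τ) * suc s * r  ≤⟨ *-monoˡ-≤ r p ⟩
        gain U (suc s , σ) * t * r  ≡⟨ eq (gain U (suc s , σ)) t r ⟩
        gain U (suc s , σ) * r * t  ≤⟨ *-monoˡ-≤ t q ⟩
        gain U (r , θ) * suc s * t  ≡⟨ eq (gain U (r , θ)) (suc s) t ⟩
        gain U (r , θ) * t * suc s  ∎)
        where
        open ≤-Reasoning
        eq : ∀ a b c → a * b * c ≡ a * c * b
        eq = solve-∀

    select-best : ∀ c cs → All (λ c → 0 < proj₁ c) (c ∷ cs) →
                  select U c cs ∈ c ∷ cs × (∀ {c′} → c′ ∈ c ∷ cs → c′ ≼ select U c cs)
    select-best c []        _              = here refl , λ { (here refl) → ≤-refl }
    select-best c (c′ ∷ cs) (p ∷ p′ ∷ ps) with better-≽ c c′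
    ... | c≼ , c′≼ , inj₁ eq rewrite eq = let (m , f) = select-best c cs (p ∷ ps) in
          (case m of λ { (here e) → here e ; (there m) → there (there m) }) ,
          λ { (here refl) → f (here refl) ; (there (here refl)) → ≼-trans {c′} {c} {select U c cs} p c′≼ (f (here refl)) ; (there (there x)) → f (there x) }
    ... | c≼ , c′≼ , inj₂ eq rewrite eq = let (m , f) = select-best c′ cs (p′ ∷ ps) in
          there m , λ { (here refl) → ≼-trans {c} {c′} {select U c′ cs} p′ c≼ (f (here refl)) ; (there x) → f x }

  SumQ-filter≤ : {X : Set} {P : X → Set} (P? : ∀ x → Dec (P x)) (f : X → ℚ) (xs : List X) → (∀ x → 0ℚ Q.≤ f x) →
                 SumQ f (filter P? xs) Q.≤ SumQ f xs
  SumQ-filter≤ P? f []       nn = Qₚ.≤-refl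
  SumQ-filter≤ P? f (x ∷ xs) nn with does (P? x)
  ... | true  = Qₚ.+-monoʳ-≤ (f x) (SumQ-filter≤ P? f xs nn)
  ... | false = Qₚ.≤-trans (SumQ-filter≤ P? f xs nn) (Qₚ.≤-trans (Qₚ.≤-reflexive (sym (Qₚ.+-identityˡ _))) (Qₚ.+-monoˡ-≤ (SumQ f xs) (nn x)))

  covG : Group → List Weighted → ℚ
  covG g z = total (filter (λ (p , _) → hits? g p) z)

  cov-gain : ∀ U t z → SumQ (λ g → covG g z) U ≡ SumQ (λ (p , w) → w Q.* ι (gain U (t , p))) z
  cov-gain U t []            = zeros U
    where
    zeros : ∀ (U : List Group) → SumQ (λ g → 0ℚ) U ≡ 0ℚ
    zeros []      = refl
    zeros (g ∷ U) = trans (Qₚ.+-identityˡ _) (zeros U)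
  cov-gain U t ((p , w) ∷ z) = trans (go U) (cong (w Q.* ι (gain U (t , p)) Q.+_) (cov-gain U t z))
    where
    go : ∀ U → SumQ (λ g → covG g ((p , w) ∷ z)) U ≡ w Q.* ι (gain U (t , p)) Q.+ SumQ (λ g → covG g z) U
    go []      = sym (trans (cong (Q._+ 0ℚ) (trans (cong (w Q.*_) ι0) (Qₚ.*-zeroʳ w))) (Qₚ.+-identityʳ 0ℚ))
    go (g ∷ U) with does (hits? g p)
    ... | true  = trans (cong ((w Q.+ covG g z) Q.+_) (go U)) (trans (eq w (covG g z) (ι (gain U (t , p))) (SumQ (λ g → covG g z) U))
                    (cong (λ x → w Q.* x Q.+ (covG g z Q.+ SumQ (λ g → covG g z) U)) (trans (cong (Q._+ ι (gain U (t , p))) (sym ι1)) (sym (ι-+ 1 (gain U (t , p)))))))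
      where
      eq : ∀ w c k s → w Q.+ c Q.+ (w Q.* k Q.+ s) ≡ w Q.* (1ℚ Q.+ k) Q.+ (c Q.+ s)
      eq = ring-solve ℚ-ring
    ... | false = trans (cong (covG g z Q.+_) (go U)) (eq (covG g z) (w Q.* ι (gain U (t , p))) (SumQ (λ g → covG g z) U))
      where
      eq : ∀ c a s → c Q.+ (a Q.+ s) ≡ a Q.+ (c Q.+ s)
      eq = ring-solve ℚ-ring

  module Greedy (d : ℕ → ℕ → ℕ) (gs : List Group) (zs : List (List Weighted)) (ρ B : ℚ)
    (nonneg   : ∀ {z} → z ∈ zs → All (λ (_ , w) → 0ℚ Q.≤ w) z)
    (short    : ∀ {i} → i < length zs → All (λ (p , _) → ι (Metric.closed d p) Q.≤ B Q.* ι (suc i)) (at zs i))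
    (capacity : ∀ {z} → z ∈ zs → total z Q.≤ ρ)
    (ρ≥0 : 0ℚ Q.≤ ρ) (B≥0 : 0ℚ Q.≤ B)
    (δ : Group → ℕ → ℚ) (δ≥0 : ∀ g t → 0ℚ Q.≤ δ g t) (δ-start : ∀ g → δ g 0 ≡ 1ℚ)
    (δ-covers : ∀ g i → 1ℚ Q.≤ covG g (at zs i) Q.+ δ g (suc i))
    (δ-end : SumQ (λ g → δ g (length zs)) gs ≡ 0ℚ) where

    open Metric d

    private
      T = length zs
      cs = choices zs

      2ℚ : ℚ
      2ℚ = ℤ.+ 2 Q./ 1

      D : ℕ → ℚ
      D t = SumQ (λ g → δ g t) gs

      -- Serving a of R groups lowers Φ by at least a for every time t
      -- with 2 D t ≥ R.
      level : ℕ → ℕ → ℚ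
      level R t = (2ℚ Q.* D t) Q.⊓ ι R

      Φ : ℕ → ℚ
      Φ R = SumQ (level R) (downFrom T)

      D≥0 : ∀ t → 0ℚ Q.≤ D t
      D≥0 t = SumQ≥0 gs (λ g _ → δ≥0 g t)

      Φ≥0 : ∀ R → 0ℚ Q.≤ Φ R
      Φ≥0 R = SumQ≥0 (downFrom T) (λ t _ → Qₚ.⊓-glb (*≥0 (/1≥0 2) (D≥0 t)) (ι≥0 R))

      Inside : List Group → Set
      Inside U = ∀ t → SumQ (λ g → δ g t) U Q.≤ D t

      record Good (U : List Group) : Set where
        field
          {i}     : ℕ
          i<T     : i < T
          half    : ι (length U) Q.≤ 2ℚ Q.* SumQ (λ g → covG g (at zs i)) U
          earlier : ∀ t → t < suc i → ι (length U) Q.≤ 2ℚ Q.* D t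

      split-δ : ∀ t U → ι (length U) Q.≤ SumQ (λ g → covG g (at zs t)) U Q.+ SumQ (λ g → δ g (suc t)) U
      split-δ t U = Qₚ.≤-trans (Qₚ.≤-reflexive (sym (SumQ-const U))) (Qₚ.≤-trans (SumQ-mono U (λ g _ → δ-covers g t)) (Qₚ.≤-reflexive (SumQ-+ _ _ U)))

      cancel-one : ∀ {x} → 2ℚ Q.* x Q.≤ x → 1ℚ Q.≤ x → ⊥
      cancel-one {x} le 1≤x = case Qₚ.≤-trans 1≤x (Qₚ.≤-trans (Qₚ.≤-reflexive (eq x)) (Qₚ.≤-trans (Qₚ.+-monoˡ-≤ (Q.- x) le) (Qₚ.≤-reflexive (Qₚ.+-inverseʳ x)))) of λ
        { (Q.*≤* (ℤ.+≤+ ())) }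
        where
        eq : ∀ x → x ≡ (ℤ.+ 2 Q./ 1) Q.* x Q.+ (Q.- x)
        eq = ring-solve ℚ-ring

      good : ∀ U → 1 ≤ length U → Inside U → Good U
      good U 1≤R inside = build (search P? T) refl
        where
        R = length U
        P? : ∀ t → Dec (2ℚ Q.* D t Q.≤ ι R)
        P? t = 2ℚ Q.* D t Qₚ.≤? ι R
        1≤ιR : 1ℚ Q.≤ ι R
        1≤ιR = subst (Q._≤ ι R) ι1 (ι-mono 1≤R)
        holds : 2ℚ Q.* D (search P? T) Q.≤ ι R
        holds with search-found P? T
        ... | inj₂ p  = p
        ... | inj₁ eq = Qₚ.≤-trans (Qₚ.≤-reflexive (trans (cong (λ t → 2ℚ Q.* D t) eq) (trans (cong (2ℚ Q.*_) δ-end) (Qₚ.*-zeroʳ 2ℚ)))) (ι≥0 R)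
        build : ∀ t → search P? T ≡ t → Good U
        build zero eq = ⊥-elim (cancel-one {ι R} (Qₚ.≤-trans (*-monoʳ-Q (/1≥0 2) (Qₚ.≤-trans (Qₚ.≤-reflexive (trans (sym (SumQ-const U)) (start U))) (inside 0)))
            (subst (λ t → 2ℚ Q.* D t Q.≤ ι R) eq holds)) 1≤ιR)
          where
          start : ∀ U → SumQ (λ _ → 1ℚ) U ≡ SumQ (λ g → δ g 0) U
          start []      = refl
          start (g ∷ U) = cong₂ Q._+_ (sym (δ-start g)) (start U)
        build (suc i) eq = record
          { i<T = ≤-trans (≤-reflexive (sym eq)) (search-≤ P? T)
          ; half = half
          ; earlier = λ t lt → Qₚ.<⇒≤ (Qₚ.≰⇒> (search-least P? T t (≤-trans lt (≤-reflexive (sym eq))))) }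
          where
          c = SumQ (λ g → covG g (at zs i)) U
          half : ι R Q.≤ 2ℚ Q.* c
          half = begin
            ι R                            ≡⟨ eq₁ (ι R) ⟩
            2ℚ Q.* ι R Q.+ (Q.- ι R)       ≤⟨ Qₚ.+-mono-≤ (*-monoʳ-Q (/1≥0 2) (split-δ i U)) (Qₚ.neg-antimono-≤ (Qₚ.≤-trans (*-monoʳ-Q (/1≥0 2) (inside (suc i))) (subst (λ t → 2ℚ Q.* D t Q.≤ ι R) eq holds))) ⟩
            2ℚ Q.* (c Q.+ e) Q.+ (Q.- (2ℚ Q.* e)) ≡⟨ eq₂ c e ⟩
            2ℚ Q.* c                       ∎
            where
            open Qₚ.≤-Reasoning
            e = SumQ (λ g → δ g (suc i)) U
            eq₁ : ∀ x → x ≡ (ℤ.+ 2 Q./ 1) Q.* x Q.+ (Q.- x)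
            eq₁ = ring-solve ℚ-ring
            eq₂ : ∀ c e → (ℤ.+ 2 Q./ 1) Q.* (c Q.+ e) Q.+ (Q.- ((ℤ.+ 2 Q./ 1) Q.* e)) ≡ (ℤ.+ 2 Q./ 1) Q.* c
            eq₂ = ring-solve ℚ-ring

      count-levels : ∀ {f : ℕ → ℚ} {a} → (∀ t → 0ℚ Q.≤ f t) → ∀ s → (∀ t → t < s → a Q.≤ f t) → ∀ T → s ≤ T →
                     ι s Q.* a Q.≤ SumQ f (downFrom T)
      count-levels {f} {a} f≥0 s large zero    z≤n = Qₚ.≤-reflexive (trans (cong (Q._* a) ι0) (Qₚ.*-zeroˡ a))
      count-levels {f} {a} f≥0 s large (suc T) le with m≤n⇒m<n∨m≡n le
      ... | inj₁ (s≤s s≤T) = Qₚ.≤-trans (count-levels f≥0 s large T s≤T)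
              (Qₚ.≤-trans (Qₚ.≤-reflexive (sym (Qₚ.+-identityˡ _))) (Qₚ.+-monoˡ-≤ (SumQ f (downFrom T)) (f≥0 T)))
      ... | inj₂ refl = Qₚ.≤-trans (Qₚ.≤-reflexive (trans (cong (Q._* a) (trans (ι-+ 1 T) (cong (Q._+ ι T) ι1))) (eq (ι T) a)))
              (Qₚ.+-mono-≤ (large T ≤-refl) (count-levels f≥0 T (λ t lt → large t (m≤n⇒m≤1+n lt)) T ≤-refl))
        where
        eq : ∀ t a → (1ℚ Q.+ t) Q.* a ≡ a Q.+ t Q.* a
        eq = ring-solve ℚ-ring

      drop : ∀ a R′ s → s ≤ T → (∀ t → t < s → ι (a + R′) Q.≤ 2ℚ Q.* D t) → ι s Q.* ι a Q.+ Φ R′ Q.≤ Φ (a + R′)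
      drop a R′ s s≤T big = Qₚ.≤-trans (Qₚ.+-monoˡ-≤ (Φ R′) (count-levels {λ t → level (a + R′) t Q.- level R′ t} nonneg′ s large T s≤T))
        (Qₚ.≤-reflexive (trans (sym (SumQ-+ _ (level R′) (downFrom T))) (restore (downFrom T))))
        where
        R≤ : ι R′ Q.≤ ι (a + R′)
        R≤ = ι-mono (m≤n+m R′ a)
        difference≥0 : ∀ {x y} → y Q.≤ x → 0ℚ Q.≤ x Q.- y
        difference≥0 {x} {y} le = Qₚ.≤-trans (Qₚ.≤-reflexive (sym (Qₚ.+-inverseʳ y))) (Qₚ.+-monoˡ-≤ (Q.- y) le)
        nonneg′ : ∀ t → 0ℚ Q.≤ level (a + R′) t Q.- level R′ t
        nonneg′ t = difference≥0 (Qₚ.⊓-monoʳ-≤ (2ℚ Q.* D t) R≤)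
        large : ∀ t → t < s → ι a Q.≤ level (a + R′) t Q.- level R′ t
        large t lt = Qₚ.≤-reflexive (sym (trans (cong₂ Q._-_ (Qₚ.p≥q⇒p⊓q≡q (big t lt)) (Qₚ.p≥q⇒p⊓q≡q (Qₚ.≤-trans R≤ (big t lt))))
          (trans (cong (Q._- ι R′) (ι-+ a R′)) (eq (ι a) (ι R′)))))
          where
          eq : ∀ a r → a Q.+ r Q.- r ≡ a
          eq = ring-solve ℚ-ring
        restore : ∀ ts → SumQ (λ t → (level (a + R′) t Q.- level R′ t) Q.+ level R′ t) ts ≡ SumQ (level (a + R′)) ts
        restore []       = refl
        restore (t ∷ ts) = cong₂ Q._+_ (eq (level (a + R′) t) (level R′ t)) (restore ts)
          where
          eq : ∀ x y → x Q.- y Q.+ y ≡ x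
          eq = ring-solve ℚ-ring

      positive-times : All (λ c → 0 < proj₁ c) cs
      positive-times = All.tabulate λ c∈ → let (i , _ , _ , eq , _) = ∈-choices zs c∈ in ≤-trans (s≤s z≤n) (≤-reflexive (sym eq))

      length-unhit : ∀ t τ U → gain U (t , τ) + length (unhit τ U) ≡ length U
      length-unhit t τ []      = refl
      length-unhit t τ (g ∷ U) with does (hits? g τ)
      ... | true  = cong suc (length-unhit t τ U)
      ... | false = trans (+-suc _ _) (cong suc (length-unhit t τ U))

      split-service : ∀ τ π U → Sum (λ g → planLat (hit? g) (τ ∷ π)) U ≡
                      closed τ * length U + Sum (λ g → planLat (hit? g) π) (unhit τ U)
      split-service τ π []      = sym (trans (+-identityʳ _) (*-zeroʳ (closed τ)))
      split-service τ π (g ∷ U) with does (hits? g τ)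
      ... | true  = trans (cong (closed τ + 0 +_) (split-service τ π U)) (eq (closed τ) (length U) _)
        where
        eq : ∀ a l s → a + 0 + (a * l + s) ≡ a * suc l + s
        eq = solve-∀
      ... | false = trans (cong (closed τ + planLat (hit? g) π +_) (split-service τ π U)) (eq (closed τ) (length U) (planLat (hit? g) π) _)
        where
        eq : ∀ a l x s → a + x + (a * l + s) ≡ a * suc l + (x + s)
        eq = solve-∀

      record Step (U : List Group) (b : Choice) : Set where
        field
          progress : 1 ≤ gain U b
          paid     : ι (closed (proj₂ b)) Q.* ι (length U) Q.≤ B Q.* (2ℚ Q.* ρ Q.* (Φ (length U) Q.- Φ (length (unhit (proj₂ b) U))))

      step : ∀ U → 1 ≤ length U → Inside U → ∀ c cs′ → cs ≡ c ∷ cs′ → Step U (select U c cs′)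
      step U 1≤R inside c cs′ eq = record { progress = progress ; paid = paid }
        where
        open Good (good U 1≤R inside)
        R = length U
        z = at zs i
        z∈ = at-∈ zs i<T
        b = select U c cs′
        a = gain U b
        s = proj₁ b
        best-b = select-best U c cs′ (subst (All (λ c → 0 < proj₁ c)) eq positive-times)
        b∈ : b ∈ cs
        b∈ = subst (b ∈_) (sym eq) (proj₁ best-b)
        0<s : 0 < s
        0<s = All.lookup positive-times b∈
        each : ∀ {p w} → (p , w) ∈ z → (w Q.* ι (gain U (s , p))) Q.* ι s Q.≤ w Q.* (ι a Q.* ι (suc i))
        each {p} {w} pw∈ = Qₚ.≤-trans (Qₚ.≤-reflexive (Qₚ.*-assoc w _ _)) (*-monoʳ-Q (All.lookup (nonneg z∈) pw∈)
          (subst₂ Q._≤_ (ι-* (gain U (s , p)) s) (ι-* a (suc i)) (ι-mono (proj₂ best-b (subst ((suc i , p) ∈_) eq (choices-∈ zs i<T pw∈))))))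
        gains : ∀ z′ → (∀ {p w} → (p , w) ∈ z′ → (w Q.* ι (gain U (s , p))) Q.* ι s Q.≤ w Q.* (ι a Q.* ι (suc i))) →
                SumQ (λ (p , w) → w Q.* ι (gain U (s , p))) z′ Q.* ι s Q.≤ total z′ Q.* (ι a Q.* ι (suc i))
        gains []             f = Qₚ.≤-reflexive (trans (Qₚ.*-zeroˡ (ι s)) (sym (Qₚ.*-zeroˡ (ι a Q.* ι (suc i)))))
        gains ((p , w) ∷ z′) f = Qₚ.≤-trans (Qₚ.≤-reflexive (Qₚ.*-distribʳ-+ (ι s) (w Q.* ι (gain U (s , p))) _)) (Qₚ.≤-trans
          (Qₚ.+-mono-≤ (f (here refl)) (gains z′ (f ∘ there))) (Qₚ.≤-reflexive (sym (Qₚ.*-distribʳ-+ (ι a Q.* ι (suc i)) w (total z′)))))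
        rate : ι R Q.* ι s Q.≤ 2ℚ Q.* ρ Q.* (ι (suc i) Q.* ι a)
        rate = begin
          ι R Q.* ι s                                          ≤⟨ *-monoˡ-Q (ι≥0 s) half ⟩
          2ℚ Q.* SumQ (λ g → covG g z) U Q.* ι s               ≡⟨ cong (λ x → 2ℚ Q.* x Q.* ι s) (cov-gain U s z) ⟩
          2ℚ Q.* SumQ (λ (p , w) → w Q.* ι (gain U (s , p))) z Q.* ι s ≡⟨ Qₚ.*-assoc 2ℚ (SumQ (λ (p , w) → w Q.* ι (gain U (s , p))) z) (ι s) ⟩
          2ℚ Q.* (SumQ (λ (p , w) → w Q.* ι (gain U (s , p))) z Q.* ι s) ≤⟨ *-monoʳ-Q (/1≥0 2) (Qₚ.≤-trans (gains z each) (*-monoˡ-Q (*≥0 (ι≥0 a) (ι≥0 (suc i))) (capacity z∈))) ⟩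
          2ℚ Q.* (ρ Q.* (ι a Q.* ι (suc i)))                   ≡⟨ eq′ ρ (ι a) (ι (suc i)) ⟩
          2ℚ Q.* ρ Q.* (ι (suc i) Q.* ι a)                     ∎
          where
          open Qₚ.≤-Reasoning
          eq′ : ∀ ρ a t → (ℤ.+ 2 Q./ 1) Q.* (ρ Q.* (a Q.* t)) ≡ (ℤ.+ 2 Q./ 1) Q.* ρ Q.* (t Q.* a)
          eq′ = ring-solve ℚ-ring
        progress : 1 ≤ a
        progress = n≢0⇒n>0 λ a≡0 → contradiction (ι-cancel (Qₚ.≤-trans (Qₚ.≤-reflexive (ι-* R s)) (Qₚ.≤-trans rate (Qₚ.≤-reflexive
            (trans (cong (λ x → 2ℚ Q.* ρ Q.* (ι (suc i) Q.* ι x)) a≡0) (trans (cong (λ x → 2ℚ Q.* ρ Q.* (ι (suc i) Q.* x)) ι0)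
              (trans (eq′ (2ℚ Q.* ρ) (ι (suc i))) (sym ι0))))))))
          (λ le → <-irrefl refl (≤-trans (*-mono-≤ 1≤R 0<s) le))
          where
          eq′ : ∀ x y → x Q.* (y Q.* 0ℚ) ≡ 0ℚ
          eq′ = ring-solve ℚ-ring
        R′ = length (unhit (proj₂ b) U)
        sum≡ : a + R′ ≡ R
        sum≡ = length-unhit s (proj₂ b) U
        gap : ι (suc i) Q.* ι a Q.≤ Φ R Q.- Φ R′
        gap = Qₚ.≤-trans (Qₚ.≤-reflexive (eq′ (ι (suc i) Q.* ι a) (Φ R′))) (Qₚ.+-monoˡ-≤ (Q.- Φ R′)
          (subst (λ r → ι (suc i) Q.* ι a Q.+ Φ R′ Q.≤ Φ r) sum≡ (drop a R′ (suc i) i<T (λ t lt → subst (λ r → ι r Q.≤ 2ℚ Q.* D t) (sym sum≡) (earlier t lt)))))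
          where
          eq′ : ∀ x y → x ≡ x Q.+ y Q.+ (Q.- y)
          eq′ = ring-solve ℚ-ring
        closed≤ : ι (closed (proj₂ b)) Q.≤ B Q.* ι s
        closed≤ = let (k , w , lt , s≡ , pw∈) = ∈-choices zs b∈ in
          subst (λ t → ι (closed (proj₂ b)) Q.≤ B Q.* ι t) (sym s≡) (All.lookup (short lt) pw∈)
        paid : ι (closed (proj₂ b)) Q.* ι R Q.≤ B Q.* (2ℚ Q.* ρ Q.* (Φ R Q.- Φ R′))
        paid = begin
          ι (closed (proj₂ b)) Q.* ι R          ≤⟨ *-monoˡ-Q (ι≥0 R) closed≤ ⟩
          B Q.* ι s Q.* ι R                     ≡⟨ trans (Qₚ.*-assoc B (ι s) (ι R)) (cong (B Q.*_) (Qₚ.*-comm (ι s) (ι R))) ⟩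
          B Q.* (ι R Q.* ι s)                   ≤⟨ *-monoʳ-Q B≥0 (Qₚ.≤-trans rate (*-monoʳ-Q (*≥0 (/1≥0 2) ρ≥0) gap)) ⟩
          B Q.* (2ℚ Q.* ρ Q.* (Φ R Q.- Φ R′))   ∎
          where open Qₚ.≤-Reasoning

      no-choice : ∀ U → 1 ≤ length U → Inside U → cs ≢ []
      no-choice U 1≤R inside none = contradiction (ι-cancel {length U} {0} (Qₚ.≤-trans half (Qₚ.≤-reflexive
          (trans (cong (2ℚ Q.*_) (trans (cov-gain U 0 (at zs i)) (cong (SumQ _) (empty (at zs i) (choices-∈ zs i<T))))) (trans (Qₚ.*-zeroʳ 2ℚ) (sym ι0))))))
        (λ le → <-irrefl refl (≤-trans 1≤R le))
        where
        open Good (good U 1≤R inside)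
        empty : ∀ z → (∀ {p w} → (p , w) ∈ z → (suc i , p) ∈ cs) → z ≡ []
        empty []            f = refl
        empty ((p , w) ∷ z) f = case subst ((suc i , p) ∈_) none (f (here refl)) of λ ()

      inside-unhit : ∀ τ U → Inside U → Inside (unhit τ U)
      inside-unhit τ U inside t = Qₚ.≤-trans (SumQ-filter≤ (λ g → ¬? (hits? g τ)) (λ g → δ g t) U (λ g → δ≥0 g t)) (inside t)

      Outcome : ℕ → List Group → List (List ℕ) → Set
      Outcome k U π = ι (Sum (λ g → planLat (hit? g) π) U) Q.≤ B Q.* (2ℚ Q.* ρ Q.* Φ (length U)) ×
                      (∀ {g} → g ∈ U → ∃[ τ ] τ ∈ π × Any (Hit g) τ)

      outcome : ∀ k U → length U ≤ k → Inside U → Outcome k U (greedy cs k U)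
      outcome k       []        _  _      = Qₚ.≤-trans (Qₚ.≤-reflexive ι0) (*≥0 B≥0 (*≥0 (*≥0 (/1≥0 2) ρ≥0) (Φ≥0 0))) , λ ()
      outcome (suc k) U@(_ ∷ _) le inside = go cs refl
        where
        go : ∀ l → cs ≡ l → Outcome (suc k) U (caseList l [] (λ c cs′ → proj₂ (select U c cs′) ∷ greedy cs k (unhit (proj₂ (select U c cs′)) U)))
        go []        eq = contradiction eq (no-choice U (s≤s z≤n) inside)
        go (c ∷ cs′) eq = bound , serves
          where
          b = select U c cs′
          τ = proj₂ b
          U′ = unhit τ U
          st = step U (s≤s z≤n) inside c cs′ eq
          shorter : length U′ ≤ k
          shorter = s≤s⁻¹ (≤-trans (+-monoˡ-≤ (length U′) (Step.progress st)) (≤-trans (≤-reflexive (length-unhit (proj₁ b) τ U)) le))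
          ih = outcome k U′ shorter (inside-unhit τ U inside)
          bound : ι (Sum (λ g → planLat (hit? g) (τ ∷ greedy cs k U′)) U) Q.≤ B Q.* (2ℚ Q.* ρ Q.* Φ (length U))
          bound = begin
            ι (Sum (λ g → planLat (hit? g) (τ ∷ greedy cs k U′)) U)
              ≡⟨ trans (cong ι (split-service τ (greedy cs k U′) U)) (trans (ι-+ (closed τ * length U) _) (cong (Q._+ ι S) (ι-* (closed τ) (length U)))) ⟩
            ι (closed τ) Q.* ι (length U) Q.+ ι S
              ≤⟨ Qₚ.+-mono-≤ (Step.paid st) (proj₁ ih) ⟩
            B Q.* (2ℚ Q.* ρ Q.* (Φ (length U) Q.- Φ (length U′))) Q.+ B Q.* (2ℚ Q.* ρ Q.* Φ (length U′))
              ≡⟨ eq′ B (2ℚ Q.* ρ) (Φ (length U)) (Φ (length U′)) ⟩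
            B Q.* (2ℚ Q.* ρ Q.* Φ (length U)) ∎
            where
            open Qₚ.≤-Reasoning
            S = Sum (λ g → planLat (hit? g) (greedy cs k U′)) U′
            eq′ : ∀ b r x y → b Q.* (r Q.* (x Q.- y)) Q.+ b Q.* (r Q.* y) ≡ b Q.* (r Q.* x)
            eq′ = ring-solve ℚ-ring
          serves : ∀ {g} → g ∈ U → ∃[ σ ] σ ∈ τ ∷ greedy cs k U′ × Any (Hit g) σ
          serves {g} g∈ = case hits? g τ of λ
            { (yes h) → τ , here refl , h
            ; (no ¬h) → let (σ , σ∈ , h) = proj₂ ih (∈-filter⁺ (λ g → ¬? (hits? g τ)) g∈ ¬h) in σ , there σ∈ , h }

    π : List (List ℕ)
    π = greedy cs (length gs) gs

    π-serves : ∀ {g} → g ∈ gs → ∃[ τ ] τ ∈ π × Any (Hit g) τ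
    π-serves = proj₂ (outcome (length gs) gs ≤-refl (λ _ → Qₚ.≤-refl))

    π-cost : ι (Sum (λ g → planLat (hit? g) π) gs) Q.≤ (ℤ.+ 4 Q./ 1) Q.* (ρ Q.* B) Q.* SumQ D (downFrom (length zs))
    π-cost = Qₚ.≤-trans (proj₁ (outcome (length gs) gs ≤-refl (λ _ → Qₚ.≤-refl)))
      (Qₚ.≤-trans (*-monoʳ-Q B≥0 (*-monoʳ-Q (*≥0 (/1≥0 2) ρ≥0) (Qₚ.≤-trans (SumQ-mono (downFrom T) (λ t _ → Qₚ.p⊓q≤p (2ℚ Q.* D t) (ι (length gs))))
          (Qₚ.≤-reflexive (SumQ-* 2ℚ D (downFrom T))))))
        (Qₚ.≤-reflexive (eq B ρ (SumQ D (downFrom T)))))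
      where
      eq : ∀ b r s → b Q.* ((ℤ.+ 2 Q./ 1) Q.* r Q.* ((ℤ.+ 2 Q./ 1) Q.* s)) ≡ (ℤ.+ 4 Q./ 1) Q.* (r Q.* b) Q.* s
      eq = ring-solve ℚ-ring

    greedy-⊆ : ∀ k U {τ} → τ ∈ greedy cs k U → ∃[ t ] (t , τ) ∈ cs
    greedy-⊆ (suc k) U {τ} τ∈ = go cs refl τ∈
      where
      go : ∀ l → cs ≡ l → τ ∈ caseList l [] (λ c cs′ → proj₂ (select U c cs′) ∷ greedy cs k (unhit (proj₂ (select U c cs′)) U)) → ∃[ t ] (t , τ) ∈ cs
      go (c ∷ cs′) eq (here refl) = _ , subst (select U c cs′ ∈_) (sym eq) (proj₁ (select-best U c cs′ (subst (All (λ c → 0 < proj₁ c)) eq positive-times)))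
      go (c ∷ cs′) eq (there m)   = greedy-⊆ k (unhit (proj₂ (select U c cs′)) U) m

    conclusion : (∀ {g} → g ∈ gs → ∃[ τ ] τ ∈ π × Any (Hit g) τ) × (∀ {τ} → τ ∈ π → ∃[ t ] (t , τ) ∈ choices zs) ×
                 ι (Sum (λ g → planLat (hit? g) π) gs) Q.≤
                 (ℤ.+ 4 Q./ 1) Q.* (ρ Q.* B) Q.* SumQ (λ t → SumQ (λ g → δ g t) gs) (downFrom (length zs))
    conclusion = π-serves , greedy-⊆ (length gs) gs , π-cost

  hitsP : {A : Set} ⦃ _ : Code A ⦄ {g : A → Group} {τ : A → List ℕ} → Poly g → Poly τ → Poly (λ a → does (hits? (g a) (τ a)))
  hitsP G L = anyP {P? = λ (a , v) → hit? _ v}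
    (extP (λ _ → sym (does-isTrue _)) (nthP (constP false) (consP (constP false) (G ∘P ₁P)) ₂P)) L
    where
    does-isTrue : ∀ b → does (isTrue? b) ≡ b
    does-isTrue true  = refl
    does-isTrue false = refl

  gainP : {A : Set} ⦃ _ : Code A ⦄ {U : A → List Group} {c : A → Choice} → Poly U → Poly c → Poly (λ a → gain (U a) (c a))
  gainP {c = c} U C = SumP {f = λ (a , g) → ind (hits? g (proj₂ (c a)))}
    (ifP (hitsP ₂P (sndP (C ∘P ₁P))) (constP 1) (constP 0)) U

  selectionP : Poly {List Group × Choice × List Choice} (λ (U , c , cs) → select U c cs)
  selectionP = foldl⁺P ₂₂P ₁₂P
    (ifP (leqP (sucP (mulP (gainP U b) (fstP c))) (mulP (gainP U c) (fstP b))) c b)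
    (out-bnd (sndP {A = (List Group × Choice × List Choice) × Choice} idP))
    λ (U , _) b c → grow U b c
    where
    I = (List Group × Choice × List Choice) × Choice × Choice
    U : Poly {I} (λ i → proj₁ (proj₁ i))
    U = ₁₁P
    b : Poly {I} (λ i → proj₁ (proj₂ i))
    b = ₁₂P
    c : Poly {I} (λ i → proj₂ (proj₂ i))
    c = ₂₂P
    grow : ∀ U (b c : Choice) → sz (better U b c) ≤ sz b + sz c
    grow U b c with does (suc (gain U b * proj₁ c) ≤? gain U c * proj₁ b)
    ... | true  = m≤n+m _ (sz b)
    ... | false = m≤m+n _ _

  sz-select : ∀ U c cs → sz (select U c cs) ≤ sz (c ∷ cs)
  sz-select U c []        = m≤n⇒m≤1+n (m≤m+n (sz c) 1)
  sz-select U c (c′ ∷ cs) with does (suc (gain U c * proj₁ c′) ≤? gain U c′ * proj₁ c)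
  ... | true  = ≤-trans (sz-select U c′ cs) (m≤n⇒m≤1+n (m≤n+m _ (sz c)))
  ... | false = ≤-trans (sz-select U c cs) (s≤s (+-monoʳ-≤ (sz c) (m≤n⇒m≤1+n (m≤n+m (sz cs) (sz c′)))))

  greedyP : Poly {List Choice × List Group} (λ (cs , gs) → greedy cs (length gs) gs)
  greedyP = extP (λ (cs , gs) → trans (cong reverse (go cs gs (length gs) gs [])) (Listₚ.reverse-involutive (greedy cs (length gs) gs)))
    (reverseP (sndP (iterP {s = step} (lengthP ₂P) (pairP ₂P nilP) stepP
      (bnd-+ (bnd-const 1) (out-bnd ₁P)) λ (cs , gs) b → grow cs gs b)))
    where
    State : Set
    State = List Group × List (List ℕ)
    append : State × Choice → State
    append ((U , acc) , (_ , τ)) = unhit τ U , τ ∷ acc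
    step : (List Choice × List Group) × State → State
    step ((cs , _) , s) = caseList cs s (λ c cs′ → append (s , select (proj₁ s) c cs′))
    appendP′ : Poly append
    appendP′ = pairP (filterP {P? = λ ((_ , (_ , τ)) , g) → ¬? (hits? g τ)} (notP (hitsP ₂P (sndP ₂₁P))) ₁₁P)
      (consP ₂₂P ₂₁P)
    stepP : Poly step
    stepP = caseListP ₁₁P ₂P
      (appendP′ ∘P pairP ₂₁P (selectionP ∘P pairP (fstP ₂₁P) ₂P))
    go : ∀ cs gs k U acc → proj₂ (foldl (λ b _ → step ((cs , gs) , b)) (U , acc) (replicate k tt)) ≡ List._ʳ++_ (greedy cs k U) acc
    go cs       gs zero    U acc = refl
    go []       gs (suc k) U acc = trans (go [] gs k U acc) (none k)
      where
      none : ∀ k → List._ʳ++_ (greedy [] k U) acc ≡ acc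
      none zero    = refl
      none (suc k) = refl
    go (c ∷ cs) gs (suc k) U acc = go (c ∷ cs) gs k _ _
    grow : ∀ cs gs (s : State) → sz (step ((cs , gs) , s)) ≤ sz s + (1 + sz cs)
    grow []       gs s         = m≤m+n (sz s) _
    grow (c ∷ cs) gs (U , acc) = s≤s (≤-trans (+-mono-≤ (sz-filter (λ g → ¬? (hits? g (proj₂ b))) U)
        (s≤s (+-monoˡ-≤ (sz acc) (≤-trans (m≤n⇒m≤1+n (m≤n+m (sz (proj₂ b)) (sz (proj₁ b)))) (sz-select U c cs)))))
      (≤-reflexive (eq (sz U) (sz (c ∷ cs)) (sz acc))))
      where
      b = select U c cs
      eq : ∀ u s a → u + suc (s + a) ≡ u + a + (1 + s)
      eq = solve-∀

  choicesP : Poly choices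
  choicesP = concatMapP {f = λ (_ , (i , z)) → map (λ (p , _) → suc i , p) z}
    (mapP {f = λ ((_ , (i , _)) , (p , _)) → suc i , p} (pairP (sucP (fstP ₂₁P)) ₁₂P) ₂₂P)
    (numberP idP)

  readTours : ℕ → List (RawPath × ℚ) → List Weighted
  readTours n = map (λ (p , w) → map (readLabel n) p , w)

  readToursP : Poly {ℕ × List (RawPath × ℚ)} (λ (n , z) → readTours n z)
  readToursP = mapP {f = λ ((n , _) , (p , w)) → map (readLabel n) p , w}
    (pairP (mapP {f = λ (((n , _) , _) , ℓ) → readLabel n ℓ}
      (quantP (constP 1) (fstP ₁₁P) ₂P (constP (true ∷ []))) ₁₂P) ₂₂P) ₂P

  RawMGL : Set
  RawMGL = (List (List ℚ) × List Group) × List (List (RawTree × ℚ))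

  roundMGL : RawMGL → List (List Bool)
  roundMGL ((m , gs) , zs) = map toBits (dedup (walk (greedy (choices (map (readTours (pred (length m))) (map flatten zs))) (length gs) gs)))

  roundMGLP : Poly roundMGL
  roundMGLP = finishP ∘P greedyP ∘P pairP
    (choicesP ∘P mapP {f = λ (((m , _) , _) , z) → readTours (pred (length m)) z}
      (readToursP ∘P pairP (predP (lengthP (fstP ₁₁P))) ₂P) (flattenP ₂P))
    ₂₁P

  rawMGL : RoundingInput (LP′ trees) → RawMGL
  rawMGL i = (matrix (MGLInstance.d (RoundingInput.inst i)) , tabulate (Vec.toList ∘ MGLInstance.G (RoundingInput.inst i))) ,
    rawTrees (Assignment.z (RoundingInput.lp i))

  rawMGLP : Poly rawMGL
  rawMGLP = selectP rawMGL λ i → cong₂ _·_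
    (sym (cong₂ _·_ (enc-matrix (MGLInstance.d (RoundingInput.inst i)))
      (encFun-enc (encVec encBool) Vec.toList (MGLInstance.G (RoundingInput.inst i)) (λ _ → refl))))
    (sym (trees-code (Assignment.z (RoundingInput.lp i))))

  clear : ∀ {n} (R : ℕ → Fin n → Set) → (∀ a {K i} → R K i → R (a * K) i) →
          (∀ i → ∃[ K ] 1 ≤ K × R K i) → ∃[ K ] 1 ≤ K × (∀ i → R K i)
  clear {zero}  R scale f = 1 , ≤-refl , λ ()
  clear {suc n} R scale f =
    let (K , p , s) = f zero ; (K′ , p′ , s′) = clear (λ K i → R K (suc i)) (λ a r → scale a r) (f ∘ suc) in
    K′ * K , *-mono-≤ p′ p , λ { zero → scale K′ s ; (suc i) → subst (λ k → R k (suc i)) (*-comm K K′) (scale K (s′ i)) }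

  -- Multiplying all distances by a common denominator makes them natural
  -- numbers; the algorithm never sees this metric.

  module Scaling (P : Problem) (isMetric : IsMetric _≡_ (Problem.d P)) where

    open Problem P
    private module M = IsMetric isMetric

    Integral : ℕ → ℚ → Set
    Integral K q = ∃[ c ] ι K Q.* q ≡ ι c

    multiple : ∀ a {K q} → Integral K q → Integral (a * K) q
    multiple a {K} {q} (c , eq) = a * c , trans (cong (Q._* q) (ι-* a K)) (trans (Qₚ.*-assoc (ι a) (ι K) q) (trans (cong (ι a Q.*_) eq) (sym (ι-* a c))))

    abstract
      cleared : ∃[ K ] 1 ≤ K × (∀ u v → Integral K (d u v))
      cleared = clear (λ K u → ∀ v → Integral K (d u v)) (λ a r v → multiple a {q = d _ v} (r v)) λ u →
        clear (λ K v → Integral K (d u v)) (λ a {_} {v} → multiple a {q = d u v}) λ v →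
          let (c , k , _ , _ , eq) = fraction (M.nonNegative {u} {v}) in suc k , s≤s z≤n , c , eq

    K : ℕ
    K = proj₁ cleared

    κ : ℚ
    κ = ι K

    κ≥0 : 0ℚ Q.≤ κ
    κ≥0 = ι≥0 K

    cancel-κ : ∀ {x y} → κ Q.* x Q.≤ κ Q.* y → x Q.≤ y
    cancel-κ = Qₚ.*-cancelˡ-≤-pos κ ⦃ ι-positive {K} (proj₁ (proj₂ cleared)) ⦄

    scaled : Problem
    scaled = record { n = n ; d = λ u v → κ Q.* d u v ; m = m ; Target = Target ; Target? = Target? }

    scaled-metric : IsMetric _≡_ (Problem.d scaled)
    scaled-metric = record
      { isSemiMetric = record
        { isQuasiSemiMetric = record
          { isPreMetric = record
            { isProtoMetric = record
              { isPartialOrder = M.isPartialOrder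
              ; ≈-isEquivalence = M.≈-isEquivalence
              ; cong = cong₂ (λ u v → κ Q.* d u v)
              ; nonNegative = *≥0 κ≥0 M.nonNegative }
            ; ≈⇒0 = λ eq → trans (cong (κ Q.*_) (M.≈⇒0 eq)) (Qₚ.*-zeroʳ κ) }
          ; 0⇒≈ = λ {u} {v} eq → M.0⇒≈ (Qₚ.≤-antisym (cancel-κ (Qₚ.≤-reflexive (trans eq (sym (Qₚ.*-zeroʳ κ))))) M.nonNegative) }
        ; sym = λ u v → cong (κ Q.*_) (M.sym u v) }
      ; triangle = λ u v w → Qₚ.≤-trans (*-monoʳ-Q κ≥0 (M.triangle u v w)) (Qₚ.≤-reflexive (Qₚ.*-distribˡ-+ κ (d u v) (d v w))) }

    dℕ : ℕ → ℕ → ℕ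
    dℕ u v = proj₁ (proj₂ (proj₂ cleared) (clamp n u) (clamp n v))

    embed : ∀ u v → ι (dℕ u v) ≡ κ Q.* d (clamp n u) (clamp n v)
    embed u v = sym (proj₂ (proj₂ (proj₂ cleared) (clamp n u) (clamp n v)))

    latency-scaled : ∀ j p → latency scaled j p ≡ κ Q.* latency P j p
    latency-scaled j []           = sym (Qₚ.*-zeroʳ κ)
    latency-scaled j (_ ∷ [])     = sym (Qₚ.*-zeroʳ κ)
    latency-scaled j (u ∷ v ∷ vs) = trans
      (cong (λ l → if does (Target? j u) then 0ℚ else κ Q.* d u v Q.+ l) (latency-scaled j (v ∷ vs))) (branch (does (Target? j u)))
      where
      L = latency P j (v ∷ vs)
      branch : ∀ b → (if b then 0ℚ else κ Q.* d u v Q.+ κ Q.* L) ≡ κ Q.* (if b then 0ℚ else d u v Q.+ L)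
      branch true  = sym (Qₚ.*-zeroʳ κ)
      branch false = sym (Qₚ.*-distribˡ-+ κ (d u v) L)

    cost-scaled : ∀ p → cost scaled p ≡ κ Q.* cost P p
    cost-scaled p = trans (sum-eq {m} (λ j → latency-scaled j p)) (factor (λ j → latency P j p))
      where
      factor : ∀ {k} (f : Fin k → ℚ) → sum (λ j → κ Q.* f j) ≡ κ Q.* sum f
      factor {zero}  f = sym (Qₚ.*-zeroʳ κ)
      factor {suc k} f = trans (cong (κ Q.* f zero Q.+_) (factor (f ∘ suc))) (sym (Qₚ.*-distribˡ-+ κ (f zero) _))

    open Embed scaled scaled-metric dℕ embed public
    open Preorder P isMetric using (through; tree-closed)

    closed-tree : ∀ Q → ι (Metric.closed dℕ (map toℕ (labels Q))) Q.≤ κ Q.* ((ℤ.+ 2 Q./ 1) Q.* treeLength P Q)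
    closed-tree (node v ts) = Qₚ.≤-trans (Qₚ.≤-reflexive (go v (labelsₗ ts))) (*-monoʳ-Q κ≥0 (tree-closed v ts))
      where
      go : ∀ u us → ι (Metric.loop′ dℕ (toℕ v) (toℕ u) (map toℕ us)) ≡ κ Q.* through u us v
      go u []       = embed-Fin u v
      go u (x ∷ us) = trans (ι-+ (dℕ (toℕ u) (toℕ x)) _) (trans (cong₂ Q._+_ (embed-Fin u x) (go x us)) (sym (Qₚ.*-distribˡ-+ κ (d u x) _)))

  SumQ-tabulate : ∀ {X : Set} {k} (f : X → ℚ) (g : Fin k → X) → SumQ f (tabulate g) ≡ sum (f ∘ g)
  SumQ-tabulate {k = zero}  f g = refl
  SumQ-tabulate {k = suc k} f g = cong (f (g zero) Q.+_) (SumQ-tabulate f (g ∘ suc))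

  SumQ-sum : ∀ {X : Set} {k} (f : X → Fin k → ℚ) (xs : List X) → SumQ (λ x → sum (f x)) xs ≡ sum (λ j → SumQ (λ x → f x j) xs)
  SumQ-sum {k = k} f [] = zeros k
    where
    zeros : ∀ k → 0ℚ ≡ sum {k} (λ _ → 0ℚ)
    zeros zero    = refl
    zeros (suc k) = trans (zeros k) (sym (Qₚ.+-identityˡ _))
  SumQ-sum f (x ∷ xs) = trans (cong (sum (f x) Q.+_) (SumQ-sum f xs)) (join (f x) _)
    where
    join : ∀ {k} (f g : Fin k → ℚ) → sum f Q.+ sum g ≡ sum (λ j → f j Q.+ g j)
    join {zero}  f g = refl
    join {suc k} f g = trans (shuffle (f zero) (sum (f ∘ suc)) (g zero) (sum (g ∘ suc))) (cong (f zero Q.+ g zero Q.+_) (join (f ∘ suc) (g ∘ suc)))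
      where
      shuffle : ∀ a b c e → a Q.+ b Q.+ (c Q.+ e) ≡ a Q.+ c Q.+ (b Q.+ e)
      shuffle = ring-solve ℚ-ring

  deficits-delay : ∀ xs → All (0ℚ Q.≤_) xs → 1ℚ Q.≤ sumℚ xs → ∀ T → SumQ (deficit 1ℚ xs) (downFrom T) Q.≤ delay xs
  deficits-delay xs nn full T = Qₚ.≤-trans (Qₚ.≤-trans (Qₚ.≤-reflexive (sym (Qₚ.+-identityˡ _)))
      (Qₚ.≤-trans (Qₚ.+-monoˡ-≤ _ (tails≥0 1ℚ xs T)) (Qₚ.≤-reflexive (sym (go T))))) (tails-delay 1ℚ xs nn full)
    where
    go : ∀ T → tails 1ℚ xs 0 ≡ tails 1ℚ xs T Q.+ SumQ (deficit 1ℚ xs) (downFrom T)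
    go zero    = sym (Qₚ.+-identityʳ _)
    go (suc T) = trans (go T) (trans (cong (Q._+ SumQ (deficit 1ℚ xs) (downFrom T)) (tails-step 1ℚ xs T))
      (eq (deficit 1ℚ xs T) (tails 1ℚ xs (suc T)) (SumQ (deficit 1ℚ xs) (downFrom T))))
      where
      eq : ∀ a b c → a Q.+ b Q.+ c ≡ b Q.+ (a Q.+ c)
      eq = ring-solve ℚ-ring

  nth-lookup : ∀ {k} e (p : Vec.Vec Bool k) (v : Fin k) → nth e (Vec.toList p) (toℕ v) ≡ Vec.lookup p v
  nth-lookup e (b Vec.∷ p) zero    = refl
  nth-lookup e (b Vec.∷ p) (suc v) = nth-lookup b p v

  module RoundMGL (i : RoundingInput (LP′ trees)) where

    open RoundingInput i
    open Assignment lp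
    open IsFeasible feasible
    open MGLInstance inst

    private
      P = mglProblem inst
      open Problem P using (V; Target; Target?)
      open Scaling P isMetric

      2γ : ℚ
      2γ = (ℤ.+ 2 Q./ 1) Q.* γ

      group : Fin m → Group
      group j = Vec.toList (G j)

      hit⁻ : ∀ {j v} → Hit (group j) (toℕ v) → Target j v
      hit⁻ {j} {v} h = Vecₚ.lookup⇒[]= v (Subset.outside Vec.∷ G j)
        (trans (sym (nth-lookup false (false Vec.∷ G j) v)) h)

      hit⁺ : ∀ {j v} → Target j v → Hit (group j) (toℕ v)
      hit⁺ {j} {v} t = trans (nth-lookup false (false Vec.∷ G j) v) (Vecₚ.[]=⇒lookup t)

      same : ∀ j v → does (Target? j v) ≡ does (hit? (group j) (toℕ v))
      same j v = agree (Target? j v) (hit? (group j) (toℕ v))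
        where
        agree : (a : Dec (Target j v)) (b : Dec (Hit (group j) (toℕ v))) → does a ≡ does b
        agree (yes _) (yes _) = refl
        agree (no _)  (no _)  = refl
        agree (yes t) (no ¬h) = contradiction (hit⁺ {j} {v} t) ¬h
        agree (no ¬t) (yes h) = contradiction (hit⁻ {j} {v} h) ¬t

      same-any : ∀ j ps → does (any? (Target? j) ps) ≡ does (hits? (group j) (map toℕ ps))
      same-any j []       = refl
      same-any j (p ∷ ps) = cong₂ _∨_ (same j p) (same-any j ps)

      entries : Rose V × ℚ → Weighted
      entries (Q , w) = map toℕ (labels Q) , w

      zs : List (List Weighted)
      zs = tabulate (λ t → map entries (z t))

      zs-All : ∀ {Q : List Weighted → Set} → (∀ t → Q (map entries (z t))) → ∀ {l} → l ∈ zs → Q l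
      zs-All {Q} f l∈ = All.lookup (Allₚ.tabulate⁺ f) l∈

      gs : List Group
      gs = tabulate group

      T≡ : length zs ≡ T
      T≡ = Listₚ.length-tabulate _

      index : ∀ {k} → k < length zs → ∃[ t ] toℕ {T} t ≡ k
      index {k} lt = let lt′ = subst (k <_) T≡ lt in Fin.fromℕ< lt′ , Finₚ.toℕ-fromℕ< lt′

      zs-at : ∀ t → at zs (toℕ t) ≡ map entries (z t)
      zs-at = at-tabulate (λ t → map entries (z t))

      short : ∀ {k} → k < length zs → All (λ (p , _) → ι (Metric.closed dℕ p) Q.≤ κ Q.* 2γ Q.* ι (suc k)) (at zs k)
      short {k} lt with index lt
      ... | t , refl = subst (All (λ (p , _) → ι (Metric.closed dℕ p) Q.≤ κ Q.* 2γ Q.* ι (suc k))) (sym (zs-at t))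
          (Allₚ.map⁺ (All.map (λ {q} → fits {proj₁ q}) (z-within t)))
        where
        fits : ∀ {Q} → rootOf Q ≡ zero × Unique (labels Q) × treeLength P Q Q.≤ γ Q.* time t →
                ι (Metric.closed dℕ (map toℕ (labels Q))) Q.≤ κ Q.* 2γ Q.* ι (suc (toℕ t))
        fits {Q} (_ , _ , le) = Qₚ.≤-trans (closed-tree Q) (Qₚ.≤-trans (*-monoʳ-Q κ≥0 (*-monoʳ-Q (/1≥0 2) le))
          (Qₚ.≤-reflexive (trans (eq κ γ (time t)) (cong (κ Q.* 2γ Q.*_) (time-ι t)))))
          where
          eq : ∀ k g t → k Q.* ((ℤ.+ 2 Q./ 1) Q.* (g Q.* t)) ≡ k Q.* ((ℤ.+ 2 Q./ 1) Q.* g) Q.* t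
          eq = ring-solve ℚ-ring

      total-map : ∀ z → total (map entries z) ≡ total z
      total-map []            = refl
      total-map ((p , w) ∷ z) = cong (w Q.+_) (total-map z)

      cover-map : ∀ j z → total (filter (λ (Q , _) → any? (Target? j) (labels Q)) z) ≡ covG (group j) (map entries z)
      cover-map j []            = refl
      cover-map j ((Q , w) ∷ z) with does (any? (Target? j) (labels Q)) | does (hits? (group j) (map toℕ (labels Q))) | same-any j (labels Q)
      ... | true  | true  | _ = cong (w Q.+_) (cover-map j z)
      ... | false | false | _ = cover-map j z

      δ : Group → ℕ → ℚ
      δ g zero    = 1ℚ
      δ g (suc k) = pos (1ℚ Q.- covG g (at zs k))

      δ≥0 : ∀ g t → 0ℚ Q.≤ δ g t
      δ≥0 g zero    = /1≥0 1
      δ≥0 g (suc k) = pos≥0 (1ℚ Q.- covG g (at zs k))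

      δ-covers : ∀ g k → 1ℚ Q.≤ covG g (at zs k) Q.+ δ g (suc k)
      δ-covers g k = Qₚ.≤-trans (Qₚ.≤-reflexive (eq (covG g (at zs k)))) (Qₚ.+-monoʳ-≤ (covG g (at zs k)) (Qₚ.p≤p⊔q (1ℚ Q.- covG g (at zs k)) 0ℚ))
        where
        eq : ∀ c → 1ℚ ≡ c Q.+ (1ℚ Q.- c)
        eq = ring-solve ℚ-ring

      xs : Fin m → List ℚ
      xs j = tabulate (x j)

      xs≥0 : ∀ j → All (0ℚ Q.≤_) (xs j)
      xs≥0 j = Allₚ.tabulate⁺ (x≥0 j)

      xs-full : ∀ j → 1ℚ Q.≤ sumℚ (xs j)
      xs-full j = Qₚ.≤-trans (assigned j) (Qₚ.≤-reflexive (sym (sumℚ-tabulate (x j))))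

      δ≤deficit : ∀ j t → t ≤ length zs → δ (group j) t Q.≤ deficit 1ℚ (xs j) t
      δ≤deficit j zero    _  = Qₚ.p≤p⊔q 1ℚ 0ℚ
      δ≤deficit j (suc k) lt with index lt
      ... | t , refl = Qₚ.⊔-lub (sub-add {1ℚ} {covG (group j) (at zs (toℕ t))} {deficit 1ℚ (xs j) (suc (toℕ t))} (Qₚ.≤-trans (deficit-covers 1ℚ (xs j) (≤-trans (Finₚ.toℕ<n t) (≤-reflexive (sym (Listₚ.length-tabulate (x j))))))
            (Qₚ.+-monoˡ-≤ _ served))) (deficit≥0 1ℚ (xs j) (suc (toℕ t)))
        where
        served : prefix (xs j) (suc (toℕ t)) Q.≤ covG (group j) (at zs (toℕ t))
        served = subst₂ Q._≤_ (sym (prefix-tabulate (x j) t)) (trans (cover-map j (z t)) (cong (covG (group j)) (sym (zs-at t)))) (covered j t)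

      δ-end : SumQ (λ g → δ g (length zs)) gs ≡ 0ℚ
      δ-end = trans (SumQ-tabulate (λ g → δ g (length zs)) group) (trans (sum-eq {m} vanish) (sym (SumQ-sum {X = ⊥} {k = m} (λ ()) [])))
        where
        vanish : ∀ j → δ (group j) (length zs) ≡ 0ℚ
        vanish j = Qₚ.≤-antisym (Qₚ.≤-trans (δ≤deficit j (length zs) ≤-refl) (Qₚ.≤-reflexive
          (deficit-end 1ℚ (xs j) (xs≥0 j) (xs-full j) (≤-reflexive (trans (Listₚ.length-tabulate (x j)) (sym T≡)))))) (δ≥0 (group j) (length zs))

      π : List (List ℕ)
      π = greedy (choices zs) (length gs) gs

      conclusion : (∀ {g} → g ∈ gs → ∃[ τ ] τ ∈ π × Any (Hit g) τ) × (∀ {τ} → τ ∈ π → ∃[ t ] (t , τ) ∈ choices zs) ×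
                   ι (Sum (λ g → Metric.planLat dℕ (hit? g) π) gs) Q.≤
                   (ℤ.+ 4 Q./ 1) Q.* (ρ Q.* (κ Q.* 2γ)) Q.* SumQ (λ t → SumQ (λ g → δ g t) gs) (downFrom (length zs))
      conclusion = Greedy.conclusion dℕ gs zs ρ (κ Q.* 2γ)
        (zs-All {λ l → All (λ (_ , w) → 0ℚ Q.≤ w) l} λ t → Allₚ.map⁺ (z≥0 t)) short
        (zs-All {λ l → total l Q.≤ ρ} λ t → Qₚ.≤-trans (Qₚ.≤-reflexive (total-map (z t))) (capacity t))
        (γ-scale 1≤ρ) (*≥0 κ≥0 (*≥0 (/1≥0 2) (γ-scale 1≤γ))) δ δ≥0 (λ _ → refl) δ-covers δ-end

      tours : ∀ {τ} → τ ∈ π → FromRoot τ × All (_≤ n) τ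
      tours τ∈ = let (_ , c∈) = proj₁ (proj₂ conclusion) τ∈ ; (k , w , lt , _ , pw∈) = ∈-choices zs c∈ in
        All.lookup (zs-All {All (λ (τ , _) → FromRoot τ × All (_≤ n) τ)} (λ t → Allₚ.map⁺ (All.map (λ {q} → sound {proj₁ q}) (z-within t))) (at-∈ zs lt)) pw∈
        where
        sound : ∀ {Q s} → rootOf Q ≡ zero × Unique (labels Q) × treeLength P Q Q.≤ s →
                FromRoot (map toℕ (labels Q)) × All (_≤ n) (map toℕ (labels Q))
        sound {node v ts} (refl , _) = (_ , refl) , Allₚ.map⁺ (All.tabulate (λ {v} _ → Finₚ.toℕ≤pred[n] v))

      open Output π (All.tabulate (proj₁ ∘ tours)) (All.tabulate (proj₂ ∘ tours))

    solution : Solution P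
    solution = vertices , rooted , λ j →
      let (τ , τ∈ , h) = proj₁ conclusion (Membershipₚ.∈-tabulate⁺ j) ; (v , v∈ , hv) = find h in
      lose (visits v∈ τ∈) (hit⁻ {j} (subst (Hit (group j)) (sym (toℕ-clamp (All.lookup (proj₂ (tours τ∈)) v∈))) hv))

    solution-code : encList encFin (proj₁ solution) ≡ enc (roundMGL (rawMGL i))
    solution-code = trans output-code (cong enc (sym (cong (λ zs → map toBits (dedup (walk (greedy (choices zs) (length gs) gs))))
        (trans (cong (λ k → map (readTours k) (map flatten (rawTrees z))) (cong pred (Listₚ.length-tabulate (λ u → tabulate (d u)))))
          (trans (cong (map (readTours n)) (Listₚ.map-tabulate _ flatten))
            (trans (Listₚ.map-tabulate _ (readTours n)) (Listₚ.tabulate-cong (λ t → each (z t)))))))))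
      where
      read-labels : ∀ (ps : List V) → map (readLabel n) (map label ps) ≡ map toℕ ps
      read-labels []       = refl
      read-labels (v ∷ ps) = cong₂ _∷_ (readLabel-bits n (Finₚ.toℕ≤pred[n] v)) (read-labels ps)
      each : ∀ z → readTours n (flatten (map (λ (Q , w) → mapRose label Q , w) z)) ≡ map entries z
      each []            = refl
      each ((Q , w) ∷ z) = cong₂ _∷_ (cong (_, w) (trans (cong (map (readLabel n)) (labels-map label Q)) (read-labels (labels Q)))) (each z)

    solution-cost : cost P (proj₁ solution) Q.≤ (ℤ.+ 8 Q./ 1) Q.* (ρ Q.* γ) Q.* objective lp
    solution-cost = cancel-κ (begin
      κ Q.* cost P vertices                                              ≡⟨ cost-scaled vertices ⟨
      cost scaled vertices                                               ≤⟨ sum-mono {m} (λ j → latency≤ j (hit? (group j)) (same j)) ⟩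
      sum {m} (λ j → ι (planLat (hit? (group j)) π))                     ≡⟨ SumQ-tabulate (λ g → ι (planLat (hit? g) π)) group ⟨
      SumQ (λ g → ι (planLat (hit? g) π)) gs                             ≡⟨ ι-Sum (λ g → planLat (hit? g) π) gs ⟨
      ι (Sum (λ g → planLat (hit? g) π) gs)                              ≤⟨ proj₂ (proj₂ conclusion) ⟩
      (ℤ.+ 4 Q./ 1) Q.* (ρ Q.* (κ Q.* 2γ)) Q.* SumQ (λ t → SumQ (λ g → δ g t) gs) (downFrom (length zs))
        ≤⟨ *-monoʳ-Q (*≥0 (/1≥0 4) (*≥0 (γ-scale 1≤ρ) (*≥0 κ≥0 (*≥0 (/1≥0 2) (γ-scale 1≤γ))))) delays ⟩
      (ℤ.+ 4 Q./ 1) Q.* (ρ Q.* (κ Q.* 2γ)) Q.* objective lp              ≡⟨ eq ρ κ γ (objective lp) ⟩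
      κ Q.* ((ℤ.+ 8 Q./ 1) Q.* (ρ Q.* γ) Q.* objective lp)               ∎)
      where
      open Qₚ.≤-Reasoning
      open Metric dℕ
      eq : ∀ r k g o → (ℤ.+ 4 Q./ 1) Q.* (r Q.* (k Q.* ((ℤ.+ 2 Q./ 1) Q.* g))) Q.* o ≡ k Q.* ((ℤ.+ 8 Q./ 1) Q.* (r Q.* g) Q.* o)
      eq = ring-solve ℚ-ring
      Ts = downFrom (length zs)
      delays : SumQ (λ t → SumQ (λ g → δ g t) gs) Ts Q.≤ objective lp
      delays = Qₚ.≤-trans (SumQ-mono Ts (λ t t∈ → Qₚ.≤-trans (Qₚ.≤-reflexive (SumQ-tabulate (λ g → δ g t) group))
          (sum-mono {m} (λ j → δ≤deficit j t (<⇒≤ (Membershipₚ.∈-downFrom⁻ t∈))))))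
        (Qₚ.≤-trans (Qₚ.≤-reflexive (SumQ-sum (λ t j → deficit 1ℚ (xs j) t) Ts))
          (sum-mono {m} (λ j → Qₚ.≤-trans (deficits-delay (xs j) (xs≥0 j) (xs-full j) (length zs)) (Qₚ.≤-reflexive (delay-tabulate (x j))))))

  trees-rounding-MGL : RandomizedRounding (LP′ trees) (ℤ.+ 8 Q./ 1)
  trees-rounding-MGL = randomized (ℤ.+ 8 Q./ 1) (roundMGL ∘ rawMGL) (roundMGLP ∘P rawMGLP)
    RoundMGL.solution RoundMGL.solution-code RoundMGL.solution-cost

open import Defs
open import Data.Integer.Base using (+_)
open import Data.Product.Base using (_×_; ∃-syntax; _,_)
open import Data.Rational.Base using (_*_; _/_)

theorem3p4 :
    ((∃[ C ] RandomizedRounding (LP2 trees) C) × (∃[ C ] RandomizedRounding (LP′ trees) C))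
    × DeterministicRounding (LP2 paths) ((+ 359 / 100) * (+ 2 / 1))
theorem3p4 = ((+ 287 / 20 , Rounding.trees-rounding-ML) , (+ 8 / 1 , Rounding.trees-rounding-MGL)) , Rounding.paths-rounding
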